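{- Let $M$ be a matroid. Then $M$ is representable over $\mathrm{GF}(4)\otimes\mathbb{H}_2$ if and only if $M$ is representable over $\mathbb{K}_2$.
   Context: For a commutative ring $R$ and $S\subseteq R^*$, the partial field $\mathbb{P}(R,S)$ has underlying set $\langle S\cup\{ -1\}\rangle\cup\{0\}$ (the multiplicative subgroup generated, together with $0$), multiplication as in $R$, and $p+q$ defined exactly when the ring sum lies in this set. A matrix over such a partial field $\mathbb{P}$ is a $\mathbb{P}$-matrix if all its square subdeterminants are defined (for $\mathbb{P}(R,S)$: lie in the underlying set); a matroid is $\mathbb{P}$-representable if it is the matroid $M[A]$ of a full-row-rank $\mathbb{P}$-matrix $A$ whose bases are the column sets indexing nonsingular maximal square submatrices. Fields are partial fields. $\mathbb{H}_2=\mathbb{P}(\mathbb{C},\{i,1-i\})$ with $i^2=-1$. $\mathbb{K}_2=\mathbb{P}(\mathbb{Q}(\alpha),\{\alpha,\alpha-1,\alpha^2-1\})$ with $\alpha$ an indeterminate. For partial fields $\mathbb{P}_1,\mathbb{P}_2$, the direct product $\mathbb{P}_1\otimes\mathbb{P}_2$ has elements $(p_1,p_2)$ with $p_1\ne0$ iff $p_2\ne0$, componentwise multiplication, and $(p_1,p_2)+(q_1,q_2)\doteq(p_1+q_1,p_2+q_2)$ iff both component sums are defined and $p_1+q_1=0$ iff $p_2+q_2=0$. -}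

module Defs where

open import Level using (0ℓ)
open import Data.Nat as ℕ using (ℕ; zero; suc)
open import Data.Integer as ℤ using (ℤ; +_; -[1+_])
open import Data.Rational as ℚ using (ℚ; 0ℚ; 1ℚ)
open import Data.Bool using (Bool; true; false)
open import Data.Fin using (Fin; zero; suc; punchIn)
open import Data.Fin.Subset using (Subset; _∈_; _∉_; _∪_; _-_; ⁅_⁆; ∣_∣)
open import Data.List using (List; []; _∷_; map)
open import Data.List.Relation.Unary.All using (All)
open import Data.Product using (Σ; ∃; ∃-syntax; _×_; _,_)
open import Data.Sum using (_⊎_)
open import Relation.Binary.PropositionalEquality using (_≡_; _≢_)
open import Relation.Nullary using (¬_)
open import Function.Definitions using (Injective)
open import Function.Bundles using (_⇔_)
open import Algebra.Bundles.Raw using (RawRing)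

record Matroid (n : ℕ) : Set₁ where
  field
    IsBasis  : Subset n → Set
    nonempty : ∃[ B ] IsBasis B
    exchange : ∀ B₁ B₂ → IsBasis B₁ → IsBasis B₂ → ∀ x → x ∈ B₁ → x ∉ B₂ →
               ∃[ y ] (y ∈ B₂ × y ∉ B₁ × IsBasis ((B₁ - x) ∪ ⁅ y ⁆))

-- Partial fields in the sense of Pendavingh–van Zwam: a commutative
-- ring R (given by its operations) together with a subgroup G of the
-- units (given by a membership predicate).  The underlying set is G ∪ {0}.

record PartialField : Set₁ where
  field
    ring : RawRing 0ℓ 0ℓ
  open RawRing ring public
  field
    InG : Carrier → Set

  Elem : Carrier → Set
  Elem x = (x ≈ 0#) ⊎ InG x

module Det (R : RawRing 0ℓ 0ℓ) where
  open RawRing R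

  sumFin : ∀ n → (Fin n → Carrier) → Carrier
  sumFin zero    f = 0#
  sumFin (suc n) f = f zero + sumFin n (λ j → f (suc j))

  signed : ℕ → Carrier → Carrier
  signed zero    x = x
  signed (suc k) x = - signed k x

  det : ∀ n → (Fin n → Fin n → Carrier) → Carrier
  det zero    A = 1#
  det (suc n) A = sumFin (suc n) (λ j →
    signed (Data.Fin.toℕ j)
      (A zero j * det n (λ r c → A (suc r) (punchIn j c))))

-- P(R, S): the subgroup generated by S ∪ {-1}.  The generators are
-- given together with their (ring) inverses, so that negative powers
-- can be formed.
module _ (R : RawRing 0ℓ 0ℓ) where
  open RawRing R

  powN : Carrier → ℕ → Carrier
  powN g zero    = 1#
  powN g (suc k) = g * powN g k

  powZ : Carrier → Carrier → ℤ → Carrier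
  powZ g ginv (+ k)      = powN g k
  powZ g ginv -[1+ k ]   = powN ginv (suc k)

  prodFin : ∀ m → (Fin m → Carrier) → Carrier
  prodFin zero    f = 1#
  prodFin (suc m) f = f zero * prodFin m (λ j → f (suc j))

  InGenerated : ∀ m → (Fin m → Carrier) → (Fin m → Carrier) → Carrier → Set
  InGenerated m gen ginv x =
    Σ ℕ λ s → Σ (Fin m → ℤ) λ e → (x ≈ powN (- 1#) s * prodFin m (λ j → powZ (gen j) (ginv j) (e j)))

mkPF : (R : RawRing 0ℓ 0ℓ) (m : ℕ) → (Fin m → RawRing.Carrier R) →
       (Fin m → RawRing.Carrier R) → PartialField
mkPF R m gen ginv = record { ring = R ; InG = InGenerated R m gen ginv }

_⊗_ : PartialField → PartialField → PartialField
P₁ ⊗ P₂ = record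
  { ring = record
    { Carrier = P.Carrier × Q.Carrier
    ; _≈_ = λ { (a , b) (c , d) → (a P.≈ c) × (b Q.≈ d) }
    ; _+_ = λ { (a , b) (c , d) → (a P.+ c , b Q.+ d) }
    ; _*_ = λ { (a , b) (c , d) → (a P.* c , b Q.* d) }
    ; -_  = λ { (a , b) → (P.- a , Q.- b) }
    ; 0#  = (P.0# , Q.0#)
    ; 1#  = (P.1# , Q.1#)
    }
  ; InG = λ { (a , b) → P.InG a × Q.InG b }
  }
  where
  module P = PartialField P₁
  module Q = PartialField P₂

module _ (P : PartialField) where
  open PartialField P
  open Det ring

  Matrix : ℕ → ℕ → Set
  Matrix r n = Fin r → Fin n → Carrier

  IsPMatrix : ∀ {r n} → Matrix r n → Set
  IsPMatrix {r} {n} A =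
    ∀ k (ρ : Fin k → Fin r) (κ : Fin k → Fin n) → Injective _≡_ _≡_ ρ →
      Injective _≡_ _≡_ κ → Elem (det k (λ i j → A (ρ i) (κ j)))

  NonsingularCols : ∀ {r n} → Matrix r n → (Fin r → Fin n) → Set
  NonsingularCols {r} A κ = ¬ (det r (λ i j → A i (κ j)) ≈ 0#)

  IsBasisOf : ∀ {r n} → Matrix r n → Subset n → Set
  IsBasisOf {r} {n} A B =
    ∃[ κ ] (Injective _≡_ _≡_ κ × (∀ x → (x ∈ B) ⇔ (∃[ i ] κ i ≡ x)) × NonsingularCols A κ)

  FullRowRank : ∀ {r n} → Matrix r n → Set
  FullRowRank {r} {n} A = ∃[ κ ] (Injective _≡_ _≡_ κ × NonsingularCols A κ)

  Representable : ∀ {n} → Matroid n → Set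
  Representable {n} M =
    ∃[ r ] Σ (Matrix r n) λ A → IsPMatrix A × FullRowRank A ×
      (∀ B → Matroid.IsBasis M B ⇔ IsBasisOf A B)

-- GF(4) = {0, 1, ω, ω²} with ω² = ω + 1

data GF4 : Set where
  O I W W² : GF4

gf4+ : GF4 → GF4 → GF4
gf4+ O y = y
gf4+ x O = x
gf4+ I I = O
gf4+ I W = W²
gf4+ I W² = W
gf4+ W I = W²
gf4+ W W = O
gf4+ W W² = I
gf4+ W² I = W
gf4+ W² W = I
gf4+ W² W² = O

gf4* : GF4 → GF4 → GF4
gf4* O y = O
gf4* x O = O
gf4* I y = y
gf4* x I = x
gf4* W W = W²
gf4* W W² = I
gf4* W² W = I
gf4* W² W² = W

GF4-ring : RawRing 0ℓ 0ℓ
GF4-ring = record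
  { Carrier = GF4 ; _≈_ = _≡_ ; _+_ = gf4+ ; _*_ = gf4* ; -_ = λ x → x
  ; 0# = O ; 1# = I }

GF4-pf : PartialField
GF4-pf = record { ring = GF4-ring ; InG = λ x → x ≢ O }

ℚi-ring : RawRing 0ℓ 0ℓ
ℚi-ring = record
  { Carrier = ℚ × ℚ
  ; _≈_ = _≡_
  ; _+_ = λ { (a , b) (c , d) → (a ℚ.+ c , b ℚ.+ d) }
  ; _*_ = λ { (a , b) (c , d) → (a ℚ.* c ℚ.- b ℚ.* d , a ℚ.* d ℚ.+ b ℚ.* c) }
  ; -_  = λ { (a , b) → (ℚ.- a , ℚ.- b) }
  ; 0#  = (0ℚ , 0ℚ)
  ; 1#  = (1ℚ , 0ℚ)
  }

-- H₂ = P(ℂ, {i, 1 - i}); i⁻¹ = -i, (1 - i)⁻¹ = (1 + i)/2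
H₂-gen H₂-inv : Fin 2 → ℚ × ℚ
H₂-gen zero       = (0ℚ , 1ℚ)
H₂-gen (suc zero) = (1ℚ , ℚ.- 1ℚ)
H₂-inv zero       = (0ℚ , ℚ.- 1ℚ)
H₂-inv (suc zero) = (ℚ.½ , ℚ.½)

H₂ : PartialField
H₂ = mkPF ℚi-ring 2 H₂-gen H₂-inv

-- ℚ(α): rational functions in an indeterminate α over ℚ.
-- Polynomials are coefficient lists (constant term first).

Poly : Set
Poly = List ℚ

padd : Poly → Poly → Poly
padd []       q        = q
padd (a ∷ p)  []       = a ∷ p
padd (a ∷ p)  (b ∷ q)  = (a ℚ.+ b) ∷ padd p q

pneg : Poly → Poly
pneg = map (λ a → ℚ.- a)

pmul : Poly → Poly → Poly
pmul []      q = []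
pmul (a ∷ p) q = padd (map (a ℚ.*_) q) (0ℚ ∷ pmul p q)

_≈ₚ_ : Poly → Poly → Set
p ≈ₚ q = All (_≡ 0ℚ) (padd p (pneg q))

-- fractions num/den (denominators nonzero for every element we build)
RatFun : Set
RatFun = Poly × Poly

ℚα-ring : RawRing 0ℓ 0ℓ
ℚα-ring = record
  { Carrier = RatFun
  ; _≈_ = λ { (p , q) (p' , q') → pmul p q' ≈ₚ pmul p' q }
  ; _+_ = λ { (p , q) (p' , q') → (padd (pmul p q') (pmul p' q) , pmul q q') }
  ; _*_ = λ { (p , q) (p' , q') → (pmul p p' , pmul q q') }
  ; -_  = λ { (p , q) → (pneg p , q) }
  ; 0#  = ([] , 1ℚ ∷ [])
  ; 1#  = (1ℚ ∷ [] , 1ℚ ∷ [])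
  }

K₂-gen K₂-inv : Fin 3 → RatFun
K₂-gen zero             = (0ℚ ∷ 1ℚ ∷ [] , 1ℚ ∷ [])
K₂-gen (suc zero)       = (ℚ.- 1ℚ ∷ 1ℚ ∷ [] , 1ℚ ∷ [])
K₂-gen (suc (suc zero)) = (ℚ.- 1ℚ ∷ 0ℚ ∷ 1ℚ ∷ [] , 1ℚ ∷ [])
K₂-inv zero             = (1ℚ ∷ [] , 0ℚ ∷ 1ℚ ∷ [])
K₂-inv (suc zero)       = (1ℚ ∷ [] , ℚ.- 1ℚ ∷ 1ℚ ∷ [])
K₂-inv (suc (suc zero)) = (1ℚ ∷ [] , ℚ.- 1ℚ ∷ 0ℚ ∷ 1ℚ ∷ [])

K₂ : PartialField
K₂ = mkPF ℚα-ring 3 K₂-gen K₂-inv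

{-# OPTIONS --safe #-}
module Submission where

-- Substituting ω ∈ GF(4) and i ∈ ℂ for α maps K₂ to GF(4) ⊗ H₂ and sends only 0 to 0, so that matrices over K₂ can be mapped entrywise.
-- Conversely, every cross ratio of GF(4) ⊗ H₂ (an element z such that 1 - z is an element as well) lifts uniquely to a cross ratio of K₂, compatibly with products and negation.  By induction on the support of a matrix this lifts every matrix, uniquely up to scaling: a matrix whose bipartite support graph has a vertex of degree at least three has two rows or two columns such that the lifts obtained by deleting either one agree and can be glued; otherwise the graph consists of paths and cycles, and a cycle is shortened by a pivot.
-- The ring ℚ(α) is replaced by the product Ω of GF(4), ℚ(i) and the functions on a sequence of rational evaluation points, where α is represented by (ω, i, evaluation).  In this ring the substitution is a projection.

open import Defs
open import Algebra.Bundles using (CommutativeRing)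
open import Algebra.Bundles.Raw using (RawRing)
import Algebra.Construct.DirectProduct as DirectProduct
import Algebra.Construct.Pointwise as Pointwise
import Algebra.Solver.Ring
open import Algebra.Solver.Ring.AlmostCommutativeRing using (AlmostCommutativeRing; fromCommutativeRing; _-Raw-AlmostCommutative⟶_)
open import Data.Bool using (Bool; true; false; not; _xor_)
import Data.Bool.Properties as BoolP
open import Data.Empty using (⊥)
open import Data.Fin using (Fin; zero; suc; toℕ; punchIn; punchOut; _≟_)
import Data.Fin.Properties as FinP
open import Data.Integer as ℤ using (ℤ; +_; -[1+_])
import Data.Integer.Properties as ℤP
open import Data.List as List using (List; []; _∷_; _++_; length; filter)
import Data.List.Properties as ListP
open import Data.List.Membership.Propositional using (_∈_; _∉_; find; lose)
open import Data.List.Membership.Propositional.Properties using (∈-filter⁺; ∈-filter⁻; ∈-allFin; ∈-map⁺; ∈-++⁺ˡ; ∈-++⁺ʳ)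
import Data.List.Membership.DecPropositional as DecMembership
open import Data.List.Relation.Unary.All as All using (All; []; _∷_)
import Data.List.Relation.Unary.All.Properties as AllP
open import Data.List.Relation.Unary.Any as Any using (Any; here; there; any?)
open import Data.Maybe using (Maybe; just; nothing)
open import Data.Nat as ℕ using (ℕ; zero; suc; z≤n; s≤s; _≤_; _<_)
import Data.Nat.Properties as ℕP
open import Data.Product using (∃; Σ; _×_; _,_; proj₁; proj₂)
import Data.Product.Properties as ProductP
open import Data.Rational as ℚ using (ℚ; 0ℚ; 1ℚ; ½; ↥_; ↧_)
import Data.Rational.Properties as ℚP
open import Data.Rational.Unnormalised as ℚᵘ using (mkℚᵘ; *≡*)
import Data.Rational.Unnormalised.Properties as ℚᵘP
open import Data.Sum as Sum using (_⊎_; inj₁; inj₂; swap)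
import Data.Sum.Properties as SumP
open import Data.Unit using (⊤; tt)
open import Data.Vec.Functional using () renaming (_∷_ to _∷ᵛ_)
open import Function using (_∘_; flip; id)
open import Function.Bundles using (_⇔_; mk⇔; Equivalence)
open import Function.Definitions using (Injective)
open import Level using (0ℓ)
open import Relation.Binary.PropositionalEquality as ≡ using (_≡_; _≢_; cong; cong₂; subst; subst₂)
open import Relation.Nullary using (¬_; Dec; yes; no; contradiction)
open import Relation.Nullary.Decidable using (map′; _×-dec_; _→-dec_; ¬?; toWitness)

-- A minor containing both glued columns is seen by neither deletion; this is why the rows involved
-- have to stay connected. Pivoting reduces such a minor to size 2×2, and a walk between its two
-- rows then expresses it through known minors by products of cross ratios. Uniqueness cannot be
-- postponed: the two lifts can be glued only if they agree on the common deletion. Fractions with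
-- denominator zero make equality in ℚ(α) intransitive, so no ring laws hold there. In Ω, an element
-- that is an integer polynomial up to a power of the generators vanishes as soon as it does so at
-- all large integer points. The nonzero cross ratios of GF(4) ⊗ H₂ are 1 and eighteen others, which
-- lift to the orbits of α, -α and α² under z ↦ 1 - z and z ↦ 1/z. That Ω has no further ones
-- follows from 2-adic and 3-adic valuations at α = 2, -2 and 1/2, which together with the image
-- bound all exponents.

-- A ring solver with integer coefficients for arbitrary commutative rings

module IntegerSolver (R : CommutativeRing 0ℓ 0ℓ) where
  open CommutativeRing R
  open import Algebra.Properties.Ring ring using (-‿distribˡ-*; -‿distribʳ-*; -‿+-comm; -0#≈0#; -‿involutive)
  open import Algebra.Properties.Semiring.Mult.TCOptimised semiring
    using (×-homo-+; ×1-homo-*; 1+×) renaming (_×_ to _⋆_)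
  open import Relation.Binary.Reasoning.Setoid setoid

  ⟦_⟧ℤ : ℤ → Carrier
  ⟦ + n ⟧ℤ      = n ⋆ 1#
  ⟦ -[1+ n ] ⟧ℤ = - (suc n ⋆ 1#)

  cancel-+ : ∀ a b c → (c + a) + - (c + b) ≈ a + - b
  cancel-+ a b c = begin
    (c + a) + - (c + b)   ≈⟨ +-cong (+-comm c a) (sym (-‿+-comm c b)) ⟩
    (a + c) + (- c + - b) ≈⟨ +-assoc a c _ ⟩
    a + (c + (- c + - b)) ≈⟨ +-congˡ (sym (+-assoc c (- c) (- b))) ⟩
    a + ((c + - c) + - b) ≈⟨ +-congˡ (+-congʳ (-‿inverseʳ c)) ⟩
    a + (0# + - b)        ≈⟨ +-congˡ (+-identityˡ (- b)) ⟩
    a + - b ∎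

  ⊖-homo : ∀ m n → ⟦ m ℤ.⊖ n ⟧ℤ ≈ m ⋆ 1# + - (n ⋆ 1#)
  ⊖-homo zero    zero    = sym (trans (+-identityˡ _) -0#≈0#)
  ⊖-homo zero    (suc n) = sym (+-identityˡ _)
  ⊖-homo (suc m) zero    = sym (trans (+-congˡ -0#≈0#) (+-identityʳ _))
  ⊖-homo (suc m) (suc n) = begin
    ⟦ suc m ℤ.⊖ suc n ⟧ℤ ≡⟨ ≡.cong ⟦_⟧ℤ (ℤP.[1+m]⊖[1+n]≡m⊖n m n) ⟩
    ⟦ m ℤ.⊖ n ⟧ℤ         ≈⟨ ⊖-homo m n ⟩
    m ⋆ 1# + - (n ⋆ 1#)  ≈⟨ sym (cancel-+ _ _ 1#) ⟩
    (1# + m ⋆ 1#) + - (1# + n ⋆ 1#)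
      ≈⟨ +-cong (sym (1+× m 1#)) (-‿cong (sym (1+× n 1#))) ⟩
    suc m ⋆ 1# + - (suc n ⋆ 1#) ∎

  +-homoℤ : ∀ x y → ⟦ x ℤ.+ y ⟧ℤ ≈ ⟦ x ⟧ℤ + ⟦ y ⟧ℤ
  +-homoℤ (+ m)      (+ n)      = ×-homo-+ 1# m n
  +-homoℤ (+ m)      (-[1+ n ]) = ⊖-homo m (suc n)
  +-homoℤ (-[1+ m ]) (+ n)      = trans (⊖-homo n (suc m)) (+-comm _ _)
  +-homoℤ (-[1+ m ]) (-[1+ n ]) = begin
    - (suc (suc (m ℕ.+ n)) ⋆ 1#)     ≡⟨ ≡.cong (λ k → - (suc k ⋆ 1#)) (≡.sym (ℕP.+-suc m n)) ⟩
    - ((suc m ℕ.+ suc n) ⋆ 1#)       ≈⟨ -‿cong (×-homo-+ 1# (suc m) (suc n)) ⟩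
    - (suc m ⋆ 1# + suc n ⋆ 1#)      ≈⟨ sym (-‿+-comm _ _) ⟩
    - (suc m ⋆ 1#) + - (suc n ⋆ 1#)  ∎

  -‿homoℤ : ∀ x → ⟦ ℤ.- x ⟧ℤ ≈ - ⟦ x ⟧ℤ
  -‿homoℤ (+ zero)  = sym -0#≈0#
  -‿homoℤ (+ suc n) = refl
  -‿homoℤ -[1+ n ]  = sym (-‿involutive _)

  pos-homo-* : ∀ n y → ⟦ + n ℤ.* y ⟧ℤ ≈ ⟦ + n ⟧ℤ * ⟦ y ⟧ℤ
  pos-homo-* n (+ m) = trans (reflexive (≡.cong ⟦_⟧ℤ (≡.sym (ℤP.pos-* n m)))) (×1-homo-* n m)
  pos-homo-* n -[1+ m ] = begin
    ⟦ + n ℤ.* (ℤ.- (+ suc m)) ⟧ℤ  ≡⟨ ≡.cong ⟦_⟧ℤ (≡.sym (ℤP.neg-distribʳ-* (+ n) (+ suc m))) ⟩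
    ⟦ ℤ.- (+ n ℤ.* + suc m) ⟧ℤ    ≈⟨ -‿homoℤ (+ n ℤ.* + suc m) ⟩
    - ⟦ + n ℤ.* + suc m ⟧ℤ        ≈⟨ -‿cong (pos-homo-* n (+ suc m)) ⟩
    - (n ⋆ 1# * (suc m ⋆ 1#))     ≈⟨ -‿distribʳ-* _ _ ⟩
    n ⋆ 1# * - (suc m ⋆ 1#) ∎

  *-homoℤ : ∀ x y → ⟦ x ℤ.* y ⟧ℤ ≈ ⟦ x ⟧ℤ * ⟦ y ⟧ℤ
  *-homoℤ (+ n)    y = pos-homo-* n y
  *-homoℤ -[1+ n ] y = begin
    ⟦ (ℤ.- (+ suc n)) ℤ.* y ⟧ℤ  ≡⟨ ≡.cong ⟦_⟧ℤ (≡.sym (ℤP.neg-distribˡ-* (+ suc n) y)) ⟩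
    ⟦ ℤ.- (+ suc n ℤ.* y) ⟧ℤ    ≈⟨ -‿homoℤ (+ suc n ℤ.* y) ⟩
    - ⟦ + suc n ℤ.* y ⟧ℤ        ≈⟨ -‿cong (pos-homo-* (suc n) y) ⟩
    - (suc n ⋆ 1# * ⟦ y ⟧ℤ)     ≈⟨ -‿distribˡ-* _ _ ⟩
    - (suc n ⋆ 1#) * ⟦ y ⟧ℤ ∎

  almost : AlmostCommutativeRing 0ℓ 0ℓ
  almost = fromCommutativeRing R

  morphism : ℤ.+-*-rawRing -Raw-AlmostCommutative⟶ almost
  morphism = record
    { ⟦_⟧ = ⟦_⟧ℤ ; +-homo = +-homoℤ ; *-homo = *-homoℤ ; -‿homo = -‿homoℤ
    ; 0-homo = refl ; 1-homo = refl }

  coeff≟ : ∀ x y → Maybe (⟦ x ⟧ℤ ≈ ⟦ y ⟧ℤ)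
  coeff≟ x y with x ℤ.≟ y
  ... | yes x≡y = just (reflexive (≡.cong ⟦_⟧ℤ x≡y))
  ... | no  _   = nothing

  open Algebra.Solver.Ring ℤ.+-*-rawRing almost morphism coeff≟ public
    using (Polynomial; solve; _:=_; _:+_; _:*_; :-_; _:-_; con)

-- Determinants: transposition, row operations and condensation

module DetTheory (R : CommutativeRing 0ℓ 0ℓ) where
  open CommutativeRing R hiding (zero)
  open import Algebra.Properties.Ring ring using (-‿distribˡ-*; -‿distribʳ-*; -‿+-comm; -0#≈0#; -‿involutive)
  open IntegerSolver R
  open Det rawRing
  open import Relation.Binary.Reasoning.Setoid setoid

  Row : ℕ → Set
  Row n = Fin n → Carrier

  Mat : ℕ → ℕ → Set
  Mat k n = Fin k → Row n

  abstract
    -- Opaque copies of `sumFin` and `det`. Only the recursion equations are exported, so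
    -- determinants are never unfolded into their expansions.
    ∑ : ∀ n → Row n → Carrier
    ∑ = sumFin

    D : ∀ n → Mat n n → Carrier
    D = det

    D≈det : ∀ n A → D n A ≈ det n A
    D≈det n A = refl

    ∑-0 : ∀ (f : Row 0) → ∑ 0 f ≈ 0#
    ∑-0 f = refl

    ∑-suc : ∀ n (f : Row (suc n)) → ∑ (suc n) f ≈ f zero + ∑ n (f ∘ suc)
    ∑-suc n f = refl

    D-0 : ∀ A → D 0 A ≈ 1#
    D-0 A = refl

    D-suc : ∀ n A → D (suc n) A ≈ ∑ (suc n) (λ j → signed (toℕ j) (A zero j * D n (λ r c → A (suc r) (punchIn j c))))
    D-suc n A = refl

    ∑-cong : ∀ n {f g : Row n} → (∀ i → f i ≈ g i) → ∑ n f ≈ ∑ n g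
    ∑-cong zero    e = refl
    ∑-cong (suc n) e = +-cong (e zero) (∑-cong n (λ i → e (suc i)))

  ∑-zero : ∀ n {f : Row n} → (∀ i → f i ≈ 0#) → ∑ n f ≈ 0#
  ∑-zero zero    e = ∑-0 _
  ∑-zero (suc n) e = trans (∑-suc n _) (trans (+-cong (e zero) (∑-zero n (λ i → e (suc i)))) (+-identityˡ 0#))

  ∑-1 : ∀ (f : Row 1) → ∑ 1 f ≈ f zero
  ∑-1 f = trans (∑-suc 0 f) (trans (+-congˡ (∑-0 _)) (+-identityʳ _))

  ∑-+ : ∀ n (f g : Row n) → ∑ n (λ i → f i + g i) ≈ ∑ n f + ∑ n g
  ∑-+ zero    f g = trans (∑-0 _) (sym (trans (+-cong (∑-0 f) (∑-0 g)) (+-identityˡ 0#)))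
  ∑-+ (suc n) f g = trans (∑-suc n _) (trans (+-congˡ (∑-+ n _ _)) (trans
    (solve 4 (λ a b c d → (a :+ b) :+ (c :+ d) := (a :+ c) :+ (b :+ d)) refl _ _ _ _)
    (sym (+-cong (∑-suc n f) (∑-suc n g)))))

  ∑-* : ∀ n x (f : Row n) → ∑ n (λ i → x * f i) ≈ x * ∑ n f
  ∑-* zero    x f = trans (∑-0 _) (sym (trans (*-congˡ (∑-0 f)) (zeroʳ x)))
  ∑-* (suc n) x f = trans (∑-suc n _) (trans (+-congˡ (∑-* n x _)) (trans (sym (distribˡ x _ _)) (*-congˡ (sym (∑-suc n f)))))

  ∑-neg : ∀ n (f : Row n) → ∑ n (λ i → - f i) ≈ - ∑ n f
  ∑-neg n f = trans (∑-cong n (λ i → sym (trans (sym (-‿distribˡ-* 1# (f i))) (-‿cong (*-identityˡ _)))))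
    (trans (∑-* n (- 1#) f) (trans (sym (-‿distribˡ-* 1# _)) (-‿cong (*-identityˡ _))))

  ∑-swap : ∀ m n (f : Fin m → Fin n → Carrier) →
    ∑ m (λ i → ∑ n (f i)) ≈ ∑ n (λ j → ∑ m (λ i → f i j))
  ∑-swap zero    n f = trans (∑-0 _) (sym (∑-zero n (λ _ → ∑-0 _)))
  ∑-swap (suc m) n f = trans (∑-suc m _) (trans (+-congˡ (∑-swap m n _))
    (trans (sym (∑-+ n _ _)) (∑-cong n (λ j → sym (∑-suc m _)))))

  signed-cong : ∀ k {x y} → x ≈ y → signed k x ≈ signed k y
  signed-cong zero    e = e
  signed-cong (suc k) e = -‿cong (signed-cong k e)

  signed-0 : ∀ k → signed k 0# ≈ 0#
  signed-0 zero    = refl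
  signed-0 (suc k) = trans (-‿cong (signed-0 k)) -0#≈0#

  signed-+ : ∀ k x y → signed k (x + y) ≈ signed k x + signed k y
  signed-+ zero    x y = refl
  signed-+ (suc k) x y = trans (-‿cong (signed-+ k x y)) (sym (-‿+-comm _ _))

  signed-* : ∀ k x y → signed k (x * y) ≈ x * signed k y
  signed-* zero    x y = refl
  signed-* (suc k) x y = trans (-‿cong (signed-* k x y)) (-‿distribʳ-* x _)

  signed-neg : ∀ k x → signed k (- x) ≈ - signed k x
  signed-neg zero    x = refl
  signed-neg (suc k) x = -‿cong (signed-neg k x)

  signed-comm : ∀ k l x → signed k (signed l x) ≈ signed l (signed k x)
  signed-comm zero    l x = refl
  signed-comm (suc k) l x = trans (-‿cong (signed-comm k l x)) (sym (signed-neg l _))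

  signed-sum : ∀ k n (f : Row n) → signed k (∑ n f) ≈ ∑ n (λ i → signed k (f i))
  signed-sum k zero    f = trans (signed-cong k (∑-0 f)) (trans (signed-0 k) (sym (∑-0 _)))
  signed-sum k (suc n) f = trans (signed-cong k (∑-suc n f)) (trans (signed-+ k _ _) (trans (+-congˡ (signed-sum k n _)) (sym (∑-suc n _))))

  D-cong : ∀ n {A B : Mat n n} → (∀ i j → A i j ≈ B i j) → D n A ≈ D n B
  D-cong zero    e = trans (D-0 _) (sym (D-0 _))
  D-cong (suc n) e = trans (D-suc n _) (trans
    (∑-cong (suc n) λ j → signed-cong (toℕ j) (*-cong (e zero j) (D-cong n (λ r c → e (suc r) (punchIn j c)))))
    (sym (D-suc n _)))

  D-suc′ : ∀ n (A : Mat (suc n) (suc n)) → D (suc n) A ≈ A zero zero * D n (λ r c → A (suc r) (suc c)) +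
    ∑ n (λ j → - signed (toℕ j) (A zero (suc j) * D n (λ r c → A (suc r) (punchIn (suc j) c))))
  D-suc′ n A = trans (D-suc n A) (∑-suc n _)

  -- Expanding along row 0, and each of the resulting minors along column 0, gives a double sum over
  -- the minors `M i j` that miss row 0, column 0, row i + 1 and column j + 1. Interchanging the two
  -- sums turns it into the expansion along column 0, from which invariance under transposition
  -- follows.
  det-firstColumn′ : ∀ n (A : Mat (suc n) (suc n)) → D (suc n) A ≈ A zero zero * D n (λ r c → A (suc r) (suc c)) +
    ∑ n (λ i → - signed (toℕ i) (A (suc i) zero * D n (λ r c → A (punchIn (suc i) r) (suc c))))
  det-firstColumn′ zero    A = trans (D-suc′ 0 A) (+-congˡ (trans (∑-0 _) (sym (∑-0 _))))
  det-firstColumn′ (suc n) A = trans (D-suc′ (suc n) A) (+-congˡ (begin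
    ∑ (suc n) (λ j → - signed (toℕ j) (A zero (suc j) *
      D (suc n) (λ r c → A (suc r) (punchIn (suc j) c))))
      ≈⟨ ∑-cong (suc n) (λ j → trans
           (-‿cong (signed-cong (toℕ j) (*-congˡ (trans (det-firstColumn′ n (λ r c → A (suc r) (punchIn (suc j) c))) (sym (∑-suc n (λ i → signed (toℕ i) (A (suc i) zero * M i j))))))))
           (expand (toℕ j) _ _)) ⟩
    ∑ (suc n) (λ j → ∑ (suc n) (λ i → - signed (toℕ j) (A zero (suc j) *
      signed (toℕ i) (A (suc i) zero * M i j))))
      ≈⟨ ∑-swap (suc n) (suc n) _ ⟩
    ∑ (suc n) (λ i → ∑ (suc n) (λ j → - signed (toℕ j) (A zero (suc j) *
      signed (toℕ i) (A (suc i) zero * M i j))))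
      ≈⟨ ∑-cong (suc n) (λ i → ∑-cong (suc n) (λ j → -‿cong (exchange (toℕ j) (toℕ i) _ _ _))) ⟩
    ∑ (suc n) (λ i → ∑ (suc n) (λ j → - signed (toℕ i) (A (suc i) zero *
      signed (toℕ j) (A zero (suc j) * M i j))))
      ≈⟨ ∑-cong (suc n) (λ i → trans (sym (expand (toℕ i) _ _)) (-‿cong (signed-cong (toℕ i) (*-congˡ (sym (D-suc n _)))))) ⟩
    ∑ (suc n) (λ i → - signed (toℕ i) (A (suc i) zero *
      D (suc n) (λ r c → A (punchIn (suc i) r) (suc c)))) ∎))
    where
    M : Fin (suc n) → Fin (suc n) → Carrier
    M i j = D n (λ r c → A (suc (punchIn i r)) (suc (punchIn j c)))
    expand : ∀ k x (f : Row (suc n)) →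
      - signed k (x * ∑ (suc n) f) ≈ ∑ (suc n) (λ i → - signed k (x * f i))
    expand k x f = trans (-‿cong (trans (signed-cong k (sym (∑-* (suc n) x f))) (signed-sum k (suc n) _)))
      (sym (∑-neg (suc n) _))
    exchange : ∀ k l x y z → signed k (x * signed l (y * z)) ≈ signed l (y * signed k (x * z))
    exchange k l x y z = begin
      signed k (x * signed l (y * z))  ≈⟨ signed-cong k (sym (signed-* l x _)) ⟩
      signed k (signed l (x * (y * z))) ≈⟨ signed-comm k l _ ⟩
      signed l (signed k (x * (y * z))) ≈⟨ signed-cong l (signed-cong k (solve 3 (λ x y z → x :* (y :* z) := y :* (x :* z)) refl x y z)) ⟩
      signed l (signed k (y * (x * z))) ≈⟨ signed-cong l (signed-* k y _) ⟩
      signed l (y * signed k (x * z)) ∎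

  det-firstColumn : ∀ n (A : Mat (suc n) (suc n)) → D (suc n) A ≈
    ∑ (suc n) (λ i → signed (toℕ i) (A i zero * D n (λ r c → A (punchIn i r) (suc c))))
  det-firstColumn n A = trans (det-firstColumn′ n A) (sym (∑-suc n _))

  det-transpose : ∀ n (A : Mat n n) → D n (λ i j → A j i) ≈ D n A
  det-transpose zero    A = trans (D-0 _) (sym (D-0 _))
  det-transpose (suc n) A = trans (D-suc n _) (trans
    (∑-cong (suc n) λ j → signed-cong (toℕ j) (*-congˡ (det-transpose n (λ r c → A (punchIn j r) (suc c)))))
    (sym (det-firstColumn n A)))

  -- The expansion along two rows, with the remaining minors abstracted to a function `m` of the map
  -- that lists their columns. Induction on the columns needs this generality: splitting off column
  -- 0 replaces `m` by `m ∘ lift`.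
  twoRows : ∀ n → Row (suc (suc n)) → Row (suc (suc n)) → ((Fin n → Fin (suc (suc n))) → Carrier) → Carrier
  twoRows n a b m = ∑ (suc (suc n)) λ j → signed (toℕ j) (a j *
    ∑ (suc n) (λ k → signed (toℕ k) (b (punchIn j k) * m (λ c → punchIn j (punchIn k c)))))

  lift : ∀ {m n} → (Fin m → Fin n) → Fin (suc m) → Fin (suc n)
  lift f zero    = zero
  lift f (suc c) = suc (f c)

  Respects : ∀ {m n} → ((Fin m → Fin n) → Carrier) → Set
  Respects m = ∀ {f g} → (∀ c → f c ≡ g c) → m f ≈ m g

  -- Splitting off column 0 leaves terms with exactly one of the two rows in column 0, which pair up, and the same sum over the remaining columns.
  twoRows-split : ∀ n a b (m : (Fin (suc n) → Fin (suc (suc (suc n)))) → Carrier) → Respects m →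
    let t = λ (x y : Row (suc (suc (suc n)))) → ∑ (suc (suc n)) (λ k → x zero * signed (toℕ k) (y (suc k) * m (λ c → suc (punchIn k c)))) in
    twoRows (suc n) a b m ≈ (t a b - t b a) + twoRows n (a ∘ suc) (b ∘ suc) (m ∘ lift)
  twoRows-split n a b m cong-m = begin
    twoRows (suc n) a b m
      ≈⟨ trans (∑-suc (suc (suc n)) _) (+-congˡ (∑-cong (suc (suc n)) (λ j → -‿cong (signed-cong (toℕ j) (*-congˡ (trans (∑-suc (suc n) _) (+-congʳ (*-congˡ (cong-m (λ c → ≡.refl)))))))))) ⟩
    a zero * ∑ (suc (suc n)) (λ k → signed (toℕ k) (b (suc k) * m (λ c → suc (punchIn k c)))) + ∑ (suc (suc n)) (λ j → - signed (toℕ j) (a (suc j) * (b zero * m (λ c → suc (punchIn j c)) + rest j)))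
      ≈⟨ +-cong (sym (∑-* (suc (suc n)) (a zero) _)) (∑-cong (suc (suc n)) λ j → step (toℕ j) (a (suc j)) (b zero) (m (λ c → suc (punchIn j c))) (rest j)) ⟩
    T a b + ∑ (suc (suc n)) (λ j → - (b zero * signed (toℕ j) (a (suc j) * m (λ c → suc (punchIn j c)))) + signed (toℕ j) (a (suc j) * - rest j))
      ≈⟨ +-congˡ (trans (∑-+ (suc (suc n)) _ _) (+-cong (∑-neg (suc (suc n)) _) (∑-cong (suc (suc n)) (λ j → signed-cong (toℕ j) (*-congˡ (tail j)))))) ⟩
    T a b + (- T b a + twoRows n (a ∘ suc) (b ∘ suc) (m ∘ lift))
      ≈⟨ sym (+-assoc _ _ _) ⟩
    (T a b - T b a) + twoRows n (a ∘ suc) (b ∘ suc) (m ∘ lift) ∎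
    where
    T : Row (suc (suc (suc n))) → Row (suc (suc (suc n))) → Carrier
    T x y = ∑ (suc (suc n)) (λ k → x zero * signed (toℕ k) (y (suc k) * m (λ c → suc (punchIn k c))))
    rest : Fin (suc (suc n)) → Carrier
    rest j = ∑ (suc n) (λ k → - signed (toℕ k) (b (suc (punchIn j k)) * m (λ c → punchIn (suc j) (punchIn (suc k) c))))
    step : ∀ k x y z w → - signed k (x * (y * z + w)) ≈ - (y * signed k (x * z)) + signed k (x * - w)
    step k x y z w = begin
      - signed k (x * (y * z + w)) ≈⟨ sym (signed-neg k _) ⟩
      signed k (- (x * (y * z + w))) ≈⟨ signed-cong k (solve 4 (λ x y z w → :- (x :* (y :* z :+ w)) := :- (y :* (x :* z)) :+ x :* (:- w)) refl x y z w) ⟩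
      signed k (- (y * (x * z)) + x * - w) ≈⟨ signed-+ k _ _ ⟩
      signed k (- (y * (x * z))) + signed k (x * - w) ≈⟨ +-congʳ (trans (signed-neg k _) (-‿cong (signed-* k _ _))) ⟩
      - (y * signed k (x * z)) + signed k (x * - w) ∎
    tail : ∀ j → - rest j ≈ ∑ (suc n) (λ k → signed (toℕ k) (b (suc (punchIn j k)) * m (lift (λ c → punchIn j (punchIn k c)))))
    tail j = trans (sym (∑-neg (suc n) _)) (∑-cong (suc n) (λ k → trans (-‿involutive _)
      (signed-cong (toℕ k) (*-congˡ (cong-m λ { zero → ≡.refl ; (suc c) → ≡.refl })))))

  lift-cong : ∀ {m n} {f g : Fin m → Fin n} → (∀ c → f c ≡ g c) → ∀ c → lift f c ≡ lift g c
  lift-cong e zero    = ≡.refl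
  lift-cong e (suc c) = ≡.cong suc (e c)

  twoRows-base : ∀ a b m → Respects m → twoRows 0 a b m ≈ (a zero * b (suc zero) - a (suc zero) * b zero) * m (λ ())
  twoRows-base a b m cong-m = begin
    twoRows 0 a b m
      ≈⟨ trans (∑-suc 1 _) (+-cong (*-congˡ (∑-1 _)) (trans (∑-1 _) (-‿cong (*-congˡ (∑-1 _))))) ⟩
    a zero * (b (suc zero) * m _) + - (a (suc zero) * (b zero * m _))
      ≈⟨ +-cong (*-congˡ (*-congˡ (cong-m λ ()))) (-‿cong (*-congˡ (*-congˡ (cong-m λ ())))) ⟩
    a zero * (b (suc zero) * m (λ ())) + - (a (suc zero) * (b zero * m (λ ())))
      ≈⟨ solve 5 (λ a b c d m → a :* (b :* m) :+ (:- (c :* (d :* m))) := (a :* b :- c :* d) :* m) refl _ _ _ _ _ ⟩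
    (a zero * b (suc zero) - a (suc zero) * b zero) * m (λ ()) ∎

  twoRows-swap : ∀ n a b m → Respects m → twoRows n a b m ≈ - twoRows n b a m
  twoRows-swap zero    a b m cong-m = trans (twoRows-base a b m cong-m) (trans
    (solve 5 (λ a b c d m → (a :* b :- c :* d) :* m := :- ((d :* c :- b :* a) :* m)) refl _ _ _ _ _)
    (-‿cong (sym (twoRows-base b a m cong-m))))
  twoRows-swap (suc n) a b m cong-m = begin
    twoRows (suc n) a b m ≈⟨ twoRows-split n a b m cong-m ⟩
    _ ≈⟨ +-congˡ (twoRows-swap n (a ∘ suc) (b ∘ suc) (m ∘ lift) (λ e → cong-m (lift-cong e))) ⟩
    _ ≈⟨ solve 3 (λ a b c → (a :- b) :+ :- c := :- ((b :- a) :+ c)) refl _ _ _ ⟩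
    _ ≈⟨ -‿cong (sym (twoRows-split n b a m cong-m)) ⟩
    - twoRows (suc n) b a m ∎

  -- Antisymmetry only shows that twice the value is zero, which says nothing in characteristic 2;
  -- hence a separate induction.
  twoRows-equal : ∀ n a m → Respects m → twoRows n a a m ≈ 0#
  twoRows-equal zero    a m cong-m = trans (twoRows-base a a m cong-m)
    (trans (*-congʳ (trans (+-congʳ (*-comm _ _)) (-‿inverseʳ _))) (zeroˡ _))
  twoRows-equal (suc n) a m cong-m = trans (twoRows-split n a a m cong-m)
    (trans (+-cong (-‿inverseʳ _) (twoRows-equal n (a ∘ suc) (m ∘ lift) (λ e → cong-m (lift-cong e)))) (+-identityˡ 0#))

  D-twoRows : ∀ n a b (C : Mat n (suc (suc n))) →
    D (suc (suc n)) (a ∷ᵛ b ∷ᵛ C) ≈ twoRows n a b (λ f → D n (λ r c → C r (f c)))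
  D-twoRows n a b C = trans (D-suc (suc n) _) (∑-cong (suc (suc n)) λ j → signed-cong (toℕ j) (*-congˡ (D-suc n _)))

  det-swap : ∀ n a b (C : Mat n (suc (suc n))) → D (suc (suc n)) (a ∷ᵛ b ∷ᵛ C) ≈ - D (suc (suc n)) (b ∷ᵛ a ∷ᵛ C)
  det-swap n a b C = trans (D-twoRows n a b C) (trans
    (twoRows-swap n a b (λ f → D n (λ r c → C r (f c)))
      (λ e → D-cong n (λ r c → reflexive (≡.cong (C r) (e c)))))
    (-‿cong (sym (D-twoRows n b a C))))

  -- If the repeated row lies further down, exchanging the two top rows and expanding along the new
  -- top row leaves minors that still contain the repetition.
  det-equal : ∀ n v (C : Mat n (suc n)) i → (∀ c → C i c ≈ v c) → D (suc n) (v ∷ᵛ C) ≈ 0#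
  det-equal (suc n) v C zero    e = trans
    (D-cong (suc (suc n)) {v ∷ᵛ C} {v ∷ᵛ v ∷ᵛ C ∘ suc} λ { zero c → refl ; (suc zero) c → e c ; (suc (suc r)) c → refl })
    (trans (D-twoRows n v v (C ∘ suc)) (twoRows-equal n v (λ f → D n (λ r c → C (suc r) (f c)))
      (λ e → D-cong n (λ r c → reflexive (≡.cong (C (suc r)) (e c))))))
  det-equal (suc n) v C (suc i) e = begin
    D (suc (suc n)) (v ∷ᵛ C)
      ≈⟨ D-cong (suc (suc n)) {v ∷ᵛ C} {v ∷ᵛ C zero ∷ᵛ C ∘ suc} (λ { zero c → refl ; (suc zero) c → refl ; (suc (suc r)) c → refl }) ⟩
    D (suc (suc n)) (v ∷ᵛ C zero ∷ᵛ C ∘ suc)   ≈⟨ det-swap n v (C zero) (C ∘ suc) ⟩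
    - D (suc (suc n)) (C zero ∷ᵛ v ∷ᵛ C ∘ suc)
      ≈⟨ -‿cong (trans (D-suc (suc n) _) (∑-zero (suc (suc n)) (λ j → trans (signed-cong (toℕ j) (trans (*-congˡ (minor j)) (zeroʳ _))) (signed-0 (toℕ j))))) ⟩
    - 0#  ≈⟨ -0#≈0# ⟩
    0# ∎
    where
    minor : ∀ j → D (suc n) (λ r c → (v ∷ᵛ C ∘ suc) r (punchIn j c)) ≈ 0#
    minor j = trans
      (D-cong (suc n) {B = (v ∘ punchIn j) ∷ᵛ (λ r c → C (suc r) (punchIn j c))} λ { zero c → refl ; (suc r) c → refl })
      (det-equal n (v ∘ punchIn j) (λ r c → C (suc r) (punchIn j c)) i (λ c → e (punchIn j c)))

  module _ {n : ℕ} where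
    _≐_ : ∀ {k} → Mat k n → Mat k n → Set
    A ≐ B = ∀ i j → A i j ≈ B i j

    -- Linearity is demanded of the top row, and recursively of the function of the other rows that
    -- arises when the top row is fixed. Rows can thus be treated from the top, without replacing a
    -- row in the middle of a matrix.
    Multilinear : ∀ k → (Mat k n → Carrier) → Set
    Multilinear zero    f = ∀ {A B} → A ≐ B → f A ≈ f B
    Multilinear (suc k) f = (∀ {A B} → A ≐ B → f A ≈ f B)
      × (∀ x y t C → f ((λ j → x j + t * y j) ∷ᵛ C) ≈ f (x ∷ᵛ C) + t * f (y ∷ᵛ C))
      × (∀ x → Multilinear k (λ C → f (x ∷ᵛ C)))

    multilinear-resp : ∀ k {f g} → (∀ C → f C ≈ g C) → Multilinear k f → Multilinear k g
    multilinear-resp zero    e ml = λ eq → trans (sym (e _)) (trans (ml eq) (e _))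
    multilinear-resp (suc k) e (cg , lin , ml) =
      (λ eq → trans (sym (e _)) (trans (cg eq) (e _))) ,
      (λ x y t C → trans (sym (e _)) (trans (lin x y t C) (+-cong (e _) (*-congˡ (e _))))) ,
      (λ x → multilinear-resp k (λ C → e (x ∷ᵛ C)) (ml x))

    multilinear-0 : ∀ k → Multilinear k (λ _ → 0#)
    multilinear-0 zero    = λ _ → refl
    multilinear-0 (suc k) = (λ _ → refl) ,
      (λ x y t C → sym (trans (+-identityˡ _) (zeroʳ t))) , (λ x → multilinear-0 k)

    multilinear-+ : ∀ k {f g} → Multilinear k f → Multilinear k g → Multilinear k (λ C → f C + g C)
    multilinear-+ zero    mf mg = λ eq → +-cong (mf eq) (mg eq)
    multilinear-+ (suc k) (cf , lf , mf) (cg , lg , mg) = (λ eq → +-cong (cf eq) (cg eq)) ,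
      (λ x y t C → trans (+-cong (lf x y t C) (lg x y t C))
        (solve 5 (λ a b c d t → (a :+ t :* b) :+ (c :+ t :* d) := (a :+ c) :+ t :* (b :+ d)) refl _ _ _ _ t)) ,
      (λ x → multilinear-+ k (mf x) (mg x))

    multilinear-scale : ∀ k s {f} → Multilinear k f → Multilinear k (λ C → s * f C)
    multilinear-scale zero    s mf = λ eq → *-congˡ (mf eq)
    multilinear-scale (suc k) s (cf , lf , mf) = (λ eq → *-congˡ (cf eq)) ,
      (λ x y t C → trans (*-congˡ (lf x y t C))
        (solve 4 (λ s a b t → s :* (a :+ t :* b) := s :* a :+ t :* (s :* b)) refl s _ _ t)) ,
      (λ x → multilinear-scale k s (mf x))

    multilinear-neg : ∀ k {f} → Multilinear k f → Multilinear k (λ C → - f C)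
    multilinear-neg k {f} ml = multilinear-resp k
      (λ C → trans (sym (-‿distribˡ-* 1# (f C))) (-‿cong (*-identityˡ (f C)))) (multilinear-scale k (- 1#) ml)

    multilinear-signed : ∀ k l {f} → Multilinear k f → Multilinear k (λ C → signed l (f C))
    multilinear-signed k zero    ml = ml
    multilinear-signed k (suc l) ml = multilinear-neg k (multilinear-signed k l ml)

    multilinear-sum : ∀ k m (f : Fin m → Mat k n → Carrier) → (∀ j → Multilinear k (f j)) →
      Multilinear k (λ C → ∑ m (λ j → f j C))
    multilinear-sum k zero    f ml = multilinear-resp k (λ C → sym (∑-0 _)) (multilinear-0 k)
    multilinear-sum k (suc m) f ml = multilinear-resp k (λ C → sym (∑-suc m _))
      (multilinear-+ k (ml zero) (multilinear-sum k m (f ∘ suc) (ml ∘ suc)))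

  multilinear-columns : ∀ {m n} k (g : Fin m → Fin n) {f} → Multilinear k f → Multilinear k (λ C → f (λ r c → C r (g c)))
  multilinear-columns zero    g ml = λ eq → ml (λ i j → eq i (g j))
  multilinear-columns (suc k) g {f} (cg , lin , ml) = (λ eq → cg (λ i j → eq i (g j))) ,
    (λ x y t C → trans (cg λ { zero j → refl ; (suc i) j → refl })
      (trans (lin (x ∘ g) (y ∘ g) t (λ r c → C r (g c)))
        (+-cong (cg λ { zero j → refl ; (suc i) j → refl }) (*-congˡ (cg λ { zero j → refl ; (suc i) j → refl }))))) ,
    (λ x → multilinear-resp k (λ C → cg λ { zero j → refl ; (suc i) j → refl }) (multilinear-columns k g (ml (x ∘ g))))

  det-multilinear-tail : ∀ n (x : Row (suc n)) → Multilinear n (λ C → D (suc n) (x ∷ᵛ C))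
  det-multilinear : ∀ n → Multilinear n (D n)

  det-multilinear-tail n x = multilinear-resp n (λ C → sym (D-suc n (x ∷ᵛ C))) (multilinear-sum n (suc n) _ λ j →
    multilinear-signed n (toℕ j) (multilinear-scale n (x j) (multilinear-columns n (punchIn j) (det-multilinear n))))

  det-multilinear zero    = D-cong zero
  det-multilinear (suc n) = D-cong (suc n) ,
    (λ x y t C → trans
      (D-suc n _)
      (trans (∑-cong (suc n) λ j → trans
        (signed-cong (toℕ j) (solve 4 (λ x y t d → (x :+ t :* y) :* d := x :* d :+ t :* (y :* d)) refl (x j) (y j) t _))
        (trans (signed-+ (toℕ j) _ _) (+-congˡ (signed-* (toℕ j) t _))))
      (trans (∑-+ (suc n) _ _) (+-cong (sym (D-suc n _)) (trans (∑-* (suc n) t _) (*-congˡ (sym (D-suc n _)))))))) ,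
    det-multilinear-tail n

  -- The multiple of `v` added to the top row contributes the value at a matrix that has `v` as a
  -- row, which `kill` makes zero. The other rows follow by recursion with the top row fixed.
  multilinear-eliminate : ∀ {n} k {f : Mat k n → Carrier} → Multilinear k f → (v : Row n) →
    (∀ (C : Mat k n) i → (∀ c → C i c ≈ v c) → f C ≈ 0#) →
    ∀ (C : Mat k n) (t : Row k) → f (λ i j → C i j + t i * v j) ≈ f C
  multilinear-eliminate zero        ml v kill C t = ml (λ ())
  multilinear-eliminate {n} (suc k) {f} (cg , lin , ml) v kill C t = begin
    f (λ i j → C i j + t i * v j)
      ≈⟨ cg (λ { zero j → refl ; (suc i) j → refl }) ⟩
    f ((λ j → C zero j + t zero * v j) ∷ᵛ (λ i j → C (suc i) j + t (suc i) * v j))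
      ≈⟨ lin (C zero) v (t zero) _ ⟩
    f (C zero ∷ᵛ (λ i j → C (suc i) j + t (suc i) * v j)) + t zero * f (v ∷ᵛ (λ i j → C (suc i) j + t (suc i) * v j))
      ≈⟨ +-congˡ (trans (*-congˡ (kill _ zero (λ _ → refl))) (zeroʳ _)) ⟩
    f (C zero ∷ᵛ (λ i j → C (suc i) j + t (suc i) * v j)) + 0#
      ≈⟨ +-identityʳ _ ⟩
    f (C zero ∷ᵛ (λ i j → C (suc i) j + t (suc i) * v j))
      ≈⟨ multilinear-eliminate k {f = λ D → f (C zero ∷ᵛ D)} (ml (C zero)) v (λ D i → kill (C zero ∷ᵛ D) (suc i)) (C ∘ suc) (t ∘ suc) ⟩
    f (C zero ∷ᵛ C ∘ suc) ≈⟨ cg (λ { zero j → refl ; (suc i) j → refl }) ⟩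
    f C ∎

  det-eliminate : ∀ n v (C : Mat n (suc n)) (t : Row n) →
    D (suc n) (v ∷ᵛ (λ i j → C i j + t i * v j)) ≈ D (suc n) (v ∷ᵛ C)
  det-eliminate n v C t = multilinear-eliminate n {f = λ C → D (suc n) (v ∷ᵛ C)} (det-multilinear-tail n v) v (det-equal n v) C t

  prod : ∀ n → Row n → Carrier
  prod zero    f = 1#
  prod (suc n) f = f zero * prod n (f ∘ suc)

  det-scaleRows : ∀ n (s : Row n) (A : Mat n n) → D n (λ i j → s i * A i j) ≈ prod n s * D n A
  det-scaleRows zero    s A = trans (D-0 _) (sym (trans (*-identityˡ _) (D-0 A)))
  det-scaleRows (suc n) s A = trans (D-suc n _) (trans
    (∑-cong (suc n) λ j → trans
      (signed-cong (toℕ j) (trans (*-congˡ (det-scaleRows n (s ∘ suc) _))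
        (solve 4 (λ s a p d → (s :* a) :* (p :* d) := (s :* p) :* (a :* d)) refl _ _ _ _)))
      (signed-* (toℕ j) _ _))
    (trans (∑-* (suc n) _ _) (*-congˡ (sym (D-suc n A)))))

  det-front : ∀ n (A : Mat (suc n) (suc n)) i → D (suc n) A ≈ signed (toℕ i) (D (suc n) (A i ∷ᵛ (λ r → A (punchIn i r))))
  det-front n       A zero    = D-cong (suc n) λ { zero c → refl ; (suc r) c → refl }
  det-front (suc n) A (suc i) = begin
    D (suc (suc n)) A
      ≈⟨ trans (D-suc (suc n) A) (∑-cong (suc (suc n)) (λ j → signed-cong (toℕ j) (*-congˡ (det-front n (λ r c → A (suc r) (punchIn j c)) i)))) ⟩
    ∑ (suc (suc n)) (λ j → signed (toℕ j) (A zero j * signed (toℕ i) (M j)))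
      ≈⟨ ∑-cong (suc (suc n)) (λ j → trans (signed-cong (toℕ j) (sym (signed-* (toℕ i) _ _))) (signed-comm (toℕ j) (toℕ i) _)) ⟩
    ∑ (suc (suc n)) (λ j → signed (toℕ i) (signed (toℕ j) (A zero j * M j)))
      ≈⟨ sym (signed-sum (toℕ i) (suc (suc n)) _) ⟩
    signed (toℕ i) (∑ (suc (suc n)) (λ j → signed (toℕ j) (A zero j * M j)))
      ≈⟨ signed-cong (toℕ i) (trans (∑-cong (suc (suc n)) (λ j → signed-cong (toℕ j) (*-congˡ (D-cong (suc n) (λ { zero c → refl ; (suc r) c → refl }))))) (sym (D-suc (suc n) _))) ⟩
    signed (toℕ i) (D (suc (suc n)) (A zero ∷ᵛ A (suc i) ∷ᵛ (λ r → A (suc (punchIn i r)))))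
      ≈⟨ signed-cong (toℕ i) (det-swap n _ _ _) ⟩
    signed (toℕ i) (- D (suc (suc n)) (A (suc i) ∷ᵛ A zero ∷ᵛ (λ r → A (suc (punchIn i r)))))
      ≈⟨ signed-neg (toℕ i) _ ⟩
    - signed (toℕ i) (D (suc (suc n)) (A (suc i) ∷ᵛ A zero ∷ᵛ (λ r → A (suc (punchIn i r)))))
      ≈⟨ -‿cong (signed-cong (toℕ i) (D-cong (suc (suc n)) λ { zero c → refl ; (suc zero) c → refl ; (suc (suc r)) c → refl })) ⟩
    - signed (toℕ i) (D (suc (suc n)) (A (suc i) ∷ᵛ (λ r → A (punchIn (suc i) r)))) ∎
    where
    M : Fin (suc (suc n)) → Carrier
    M j = D (suc n) ((λ c → A (suc i) (punchIn j c)) ∷ᵛ (λ r c → A (suc (punchIn i r)) (punchIn j c)))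

  private
    signed-zeroTerm : ∀ k {x} y → x ≈ 0# → signed k (x * y) ≈ 0#
    signed-zeroTerm k y e = trans (signed-cong k (trans (*-congʳ e) (zeroˡ y))) (signed-0 k)

    only-first : ∀ n x (f : Row n) (k : Fin n → ℕ) (g : Row n) → (∀ i → f i ≈ 0#) →
      x + ∑ n (λ i → - signed (k i) (f i * g i)) ≈ x
    only-first n x f k g e = trans
      (+-congˡ (∑-zero n λ i → trans (-‿cong (signed-zeroTerm (k i) (g i) (e i))) -0#≈0#)) (+-identityʳ x)

  det-lowerColumn : ∀ n (A : Mat (suc n) (suc n)) → (∀ i → A (suc i) zero ≈ 0#) →
    D (suc n) A ≈ A zero zero * D n (λ i j → A (suc i) (suc j))
  det-lowerColumn n A e = trans (det-firstColumn′ n A) (only-first n _ _ toℕ _ e)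

  det-upperRow : ∀ n (A : Mat (suc n) (suc n)) → (∀ j → A zero (suc j) ≈ 0#) →
    D (suc n) A ≈ A zero zero * D n (λ i j → A (suc i) (suc j))
  det-upperRow n A e = trans (D-suc′ n A) (only-first n _ _ toℕ _ e)

  det-zeroRow : ∀ n (A : Mat (suc n) (suc n)) → (∀ j → A zero j ≈ 0#) → D (suc n) A ≈ 0#
  det-zeroRow n A e = trans (D-suc n A) (∑-zero (suc n) λ j → signed-zeroTerm (toℕ j) _ (e j))

  -- Chio's condensation at the top left entry.
  det-condense : ∀ n (A : Mat (suc n) (suc n)) →
    A zero zero * D n (λ i j → A zero zero * A (suc i) (suc j) - A (suc i) zero * A zero (suc j))
      ≈ prod n (λ _ → A zero zero) * D (suc n) A
  det-condense n A = begin
    p * D n (λ i j → p * A (suc i) (suc j) - A (suc i) zero * A zero (suc j))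
      ≈⟨ *-congˡ (D-cong n (λ i j → solve 4 (λ p a b c → p :* a :- b :* c := p :* a :+ (:- b) :* c) refl p _ _ _)) ⟩
    p * D n (λ i j → B (suc i) (suc j))
      ≈⟨ sym (det-lowerColumn n B (λ i → solve 2 (λ p b → p :* b :+ (:- b) :* p := con (ℤ.+ 0)) refl p _)) ⟩
    D (suc n) B
      ≈⟨ det-eliminate n (A zero) (λ i j → p * A (suc i) j) (λ i → - A (suc i) zero) ⟩
    D (suc n) (A zero ∷ᵛ (λ i j → p * A (suc i) j))
      ≈⟨ trans (D-suc n _) (∑-cong (suc n) (λ j → trans (signed-cong (toℕ j) (trans (*-congˡ (det-scaleRows n (λ _ → p) _))
           (solve 3 (λ a q d → a :* (q :* d) := q :* (a :* d)) refl _ _ _))) (signed-* (toℕ j) _ _))) ⟩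
    ∑ (suc n) (λ j → prod n (λ _ → p) * _)
      ≈⟨ trans (∑-* (suc n) _ _) (*-congˡ (sym (D-suc n A))) ⟩
    prod n (λ _ → p) * D (suc n) A ∎
    where
    p : Carrier
    p = A zero zero
    B : Mat (suc n) (suc n)
    B = A zero ∷ᵛ (λ i j → p * A (suc i) j + - A (suc i) zero * A zero j)

-- Partial fields inside commutative rings, and matrices whose minors lie in them

record UnitGroup (R : CommutativeRing 0ℓ 0ℓ) : Set₁ where
  open CommutativeRing R hiding (zero)
  field
    G      : Carrier → Set
    G-resp : ∀ {x y} → x ≈ y → G x → G y
    G-1    : G 1#
    G-neg  : ∀ {x} → G x → G (- x)
    G-*    : ∀ {x y} → G x → G y → G (x * y)
    G-inv  : ∀ {x} → G x → Σ Carrier λ y → G y × (x * y ≈ 1#)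
    G-≉0   : ∀ {x} → G x → ¬ (x ≈ 0#)

Sel : ℕ → Set₁
Sel n = Fin n → Set

Every : ∀ {n} → Sel n
Every _ = ⊤

_∖_ : ∀ {n} → Sel n → Fin n → Sel n
(P ∖ x) i = P i × i ≢ x

-- A repetition is reported as a position `i` together with a position `j` in the list without `i`.
-- This is the form that `det-equal` needs once row `i` has been moved to the front.
repeats : ∀ {X : Set} → ((x y : X) → Dec (x ≡ y)) → ∀ k (ρ : Fin (suc k) → X) →
  Injective _≡_ _≡_ ρ ⊎ Σ (Fin (suc k)) λ i → Σ (Fin k) λ j → ρ (punchIn i j) ≡ ρ i
repeats _≟X_ zero    ρ = inj₁ λ { {zero} {zero} _ → ≡.refl }
repeats _≟X_ (suc k) ρ with FinP.any? (λ j → ρ (suc j) ≟X ρ zero)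
... | yes (j , e) = inj₂ (zero , j , e)
... | no  new     with repeats _≟X_ k (ρ ∘ suc)
...   | inj₂ (i , j , e) = inj₂ (suc i , suc j , e)
...   | inj₁ inj = inj₁ λ
  { {zero}  {zero}  _ → ≡.refl
  ; {zero}  {suc j} e → contradiction (j , ≡.sym e) new
  ; {suc i} {zero}  e → contradiction (i , e) new
  ; {suc i} {suc j} e → ≡.cong suc (inj e) }

punchIn-avoids : ∀ {X : Set} {k} {ρ : Fin (suc k) → X} → Injective _≡_ _≡_ ρ → ∀ i j → ρ (punchIn i j) ≢ ρ i
punchIn-avoids inj i j e = FinP.punchInᵢ≢i i j (inj e)

punchIn-preserves-inj : ∀ {X : Set} {k} {ρ : Fin (suc k) → X} → Injective _≡_ _≡_ ρ → ∀ i →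
  Injective _≡_ _≡_ (ρ ∘ punchIn i)
punchIn-preserves-inj inj i e = FinP.punchIn-injective i _ _ (inj e)

module PMatrices {R : CommutativeRing 0ℓ 0ℓ} (𝒢 : UnitGroup R) where
  open CommutativeRing R hiding (zero)
  open UnitGroup 𝒢 public
  open import Algebra.Properties.Ring ring using (-‿distribˡ-*; -0#≈0#)
  open IntegerSolver R
  open DetTheory R
  open Det rawRing using (signed)
  open import Relation.Binary.Reasoning.Setoid setoid

  -- A membership proof also decides whether the element is zero. Case distinctions are made on such
  -- proofs throughout, because equality in Ω, which contains functions on ℕ, cannot be decided.
  E : Carrier → Set
  E x = (x ≈ 0#) ⊎ G x

  E-resp : ∀ {x y} → x ≈ y → E x → E y
  E-resp e (inj₁ z) = inj₁ (trans (sym e) z)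
  E-resp e (inj₂ g) = inj₂ (G-resp e g)

  E-0 : E 0#
  E-0 = inj₁ refl

  E-1 : E 1#
  E-1 = inj₂ G-1

  E-neg : ∀ {x} → E x → E (- x)
  E-neg (inj₁ z) = inj₁ (trans (-‿cong z) -0#≈0#)
  E-neg (inj₂ g) = inj₂ (G-neg g)

  E-* : ∀ {x y} → E x → E y → E (x * y)
  E-* (inj₁ z) _        = inj₁ (trans (*-congʳ z) (zeroˡ _))
  E-* (inj₂ g) (inj₁ z) = inj₁ (trans (*-congˡ z) (zeroʳ _))
  E-* (inj₂ g) (inj₂ h) = inj₂ (G-* g h)

  E-signed : ∀ k {x} → E x → E (signed k x)
  E-signed zero    e = e
  E-signed (suc k) e = E-neg (E-signed k e)

  G-inverse : ∀ {g} → G g → Carrier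
  G-inverse gg = proj₁ (G-inv gg)

  unscale : ∀ {g} (gg : G g) x → G-inverse gg * (g * x) ≈ x
  unscale {g} gg x = begin
    G-inverse gg * (g * x) ≈⟨ solve 3 (λ h g x → h :* (g :* x) := (g :* h) :* x) refl _ g x ⟩
    g * G-inverse gg * x   ≈⟨ *-congʳ (proj₂ (proj₂ (G-inv gg))) ⟩
    1# * x                 ≈⟨ *-identityˡ x ⟩
    x ∎

  G-cancel : ∀ {g x y} → G g → g * x ≈ g * y → x ≈ y
  G-cancel gg e = trans (sym (unscale gg _)) (trans (*-congˡ e) (unscale gg _))

  E-cancel : ∀ {g x} → G g → E (g * x) → E x
  E-cancel gg e = E-resp (unscale gg _) (E-* (inj₂ (proj₁ (proj₂ (G-inv gg)))) e)

  E-nonzero : ∀ {x} → E x → ¬ (x ≈ 0#) → G x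
  E-nonzero (inj₁ z) nz = contradiction z nz
  E-nonzero (inj₂ g) nz = g

  G-factorˡ : ∀ {x y} → E x → G (x * y) → G x
  G-factorˡ (inj₂ g) _ = g
  G-factorˡ (inj₁ z) g = contradiction (trans (*-congʳ z) (zeroˡ _)) (G-≉0 g)

  G-prod : ∀ n {f : Row n} → (∀ i → G (f i)) → G (prod n f)
  G-prod zero    g = G-1
  G-prod (suc n) g = G-* (g zero) (G-prod n (g ∘ suc))

  sub : ∀ {r m k l} → Mat r m → (Fin k → Fin r) → (Fin l → Fin m) → Mat k l
  sub A ρ κ i j = A (ρ i) (κ j)

  -- Rows and columns are restricted by predicates, so that removing some of them does not change
  -- the index types. The selections may repeat indices: `PM-condense` puts `x` and `y` in front of
  -- selections that may already contain them.
  record PM {r m} (P : Sel r) (Q : Sel m) (A : Mat r m) : Set where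
    constructor mkPM
    field minor : ∀ k (ρ : Fin k → Fin r) (κ : Fin k → Fin m) →
            (∀ i → P (ρ i)) → (∀ j → Q (κ j)) → E (D k (sub A ρ κ))
  open PM public

  _ᵀ : ∀ {r m} → Mat r m → Mat m r
  (A ᵀ) i j = A j i

  -- Chio's condensation in the original format and without division. Row `x` and column `y` of the
  -- result are zero, and an entry (i, j) with A i y = 0 or A x j = 0 is merely multiplied by the
  -- pivot.
  condense : ∀ {r m} → Mat r m → Fin r → Fin m → Mat r m
  condense A x y i j = A x y * A i j - A i y * A x j

  abstract
    PM-cong : ∀ {r m} {P : Sel r} {Q : Sel m} {A B : Mat r m} →
      (∀ i j → P i → Q j → A i j ≈ B i j) → PM P Q A → PM P Q B
    PM-cong e pm = mkPM λ k ρ κ p q → E-resp (D-cong k (λ i j → e _ _ (p i) (q j))) (minor pm k ρ κ p q)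

  abstract
    PM-mono : ∀ {r m} {P P′ : Sel r} {Q Q′ : Sel m} {A : Mat r m} →
      (∀ {i} → P′ i → P i) → (∀ {j} → Q′ j → Q j) → PM P Q A → PM P′ Q′ A
    PM-mono f g pm = mkPM λ k ρ κ p q → minor pm k ρ κ (λ i → f (p i)) (λ j → g (q j))

  abstract
    PM-transpose : ∀ {r m} {P : Sel r} {Q : Sel m} {A : Mat r m} → PM P Q A → PM Q P (A ᵀ)
    PM-transpose pm = mkPM λ k ρ κ p q → E-resp (sym (det-transpose k _)) (minor pm k κ ρ q p)

  E-frontRow : ∀ {k} {M : Mat (suc k) (suc k)} i → E (D (suc k) (M i ∷ᵛ (M ∘ punchIn i))) → E (D (suc k) M)
  E-frontRow {k} {M} i e = E-resp (sym (det-front k M i)) (E-signed (toℕ i) e)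

  E-transpose : ∀ {k} {M : Mat k k} → E (D k (M ᵀ)) → E (D k M)
  E-transpose {k} e = E-resp (det-transpose k _) e

  front : ∀ {X : Set} {k} → (Fin (suc k) → X) → Fin (suc k) → Fin (suc k) → X
  front ρ i = ρ i ∷ᵛ (ρ ∘ punchIn i)

  module _ {r m : ℕ} (A : Mat r m) where
    frontRow : ∀ {k} (ρ : Fin (suc k) → Fin r) (κ : Fin (suc k) → Fin m) i →
      E (D (suc k) (sub A (front ρ i) κ)) → E (D (suc k) (sub A ρ κ))
    frontRow ρ κ i e = E-frontRow i (E-resp (D-cong _ λ { zero c → refl ; (suc j) c → refl }) e)

  frontColumn : ∀ {r m} (A : Mat r m) → ∀ {k} (ρ : Fin (suc k) → Fin r) (κ : Fin (suc k) → Fin m) j →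
    E (D (suc k) (sub A ρ (front κ j))) → E (D (suc k) (sub A ρ κ))
  frontColumn A ρ κ j e = E-transpose (frontRow (A ᵀ) κ ρ j (E-transpose e))

  repeatedRow : ∀ {r m} (A : Mat r m) k (ρ : Fin (suc k) → Fin r) (κ : Fin (suc k) → Fin m) i j →
    ρ (punchIn i j) ≡ ρ i → E (D (suc k) (sub A ρ κ))
  repeatedRow A k ρ κ i j e = E-frontRow i
    (inj₁ (det-equal k _ _ j (λ c → reflexive (≡.cong (λ x → A x (κ c)) e))))

  abstract
    -- A repeated row or column makes a minor zero, so injective selections are enough.
    PM-injective : ∀ {r m} {P : Sel r} {Q : Sel m} {A : Mat r m} →
      (∀ k (ρ : Fin k → Fin r) (κ : Fin k → Fin m) → Injective _≡_ _≡_ ρ → Injective _≡_ _≡_ κ →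
        (∀ i → P (ρ i)) → (∀ j → Q (κ j)) → E (D k (sub A ρ κ))) → PM P Q A
    PM-injective {r} {m} {P} {Q} {A} h = mkPM go
      where
      go : ∀ k (ρ : Fin k → Fin r) (κ : Fin k → Fin m) →
        (∀ i → P (ρ i)) → (∀ j → Q (κ j)) → E (D k (sub A ρ κ))
      go zero    ρ κ p q = E-resp (sym (D-0 _)) E-1
      go (suc k) ρ κ p q with repeats _≟_ k ρ | repeats _≟_ k κ
      ... | inj₂ (i , j , e) | _ = repeatedRow A k ρ κ i j e
      ... | inj₁ _ | inj₂ (i , j , e) = E-transpose (repeatedRow (A ᵀ) k κ ρ i j e)
      ... | inj₁ injρ | inj₁ injκ = h (suc k) ρ κ injρ injκ p q

  E-condense : ∀ n (M : Mat (suc n) (suc n)) → G (M zero zero) → E (D (suc n) M) →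
    E (D n (λ i j → condense M zero zero (suc i) (suc j)))
  E-condense n M g e = E-cancel g (E-resp (sym (det-condense n M)) (E-* (inj₂ (G-prod n (λ _ → g))) e))

  E-uncondense : ∀ n (M : Mat (suc n) (suc n)) → G (M zero zero) →
    E (D n (λ i j → condense M zero zero (suc i) (suc j))) → E (D (suc n) M)
  E-uncondense n M g e = E-cancel (G-prod n (λ _ → g)) (E-resp (det-condense n M) (E-* (inj₂ g) e))

  abstract
    PM-condense : ∀ {r m} {P : Sel r} {Q : Sel m} {A : Mat r m} {x y} →
      P x → Q y → G (A x y) → PM P Q A → PM P Q (condense A x y)
    PM-condense {A = A} {x} {y} px qy g pm = mkPM λ k ρ κ p q → E-condense k (sub A (x ∷ᵛ ρ) (y ∷ᵛ κ)) g
      (minor pm (suc k) (x ∷ᵛ ρ) (y ∷ᵛ κ) (λ { zero → px ; (suc i) → p i }) (λ { zero → qy ; (suc j) → q j }))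

  uncondense : ∀ {r m} (A : Mat r m) x y → G (A x y) → ∀ {k} (ρ : Fin k → Fin r) (κ : Fin k → Fin m) →
    E (D k (sub (condense A x y) ρ κ)) → E (D (suc k) (sub A (x ∷ᵛ ρ) (y ∷ᵛ κ)))
  uncondense A x y g {k} ρ κ e = E-uncondense k (sub A (x ∷ᵛ ρ) (y ∷ᵛ κ)) g e

  E-scaleRows : ∀ k (s : Row k) {M : Mat k k} → (∀ i → G (s i)) → E (D k M) → E (D k (λ i j → s i * M i j))
  E-scaleRows k s g e = E-resp (sym (det-scaleRows k s _)) (E-* (inj₂ (G-prod k g)) e)

  abstract
    PM-scaleRows : ∀ {r m} {P : Sel r} {Q : Sel m} {A B : Mat r m} (s : Fin r → Carrier) → (∀ i → P i → G (s i)) →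
      (∀ i j → P i → Q j → B i j ≈ s i * A i j) → PM P Q A → PM P Q B
    PM-scaleRows s g e pm = mkPM λ k ρ κ p q → E-resp (D-cong k (λ i j → sym (e _ _ (p i) (q j))))
      (E-scaleRows k (s ∘ ρ) (λ i → g (ρ i) (p i)) (minor pm k ρ κ p q))

  abstract
    PM-scale : ∀ {r m} {P : Sel r} {Q : Sel m} {A B : Mat r m} (s : Fin r → Carrier) (t : Fin m → Carrier) →
      (∀ i → G (s i)) → (∀ j → G (t j)) →
      (∀ i j → P i → Q j → B i j ≈ s i * (t j * A i j)) → PM P Q A → PM P Q B
    PM-scale s t gs gt e pm = PM-scaleRows s (λ i _ → gs i) e
      (PM-transpose (PM-scaleRows t (λ j _ → gt j) (λ _ _ _ _ → refl) (PM-transpose pm)))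

  occurs? : ∀ {k n} (ρ : Fin k → Fin n) x → Dec (∃ λ i → ρ i ≡ x)
  occurs? ρ x = FinP.any? (λ i → ρ i ≟ x)

  abstract
    PM-singleRow : ∀ {r m} {P : Sel r} {Q : Sel m} {A : Mat r m} x y →
      (∀ j → Q j → j ≢ y → A x j ≈ 0#) → E (A x y) → PM (P ∖ x) Q A → PM P Q A
    PM-singleRow {P = P} {Q} {A} x y z e pm = PM-injective go
      where
      go : ∀ k ρ κ → Injective _≡_ _≡_ ρ → Injective _≡_ _≡_ κ →
        (∀ i → P (ρ i)) → (∀ j → Q (κ j)) → E (D k (sub A ρ κ))
      go zero ρ κ injρ injκ p q = E-resp (sym (D-0 _)) E-1
      go (suc k) ρ κ injρ injκ p q with occurs? ρ x
      ... | no  x∉ρ = minor pm (suc k) ρ κ (λ i → p i , λ e → x∉ρ (i , e)) q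
      ... | yes (i , ≡.refl) with occurs? κ y
      ...   | no  y∉κ = frontRow A ρ κ i (inj₁ (det-zeroRow k _ (λ j → z _ (q j) (λ e → y∉κ (j , e)))))
      ...   | yes (j , ≡.refl) = frontRow A ρ κ i (frontColumn A (front ρ i) κ j
        (E-resp (sym (det-upperRow k _ (λ l → z _ (q _) (punchIn-avoids injκ j l))))
          (E-* e (minor pm k (ρ ∘ punchIn i) (κ ∘ punchIn j) (λ l → p _ , punchIn-avoids injρ i l) (λ l → q _)))))

  abstract
    PM-singleColumn : ∀ {r m} {P : Sel r} {Q : Sel m} {A : Mat r m} x y →
      (∀ i → P i → i ≢ x → A i y ≈ 0#) → E (A x y) → PM P (Q ∖ y) A → PM P Q A
    PM-singleColumn {A = A} x y z e pm = PM-transpose (PM-singleRow {A = A ᵀ} y x z e (PM-transpose pm))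

  abstract
    -- A minor that avoids row `x` or column `y` is covered by one of the first two hypotheses; one
    -- through both is, up to units and sign, a minor of the condensed matrix.
    PM-join : ∀ {r m} {P : Sel r} {Q : Sel m} {A : Mat r m} x y → G (A x y) →
      PM (P ∖ x) Q A → PM P (Q ∖ y) A → PM P Q (condense A x y) → PM P Q A
    PM-join {P = P} {Q} {A} x y g pm₁ pm₂ pm₃ = PM-injective go
      where
      go : ∀ k ρ κ → Injective _≡_ _≡_ ρ → Injective _≡_ _≡_ κ →
        (∀ i → P (ρ i)) → (∀ j → Q (κ j)) → E (D k (sub A ρ κ))
      go zero ρ κ injρ injκ p q = E-resp (sym (D-0 _)) E-1
      go (suc k) ρ κ injρ injκ p q with occurs? ρ x
      ... | no  x∉ρ = minor pm₁ (suc k) ρ κ (λ i → p i , λ e → x∉ρ (i , e)) q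
      ... | yes (i , ≡.refl) with occurs? κ y
      ...   | no  y∉κ = minor pm₂ (suc k) ρ κ p (λ j → q j , λ e → y∉κ (j , e))
      ...   | yes (j , ≡.refl) = frontRow A ρ κ i (frontColumn A (front ρ i) κ j
        (uncondense A (ρ i) (κ j) g (ρ ∘ punchIn i) (κ ∘ punchIn j) (minor pm₃ k _ _ (λ l → p _) (λ l → q _))))

  D-1 : ∀ (M : Mat 1 1) → D 1 M ≈ M zero zero
  D-1 M = trans (det-upperRow 0 M (λ ())) (trans (*-congˡ (D-0 _)) (*-identityʳ _))

  abstract
    PM-entry : ∀ {r m} {P : Sel r} {Q : Sel m} {A : Mat r m} → PM P Q A → ∀ {i j} → P i → Q j → E (A i j)
    PM-entry pm {i} {j} p q = E-resp (D-1 _) (minor pm 1 (λ _ → i) (λ _ → j) (λ _ → p) (λ _ → q))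

  minor₂ : ∀ {r m} → Mat r m → (i i′ : Fin r) (j j′ : Fin m) → Carrier
  minor₂ A i i′ j j′ = A i j * A i′ j′ - A i′ j * A i j′

  D-2 : ∀ (M : Mat 2 2) → D 2 M ≈ minor₂ M zero (suc zero) zero (suc zero)
  D-2 M = trans (D-suc 1 M) (trans (∑-suc 1 _) (trans
    (+-cong (*-congˡ (D-1 _)) (trans (∑-1 _) (-‿cong (trans (*-congˡ (D-1 _)) (*-comm _ _))))) refl))

  abstract
    PM-minor₂ : ∀ {r m} {P : Sel r} {Q : Sel m} {A : Mat r m} → PM P Q A → ∀ {i i′ j j′} →
      P i → P i′ → Q j → Q j′ → E (minor₂ A i i′ j j′)
    PM-minor₂ pm {i} {i′} {j} {j′} p p′ q q′ = E-resp (D-2 _)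
      (minor pm 2 (i ∷ᵛ i′ ∷ᵛ λ ()) (j ∷ᵛ j′ ∷ᵛ λ ()) (λ { zero → p ; (suc zero) → p′ }) (λ { zero → q ; (suc zero) → q′ }))

  -- Exchanging a basis element with the column y: the pivot A x y is cleared from the denominators, and signs are chosen so that the operation commutes with transposition.
  pivot : ∀ {r m} → Mat r m → Fin r → Fin m → Mat r m
  pivot A x y i j with i ≟ x | j ≟ y
  ... | yes _ | yes _ = - 1#
  ... | yes _ | no  _ = A i j
  ... | no  _ | yes _ = A i j
  ... | no  _ | no  _ = condense A x y i j

  module _ {r m : ℕ} (A : Mat r m) (x : Fin r) (y : Fin m) where
    pivot-xy : pivot A x y x y ≈ - 1#
    pivot-xy with x ≟ x | y ≟ y
    ... | yes _  | yes _  = refl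
    ... | no x≢x | _      = contradiction ≡.refl x≢x
    ... | yes _  | no y≢y = contradiction ≡.refl y≢y

    pivot-row : ∀ {j} → j ≢ y → pivot A x y x j ≈ A x j
    pivot-row {j} j≢y with x ≟ x | j ≟ y
    ... | yes _  | no _   = refl
    ... | no x≢x | _      = contradiction ≡.refl x≢x
    ... | yes _  | yes j≡y = contradiction j≡y j≢y

    pivot-column : ∀ {i} → i ≢ x → pivot A x y i y ≈ A i y
    pivot-column {i} i≢x with i ≟ x | y ≟ y
    ... | no _ | yes _     = refl
    ... | yes i≡x | _      = contradiction i≡x i≢x
    ... | no _ | no y≢y    = contradiction ≡.refl y≢y

    pivot-other : ∀ {i j} → i ≢ x → j ≢ y → pivot A x y i j ≈ condense A x y i j
    pivot-other {i} {j} i≢x j≢y with i ≟ x | j ≟ y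
    ... | no _    | no _    = refl
    ... | yes i≡x | _       = contradiction i≡x i≢x
    ... | no _    | yes j≡y = contradiction j≡y j≢y

  pivot-transpose : ∀ {r m} (A : Mat r m) x y i j → pivot (A ᵀ) y x j i ≈ pivot A x y i j
  pivot-transpose A x y i j with i ≟ x | j ≟ y
  ... | yes _ | yes _ = refl
  ... | yes _ | no  _ = refl
  ... | no  _ | yes _ = refl
  ... | no  _ | no  _ = +-congˡ (-‿cong (*-comm _ _))

  private
    -- Up to multiples of row `x`, the other rows are the old ones times the pivot, so the minor is
    -- the old one times a power of the pivot.
    pivot-inRow : ∀ {r m} {P : Sel r} {Q : Sel m} {A : Mat r m} {x y} → P x → Q y → G (A x y) → PM P Q A →
      ∀ k (ρ : Fin k → Fin r) (κ : Fin (suc k) → Fin m) → (∀ i → P (ρ i)) → (∀ j → Q (κ j)) →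
      (∀ i → ρ i ≢ x) → (∀ j → κ j ≢ y) → E (D (suc k) (sub (pivot A x y) (x ∷ᵛ ρ) κ))
    pivot-inRow {A = A} {x} {y} px qy g pm k ρ κ p q x∉ρ y∉κ = E-resp (sym eq)
      (E-scaleRows (suc k) (1# ∷ᵛ λ _ → A x y) {sub A (x ∷ᵛ ρ) κ} (λ { zero → G-1 ; (suc i) → g })
        (minor pm (suc k) (x ∷ᵛ ρ) κ (λ { zero → px ; (suc i) → p i }) q))
      where
      eq : D (suc k) (sub (pivot A x y) (x ∷ᵛ ρ) κ) ≈ D (suc k) (λ i j → (1# ∷ᵛ (λ _ → A x y)) i * sub A (x ∷ᵛ ρ) κ i j)
      eq = trans
        (D-cong (suc k) {B = (A x ∘ κ) ∷ᵛ (λ i j → A x y * A (ρ i) (κ j) + - A (ρ i) y * A x (κ j))} λ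
          { zero j → pivot-row A x y (y∉κ j)
          ; (suc i) j → trans (pivot-other A x y (x∉ρ i) (y∉κ j)) (+-congˡ (-‿distribˡ-* _ _)) })
        (trans (det-eliminate k (A x ∘ κ) (λ i j → A x y * A (ρ i) (κ j)) (λ i → - A (ρ i) y))
          (D-cong (suc k) λ { zero j → sym (*-identityˡ _) ; (suc i) j → refl }))

  abstract
    PM-pivot : ∀ {r m} {P : Sel r} {Q : Sel m} {A : Mat r m} {x y} →
      P x → Q y → G (A x y) → PM P Q A → PM P Q (pivot A x y)
    PM-pivot {r} {m} {P} {Q} {A} {x} {y} px qy g pm = PM-injective go
      where
      go : ∀ k ρ κ → Injective _≡_ _≡_ ρ → Injective _≡_ _≡_ κ →
        (∀ i → P (ρ i)) → (∀ j → Q (κ j)) → E (D k (sub (pivot A x y) ρ κ))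
      go zero ρ κ injρ injκ p q = E-resp (sym (D-0 _)) E-1
      go (suc k) ρ κ injρ injκ p q with occurs? ρ x | occurs? κ y
      ... | no x∉ρ | no y∉κ = E-resp
        (D-cong (suc k) (λ i j → sym (pivot-other A x y (λ e → x∉ρ (i , e)) (λ e → y∉κ (j , e)))))
        (minor (PM-condense px qy g pm) (suc k) ρ κ p q)
      ... | yes (i , ≡.refl) | no y∉κ = frontRow (pivot A x y) ρ κ i
        (pivot-inRow px qy g pm k (ρ ∘ punchIn i) κ (λ l → p _) q (punchIn-avoids injρ i) (λ j e → y∉κ (j , e)))
      ... | no x∉ρ | yes (j , ≡.refl) = frontColumn (pivot A x y) ρ κ j
        (E-transpose (E-resp (D-cong (suc k) (λ a b → pivot-transpose A x y (ρ b) (front κ j a)))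
          (E-resp (D-cong (suc k) λ { zero b → refl ; (suc a) b → refl })
            (pivot-inRow {A = A ᵀ} qy px g (PM-transpose pm) k (κ ∘ punchIn j) ρ (λ l → q _) p (punchIn-avoids injκ j) (λ i e → x∉ρ (i , e))))))
      ... | yes (i , ≡.refl) | yes (j , ≡.refl) = frontRow (pivot A x y) ρ κ i (frontColumn (pivot A x y) (front ρ i) κ j
        (E-uncondense k M (G-resp (sym (pivot-xy A x y)) (G-neg G-1))
          (E-resp (D-cong k (λ a b → sym (entry a b)))
            (E-scaleRows k (λ _ → - A x y) (λ _ → G-neg g) (minor pm k (ρ ∘ punchIn i) (κ ∘ punchIn j) (λ l → p _) (λ l → q _))))))
        where
        M : Mat (suc k) (suc k)
        M = sub (pivot A x y) (front ρ i) (front κ j)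
        -- Condensing the pivoted matrix at its entry -1 gives back the old entries times `- A x y`,
        -- because the products of column `y` with row `x` cancel.
        entry : ∀ a b → condense M zero zero (suc a) (suc b) ≈ - A x y * A (ρ (punchIn i a)) (κ (punchIn j b))
        entry a b = trans
          (+-cong (*-cong (pivot-xy A x y) (pivot-other A x y (punchIn-avoids injρ i a) (punchIn-avoids injκ j b)))
            (-‿cong (*-cong (pivot-column A x y (punchIn-avoids injρ i a)) (pivot-row A x y (punchIn-avoids injκ j b)))))
          (trans (+-congʳ (trans (sym (-‿distribˡ-* _ _)) (-‿cong (*-identityˡ _))))
            (solve 4 (λ p a b c → :- (p :* a :- b :* c) :- b :* c := (:- p) :* a) refl _ _ _ _))

search : ∀ n {P Q : Fin n → Set} → (∀ i → P i ⊎ Q i) → ∃ P ⊎ (∀ i → Q i)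
search zero    h = inj₂ λ ()
search (suc n) h with h zero | search n (h ∘ suc)
... | inj₁ p | _            = inj₁ (zero , p)
... | inj₂ q | inj₁ (i , p) = inj₁ (suc i , p)
... | inj₂ q | inj₂ qs      = inj₂ λ { zero → q ; (suc i) → qs i }

-- The hypotheses of the lift theorem: cross ratios z (those with z and 1 - z both in the partial field) lift uniquely, and the lifts are compatible with products and with z ↦ -z.
record Lifting (Ω R : CommutativeRing 0ℓ 0ℓ) (𝒢 : UnitGroup Ω) (ℋ : UnitGroup R) : Set₁ where
  private
    module Ω = CommutativeRing Ω
    module R = CommutativeRing R
  open PMatrices 𝒢 using (G; E)
  open PMatrices ℋ using () renaming (G to H; E to F)
  field
    π      : Ω.Carrier → R.Carrier
    π-cong : ∀ {x y} → x Ω.≈ y → π x R.≈ π y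
    π-+    : ∀ x y → π (x Ω.+ y) R.≈ π x R.+ π y
    π-*    : ∀ x y → π (x Ω.* y) R.≈ π x R.* π y
    π-neg  : ∀ x → π (Ω.- x) R.≈ R.- π x
    π-0    : π Ω.0# R.≈ R.0#
    π-1    : π Ω.1# R.≈ R.1#
    π-G    : ∀ {x} → G x → H (π x)
    section     : ∀ {x} → H x → ∃ λ z → G z × (π z R.≈ x)
    cross-lift  : ∀ {x} → H x → F (R.1# R.- x) → ∃ λ z → G z × E (Ω.1# Ω.- z) × (π z R.≈ x)
    cross-unique : ∀ {z w} → G z → E (Ω.1# Ω.- z) → G w → E (Ω.1# Ω.- w) → π z R.≈ π w → z Ω.≈ w
    cross-*     : ∀ {z w} → G z → E (Ω.1# Ω.- z) → G w → E (Ω.1# Ω.- w) → F (R.1# R.- π (z Ω.* w)) →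
                  E (Ω.1# Ω.- z Ω.* w)
    cross-neg   : ∀ {z} → G z → E (Ω.1# Ω.- z) → F (R.1# R.+ π z) → E (Ω.1# Ω.+ z)

-- Gluing: minors that contain two given columns

module LiftTheory {Ω R : CommutativeRing 0ℓ 0ℓ} {𝒢 : UnitGroup Ω} {ℋ : UnitGroup R} (lifting : Lifting Ω R 𝒢 ℋ) where
  open CommutativeRing Ω hiding (zero)
  open PMatrices 𝒢
  open Lifting lifting public
  open IntegerSolver Ω
  open DetTheory Ω using (Mat; D; D-0; D-cong; det-zeroRow)
  module R where
    open CommutativeRing R hiding (zero) public
    open PMatrices ℋ public
    open DetTheory R public using (Mat; D)
  open import Algebra.Properties.Ring ring using (-0#≈0#; -‿involutive)
  open import Relation.Binary.Reasoning.Setoid setoid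

  πₘ : ∀ {r m} → Mat r m → R.Mat r m
  πₘ A i j = π (A i j)

  π-minus : ∀ x y → π (x - y) R.≈ π x R.- π y
  π-minus x y = R.trans (π-+ x (- y)) (R.+-congˡ (π-neg y))

  π-condense : ∀ {r m} (A : Mat r m) x y i j → π (condense A x y i j) R.≈ R.condense (πₘ A) x y i j
  π-condense A x y i j = R.trans (π-minus _ _) (R.+-cong (π-* _ _) (R.-‿cong (π-* _ _)))

  π-pivot : ∀ {r m} (A : Mat r m) x y i j → π (pivot A x y i j) R.≈ R.pivot (πₘ A) x y i j
  π-pivot A x y i j with i ≟ x | j ≟ y
  ... | yes _ | yes _ = R.trans (π-neg _) (R.-‿cong π-1)
  ... | yes _ | no  _ = R.refl
  ... | no  _ | yes _ = R.refl
  ... | no  _ | no  _ = π-condense A x y i j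

  private
    factor : ∀ {p} (g : G p) q → p * (1# - G-inverse g * q) ≈ p - q
    factor {p} g q = begin
      p * (1# - G-inverse g * q)      ≈⟨ solve 4 (λ o p h q → p :* (o :- h :* q) := p :* o :- (p :* h) :* q) refl 1# p _ q ⟩
      p * 1# - (p * G-inverse g) * q  ≈⟨ +-cong (*-identityʳ p) (-‿cong (trans (*-congʳ (proj₂ (proj₂ (G-inv g)))) (*-identityˡ q))) ⟩
      p - q ∎

    ratio-E : ∀ {p q} (g : G p) → E (p - q) → E (1# - G-inverse g * q)
    ratio-E g e = E-cancel g (E-resp (sym (factor g _)) e)

    ratio-G : ∀ {p q} (g : G p) → G q → G (G-inverse g * q)
    ratio-G g h = G-* (proj₁ (proj₂ (G-inv g))) h

    π-cancel : ∀ {g x} → G g → R.E (π (g * x)) → R.E (π x)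
    π-cancel g e = R.E-cancel (π-G g) (R.E-resp (π-* _ _) e)

  -- The homogeneous form of `cross-*`: for z = q / p and w = q′ / p′ the difference is p p′ (1 - z
  -- w).
  minus-* : ∀ {p q p′ q′} → G p → G q → E (p - q) → G p′ → G q′ → E (p′ - q′) →
    R.E (π (p * p′ - q * q′)) → E (p * p′ - q * q′)
  minus-* {p} {q} {p′} {q′} gp gq e gp′ gq′ e′ eπ = E-resp eq (E-* (inj₂ (G-* gp gp′))
    (cross-* (ratio-G gp gq) (ratio-E gp e) (ratio-G gp′ gq′) (ratio-E gp′ e′)
      (R.E-resp (R.trans (π-minus _ _) (R.+-congʳ π-1)) (π-cancel (G-* gp gp′) (R.E-resp (π-cong (sym eq)) eπ)))))
    where
    h h′ : Carrier
    h = G-inverse gp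
    h′ = G-inverse gp′
    eq : p * p′ * (1# - (h * q) * (h′ * q′)) ≈ p * p′ - q * q′
    eq = begin
      p * p′ * (1# - (h * q) * (h′ * q′))
        ≈⟨ solve 7 (λ o p p′ h h′ q q′ → p :* p′ :* (o :- (h :* q) :* (h′ :* q′)) :=
             p :* p′ :* o :- (p :* h) :* (p′ :* h′) :* (q :* q′)) refl 1# p p′ h h′ q q′ ⟩
      p * p′ * 1# - (p * h) * (p′ * h′) * (q * q′)
        ≈⟨ +-cong (*-identityʳ _) (-‿cong (trans (*-congʳ (trans (*-cong (proj₂ (proj₂ (G-inv gp))) (proj₂ (proj₂ (G-inv gp′)))) (*-identityˡ 1#))) (*-identityˡ _))) ⟩
      p * p′ - q * q′ ∎

  -- The homogeneous form of `cross-neg`, applied to z = q / p.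
  plus : ∀ {p q} → G p → G q → E (p - q) → R.E (π (p + q)) → E (p + q)
  plus {p} {q} gp gq e eπ = E-resp eq (E-* (inj₂ gp)
    (cross-neg (ratio-G gp gq) (ratio-E gp e)
      (R.E-resp (R.trans (π-+ _ _) (R.+-congʳ π-1)) (π-cancel gp (R.E-resp (π-cong (sym eq)) eπ)))))
    where
    eq : p * (1# + G-inverse gp * q) ≈ p + q
    eq = trans (distribˡ _ _ _) (+-cong (*-identityʳ p) (trans (sym (*-assoc _ _ _))
      (trans (*-congʳ (proj₂ (proj₂ (G-inv gp)))) (*-identityˡ q))))

  -- The state after gluing two lifts: minors that avoid `u` or avoid `v` are known to be elements,
  -- while for those containing both columns only the images are under control.
  record OffTwo {r m} (A : Mat r m) (u v : Fin m) : Set where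
    field
      off-u : PM Every (Every ∖ u) A
      off-v : PM Every (Every ∖ v) A
      below : R.PM Every Every (πₘ A)

  OffTwo-swap : ∀ {r m} {A : Mat r m} {u v} → OffTwo A u v → OffTwo A v u
  OffTwo-swap o = record { off-u = OffTwo.off-v o ; off-v = OffTwo.off-u o ; below = OffTwo.below o }

  OffTwo-condense : ∀ {r m} {A : Mat r m} {u v x y} → G (A x y) → y ≢ u → y ≢ v → OffTwo A u v →
    OffTwo (condense A x y) u v
  OffTwo-condense {A = A} {x = x} {y} g y≢u y≢v o = record
    { off-u = PM-condense tt (tt , y≢u) g (OffTwo.off-u o)
    ; off-v = PM-condense tt (tt , y≢v) g (OffTwo.off-v o)
    ; below = R.PM-cong (λ i j _ _ → R.sym (π-condense A x y i j)) (R.PM-condense tt tt (π-G g) (OffTwo.below o)) }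

  OffTwo-pivot : ∀ {r m} {A : Mat r m} {u v x y} → G (A x y) → y ≢ u → y ≢ v → OffTwo A u v →
    OffTwo (pivot A x y) u v
  OffTwo-pivot {A = A} {x = x} {y} g y≢u y≢v o = record
    { off-u = PM-pivot tt (tt , y≢u) g (OffTwo.off-u o)
    ; off-v = PM-pivot tt (tt , y≢v) g (OffTwo.off-v o)
    ; below = R.PM-cong (λ i j _ _ → R.sym (π-pivot A x y i j)) (R.PM-pivot tt tt (π-G g) (OffTwo.below o)) }

  -- Walks between rows in the support graph without the columns `u` and `v`; the length counts the
  -- columns passed.
  data Walk {r m} (A : Mat r m) (u v : Fin m) : ℕ → Fin r → Fin r → Set where
    []   : ∀ {e} → Walk A u v 0 e e
    step : ∀ {n e g f} w → w ≢ u → w ≢ v → G (A e w) → G (A g w) → Walk A u v n g f → Walk A u v (suc n) e f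

  minor-swap : ∀ {r m} (A : Mat r m) e f u v → - minor₂ A f e u v ≈ minor₂ A e f u v
  minor-swap A e f u v = solve 4 (λ a b c d → :- (a :* b :- c :* d) := c :* d :- a :* b) refl _ _ _ _

  minor-swap′ : ∀ {r m} (A : Mat r m) e f u v → - minor₂ A e f v u ≈ minor₂ A e f u v
  minor-swap′ A e f u v = solve 4 (λ a b c d → :- (a :* b :- c :* d) := d :* c :- b :* a) refl _ _ _ _

  -- If one of the four entries vanishes, the minor is a single product up to sign; so all four may
  -- be taken to be units.
  minor-zero : ∀ {r m} (A : Mat r m) e f u v → (∀ i → E (A i u)) → (∀ i → E (A i v)) →
    (G (A e u) → G (A e v) → G (A f u) → G (A f v) → E (minor₂ A e f u v)) → E (minor₂ A e f u v)
  minor-zero A e f u v Eu Ev h with Eu e | Ev e | Eu f | Ev f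
  ... | inj₂ a | inj₂ b | inj₂ c | inj₂ d = h a b c d
  ... | inj₁ z | _ | c | d = E-resp (sym (trans (+-congʳ (trans (*-congʳ z) (zeroˡ _))) (+-identityˡ _))) (E-neg (E-* c (Ev e)))
  ... | a | inj₁ z | _ | d = E-resp (sym (trans (+-congˡ (trans (-‿cong (trans (*-congˡ z) (zeroʳ _))) -0#≈0#)) (+-identityʳ _))) (E-* a d)
  ... | a | b | inj₁ z | d = E-resp (sym (trans (+-congˡ (trans (-‿cong (trans (*-congʳ z) (zeroˡ _))) -0#≈0#)) (+-identityʳ _))) (E-* a d)
  ... | a | b | c | inj₁ z = E-resp (sym (trans (+-congʳ (trans (*-congˡ z) (zeroʳ _))) (+-identityˡ _))) (E-neg (E-* c b))

  condense-zeroˡ : ∀ {r m} (A : Mat r m) x y {i j} → A i y ≈ 0# → condense A x y i j ≈ A x y * A i j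
  condense-zeroˡ A x y z = trans (+-congˡ (trans (-‿cong (trans (*-congʳ z) (zeroˡ _))) -0#≈0#)) (+-identityʳ _)

  condense-zeroʳ : ∀ {r m} (A : Mat r m) x y {i j} → A x j ≈ 0# → condense A x y i j ≈ A x y * A i j
  condense-zeroʳ A x y z = trans (+-congˡ (trans (-‿cong (trans (*-congˡ z) (zeroʳ _))) -0#≈0#)) (+-identityʳ _)

  condense-zero : ∀ {r m} (A : Mat r m) x y {i j} → A i j ≈ 0# → condense A x y i j ≈ - (A i y * A x j)
  condense-zero A x y z = trans (+-congʳ (trans (*-congˡ z) (zeroʳ _))) (+-identityˡ _)

  minor-scale : ∀ {r m} (A B : Mat r m) {e f u v} s → B e u ≈ s * A e u → B e v ≈ s * A e v →
    B f u ≈ s * A f u → B f v ≈ s * A f v → minor₂ B e f u v ≈ s * s * minor₂ A e f u v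
  minor-scale A B s a b c d = trans (+-cong (*-cong a d) (-‿cong (*-cong c b)))
    (solve 5 (λ s a b c d → (s :* a) :* (s :* d) :- (s :* c) :* (s :* b) := s :* s :* (a :* d :- c :* b)) refl s _ _ _ _)

  module _ {r m : ℕ} where

    module Entries {A : Mat r m} {u v : Fin m} (o : OffTwo A u v) (u≢v : u ≢ v) where
      open OffTwo o
      at-u : ∀ i → E (A i u)
      at-u i = PM-entry off-v tt (tt , u≢v)
      at-v : ∀ i → E (A i v)
      at-v i = PM-entry off-u tt (tt , ≡.≢-sym u≢v)
      at : ∀ i {w} → w ≢ u → E (A i w)
      at i w≢u = PM-entry off-u tt (tt , w≢u)
      minor-below : ∀ e f → R.E (π (minor₂ A e f u v))
      minor-below e f = R.E-resp (R.sym (R.trans (π-minus _ _) (R.+-cong (π-* _ _) (R.-‿cong (π-* _ _)))))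
        (R.PM-minor₂ below tt tt tt tt)

    -- With `w` as a third column, the cross ratio of the minor on `u` and `v` is the product of the
    -- cross ratios of the minors on `w`, `u` and on `w`, `v` in the same two rows.
    minor-walk₁ : ∀ {A : Mat r m} {u v} → OffTwo A u v → u ≢ v → ∀ {e f w} → w ≢ u → w ≢ v → G (A e w) → G (A f w) →
      E (minor₂ A e f u v)
    minor-walk₁ {A} {u} {v} o u≢v {e} {f} {w} w≢u w≢v ge gf = minor-zero A e f u v at-u at-v λ a b c d →
      E-resp (-‿involutive _) (E-neg (E-cancel (G-* ge gf) (E-resp (eq _ _ _ _ _ _)
      (minus-* (G-* ge c) (G-* gf a) (PM-minor₂ off-v tt tt (tt , w≢v) (tt , u≢v))
               (G-* gf b) (G-* ge d) (PM-minor₂ off-u tt tt (tt , w≢u) (tt , ≡.≢-sym u≢v))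
        (R.E-resp (π-cong (sym (eq _ _ _ _ _ _))) (R.E-resp (R.sym (π-* _ _))
          (R.E-* (inj₂ (π-G (G-* ge gf))) (R.E-resp (R.sym (π-neg _)) (R.E-neg (minor-below e f))))))))))
      where
      open OffTwo o
      open Entries o u≢v
      eq : ∀ p q a b c d → (p * c) * (q * b) - (q * a) * (p * d) ≈ (p * q) * - (a * d - c * b)
      eq = solve 6 (λ p q a b c d → (p :* c) :* (q :* b) :- (q :* a) :* (p :* d) := (p :* q) :* (:- (a :* d :- c :* b))) refl

    -- The same multiplication of cross ratios with a third row in place of a third column.
    minor-through : ∀ {A : Mat r m} {u v} → OffTwo A u v → u ≢ v → ∀ {e g f} → G (A g u) → G (A g v) →
      E (minor₂ A e g u v) → E (minor₂ A g f u v) → E (minor₂ A e f u v)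
    minor-through {A} {u} {v} o u≢v {e} {g} {f} gu gv e₁ e₂ = minor-zero A e f u v at-u at-v λ a b c d →
      E-cancel (G-* gu gv) (E-resp (eq _ _ _ _ _ _)
        (minus-* (G-* a gv) (G-* gu b) e₁ (G-* gu d) (G-* c gv) e₂
          (R.E-resp (π-cong (sym (eq _ _ _ _ _ _))) (R.E-resp (R.sym (π-* _ _))
            (R.E-* (inj₂ (π-G (G-* gu gv))) (minor-below e f))))))
      where
      open Entries o u≢v
      eq : ∀ x y a b c d → (a * y) * (x * d) - (x * b) * (c * y) ≈ (x * y) * (a * d - c * b)
      eq = solve 6 (λ x y a b c d → (a :* y) :* (x :* d) :- (x :* b) :* (c :* y) := (x :* y) :* (a :* d :- c :* b)) refl

    private
      -- e — w — g — w′ — f where column v misses the middle row g.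
      module Middle {A : Mat r m} {u v} (o : OffTwo A u v) (u≢v : u ≢ v) {e g f w w′}
        (w≢u : w ≢ u) (w≢v : w ≢ v) (w′≢u : w′ ≢ u) (w′≢v : w′ ≢ v)
        (ge : G (A e w)) (gg : G (A g w)) (gg′ : G (A g w′)) (gf : G (A f w′))
        (zf : A f w ≈ 0#) (ze : A e w′ ≈ 0#) (gu : G (A g u)) (zv : A g v ≈ 0#) where
        open OffTwo o
        open Entries o u≢v

        C : Mat r m
        C = condense A e w

        o′ : OffTwo C u v
        o′ = OffTwo-condense ge w≢u w≢v o

        C-g : C g w′ ≈ A e w * A g w′
        C-g = condense-zeroʳ A e w ze

        C-f : ∀ j → C f j ≈ A e w * A f j
        C-f j = condense-zeroˡ A e w zf

        C-v : C g v ≈ - (A g w * A e v)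
        C-v = condense-zero A e w zv

        -- In `C` the rows `g` and `f` share the column `w′`, so their minor on `u` and `v` is an
        -- element. The cross ratio of this minor is multiplied by the one formed from `C g u` and A
        -- g w · A e u, whose difference is a product of entries of `A`. The entry `C g u` cancels,
        -- which is why it has to be a unit.
        uneven : G (C g u) → E (minor₂ A e f u v)
        uneven x = minor-zero A e f u v at-u at-v λ a b c d →
          E-cancel (G-* x (G-* ge (G-neg gg))) (E-resp (eq (A e u) (A e v) (A f u) (A f v) (A e w) (A g w) (C g u))
            (minus-* (G-* x (G-* ge d)) (G-* (G-* ge c) (G-neg (G-* gg b))) first
                     (G-neg (G-* gg a)) x second
              (R.E-resp (π-cong (sym (eq _ _ _ _ _ _ _))) (R.E-resp (R.sym (π-* _ _))
                (R.E-* (inj₂ (π-G (G-* x (G-* ge (G-neg gg))))) (minor-below e f))))))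
          where
          first : E (C g u * (A e w * A f v) - (A e w * A f u) * - (A g w * A e v))
          first = E-resp (+-cong (*-congˡ (C-f v)) (-‿cong (*-cong (C-f u) C-v)))
            (minor-walk₁ o′ u≢v w′≢u w′≢v (G-resp (sym C-g) (G-* ge gg′)) (G-resp (sym (C-f w′)) (G-* ge gf)))
          second : E (- (A g w * A e u) - C g u)
          second = E-resp (solve 4 (λ p x q a → :- (p :* x) := :- (q :* a) :- (p :* x :- q :* a)) refl _ _ _ _)
            (E-neg (E-* (inj₂ ge) (inj₂ gu)))
          eq : ∀ a b c d p q x → (x * (p * d)) * - (q * a) - ((p * c) * - (q * b)) * x ≈ (x * (p * - q)) * (a * d - c * b)
          eq = solve 7 (λ a b c d p q x → (x :* (p :* d)) :* (:- (q :* a)) :- ((p :* c) :* (:- (q :* b))) :* x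
                 := (x :* (p :* (:- q))) :* (a :* d :- c :* b)) refl

        -- With b = A e v and d = A f v, the two equations turn the wanted minor into p s d - q t b
        -- up to units, whereas the 3×3 minor on the columns `w`, `w′`, `v` is p s d + q t b. The
        -- two differ by a sign only; this is what `cross-neg` is for.
        even : A e w * A g u ≈ A g w * A e u → A f w′ * A g u ≈ A g w′ * A f u → E (minor₂ A e f u v)
        even z z′ = minor-zero A e f u v at-u at-v λ a b c d →
          E-cancel (G-* gg gg′) (E-resp eq (E-* (inj₂ gu)
            (plus (G-* (G-* ge gg′) d) (G-neg (G-* (G-* gg gf) b)) (E-cancel ge det₃)
              (R.E-cancel (π-G gu) (R.E-resp (π-* _ _) (R.E-resp (π-cong (sym eq)) (R.E-resp (R.sym (π-* _ _))
                (R.E-* (inj₂ (π-G (G-* gg gg′))) (minor-below e f)))))))))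
          where
          p = A e w
          q = A g w
          s = A g w′
          t = A f w′
          det₃ : E (p * (p * s * A f v - - (q * t * A e v)))
          det₃ = E-resp (trans (+-cong (*-cong C-g (C-f v)) (-‿cong (*-cong (C-f w′) C-v)))
              (solve 6 (λ p q s t b d → (p :* s) :* (p :* d) :- (p :* t) :* (:- (q :* b)) := p :* (p :* s :* d :- (:- (q :* t :* b)))) refl p q s t _ _))
            (PM-minor₂ (OffTwo.off-u o′) tt tt (tt , w′≢u) (tt , ≡.≢-sym u≢v))
          eq : A g u * (p * s * A f v + - (q * t * A e v)) ≈ (q * s) * minor₂ A e f u v
          eq = begin
            A g u * (p * s * A f v + - (q * t * A e v))
              ≈⟨ solve 7 (λ x p q s t b d → x :* (p :* s :* d :+ (:- (q :* t :* b))) := (p :* x) :* (s :* d) :- (t :* x) :* (q :* b)) refl (A g u) p q s t _ _ ⟩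
            (p * A g u) * (s * A f v) - (t * A g u) * (q * A e v)
              ≈⟨ +-cong (*-congʳ z) (-‿cong (*-congʳ z′)) ⟩
            (q * A e u) * (s * A f v) - (s * A f u) * (q * A e v)
              ≈⟨ solve 6 (λ q s a b c d → (q :* a) :* (s :* d) :- (s :* c) :* (q :* b) := (q :* s) :* (a :* d :- c :* b)) refl q s _ _ _ _ ⟩
            (q * s) * minor₂ A e f u v ∎

    private
      difference-zero : ∀ {x y} → x - y ≈ 0# → x ≈ y
      difference-zero {x} {y} e = begin
        x            ≈⟨ solve 2 (λ x y → x := (x :- y) :+ y) refl x y ⟩
        (x - y) + y  ≈⟨ trans (+-congʳ e) (+-identityˡ y) ⟩
        y ∎

    minor-middle : ∀ {A : Mat r m} {u v} → OffTwo A u v → u ≢ v → ∀ {e g f w w′} →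
      w ≢ u → w ≢ v → w′ ≢ u → w′ ≢ v → G (A e w) → G (A g w) → G (A g w′) → G (A f w′) →
      A f w ≈ 0# → A e w′ ≈ 0# → G (A g u) → A g v ≈ 0# → E (minor₂ A e f u v)
    minor-middle {A} {u} {v} o u≢v {e} {g} {f} {w} {w′} w≢u w≢v w′≢u w′≢v ge gg gg′ gf zf ze gu zv
      with PM-entry (OffTwo.off-v (OffTwo-condense ge w≢u w≢v o)) {g} {u} tt (tt , u≢v)
         | PM-entry (OffTwo.off-v (OffTwo-condense gf w′≢u w′≢v o)) {g} {u} tt (tt , u≢v)
    ... | inj₂ x | _      = Middle.uneven o u≢v w≢u w≢v w′≢u w′≢v ge gg gg′ gf zf ze gu zv x
    ... | inj₁ z | inj₂ x = E-resp (minor-swap A e f u v) (E-neg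
      (Middle.uneven o u≢v w′≢u w′≢v w≢u w≢v gf gg′ gg ge ze zf gu zv x))
    ... | inj₁ z | inj₁ z′ = Middle.even o u≢v w≢u w≢v w′≢u w′≢v ge gg gg′ gf zf ze gu zv
      (difference-zero z) (difference-zero z′)

    minor-walk₂ : ∀ {A : Mat r m} {u v} → OffTwo A u v → u ≢ v → ∀ {e g f w w′} →
      w ≢ u → w ≢ v → w′ ≢ u → w′ ≢ v → G (A e w) → G (A g w) → G (A g w′) → G (A f w′) → E (minor₂ A e f u v)
    minor-walk₂ {A} {u} {v} o u≢v {e} {g} {f} {w} {w′} w≢u w≢v w′≢u w′≢v ge gg gg′ gf
      with Entries.at o u≢v f w≢u | Entries.at o u≢v e w′≢u | Entries.at-u o u≢v g | Entries.at-v o u≢v g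
    ... | inj₂ x | _ | _ | _ = minor-walk₁ o u≢v w≢u w≢v ge x
    ... | inj₁ _ | inj₂ x | _ | _ = minor-walk₁ o u≢v w′≢u w′≢v x gf
    ... | inj₁ _ | inj₁ _ | inj₂ gu | inj₂ gv = minor-through o u≢v gu gv
      (minor-walk₁ o u≢v w≢u w≢v ge gg) (minor-walk₁ o u≢v w′≢u w′≢v gg′ gf)
    ... | inj₁ zf | inj₁ ze | inj₂ gu | inj₁ zv = minor-middle o u≢v w≢u w≢v w′≢u w′≢v ge gg gg′ gf zf ze gu zv
    ... | inj₁ zf | inj₁ ze | inj₁ zu | inj₂ gv = E-resp (minor-swap′ A e f u v) (E-neg
      (minor-middle (OffTwo-swap o) (≡.≢-sym u≢v) w≢v w≢u w′≢v w′≢u ge gg gg′ gf zf ze gv zu))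
    -- Row `g` meets neither `u` nor `v`. Condensing at (g, w) therefore only scales these two
    -- columns, while it fills in the entry (e, w′), so that `e` and `f` acquire the common column
    -- `w′`.
    ... | inj₁ zf | inj₁ ze | inj₁ zu | inj₁ zv = E-cancel (G-* gg gg) (E-resp
      (minor-scale A C (A g w) (condense-zeroʳ A g w zu) (condense-zeroʳ A g w zv) (condense-zeroʳ A g w zu) (condense-zeroʳ A g w zv))
      (minor-walk₁ (OffTwo-condense gg w≢u w≢v o) u≢v w′≢u w′≢v
        (G-resp (sym (condense-zero A g w ze)) (G-neg (G-* ge gg′)))
        (G-resp (sym (condense-zeroˡ A g w zf)) (G-* gg gf))))
      where
      C : Mat r m
      C = condense A g w

    -- Either a row of the walk meets column `y`, and the rest of the walk from there offers a
    -- shortcut, or condensing at (x, y) only scales the rows of the walk, which therefore survives.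
    walk-condense : ∀ {A : Mat r m} {u v} → OffTwo A u v → u ≢ v → ∀ {x y} → G (A x y) → y ≢ u → ∀ {n h f} → Walk A u v n h f →
      (∃ λ l → l ℕ.≤ n × ∃ λ h′ → G (A h′ y) × Walk A u v l h′ f) ⊎
      ((A h y ≈ 0#) × (A f y ≈ 0#) × Walk (condense A x y) u v n h f)
    walk-condense o u≢v g y≢u {h = h} [] with Entries.at o u≢v h y≢u
    ... | inj₂ gh = inj₁ (0 , z≤n , h , gh , [])
    ... | inj₁ z  = inj₂ (z , z , [])
    walk-condense {A} o u≢v {x} {y} g y≢u {h = h} (step w w≢u w≢v ge gg walk)
      with Entries.at o u≢v h y≢u | walk-condense o u≢v g y≢u walk
    ... | inj₂ gh | _ = inj₁ (_ , ℕP.≤-refl , h , gh , step w w≢u w≢v ge gg walk)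
    ... | inj₁ _  | inj₁ (l , l≤n , rest) = inj₁ (l , ℕP.m≤n⇒m≤1+n l≤n , rest)
    ... | inj₁ z  | inj₂ (z′ , zf , walk′) = inj₂ (z , zf , step w w≢u w≢v
      (G-resp (sym (condense-zeroˡ A x y z)) (G-* g ge)) (G-resp (sym (condense-zeroˡ A x y z′)) (G-* g gg)) walk′)

    -- Induction on the length of a walk.  Walks with three or more steps are shortened by condensing their third row, unless they have a shortcut.
    minor-walk : ∀ k {A : Mat r m} {u v} → OffTwo A u v → u ≢ v → ∀ {n e f} → n ℕ.≤ k → Walk A u v n e f → E (minor₂ A e f u v)
    minor-walk k o u≢v n≤k [] = inj₁ (trans (+-congˡ (-‿cong (*-congʳ refl))) (-‿inverseʳ _))
    minor-walk k o u≢v n≤k (step w w≢u w≢v ge gf []) = minor-walk₁ o u≢v w≢u w≢v ge gf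
    minor-walk k o u≢v n≤k (step w w≢u w≢v ge gg (step w′ w′≢u w′≢v gg′ gf [])) =
      minor-walk₂ o u≢v w≢u w≢v w′≢u w′≢v ge gg gg′ gf
    minor-walk (suc k) {A} {u} {v} o u≢v {suc (suc (suc n))} {e} {f} (s≤s n≤k)
      (step {g = g₁} w₁ w₁≢u w₁≢v ge₁ gg₁ (step {g = g₂} w₂ w₂≢u w₂≢v ge₂ gg₂ (step {g = g₃} w₃ w₃≢u w₃≢v ge₃ gg₃ walk)))
      with Entries.at o u≢v e w₂≢u | Entries.at o u≢v g₂ w₁≢u | Entries.at o u≢v g₁ w₃≢u | walk-condense o u≢v {g₂} {w₂} gg₂ w₂≢u walk
    ... | inj₂ x | _ | _ | _ = minor-walk k o u≢v n≤k (step w₂ w₂≢u w₂≢v x gg₂ (step w₃ w₃≢u w₃≢v ge₃ gg₃ walk))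
    ... | inj₁ _ | inj₂ x | _ | _ = minor-walk k o u≢v n≤k (step w₁ w₁≢u w₁≢v ge₁ x (step w₃ w₃≢u w₃≢v ge₃ gg₃ walk))
    ... | inj₁ _ | inj₁ _ | inj₂ x | _ = minor-walk k o u≢v n≤k (step w₁ w₁≢u w₁≢v ge₁ gg₁ (step w₃ w₃≢u w₃≢v x gg₃ walk))
    ... | inj₁ _ | inj₁ _ | inj₁ _ | inj₁ (l , l≤n , h , gh , walk′) = minor-walk k o u≢v
      (ℕP.≤-trans (s≤s (s≤s l≤n)) n≤k)
      (step w₁ w₁≢u w₁≢v ge₁ gg₁ (step w₂ w₂≢u w₂≢v ge₂ gh walk′))
    ... | inj₁ ze | inj₁ z₂ | inj₁ z₁ | inj₂ (z₃ , zf , walk′) = E-cancel (G-* gg₂ gg₂) (E-resp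
      (minor-scale A (condense A g₂ w₂) (A g₂ w₂) (condense-zeroˡ A g₂ w₂ ze) (condense-zeroˡ A g₂ w₂ ze) (condense-zeroˡ A g₂ w₂ zf) (condense-zeroˡ A g₂ w₂ zf))
      (minor-walk k (OffTwo-condense gg₂ w₂≢u w₂≢v o) u≢v n≤k
        (step w₁ w₁≢u w₁≢v (G-resp (sym (condense-zeroˡ A g₂ w₂ ze)) (G-* gg₂ ge₁)) (G-resp (sym (condense-zeroʳ A g₂ w₂ z₂)) (G-* gg₂ gg₁))
          (step w₃ w₃≢u w₃≢v (G-resp (sym (condense-zero A g₂ w₂ z₁)) (G-neg (G-* ge₂ ge₃))) (G-resp (sym (condense-zeroˡ A g₂ w₂ z₃)) (G-* gg₂ gg₃)) walk′))))

    Joined : Mat r m → (u v : Fin m) → Fin r → Fin r → Set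
    Joined A u v e f = ∃ λ n → Walk A u v n e f

    joined-trans : ∀ {A u v e g f} → Joined A u v e g → Joined A u v g f → Joined A u v e f
    joined-trans (_ , [])                            j = j
    joined-trans (_ , step w w≢u w≢v ge gg walk) j = _ , step w w≢u w≢v ge gg (proj₂ (joined-trans (_ , walk) j))

    joined-edge : ∀ {A : Mat r m} {u v e f w} → w ≢ u → w ≢ v → G (A e w) → G (A f w) → Joined A u v e f
    joined-edge w≢u w≢v ge gf = _ , step _ w≢u w≢v ge gf []

    joined-sym : ∀ {A u v e f} → Joined A u v e f → Joined A u v f e
    joined-sym (_ , [])                          = _ , []
    joined-sym (_ , step w w≢u w≢v ge gg walk) =
      joined-trans (joined-sym (_ , walk)) (joined-edge w≢u w≢v gg ge)

    Connected : Mat r m → (u v : Fin m) → Set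
    Connected A u v = ∀ {e f} → G (A e u) → G (A f u) → Joined A u v e f

    module _ {A : Mat r m} {u v} (o : OffTwo A u v) (u≢v : u ≢ v) {x y} (y≢u : y ≢ u) (y≢v : y ≢ v) (g : G (A x y)) where
      private
        B : Mat r m
        B = pivot A x y

        at-row : ∀ {j} → j ≢ y → B x j ≈ A x j
        at-row = pivot-row A x y

        to-x : ∀ {i} → G (A i y) → Joined B u v i x
        to-x {i} gi with i ≟ x
        ... | yes ≡.refl = _ , []
        ... | no i≢x     = joined-edge y≢u y≢v (G-resp (sym (pivot-column A x y i≢x)) gi) (G-resp (sym (pivot-xy A x y)) (G-neg G-1))

        to-column : ∀ {i w} → w ≢ u → w ≢ y → G (A i w) → ∃ λ i′ → Joined B u v i i′ × G (B i′ w)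
        to-column {i} {w} w≢u w≢y gi with i ≟ x
        ... | yes ≡.refl = i , (_ , []) , G-resp (sym (at-row w≢y)) gi
        ... | no i≢x with Entries.at o u≢v i y≢u | Entries.at o u≢v x w≢u
        ...   | inj₁ z  | _       = i , (_ , []) , G-resp (sym (trans (pivot-other A x y i≢x w≢y) (condense-zeroˡ A x y z))) (G-* g gi)
        ...   | inj₂ _  | inj₁ z  = i , (_ , []) , G-resp (sym (trans (pivot-other A x y i≢x w≢y) (condense-zeroʳ A x y z))) (G-* g gi)
        ...   | inj₂ gy | inj₂ gx = x , to-x gy , G-resp (sym (at-row w≢y)) gx

        edge : ∀ {e f w} → w ≢ u → w ≢ v → G (A e w) → G (A f w) → Joined B u v e f
        edge {w = w} w≢u w≢v ge gf with w ≟ y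
        ... | yes ≡.refl = joined-trans (to-x ge) (joined-sym (to-x gf))
        ... | no w≢y     =
          let e′ , je , ge′ = to-column w≢u w≢y ge
              f′ , jf , gf′ = to-column w≢u w≢y gf
          in joined-trans je (joined-trans (joined-edge w≢u w≢v ge′ gf′) (joined-sym jf))

        transfer : ∀ {e f} → Joined A u v e f → Joined B u v e f
        transfer (_ , [])                          = _ , []
        transfer (_ , step w w≢u w≢v ge gg walk) = joined-trans (edge w≢u w≢v ge gg) (transfer (_ , walk))

        source : ∀ {e} → G (B e u) → ∃ λ e′ → G (A e′ u) × Joined B u v e e′
        source {e} ge = helper (e ≟ x) (Entries.at-u o u≢v e)
          where
          helper : Dec (e ≡ x) → E (A e u) → ∃ λ e′ → G (A e′ u) × Joined B u v e e′
          helper (yes ≡.refl) _        = e , G-resp (at-row (≡.≢-sym y≢u)) ge , (_ , [])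
          helper (no _)       (inj₂ h) = e , h , (_ , [])
          helper (no e≢x)     (inj₁ z) = x , G-factorˡ (Entries.at-u o u≢v x) (G-resp (*-comm _ _) h) ,
                                             to-x (G-factorˡ (Entries.at o u≢v e y≢u) h)
            where
            h : G (A e y * A x u)
            h = G-resp (-‿involutive _) (G-neg (G-resp (trans (pivot-other A x y e≢x (≡.≢-sym y≢u)) (condense-zero A x y z)) ge))

      -- Column `y` keeps its nonzero entries, and B x y = -1, so all rows that meet `y` are still
      -- joined to `x`. An entry (i, w) that the pivot might destroy has A i y and A x w nonzero,
      -- and the walk can pass through `x` instead.
      Connected-pivot : Connected A u v → Connected B u v
      Connected-pivot conn ge gf =
        let e′ , ge′ , je = source ge
            f′ , gf′ , jf = source gf
        in joined-trans je (joined-trans (transfer (conn ge′ gf′)) (joined-sym jf))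

    private
      onlyTwo : ∀ {k} {A : Mat r m} {u v} → OffTwo A u v → u ≢ v → Connected A u v →
        (ρ : Fin k → Fin r) (κ : Fin k → Fin m) → Injective _≡_ _≡_ κ → (∀ j → κ j ≡ u ⊎ κ j ≡ v) → E (D k (sub A ρ κ))
      onlyTwo {zero} o u≢v conn ρ κ inj h = E-resp (sym (D-0 _)) E-1
      onlyTwo {suc zero} o u≢v conn ρ κ inj h with h zero
      ... | inj₁ e = minor (OffTwo.off-v o) 1 ρ κ (λ _ → tt) λ { zero → tt , λ e′ → u≢v (≡.trans (≡.sym e) e′) }
      ... | inj₂ e = minor (OffTwo.off-u o) 1 ρ κ (λ _ → tt) λ { zero → tt , λ e′ → u≢v (≡.trans (≡.sym e′) e) }
      onlyTwo {suc (suc zero)} {A} {u} {v} o u≢v conn ρ κ inj h = E-resp (sym (D-2 _)) (two (h zero) (h (suc zero)))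
        where
        e = ρ zero
        f = ρ (suc zero)
        base : E (minor₂ A e f u v)
        base = minor-zero A e f u v (Entries.at-u o u≢v) (Entries.at-v o u≢v) λ a _ c _ →
          minor-walk _ o u≢v ℕP.≤-refl (proj₂ (conn a c))
        two : κ zero ≡ u ⊎ κ zero ≡ v → κ (suc zero) ≡ u ⊎ κ (suc zero) ≡ v → E (minor₂ A e f (κ zero) (κ (suc zero)))
        two (inj₁ a) (inj₁ b) = contradiction (inj (≡.trans a (≡.sym b))) λ ()
        two (inj₂ a) (inj₂ b) = contradiction (inj (≡.trans a (≡.sym b))) λ ()
        two (inj₁ a) (inj₂ b) = ≡.subst₂ (λ a b → E (minor₂ A e f a b)) (≡.sym a) (≡.sym b) base
        two (inj₂ a) (inj₁ b) = ≡.subst₂ (λ a b → E (minor₂ A e f a b)) (≡.sym a) (≡.sym b)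
          (E-resp (trans (-‿cong (sym (minor-swap′ A e f u v))) (-‿involutive _)) (E-neg base))
      onlyTwo {suc (suc (suc k))} o u≢v conn ρ κ inj h with h zero | h (suc zero) | h (suc (suc zero))
      ... | inj₁ a | inj₁ b | _      = contradiction (inj (≡.trans a (≡.sym b))) λ ()
      ... | inj₁ a | inj₂ b | inj₁ c = contradiction (inj (≡.trans a (≡.sym c))) λ ()
      ... | inj₁ a | inj₂ b | inj₂ c = contradiction (inj (≡.trans b (≡.sym c))) λ ()
      ... | inj₂ a | inj₂ b | _      = contradiction (inj (≡.trans a (≡.sym b))) λ ()
      ... | inj₂ a | inj₁ b | inj₂ c = contradiction (inj (≡.trans a (≡.sym c))) λ ()
      ... | inj₂ a | inj₁ b | inj₁ c = contradiction (inj (≡.trans b (≡.sym c))) λ ()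

      other? : ∀ {k} (κ : Fin k → Fin m) u v → ∀ j → (κ j ≢ u × κ j ≢ v) ⊎ (κ j ≡ u ⊎ κ j ≡ v)
      other? κ u v j with κ j ≟ u | κ j ≟ v
      ... | yes e | _     = inj₂ (inj₁ e)
      ... | no _  | yes e = inj₂ (inj₂ e)
      ... | no a  | no b  = inj₁ (a , b)

      -- As long as the minor has a column other than `u` and `v`, a pivot at a nonzero entry of
      -- that column reduces its size. Condensation would give the same minors, but it erases the
      -- row and the column of the pivot and with them the connections between the rows.
      minors : ∀ k {A : Mat r m} {u v} → OffTwo A u v → u ≢ v → Connected A u v →
        (ρ : Fin k → Fin r) (κ : Fin k → Fin m) → Injective _≡_ _≡_ ρ → Injective _≡_ _≡_ κ → E (D k (sub A ρ κ))
      minors zero o u≢v conn ρ κ injρ injκ = E-resp (sym (D-0 _)) E-1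
      minors (suc k) {A} {u} {v} o u≢v conn ρ κ injρ injκ with search (suc k) (other? κ u v)
      ... | inj₂ only = onlyTwo o u≢v conn ρ κ injκ only
      ... | inj₁ (j , κj≢u , κj≢v) with search (suc k) (λ i → swap (Entries.at o u≢v (ρ i) κj≢u))
        where open import Data.Sum using (swap)
      ...   | inj₂ zeros = frontColumn A ρ κ j (E-transpose (inj₁ (det-zeroRow k _ (λ i → zeros i))))
      ...   | inj₁ (i , g) = frontRow A ρ κ i (frontColumn A (front ρ i) κ j
        (uncondense A (ρ i) (κ j) g (ρ ∘ punchIn i) (κ ∘ punchIn j)
          (E-resp (D-cong k (λ a b → pivot-other A (ρ i) (κ j) (punchIn-avoids injρ i a) (punchIn-avoids injκ j b)))
            (minors k (OffTwo-pivot g κj≢u κj≢v o) u≢v (Connected-pivot o u≢v κj≢u κj≢v g conn) _ _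
              (punchIn-preserves-inj injρ i) (punchIn-preserves-inj injκ j)))))

    PM-glue : ∀ {A : Mat r m} {u v} → OffTwo A u v → u ≢ v → Connected A u v → PM Every Every A
    PM-glue o u≢v conn = PM-injective λ k ρ κ injρ injκ _ _ → minors k o u≢v conn ρ κ injρ injκ

-- Existence and uniqueness of lifts from those of deletions

module Deletion {R : CommutativeRing 0ℓ 0ℓ} (𝒢 : UnitGroup R) where
  open CommutativeRing R hiding (zero)
  open PMatrices 𝒢
  open DetTheory R using (Mat; D; D-0; det-zeroRow)

  -- The column is zeroed and not removed, so that all matrices of the induction have the same
  -- format.
  delete : ∀ {r m} → Mat r m → Fin m → Mat r m
  delete A u i j with j ≟ u
  ... | yes _ = 0#
  ... | no  _ = A i j

  delete-at : ∀ {r m} (A : Mat r m) u i → delete A u i u ≈ 0#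
  delete-at A u i with u ≟ u
  ... | yes _  = refl
  ... | no u≢u = contradiction ≡.refl u≢u

  delete-off : ∀ {r m} (A : Mat r m) {u j} → j ≢ u → ∀ i → delete A u i j ≈ A i j
  delete-off A {u} {j} j≢u i with j ≟ u
  ... | yes e = contradiction e j≢u
  ... | no _  = refl

  PM-zeroColumn : ∀ {r m} {P : Sel r} {Q : Sel m} {A : Mat r m} u →
    (∀ i → P i → A i u ≈ 0#) → PM P (Q ∖ u) A → PM P Q A
  PM-zeroColumn {r} {m} {P} {Q} {A} u z pm = mkPM go
    where
    go : ∀ k (ρ : Fin k → Fin r) (κ : Fin k → Fin m) → (∀ i → P (ρ i)) → (∀ j → Q (κ j)) → E (D k (sub A ρ κ))
    go zero ρ κ p q = E-resp (sym (D-0 _)) E-1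
    go (suc k) ρ κ p q with occurs? κ u
    ... | no  u∉κ = minor pm (suc k) ρ κ p (λ j → q j , λ e → u∉κ (j , e))
    ... | yes (j , ≡.refl) = frontColumn A ρ κ j (E-transpose (inj₁ (det-zeroRow k _ (λ i → z _ (p i)))))

  PM-delete : ∀ {r m} {A : Mat r m} u → PM Every (Every ∖ u) A → PM Every Every (delete A u)
  PM-delete {A = A} u pm = PM-zeroColumn u (λ i _ → delete-at A u i)
    (PM-cong (λ i j _ q → sym (delete-off A (proj₂ q) i)) pm)

  PM-zero : ∀ {r m} {A : Mat r m} → (∀ i j → A i j ≈ 0#) → PM Every Every A
  PM-zero z = mkPM λ
    { zero ρ κ _ _ → E-resp (sym (D-0 _)) E-1
    ; (suc k) ρ κ _ _ → inj₁ (det-zeroRow k _ (λ j → z _ _)) }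

data Chain {r m} (N : Fin r → Fin m → Set) (u v : Fin m) : Fin r → Fin r → Set where
  []   : ∀ {e} → Chain N u v e e
  link : ∀ {e g f} w → w ≢ u → w ≢ v → N e w → N g w → Chain N u v g f → Chain N u v e f

module Existence {Ω R : CommutativeRing 0ℓ 0ℓ} {𝒢 : UnitGroup Ω} {ℋ : UnitGroup R} (lifting : Lifting Ω R 𝒢 ℋ) where
  open CommutativeRing Ω hiding (zero)
  open PMatrices 𝒢
  open LiftTheory lifting hiding (module R)
  open IntegerSolver Ω
  open DetTheory Ω using (Mat; D)
  open Deletion 𝒢
  module R where
    open CommutativeRing R hiding (zero) public
    open PMatrices ℋ public
    open DetTheory R public using (Mat; D)
    open Deletion ℋ public
    open import Algebra.Properties.Ring (CommutativeRing.ring R) public using (-0#≈0#; -‿distribʳ-*; -‿distribˡ-*; -‿involutive)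
  open import Relation.Binary.Reasoning.Setoid setoid

  -- The kernel of the projection on units: the factors by which a lift can be rescaled without
  -- changing its image.
  K : Carrier → Set
  K x = G x × (π x R.≈ R.1#)

  K-1 : K 1#
  K-1 = G-1 , π-1

  K-* : ∀ {x y} → K x → K y → K (x * y)
  K-* (g , e) (h , e′) = G-* g h , R.trans (π-* _ _) (R.trans (R.*-cong e e′) (R.*-identityˡ _))

  inv : ∀ {x} → G x → Carrier
  inv = G-inverse

  inv-G : ∀ {x} (g : G x) → G (inv g)
  inv-G g = proj₁ (proj₂ (G-inv g))

  inverseʳ : ∀ {x} (g : G x) → x * inv g ≈ 1#
  inverseʳ g = proj₂ (proj₂ (G-inv g))

  inverseˡ : ∀ {x} (g : G x) → inv g * x ≈ 1#
  inverseˡ g = trans (*-comm _ _) (inverseʳ g)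

  K-inv : ∀ {x} (k : K x) → K (inv (proj₁ k))
  K-inv {x} (g , e) = inv-G g , R.trans (R.sym (R.*-identityˡ _)) (R.trans (R.*-congʳ (R.sym e))
    (R.trans (R.sym (π-* x (inv g))) (R.trans (π-cong (inverseʳ g)) π-1)))

  -- Units project to units, so every lift has exactly the zero pattern of the matrix below it.
  E-kernel : ∀ {x} → E x → π x R.≈ R.0# → x ≈ 0#
  E-kernel (inj₁ z) _ = z
  E-kernel (inj₂ g) e = contradiction e (R.G-≉0 (π-G g))

  E-unit : ∀ {x} → E x → R.G (π x) → G x
  E-unit e g = E-nonzero e λ z → R.G-≉0 g (R.trans (π-cong z) π-0)

  K-ratio : ∀ {x y} → G x → G y → π x R.≈ π y → ∃ λ k → K k × (y ≈ k * x)
  K-ratio {x} {y} g h e = y * inv g ,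
    (G-* h (inv-G g) , R.trans (π-* _ _) (R.trans (R.*-congʳ (R.sym e)) (R.trans (R.sym (π-* x (inv g))) (R.trans (π-cong (inverseʳ g)) π-1)))) ,
    sym (trans (*-assoc _ _ _) (trans (*-congˡ (inverseˡ g)) (*-identityʳ y)))

  lift-entry : ∀ {x} → R.E x → ∃ λ z → E z × (π z R.≈ x)
  lift-entry (inj₁ z) = 0# , E-0 , R.trans π-0 (R.sym z)
  lift-entry (inj₂ h) = let z , g , e = section h in z , inj₂ g , e

  record IsLift {r m} (M : R.Mat r m) (A : Mat r m) : Set where
    field
      pm   : PM Every Every A
      over : ∀ i j → π (A i j) R.≈ M i j

    entry : ∀ i j → E (A i j)
    entry i j = PM-entry pm tt tt

    zeroAt : ∀ {i j} → M i j R.≈ R.0# → A i j ≈ 0#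
    zeroAt {i} {j} z = E-kernel (entry i j) (R.trans (over i j) z)

    unitAt : ∀ {i j} → R.G (M i j) → G (A i j)
    unitAt {i} {j} g = E-unit (entry i j) (R.G-resp (R.sym (over i j)) g)

  open IsLift

  record Rescaled {r m} (A B : Mat r m) : Set where
    field
      s   : Fin r → Carrier
      t   : Fin m → Carrier
      s-K : ∀ i → K (s i)
      t-K : ∀ j → K (t j)
      eq  : ∀ i j → B i j ≈ s i * (t j * A i j)

  record Lifts {r m} (M : R.Mat r m) : Set where
    field
      exists : ∃ (IsLift M)
      unique : ∀ {A B} → IsLift M A → IsLift M B → Rescaled A B

  open Lifts

  IsLift-transpose : ∀ {r m} {M : R.Mat r m} {A} → IsLift M A → IsLift (M R.ᵀ) (A ᵀ)
  IsLift-transpose l = record { pm = PM-transpose (pm l) ; over = λ i j → over l j i }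

  Lifts-transpose : ∀ {r m} {M : R.Mat r m} → Lifts (M R.ᵀ) → Lifts M
  Lifts-transpose l = record
    { exists = let A , a = exists l in A ᵀ , IsLift-transpose a
    ; unique = λ a b → let open Rescaled (unique l (IsLift-transpose a) (IsLift-transpose b)) in record
        { s = t ; t = s ; s-K = t-K ; t-K = s-K
        ; eq = λ i j → trans (eq j i) (solve 3 (λ a b c → a :* (b :* c) := b :* (a :* c)) refl _ _ _) } }

  Lifts-zero : ∀ {r m} {M : R.Mat r m} → (∀ i j → M i j R.≈ R.0#) → Lifts M
  Lifts-zero z = record
    { exists = (λ _ _ → 0#) , record { pm = PM-zero (λ _ _ → refl) ; over = λ i j → R.trans π-0 (R.sym (z i j)) }
    ; unique = λ a b → record
        { s = λ _ → 1# ; t = λ _ → 1# ; s-K = λ _ → K-1 ; t-K = λ _ → K-1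
        ; eq = λ i j → trans (zeroAt b (z i j)) (sym (trans (*-identityˡ _) (trans (*-identityˡ _) (zeroAt a (z i j))))) } }

  IsLift-delete : ∀ {r m} {M : R.Mat r m} {A} u → IsLift M A → IsLift (R.delete M u) (delete A u)
  IsLift-delete {M = M} {A} u l = record
    { pm = PM-delete u (PM-mono (λ p → p) proj₁ (pm l)) ; over = o }
    where
    o : ∀ i j → π (delete A u i j) R.≈ R.delete M u i j
    o i j with j ≟ u
    ... | yes _ = π-0
    ... | no  _ = over l i j

  update : ∀ {n} → Fin n → Carrier → (Fin n → Carrier) → Fin n → Carrier
  update x a f i with i ≟ x
  ... | yes _ = a
  ... | no  _ = f i

  update-at : ∀ {n} x a (f : Fin n → Carrier) → update x a f x ≈ a
  update-at x a f with x ≟ x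
  ... | yes _  = refl
  ... | no x≢x = contradiction ≡.refl x≢x

  update-off : ∀ {n} {x i} a (f : Fin n → Carrier) → i ≢ x → update x a f i ≈ f i
  update-off {x = x} {i} a f i≢x with i ≟ x
  ... | yes e = contradiction e i≢x
  ... | no _  = refl

  update-all : ∀ {n} {P : Carrier → Set} x {a} {f : Fin n → Carrier} → P a → (∀ i → P (f i)) → ∀ i → P (update x a f i)
  update-all x pa pf i with i ≟ x
  ... | yes _ = pa
  ... | no  _ = pf i

  module SingleColumn {r m} {M : R.Mat r m} (pmM : R.PM Every Every M) x y (z : ∀ i → i ≢ x → M i y R.≈ R.0#) where

    extend : Lifts (R.delete M y) → ∃ (IsLift M)
    extend l = B , record { pm = pmB ; over = overB }
      where
      A : Mat r m
      A = proj₁ (exists l)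
      a : IsLift (R.delete M y) A
      a = proj₂ (exists l)
      new : ∀ i → ∃ λ z → E z × (π z R.≈ M i y)
      new i = lift-entry (R.PM-entry pmM tt tt)
      B : Mat r m
      B i = update y (proj₁ (new i)) (A i)
      overB : ∀ i j → π (B i j) R.≈ M i j
      overB i j with j ≟ y
      ... | yes ≡.refl = proj₂ (proj₂ (new i))
      ... | no j≢y     = R.trans (over a i j) (R.delete-off M j≢y i)
      pmB : PM Every Every B
      pmB = PM-singleColumn x y
        (λ i _ i≢x → trans (update-at y _ (A i)) (E-kernel (proj₁ (proj₂ (new i))) (R.trans (proj₂ (proj₂ (new i))) (z i i≢x))))
        (E-resp (sym (update-at y _ (A x))) (proj₁ (proj₂ (new x))))
        (PM-cong (λ i j _ q → sym (update-off _ (A i) (proj₂ q))) (PM-mono (λ p → p) proj₁ (pm a)))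

    -- Column `y` has only one nonzero entry to match, and the free scale of that column matches it.
    Lifts-singleColumn : R.G (M x y) → Lifts (R.delete M y) → Lifts M
    Lifts-singleColumn g l = record { exists = extend l ; unique = uniq }
      where
      uniq : ∀ {A B} → IsLift M A → IsLift M B → Rescaled A B
      uniq {A} {B} a b = record
        { s = s ; t = update y (k * inv sx) t ; s-K = s-K
        ; t-K = update-all {P = K} y (K-* k-K (K-inv (s-K x))) t-K ; eq = eq′ }
        where
        open Rescaled (unique l (IsLift-delete y a) (IsLift-delete y b))
        ratio = K-ratio (unitAt a g) (unitAt b g) (R.trans (over a x y) (R.sym (over b x y)))
        k = proj₁ ratio
        k-K = proj₁ (proj₂ ratio)
        sx = proj₁ (s-K x)
        eq′ : ∀ i j → B i j ≈ s i * (update y (k * inv sx) t j * A i j)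
        eq′ i j with j ≟ y
        ... | no j≢y = trans (sym (delete-off B j≢y i)) (trans (eq i j) (*-congˡ (*-congˡ (delete-off A j≢y i))))
        ... | yes ≡.refl with i ≟ x
        ...   | yes ≡.refl = begin
          B x y                          ≈⟨ proj₂ (proj₂ ratio) ⟩
          k * A x y                      ≈⟨ sym (*-identityˡ _) ⟩
          1# * (k * A x y)               ≈⟨ *-congʳ (sym (inverseʳ sx)) ⟩
          (s x * inv sx) * (k * A x y)   ≈⟨ solve 4 (λ s h k a → (s :* h) :* (k :* a) := s :* ((k :* h) :* a)) refl _ _ _ _ ⟩
          s x * ((k * inv sx) * A x y) ∎
        ...   | no i≢x = trans (zeroAt b (z i i≢x)) (sym (trans (*-congˡ (trans (*-congˡ (zeroAt a (z i i≢x))) (zeroʳ _))) (zeroʳ _)))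

  module Pair {r m} {M : R.Mat r m} (pmM : R.PM Every Every M) {u v : Fin m} (u≢v : u ≢ v)
    (chain : ∀ {e f} → R.G (M e u) → R.G (M f u) → Chain (λ i j → R.G (M i j)) u v e f)
    (l₁ : Lifts (R.delete M u)) (l₂ : Lifts (R.delete M v)) (l₁₂ : Lifts (R.delete (R.delete M u) v)) where

    -- Uniqueness on the common deletion makes `A₂`, rescaled by the row factors `s`, agree with
    -- `A₁` off `u` and `v` up to column factors. So column `u` of `A₂` can be inserted into `A₁`;
    -- the chains in `M` provide the connectedness that `PM-glue` asks for.
    glue : ∃ (IsLift M)
    glue = B , record { pm = PM-glue offTwo u≢v connected ; over = overB }
      where
      A₁ A₂ : Mat r m
      A₁ = proj₁ (exists l₁)
      A₂ = proj₁ (exists l₂)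
      a₁ : IsLift (R.delete M u) A₁
      a₁ = proj₂ (exists l₁)
      a₂ : IsLift (R.delete M v) A₂
      a₂ = proj₂ (exists l₂)
      both : IsLift (R.delete (R.delete M u) v) (delete A₂ u)
      both = record { pm = pm (IsLift-delete u a₂) ; over = o }
        where
        o : ∀ i j → π (delete A₂ u i j) R.≈ R.delete (R.delete M u) v i j
        o i j with j ≟ u
        o i j | yes ≡.refl = R.trans π-0 (R.sym (R.trans (R.delete-off (R.delete M u) u≢v i) (R.delete-at M u i)))
        o i j | no j≢u with j ≟ v
        ... | yes ≡.refl = R.trans (over a₂ i v) (R.delete-at M v i)
        ... | no j≢v     = R.trans (over a₂ i j) (R.trans (R.delete-off M j≢v i) (R.sym (R.delete-off M j≢u i)))
      open Rescaled (unique l₁₂ both (IsLift-delete v a₁))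
      B : Mat r m
      B i = update u (s i * A₂ i u) (A₁ i)
      overB : ∀ i j → π (B i j) R.≈ M i j
      overB i j with j ≟ u
      ... | yes ≡.refl = R.trans (π-* _ _) (R.trans (R.*-cong (proj₂ (s-K i)) (R.trans (over a₂ i u) (R.delete-off M u≢v i))) (R.*-identityˡ _))
      ... | no j≢u     = R.trans (over a₁ i j) (R.delete-off M j≢u i)
      off-v-eq : ∀ i j → Every i → (Every ∖ v) j → B i j ≈ s i * (update u 1# t j * A₂ i j)
      off-v-eq i j _ (_ , j≢v) with j ≟ u
      ... | yes ≡.refl = *-congˡ (sym (*-identityˡ _))
      ... | no j≢u     = trans (sym (delete-off A₁ j≢v i)) (trans (eq i j) (*-congˡ (*-congˡ (delete-off A₂ j≢u i))))
      offTwo : OffTwo B u v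
      offTwo = record
        { off-u = PM-cong (λ i j _ q → sym (update-off _ (A₁ i) (proj₂ q))) (PM-mono (λ p → p) proj₁ (pm a₁))
        ; off-v = PM-scale s (update u 1# t) (λ i → proj₁ (s-K i)) (update-all {P = G} u G-1 (λ j → proj₁ (t-K j)))
                    off-v-eq (PM-mono (λ p → p) proj₁ (pm a₂))
        ; below = R.PM-cong (λ i j _ _ → R.sym (overB i j)) pmM }
      entry-B : ∀ i j → E (B i j)
      entry-B i j with j ≟ u
      ... | yes ≡.refl = E-* (inj₂ (proj₁ (s-K i))) (entry a₂ i u)
      ... | no _       = entry a₁ i j
      unit-B : ∀ {i j} → R.G (M i j) → G (B i j)
      unit-B {i} {j} g = E-unit (entry-B i j) (R.G-resp (R.sym (overB i j)) g)
      walk : ∀ {e f} → Chain (λ i j → R.G (M i j)) u v e f → Joined B u v e f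
      walk []                           = 0 , []
      walk (link w w≢u w≢v ge gg rest) = _ , step w w≢u w≢v (unit-B ge) (unit-B gg) (proj₂ (walk rest))
      connected : Connected B u v
      connected ge gf = walk (chain (R.G-resp (overB _ _) (π-G ge)) (R.G-resp (overB _ _) (π-G gf)))

    private
      module Uniq {A B : Mat r m} (a : IsLift M A) (b : IsLift M B) where
        open Rescaled (unique l₁ (IsLift-delete u a) (IsLift-delete u b))
        module S = Rescaled (unique l₂ (IsLift-delete v a) (IsLift-delete v b))

        off-u : ∀ {j} → j ≢ u → ∀ i → B i j ≈ s i * (t j * A i j)
        off-u j≢u i = trans (sym (delete-off B j≢u i)) (trans (eq i _) (*-congˡ (*-congˡ (delete-off A j≢u i))))

        off-v : ∀ {j} → j ≢ v → ∀ i → B i j ≈ S.s i * (S.t j * A i j)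
        off-v j≢v i = trans (sym (delete-off B j≢v i)) (trans (S.eq i _) (*-congˡ (*-congˡ (delete-off A j≢v i))))

        agree : ∀ {i j} → j ≢ u → j ≢ v → R.G (M i j) → s i * t j ≈ S.s i * S.t j
        agree {i} {j} j≢u j≢v g = G-cancel (unitAt a g) (begin
          A i j * (s i * t j)      ≈⟨ solve 3 (λ a s t → a :* (s :* t) := s :* (t :* a)) refl _ _ _ ⟩
          s i * (t j * A i j)      ≈⟨ trans (sym (off-u j≢u i)) (off-v j≢v i) ⟩
          S.s i * (S.t j * A i j)  ≈⟨ solve 3 (λ a s t → s :* (t :* a) := a :* (s :* t)) refl _ _ _ ⟩
          A i j * (S.s i * S.t j) ∎)

        -- Each of the two deletions compares `A` with `B` by scales of its own. On a nonzero entry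
        -- outside `u` and `v` the products of row and column scale agree, so the ratio of the two
        -- row scales stays constant along a chain.
        proportional : ∀ {e f} → Chain (λ i j → R.G (M i j)) u v e f → s e * S.s f ≈ S.s e * s f
        proportional [] = *-comm _ _
        proportional {e} {f} (link {g = g} w w≢u w≢v ge gg rest) =
          G-cancel (G-* (proj₁ (t-K w)) (G-* (proj₁ (S.t-K w)) (G-* (proj₁ (s-K g)) (proj₁ (S.s-K g))))) (begin
          (t w * (S.t w * (s g * S.s g))) * (s e * S.s f)
            ≈⟨ solve 6 (λ tw tw′ sg sg′ se sf′ → (tw :* (tw′ :* (sg :* sg′))) :* (se :* sf′) := (se :* tw) :* ((sg′ :* tw′) :* (sg :* sf′))) refl _ _ _ _ _ _ ⟩
          (s e * t w) * ((S.s g * S.t w) * (s g * S.s f))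
            ≈⟨ *-cong (agree w≢u w≢v ge) (*-cong (sym (agree w≢u w≢v gg)) (proportional rest)) ⟩
          (S.s e * S.t w) * ((s g * t w) * (S.s g * s f))
            ≈⟨ solve 6 (λ tw tw′ sg sg′ se sf′ → (se :* tw′) :* ((sg :* tw) :* (sg′ :* sf′)) := (tw :* (tw′ :* (sg :* sg′))) :* (se :* sf′)) refl _ _ _ _ _ _ ⟩
          (t w * (S.t w * (s g * S.s g))) * (S.s e * s f) ∎)

        rescaled : Rescaled A B
        rescaled with search r {λ i → R.G (M i u)} {λ i → M i u R.≈ R.0#} (λ i → swap (R.PM-entry pmM tt tt))
          where open import Data.Sum using (swap)
        ... | inj₂ zeros = record { s = s ; t = t ; s-K = s-K ; t-K = t-K ; eq = eq′ }
          where
          eq′ : ∀ i j → B i j ≈ s i * (t j * A i j)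
          eq′ i j with j ≟ u
          ... | no j≢u     = off-u j≢u i
          ... | yes ≡.refl = trans (zeroAt b (zeros i)) (sym (trans (*-congˡ (trans (*-congˡ (zeroAt a (zeros i))) (zeroʳ _))) (zeroʳ _)))
        ... | inj₁ (e , ge) = record { s = s ; t = update u τ t ; s-K = s-K
          ; t-K = update-all {P = K} u (K-* (S.t-K u) (K-* (S.s-K e) (K-inv (s-K e)))) t-K ; eq = eq′ }
          where
          -- The scale of column `u` that makes the first comparison correct at row `e`; by
          -- `proportional` it is then correct at every row that meets `u`.
          τ : Carrier
          τ = S.t u * (S.s e * inv (proj₁ (s-K e)))
          eq′ : ∀ i j → B i j ≈ s i * (update u τ t j * A i j)
          eq′ i j with j ≟ u
          ... | no j≢u = off-u j≢u i
          ... | yes ≡.refl with R.PM-entry pmM {i} {u} tt tt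
          ...   | inj₁ z = trans (zeroAt b z) (sym (trans (*-congˡ (trans (*-congˡ (zeroAt a z)) (zeroʳ _))) (zeroʳ _)))
          ...   | inj₂ g = begin
            B i u                                    ≈⟨ off-v u≢v i ⟩
            S.s i * (S.t u * A i u)                  ≈⟨ sym (*-identityˡ _) ⟩
            1# * (S.s i * (S.t u * A i u))           ≈⟨ *-congʳ (sym (inverseʳ (proj₁ (s-K e)))) ⟩
            (s e * h) * (S.s i * (S.t u * A i u))    ≈⟨ solve 5 (λ se h si tu a → (se :* h) :* (si :* (tu :* a)) := (se :* si) :* (h :* (tu :* a))) refl _ _ _ _ _ ⟩
            (s e * S.s i) * (h * (S.t u * A i u))    ≈⟨ *-congʳ (proportional (chain ge g)) ⟩
            (S.s e * s i) * (h * (S.t u * A i u))    ≈⟨ solve 5 (λ se h si tu a → (se :* si) :* (h :* (tu :* a)) := si :* ((tu :* (se :* h)) :* a)) refl _ _ _ _ _ ⟩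
            s i * (τ * A i u) ∎
            where h = inv (proj₁ (s-K e))

    Lifts-pair : Lifts M
    Lifts-pair = record { exists = glue ; unique = λ a b → Uniq.rescaled a b }

-- Degree two: shortening cycles

module Cycles {Ω R : CommutativeRing 0ℓ 0ℓ} {𝒢 : UnitGroup Ω} {ℋ : UnitGroup R} (lifting : Lifting Ω R 𝒢 ℋ) where
  open CommutativeRing Ω hiding (zero)
  open PMatrices 𝒢
  open LiftTheory lifting hiding (module R)
  open Existence lifting
  open IntegerSolver Ω
  private module RS = IntegerSolver R
  open DetTheory Ω using (Mat)
  open Deletion 𝒢
  open import Algebra.Properties.Ring ring using (-0#≈0#; -‿involutive; -‿distribʳ-*)
  open import Relation.Binary.Reasoning.Setoid setoid
  import Relation.Binary.Reasoning.Setoid R.setoid as RR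
  open IsLift
  open Lifts

  private
    π-solve : ∀ {g x w} → G g → π (g * x) R.≈ π g R.* w → π x R.≈ w
    π-solve g e = R.G-cancel (π-G g) (R.trans (R.sym (π-* _ _)) e)

    cancel-inv : ∀ {g} (gg : G g) x → g * (inv gg * x) ≈ x
    cancel-inv gg x = trans (sym (*-assoc _ _ _)) (trans (*-congʳ (inverseʳ gg)) (*-identityˡ x))

  -- Write a, c, t for the images of `â`, `ĉ`, `t̂`. If d and t are nonzero, then x = a d / t and 1
  -- - x = - c b / t, so x is a cross ratio; its lift `z` divides `t̂` into z t̂ and (1 - z) t̂,
  -- which yield the lifts of d and b. If d is zero, the equation determines the lift of b; if t is
  -- zero, it determines that of d from any lift of b.
  complete : ∀ {b d â ĉ t̂} (ga : G â) (gc : G ĉ) → E t̂ → R.G b → R.E d → π t̂ R.≈ π â R.* d R.- π ĉ R.* b →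
    ∃ λ b̂ → ∃ λ d̂ → E b̂ × E d̂ × (π b̂ R.≈ b) × (π d̂ R.≈ d) × (â * d̂ - ĉ * b̂ ≈ t̂)
  complete {b} {d} {â} {ĉ} {t̂} ga gc et gb (inj₁ z) eπ =
    - (inv gc * t̂) , 0# , E-neg (E-* (inj₂ (inv-G gc)) et) , E-0 ,
    π-solve gc (RR.begin
      π (ĉ * - (inv gc * t̂))    RR.≈⟨ π-cong (trans (sym (-‿distribʳ-* _ _)) (-‿cong (cancel-inv gc t̂))) ⟩
      π (- t̂)                   RR.≈⟨ R.trans (π-neg t̂) (R.-‿cong eπ) ⟩
      R.- (π â R.* d R.- π ĉ R.* b) RR.≈⟨ R.-‿cong (R.+-congʳ (R.trans (R.*-congˡ z) (R.zeroʳ _))) ⟩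
      R.- (R.0# R.- π ĉ R.* b)  RR.≈⟨ R.trans (R.-‿cong (R.+-identityˡ _)) (R.-‿involutive _) ⟩
      π ĉ R.* b RR.∎) ,
    R.trans π-0 (R.sym z) ,
    trans (+-cong (zeroʳ â) (-‿cong (trans (sym (-‿distribʳ-* _ _)) (-‿cong (cancel-inv gc t̂)))))
      (trans (+-identityˡ _) (-‿involutive _))
  complete {b} {d} {â} {ĉ} {t̂} ga gc (inj₁ zt) gb (inj₂ gd) eπ =
    let β , gβ , eβ = section gb in
    β , inv ga * (ĉ * β) , inj₂ gβ , E-* (inj₂ (inv-G ga)) (E-* (inj₂ gc) (inj₂ gβ)) , eβ ,
    π-solve ga (RR.begin
      π (â * (inv ga * (ĉ * β)))  RR.≈⟨ π-cong (cancel-inv ga _) ⟩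
      π (ĉ * β)                   RR.≈⟨ R.trans (π-* ĉ β) (R.*-congˡ eβ) ⟩
      π ĉ R.* b                   RR.≈⟨ R.trans (R.sym (R.+-identityˡ _)) (R.+-congʳ (R.trans (R.sym (R.trans (π-cong zt) π-0)) eπ)) ⟩
      π â R.* d R.- π ĉ R.* b R.+ π ĉ R.* b RR.≈⟨ RS.solve 2 (λ x y → x RS.:- y RS.:+ y RS.:= x) R.refl _ _ ⟩
      π â R.* d RR.∎) ,
    trans (+-congʳ (cancel-inv ga _)) (trans (-‿inverseʳ _) (sym zt))
  complete {b} {d} {â} {ĉ} {t̂} ga gc (inj₂ gt) gb (inj₂ gd) eπ =
    - (inv gc * ((1# - z) * t̂)) , inv ga * (z * t̂) ,
    E-neg (E-* (inj₂ (inv-G gc)) (E-* ez (inj₂ gt))) , E-* (inj₂ (inv-G ga)) (E-* (inj₂ gz) (inj₂ gt)) ,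
    π-solve gc (RR.begin
      π (ĉ * - (inv gc * ((1# - z) * t̂))) RR.≈⟨ π-cong (trans (sym (-‿distribʳ-* _ _)) (-‿cong (cancel-inv gc _))) ⟩
      π (- ((1# - z) * t̂))      RR.≈⟨ π-cong (solve 3 (λ o z t → :- ((o :- z) :* t) := z :* t :- o :* t) refl 1# z t̂) ⟩
      π (z * t̂ - 1# * t̂)        RR.≈⟨ R.trans (π-minus _ _) (R.+-cong πzt (R.-‿cong (R.trans (π-cong (*-identityˡ t̂)) eπ))) ⟩
      π â R.* d R.- (π â R.* d R.- π ĉ R.* b) RR.≈⟨ RS.solve 2 (λ x y → x RS.:- (x RS.:- y) RS.:= y) R.refl _ _ ⟩
      π ĉ R.* b RR.∎) ,
    π-solve ga (R.trans (π-cong (cancel-inv ga _)) πzt) ,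
    (begin
      â * (inv ga * (z * t̂)) - ĉ * - (inv gc * ((1# - z) * t̂))
        ≈⟨ +-cong (cancel-inv ga _) (trans (-‿cong (sym (-‿distribʳ-* _ _))) (trans (-‿involutive _) (cancel-inv gc _))) ⟩
      z * t̂ + (1# - z) * t̂ ≈⟨ solve 3 (λ o z t → z :* t :+ (o :- z) :* t := o :* t) refl 1# z t̂ ⟩
      1# * t̂ ≈⟨ *-identityˡ t̂ ⟩
      t̂ ∎)
    where
    τ = R.G-inverse (π-G gt)
    x = τ R.* (π â R.* d)
    gx : R.G x
    gx = R.G-* (proj₁ (proj₂ (R.G-inv (π-G gt)))) (R.G-* (π-G ga) gd)
    tx : π t̂ R.* x R.≈ π â R.* d
    tx = R.trans (R.sym (R.*-assoc _ _ _)) (R.trans (R.*-congʳ (proj₂ (proj₂ (R.G-inv (π-G gt))))) (R.*-identityˡ _))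
    e1-x : R.E (R.1# R.- x)
    e1-x = R.E-cancel (π-G gt) (R.E-resp (R.sym (RR.begin
      π t̂ R.* (R.1# R.- x)            RR.≈⟨ RS.solve 3 (λ t o x → t RS.:* (o RS.:- x) RS.:= t RS.:* o RS.:- t RS.:* x) R.refl _ _ _ ⟩
      π t̂ R.* R.1# R.- π t̂ R.* x      RR.≈⟨ R.+-cong (R.trans (R.*-identityʳ _) eπ) (R.-‿cong tx) ⟩
      π â R.* d R.- π ĉ R.* b R.- π â R.* d RR.≈⟨ RS.solve 2 (λ x y → x RS.:- y RS.:- x RS.:= RS.:- y) R.refl _ _ ⟩
      R.- (π ĉ R.* b) RR.∎)) (R.E-neg (R.E-* (inj₂ (π-G gc)) (inj₂ gb))))
    lifted = cross-lift gx e1-x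
    z = proj₁ lifted
    gz = proj₁ (proj₂ lifted)
    ez = proj₁ (proj₂ (proj₂ lifted))
    πzt : π (z * t̂) R.≈ π â R.* d
    πzt = R.trans (π-* z t̂) (R.trans (R.*-congʳ (proj₂ (proj₂ (proj₂ lifted)))) (R.trans (R.*-comm _ _) tx))

  -- A stretch x₁  -  y₁  -  x  -  y₂  -  x₂ of the support graph in which `y₁`, `x` and `y₂` have
  -- no further neighbours. The ends `x₁` and `x₂` may coincide, as they do on a cycle of length
  -- four.
  record Corner {r m} (M : R.Mat r m) : Set where
    field
      x x₁ x₂ : Fin r
      y₁ y₂   : Fin m
      x₁≢x    : x₁ ≢ x
      x₂≢x    : x₂ ≢ x
      y₁≢y₂   : y₁ ≢ y₂
      row-x   : ∀ j → j ≢ y₁ → j ≢ y₂ → M x j R.≈ R.0#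
      col-y₁  : ∀ i → i ≢ x → i ≢ x₁ → M i y₁ R.≈ R.0#
      col-y₂  : ∀ i → i ≢ x → i ≢ x₂ → M i y₂ R.≈ R.0#
      G-a     : R.G (M x y₁)
      G-b     : R.G (M x y₂)
      G-c     : R.G (M x₁ y₁)

  module _ {r m} {M : R.Mat r m} (pmM : R.PM Every Every M) (corner : Corner M) where
    open Corner corner

    private
      y₂≢y₁ : y₂ ≢ y₁
      y₂≢y₁ = ≡.≢-sym y₁≢y₂

      entryM : ∀ i j → R.E (M i j)
      entryM i j = R.PM-entry pmM tt tt

      row-zero : ∀ {A : R.Mat r m} {i j} → A x j R.≈ R.0# → R.condense A x y₁ i j R.≈ A x y₁ R.* A i j
      row-zero z = R.trans (R.+-congˡ (R.trans (R.-‿cong (R.trans (R.*-congˡ z) (R.zeroʳ _))) R.-0#≈0#)) (R.+-identityʳ _)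

      column-zero : ∀ {A : R.Mat r m} {i j} → A i y₁ R.≈ R.0# → R.condense A x y₁ i j R.≈ A x y₁ R.* A i j
      column-zero z = R.trans (R.+-congˡ (R.trans (R.-‿cong (R.trans (R.*-congʳ z) (R.zeroˡ _))) R.-0#≈0#)) (R.+-identityʳ _)

      module Build (l : Lifts (R.condense M x y₁)) where
        C : Mat r m
        C = proj₁ (exists l)

        c-lift : IsLift (R.condense M x y₁) C
        c-lift = proj₂ (exists l)

        new : ∀ i j → ∃ λ z → E z × (π z R.≈ M i j)
        new i j = lift-entry (entryM i j)

        unit-new : ∀ {i j} → R.G (M i j) → G (proj₁ (new i j))
        unit-new {i} {j} g = E-unit (proj₁ (proj₂ (new i j))) (R.G-resp (R.sym (proj₂ (proj₂ (new i j)))) g)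

        â ĉ : Carrier
        â = proj₁ (new x y₁)
        ĉ = proj₁ (new x₁ y₁)

        â-G : G â
        â-G = unit-new G-a

        ĉ-G : G ĉ
        ĉ-G = unit-new G-c

        πâ : π â R.≈ M x y₁
        πâ = proj₂ (proj₂ (new x y₁))

        corner-lift = complete {b = M x y₂} {d = M x₁ y₂} â-G ĉ-G (entry c-lift x₁ y₂) G-b (entryM x₁ y₂)
          (R.trans (over c-lift x₁ y₂) (R.+-cong (R.*-congʳ (R.sym πâ)) (R.-‿cong (R.*-congʳ (R.sym (proj₂ (proj₂ (new x₁ y₁))))))))

        b̂ d̂ : Carrier
        b̂ = proj₁ corner-lift
        d̂ = proj₁ (proj₂ corner-lift)

        inner : Fin r → Fin m → Carrier
        inner i = update y₂ (update x₁ d̂ (λ i → inv â-G * C i y₂) i) (λ j → inv â-G * C i j)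

        -- Away from row `x`, column `y₁` and the entry (x₁, y₂), dividing the condensed lift by `â`
        -- gives lifts of the entries of `M`. Row `x` and column `y₁` receive arbitrary lifts,
        -- except that the entry (x, y₂) is solved for together with (x₁, y₂) so that condensation
        -- returns `C`.
        A : Mat r m
        A i j with i ≟ x
        ... | yes _ = update y₂ b̂ (λ j → proj₁ (new i j)) j
        ... | no  _ = update y₁ (proj₁ (new i y₁)) (inner i) j

        inner-corner : inner x₁ y₂ ≈ d̂
        inner-corner = trans (update-at y₂ _ _) (update-at x₁ d̂ _)

        inner-other : ∀ {i j} → i ≢ x₁ ⊎ j ≢ y₂ → inner i j ≈ inv â-G * C i j
        inner-other {i} {j} ne with j ≟ y₂
        inner-other (inj₁ ne) | yes ≡.refl = update-off d̂ _ ne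
        inner-other (inj₂ ne) | yes e      = contradiction e ne
        inner-other ne        | no _       = refl

        A-inner : ∀ {i j} → i ≢ x → j ≢ y₁ → A i j ≈ inner i j
        A-inner {i} {j} i≢x j≢y with i ≟ x
        ... | yes e = contradiction e i≢x
        ... | no _  = update-off _ (inner i) j≢y

        A-y₁ : ∀ i → A i y₁ ≈ proj₁ (new i y₁)
        A-y₁ i with i ≟ x
        ... | yes _ = update-off b̂ (λ j → proj₁ (new i j)) y₁≢y₂
        ... | no  _ = update-at y₁ _ (inner i)

        A-b : A x y₂ ≈ b̂
        A-b with x ≟ x
        ... | yes _ = update-at y₂ b̂ _
        ... | no ne = contradiction ≡.refl ne

        A-row : ∀ {j} → j ≢ y₂ → A x j ≈ proj₁ (new x j)
        A-row {j} j≢y₂ with x ≟ x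
        ... | yes _ = update-off b̂ (λ j → proj₁ (new x j)) j≢y₂
        ... | no ne = contradiction ≡.refl ne

        -- Off row x, column y₁ and the corner x₁ y₂, condensation only multiplies the entries of M by M x y₁.
        scaled : ∀ {i j} → i ≢ x → j ≢ y₁ → i ≢ x₁ ⊎ j ≢ y₂ → R.condense M x y₁ i j R.≈ M x y₁ R.* M i j
        scaled i≢x j≢y (inj₁ ne) = column-zero {M} (col-y₁ _ i≢x ne)
        scaled i≢x j≢y (inj₂ ne) = row-zero {M} (row-x _ j≢y ne)

        Good : Carrier → R.Carrier → Set
        Good a b = E a × (π a R.≈ b)

        good-resp : ∀ {a a′ b} → a′ ≈ a → Good a b → Good a′ b
        good-resp e (ea , eb) = E-resp (sym e) ea , R.trans (π-cong e) eb

        good-new : ∀ i j → Good (proj₁ (new i j)) (M i j)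
        good-new i j = proj₂ (new i j)

        good-inner : ∀ {i j} → i ≢ x → j ≢ y₁ → i ≢ x₁ ⊎ j ≢ y₂ → Good (inner i j) (M i j)
        good-inner {i} {j} i≢x j≢y ne = good-resp (inner-other ne)
          (E-* (inj₂ (inv-G â-G)) (entry c-lift i j) ,
           π-solve â-G (R.trans (π-cong (cancel-inv â-G _)) (R.trans (over c-lift i j) (R.trans (scaled i≢x j≢y ne) (R.*-congʳ (R.sym πâ))))))

        good : ∀ i j → Good (A i j) (M i j)
        good i j = helper (i ≟ x) (j ≟ y₁) (i ≟ x₁) (j ≟ y₂)
          where
          helper : Dec (i ≡ x) → Dec (j ≡ y₁) → Dec (i ≡ x₁) → Dec (j ≡ y₂) → Good (A i j) (M i j)
          helper _ (yes ≡.refl) _ _ = good-resp (A-y₁ i) (good-new i j)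
          helper (yes ≡.refl) (no _) _ (yes ≡.refl) = good-resp A-b
            (let _ , _ , eb , ed , πb , πd , eq = corner-lift in eb , πb)
          helper (yes ≡.refl) (no _) _ (no ne) = good-resp (A-row ne) (good-new i j)
          helper (no i≢x) (no j≢y) (yes ≡.refl) (yes ≡.refl) = good-resp (trans (A-inner i≢x j≢y) inner-corner)
            (let _ , _ , eb , ed , πb , πd , eq = corner-lift in ed , πd)
          helper (no i≢x) (no j≢y) (no ne) _ = good-resp (A-inner i≢x j≢y) (good-inner i≢x j≢y (inj₁ ne))
          helper (no i≢x) (no j≢y) (yes _) (no ne) = good-resp (A-inner i≢x j≢y) (good-inner i≢x j≢y (inj₂ ne))

        zero-A : ∀ {i j} → M i j R.≈ R.0# → A i j ≈ 0#
        zero-A {i} {j} z = E-kernel (proj₁ (good i j)) (R.trans (proj₂ (good i j)) z)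

        condensed : ∀ i j → condense A x y₁ i j ≈ C i j
        condensed i j = helper (i ≟ x) (j ≟ y₁) (i ≟ x₁) (j ≟ y₂)
          where
          helper : Dec (i ≡ x) → Dec (j ≡ y₁) → Dec (i ≡ x₁) → Dec (j ≡ y₂) → condense A x y₁ i j ≈ C i j
          helper _ (yes ≡.refl) _ _ = trans (trans (+-congˡ (-‿cong (*-comm _ _))) (-‿inverseʳ _))
            (sym (zeroAt c-lift (R.trans (R.+-congˡ (R.-‿cong (R.*-comm _ _))) (R.-‿inverseʳ _))))
          helper (yes ≡.refl) (no _) _ _ = trans (-‿inverseʳ _) (sym (zeroAt c-lift (R.-‿inverseʳ _)))
          helper (no i≢x) (no j≢y) (yes ≡.refl) (yes ≡.refl) = trans
            (+-cong (*-cong (A-y₁ x) (trans (A-inner i≢x j≢y) inner-corner)) (-‿cong (*-cong (A-y₁ x₁) A-b)))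
            (let _ , _ , eb , ed , πb , πd , eq = corner-lift in eq)
          helper (no i≢x) (no j≢y) (no ne) _ = trans (condense-zeroˡ A x y₁ {i} {j} (zero-A (col-y₁ i i≢x ne)))
            (trans (*-cong (A-y₁ x) (trans (A-inner i≢x j≢y) (inner-other (inj₁ ne)))) (cancel-inv â-G _))
          helper (no i≢x) (no j≢y) (yes _) (no ne) = trans (condense-zeroʳ A x y₁ {i} {j} (zero-A (row-x j j≢y ne)))
            (trans (*-cong (A-y₁ x) (trans (A-inner i≢x j≢y) (inner-other (inj₂ ne)))) (cancel-inv â-G _))

        pmA : PM Every Every A
        pmA = PM-join x y₁ (G-resp (sym (A-y₁ x)) â-G)
          (PM-singleColumn x₁ y₁ (λ i p ne → zero-A (col-y₁ i (proj₂ p) ne)) (proj₁ (good x₁ y₁)) rest)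
          (PM-singleRow x y₂ (λ j q ne → zero-A (row-x j (proj₂ q) ne)) (proj₁ (good x y₂)) rest)
          (PM-cong (λ i j _ _ → sym (condensed i j)) (pm c-lift))
          where
          -- Without row `x` and column `y₁`, column `y₂` can be nonzero in row `x₂` only; what
          -- remains without it is `C` divided by `â`.
          rest : PM (Every ∖ x) (Every ∖ y₁) A
          rest = PM-singleColumn x₂ y₂ (λ i p ne → zero-A (col-y₂ i (proj₂ p) ne)) (proj₁ (good x₂ y₂))
            (PM-scaleRows (λ _ → inv â-G) (λ _ _ → inv-G â-G)
              (λ i j p q → trans (A-inner (proj₂ p) (proj₂ (proj₁ q))) (inner-other (inj₂ (proj₂ q))))
              (PM-mono (λ _ → tt) (λ _ → tt) (pm c-lift)))

        result : ∃ (IsLift M)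
        result = A , record { pm = pmA ; over = λ i j → proj₂ (good i j) }

      IsLift-condense : ∀ {A} → IsLift M A → IsLift (R.condense M x y₁) (condense A x y₁)
      IsLift-condense {A} a = record
        { pm = PM-condense tt tt (unitAt a G-a) (pm a)
        ; over = λ i j → R.trans (π-condense A x y₁ i j)
            (R.+-cong (R.*-cong (over a x y₁) (over a i j)) (R.-‿cong (R.*-cong (over a i y₁) (over a x j)))) }

      module Uniq (l : Lifts (R.condense M x y₁)) {A B : Mat r m} (a : IsLift M A) (b : IsLift M B) where
        open Rescaled (unique l (IsLift-condense a) (IsLift-condense b))

        ratio : ∀ {i j} → R.G (M i j) → ∃ λ k → K k × (B i j ≈ k * A i j)
        ratio {i} {j} g = K-ratio (unitAt a g) (unitAt b g) (R.trans (over a i j) (R.sym (over b i j)))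

        α β γ ᾱ γ̄ σ σ̄ : Carrier
        α = proj₁ (ratio G-a)
        β = proj₁ (ratio G-b)
        γ = proj₁ (ratio G-c)
        ᾱ = inv (proj₁ (proj₁ (proj₂ (ratio G-a))))
        γ̄ = inv (proj₁ (proj₁ (proj₂ (ratio G-c))))
        σ = s x₁
        σ̄ = inv (proj₁ (s-K x₁))

        α-K : K α
        α-K = proj₁ (proj₂ (ratio G-a))
        β-K : K β
        β-K = proj₁ (proj₂ (ratio G-b))
        γ-K : K γ
        γ-K = proj₁ (proj₂ (ratio G-c))

        αᾱ : α * ᾱ ≈ 1#
        αᾱ = inverseʳ (proj₁ α-K)
        γγ̄ : γ * γ̄ ≈ 1#
        γγ̄ = inverseʳ (proj₁ γ-K)
        σσ̄ : σ * σ̄ ≈ 1#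
        σσ̄ = inverseʳ (proj₁ (s-K x₁))

        B-a : B x y₁ ≈ α * A x y₁
        B-a = proj₂ (proj₂ (ratio G-a))
        B-b : B x y₂ ≈ β * A x y₂
        B-b = proj₂ (proj₂ (ratio G-b))
        B-c : B x₁ y₁ ≈ γ * A x₁ y₁
        B-c = proj₂ (proj₂ (ratio G-c))

        a-G : G (A x y₁)
        a-G = unitAt a G-a

        -- The row scale of x and the column scales of y₁ and y₂ are forced by the entries at (x₁, y₁), (x, y₁) and (x, y₂).
        s′ : Fin r → Carrier
        s′ = update x (σ * γ̄) (λ i → ᾱ * s i)

        t′ : Fin m → Carrier
        t′ = update y₁ (γ * (α * σ̄)) (update y₂ (γ * (β * σ̄)) t)

        s′-K : ∀ i → K (s′ i)
        s′-K = update-all {P = K} x (K-* (s-K x₁) (K-inv γ-K)) (λ i → K-* (K-inv α-K) (s-K i))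

        t′-K : ∀ j → K (t′ j)
        t′-K = update-all {P = K} y₁ (K-* γ-K (K-* α-K (K-inv (s-K x₁))))
          (update-all {P = K} y₂ (K-* γ-K (K-* β-K (K-inv (s-K x₁)))) t-K)

        one : ∀ {u} z → u ≈ 1# → z ≈ u * z
        one z e = sym (trans (*-congʳ e) (*-identityˡ z))

        ones : ∀ {u v} z → u ≈ 1# → v ≈ 1# → z ≈ (u * v) * z
        ones z e f = one z (trans (*-cong e f) (*-identityˡ 1#))

        s′-off : ∀ {i} → i ≢ x → s′ i ≈ ᾱ * s i
        s′-off = update-off _ _

        t′-y₁ : t′ y₁ ≈ γ * (α * σ̄)
        t′-y₁ = update-at y₁ _ _

        t′-y₂ : t′ y₂ ≈ γ * (β * σ̄)
        t′-y₂ = trans (update-off _ _ y₂≢y₁) (update-at y₂ _ t)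

        t′-off : ∀ {j} → j ≢ y₁ → j ≢ y₂ → t′ j ≈ t j
        t′-off ne ne′ = trans (update-off _ _ ne) (update-off _ t ne′)

        both-zero : ∀ {i j} → M i j R.≈ R.0# → B i j ≈ s′ i * (t′ j * A i j)
        both-zero z = trans (zeroAt b z) (sym (trans (*-congˡ (trans (*-congˡ (zeroAt a z)) (zeroʳ _))) (zeroʳ _)))

        -- Where condensation is just multiplication by the pivot, the comparison of the condensed
        -- lifts carries over after division by `α`, the ratio of the two pivots.
        plain : ∀ {i j} → condense A x y₁ i j ≈ A x y₁ * A i j → condense B x y₁ i j ≈ B x y₁ * B i j →
          B i j ≈ (ᾱ * s i) * (t j * A i j)
        plain {i} {j} eA eB = G-cancel (G-* a-G (proj₁ α-K)) (begin
          (A x y₁ * α) * B i j                ≈⟨ trans (*-congʳ (trans (*-comm _ _) (sym B-a))) (sym eB) ⟩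
          condense B x y₁ i j                 ≈⟨ trans (eq i j) (*-congˡ (*-congˡ eA)) ⟩
          s i * (t j * (A x y₁ * A i j))      ≈⟨ one _ αᾱ ⟩
          (α * ᾱ) * (s i * (t j * (A x y₁ * A i j)))
            ≈⟨ solve 6 (λ a h s t x z → (a :* h) :* (s :* (t :* (x :* z))) := (x :* a) :* ((h :* s) :* (t :* z))) refl _ _ _ _ _ _ ⟩
          (A x y₁ * α) * ((ᾱ * s i) * (t j * A i j)) ∎)

        plainˡ : ∀ {i j} → M i y₁ R.≈ R.0# → B i j ≈ (ᾱ * s i) * (t j * A i j)
        plainˡ z = plain (condense-zeroˡ A x y₁ (zeroAt a z)) (condense-zeroˡ B x y₁ (zeroAt b z))

        plainʳ : ∀ {i j} → M x j R.≈ R.0# → B i j ≈ (ᾱ * s i) * (t j * A i j)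
        plainʳ z = plain (condense-zeroʳ A x y₁ (zeroAt a z)) (condense-zeroʳ B x y₁ (zeroAt b z))

        at-corner : condense B x y₁ x₁ y₂ ≈ σ * (t y₂ * condense A x y₁ x₁ y₂)
        at-corner = eq x₁ y₂

        -- When the corner entry vanishes, the scale of y₂ is the one inherited from the condensed matrix.
        corner-zero : M x₁ y₂ R.≈ R.0# → γ * β ≈ σ * t y₂
        corner-zero z = G-cancel (G-neg (G-* (unitAt a G-c) (unitAt a G-b))) (begin
          - (A x₁ y₁ * A x y₂) * (γ * β)
            ≈⟨ solve 4 (λ p q c b → (:- (p :* q)) :* (c :* b) := :- ((c :* p) :* (b :* q))) refl _ _ _ _ ⟩
          - ((γ * A x₁ y₁) * (β * A x y₂))  ≈⟨ -‿cong (*-cong (sym B-c) (sym B-b)) ⟩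
          - (B x₁ y₁ * B x y₂)              ≈⟨ sym (condense-zero B x y₁ (zeroAt b z)) ⟩
          condense B x y₁ x₁ y₂             ≈⟨ trans at-corner (*-congˡ (*-congˡ (condense-zero A x y₁ (zeroAt a z)))) ⟩
          σ * (t y₂ * - (A x₁ y₁ * A x y₂)) ≈⟨ solve 3 (λ s t p → s :* (t :* p) := p :* (s :* t)) refl _ _ _ ⟩
          - (A x₁ y₁ * A x y₂) * (σ * t y₂) ∎)

        module Nonzero (g : R.G (M x₁ y₂)) where
          δ = proj₁ (ratio g)
          B-d : B x₁ y₂ ≈ δ * A x₁ y₂
          B-d = proj₂ (proj₂ (ratio g))
          ad bc : Carrier
          ad = A x y₁ * A x₁ y₂
          bc = A x₁ y₁ * A x y₂
          ad-G : G ad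
          ad-G = G-* a-G (unitAt a g)
          bc-G : G bc
          bc-G = G-* (unitAt a G-c) (unitAt a G-b)

          condense-B : condense B x y₁ x₁ y₂ ≈ (α * δ) * ad - (γ * β) * bc
          condense-B = trans (+-cong (*-cong B-a B-d) (-‿cong (*-cong B-c B-b)))
            (solve 8 (λ a d c b p q u v → (a :* p) :* (d :* q) :- (c :* u) :* (b :* v) :=
              (a :* d) :* (p :* q) :- (c :* b) :* (u :* v)) refl _ _ _ _ _ _ _ _)

          main : σ * t y₂ * (ad - bc) ≈ (α * δ) * ad - (γ * β) * bc
          main = trans (*-assoc _ _ _) (trans (sym at-corner) condense-B)

          degenerate : ad - bc ≈ 0# → α * δ ≈ γ * β
          degenerate z = G-cancel ad-G (begin
            ad * (α * δ)  ≈⟨ solve 3 (λ p q e → p :* e := (e :* p :- q) :+ q) refl ad ((γ * β) * bc) (α * δ) ⟩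
            ((α * δ) * ad - (γ * β) * bc) + (γ * β) * bc
              ≈⟨ +-congʳ (trans (sym main) (trans (*-congˡ z) (zeroʳ _))) ⟩
            0# + (γ * β) * bc  ≈⟨ trans (+-identityˡ _) (*-congˡ (begin
              bc               ≈⟨ solve 2 (λ p q → q := p :- (p :- q)) refl ad bc ⟩
              ad - (ad - bc)   ≈⟨ trans (+-congˡ (trans (-‿cong z) -0#≈0#)) (+-identityʳ _) ⟩
              ad ∎)) ⟩
            (γ * β) * ad       ≈⟨ *-comm _ _ ⟩
            ad * (γ * β) ∎)

          module _ (gt : G (ad - bc)) where
            h : Carrier
            h = inv gt
            σt-G : G (σ * t y₂)
            σt-G = G-* (proj₁ (s-K x₁)) (proj₁ (t-K y₂))
            k k̄ : Carrier
            k = σ * t y₂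
            k̄ = inv σt-G
            z w : Carrier
            z = h * ad
            w = (h * k̄) * ((α * δ) * ad)
            t1-z : (ad - bc) * (1# - z) ≈ - bc
            t1-z = begin
              (ad - bc) * (1# - h * ad) ≈⟨ solve 4 (λ t o h a → t :* (o :- h :* a) := t :* o :- (t :* h) :* a) refl (ad - bc) 1# h ad ⟩
              (ad - bc) * 1# - ((ad - bc) * h) * ad ≈⟨ +-cong (*-identityʳ _) (-‿cong (sym (one ad (inverseʳ gt)))) ⟩
              (ad - bc) - ad ≈⟨ solve 2 (λ a b → (a :- b) :- a := :- b) refl ad bc ⟩
              - bc ∎
            t1-w : (k * (ad - bc)) * (1# - w) ≈ - ((γ * β) * bc)
            t1-w = begin
              (k * (ad - bc)) * (1# - (h * k̄) * ((α * δ) * ad))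
                ≈⟨ solve 6 (λ k t o h l a → (k :* t) :* (o :- (h :* l) :* a) := (k :* t) :* o :- ((t :* h) :* (k :* l)) :* a) refl k (ad - bc) 1# h k̄ ((α * δ) * ad) ⟩
              (k * (ad - bc)) * 1# - (((ad - bc) * h) * (k * k̄)) * ((α * δ) * ad)
                ≈⟨ +-cong (trans (*-identityʳ _) main) (-‿cong (sym (ones _ (inverseʳ gt) (inverseʳ σt-G)))) ⟩
              ((α * δ) * ad - (γ * β) * bc) - (α * δ) * ad
                ≈⟨ solve 2 (λ a b → (a :- b) :- a := :- b) refl _ _ ⟩
              - ((γ * β) * bc) ∎
            w-G : G w
            w-G = G-* (G-* (inv-G gt) (inv-G σt-G)) (G-* (G-* (proj₁ α-K) (proj₁ (proj₁ (proj₂ (ratio g))))) ad-G)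
            π1 : ∀ {q p} → K q → π (q * p) R.≈ π p
            π1 (_ , e) = R.trans (π-* _ _) (R.trans (R.*-congʳ e) (R.*-identityˡ _))
            z≈w : z ≈ w
            z≈w = cross-unique (G-* (inv-G gt) ad-G) (E-cancel gt (E-resp (sym t1-z) (E-neg (inj₂ bc-G))))
              w-G (E-cancel (G-* σt-G gt) (E-resp (sym t1-w) (E-neg (inj₂ (G-* (G-* (proj₁ γ-K) (proj₁ β-K)) bc-G)))))
              (R.sym (R.trans (π-cong (solve 4 (λ h k e a → (h :* k) :* (e :* a) := (k :* e) :* (h :* a)) refl h k̄ (α * δ) ad))
                (π1 (K-* (K-inv (K-* (s-K x₁) (t-K y₂))) (K-* α-K (proj₁ (proj₂ (ratio g))))))))
            αδ≈k : α * δ ≈ k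
            αδ≈k = G-cancel (G-* (inv-G gt) ad-G) (begin
              z * (α * δ)              ≈⟨ one _ (inverseʳ σt-G) ⟩
              (k * k̄) * (z * (α * δ))  ≈⟨ solve 5 (λ k l h a e → (k :* l) :* ((h :* a) :* e) := k :* ((h :* l) :* (e :* a))) refl k k̄ h ad (α * δ) ⟩
              k * w                    ≈⟨ *-congˡ (sym z≈w) ⟩
              k * z                    ≈⟨ *-comm _ _ ⟩
              z * k ∎)
            generic : α * δ ≈ γ * β
            generic = trans αδ≈k (sym (G-cancel bc-G (begin
              bc * (γ * β) ≈⟨ solve 3 (λ p q e → p :* e := q :- (q :- e :* p)) refl bc ((α * δ) * ad) (γ * β) ⟩
              (α * δ) * ad - ((α * δ) * ad - (γ * β) * bc) ≈⟨ +-cong (*-congʳ αδ≈k) (-‿cong (sym main)) ⟩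
              k * ad - k * (ad - bc) ≈⟨ solve 3 (λ k a b → k :* a :- k :* (a :- b) := b :* k) refl k ad bc ⟩
              bc * k ∎)))

          -- The four ratios of `B` to `A` on a 2×2 submatrix come from row and column scales
          -- exactly if these products agree. If the lifted minor is zero, both products of entries
          -- are equal in `A` and in `B`. Otherwise ad / (ad - bc) and its counterpart for `B` are
          -- cross ratios with the same image, hence equal.
          αδ≈γβ : α * δ ≈ γ * β
          αδ≈γβ with PM-entry (pm (IsLift-condense a)) {x₁} {y₂} tt tt
          ... | inj₁ z = degenerate z
          ... | inj₂ g = generic g

        eq-y₁ : ∀ i → B i y₁ ≈ s′ i * (t′ y₁ * A i y₁)
        eq-y₁ i with i ≟ x | i ≟ x₁
        ... | yes ≡.refl | _ = begin
          B x y₁            ≈⟨ B-a ⟩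
          α * A x y₁        ≈⟨ ones _ σσ̄ γγ̄ ⟩
          ((σ * σ̄) * (γ * γ̄)) * (α * A x y₁)
            ≈⟨ solve 6 (λ s s′ c c′ a z → ((s :* s′) :* (c :* c′)) :* (a :* z) := (s :* c′) :* ((c :* (a :* s′)) :* z)) refl _ _ _ _ _ _ ⟩
          (σ * γ̄) * ((γ * (α * σ̄)) * A x y₁)   ≈⟨ *-congˡ (*-congʳ (sym t′-y₁)) ⟩
          (σ * γ̄) * (t′ y₁ * A x y₁) ∎
        ... | no i≢x | yes ≡.refl = begin
          B x₁ y₁           ≈⟨ B-c ⟩
          γ * A x₁ y₁       ≈⟨ ones _ σσ̄ αᾱ ⟩
          ((σ * σ̄) * (α * ᾱ)) * (γ * A x₁ y₁)
            ≈⟨ solve 6 (λ s s′ a a′ c z → ((s :* s′) :* (a :* a′)) :* (c :* z) := (a′ :* s) :* ((c :* (a :* s′)) :* z)) refl _ _ _ _ _ _ ⟩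
          (ᾱ * σ) * ((γ * (α * σ̄)) * A x₁ y₁)   ≈⟨ *-congˡ (*-congʳ (sym t′-y₁)) ⟩
          (ᾱ * σ) * (t′ y₁ * A x₁ y₁) ∎
        ... | no i≢x | no i≢x₁ = trans (zeroAt b z) (sym (trans (*-congˡ (trans (*-congˡ (zeroAt a z)) (zeroʳ _))) (zeroʳ _)))
          where z = col-y₁ i i≢x i≢x₁

        t-y₂ : M x₁ y₂ R.≈ R.0# → t y₂ ≈ t′ y₂
        t-y₂ z = trans (trans (one _ σσ̄) (trans (solve 3 (λ s s′ t → (s :* s′) :* t := (s :* t) :* s′) refl _ _ _)
          (trans (*-congʳ (sym (corner-zero z))) (*-assoc _ _ _)))) (sym t′-y₂)

        eq-y₂ : ∀ i → i ≢ x → Dec (i ≡ x₁) → B i y₂ ≈ (ᾱ * s i) * (t′ y₂ * A i y₂)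
        eq-y₂ i i≢x (yes ≡.refl) with entryM x₁ y₂
        ... | inj₁ z = trans (zeroAt b z) (sym (trans (*-congˡ (trans (*-congˡ (zeroAt a z)) (zeroʳ _))) (zeroʳ _)))
        ... | inj₂ g = begin
          B x₁ y₂                      ≈⟨ Nonzero.B-d g ⟩
          δ * A x₁ y₂                  ≈⟨ ones _ αᾱ σσ̄ ⟩
          ((α * ᾱ) * (σ * σ̄)) * (δ * A x₁ y₂)
            ≈⟨ solve 6 (λ a a′ s s′ d z → ((a :* a′) :* (s :* s′)) :* (d :* z) := (a′ :* s) :* (((a :* d) :* s′) :* z)) refl _ _ _ _ _ _ ⟩
          (ᾱ * σ) * (((α * δ) * σ̄) * A x₁ y₂)
            ≈⟨ *-congˡ (*-congʳ (trans (*-congʳ (Nonzero.αδ≈γβ g)) (trans (*-assoc _ _ _) (sym t′-y₂)))) ⟩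
          (ᾱ * σ) * (t′ y₂ * A x₁ y₂) ∎
          where δ = Nonzero.δ g
        eq-y₂ i i≢x (no i≢x₁) with i ≟ x₂
        ... | no i≢x₂    = trans (zeroAt b z) (sym (trans (*-congˡ (trans (*-congˡ (zeroAt a z)) (zeroʳ _))) (zeroʳ _)))
          where z = col-y₂ i i≢x i≢x₂
        ... | yes ≡.refl = trans (plainˡ (col-y₁ i i≢x i≢x₁)) (*-congˡ (*-congʳ (t-y₂ (col-y₂ x₁ x₁≢x (≡.≢-sym i≢x₁)))))

        eq-b : B x y₂ ≈ (σ * γ̄) * (t′ y₂ * A x y₂)
        eq-b = begin
          B x y₂         ≈⟨ B-b ⟩
          β * A x y₂     ≈⟨ ones _ σσ̄ γγ̄ ⟩
          ((σ * σ̄) * (γ * γ̄)) * (β * A x y₂)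
            ≈⟨ solve 6 (λ s s′ c c′ b z → ((s :* s′) :* (c :* c′)) :* (b :* z) := (s :* c′) :* ((c :* (b :* s′)) :* z)) refl _ _ _ _ _ _ ⟩
          (σ * γ̄) * ((γ * (β * σ̄)) * A x y₂)   ≈⟨ *-congˡ (*-congʳ (sym t′-y₂)) ⟩
          (σ * γ̄) * (t′ y₂ * A x y₂) ∎

        eq′ : ∀ i j → B i j ≈ s′ i * (t′ j * A i j)
        eq′ i j = helper (i ≟ x) (j ≟ y₁) (j ≟ y₂)
          where
          helper : Dec (i ≡ x) → Dec (j ≡ y₁) → Dec (j ≡ y₂) → B i j ≈ s′ i * (t′ j * A i j)
          helper _            (yes ≡.refl) _            = eq-y₁ i
          helper (yes ≡.refl) (no _)       (yes ≡.refl) = trans eq-b (*-congʳ (sym (update-at x _ _)))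
          helper (yes ≡.refl) (no ne)      (no ne′)     = both-zero (row-x j ne ne′)
          helper (no i≢x)     (no _)       (yes ≡.refl) = trans (eq-y₂ i i≢x (i ≟ x₁)) (*-congʳ (sym (s′-off i≢x)))
          helper (no i≢x)     (no ne)      (no ne′)     = trans (plainʳ (row-x j ne ne′))
            (*-cong (sym (s′-off i≢x)) (*-congʳ (sym (t′-off ne ne′))))

    Lifts-corner : Lifts (R.condense M x y₁) → Lifts M
    Lifts-corner l = record
      { exists = Build.result l
      ; unique = λ a b → let module U = Uniq l a b in record
          { s = U.s′ ; t = U.t′ ; s-K = U.s′-K ; t-K = U.t′-K ; eq = U.eq′ } }

-- Connectivity of the bipartite support graph

without : ∀ {X : Set} → ((x y : X) → Dec (x ≡ y)) → X → List X → List X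
without _≟X_ x = filter (λ y → ¬? (y ≟X x))

module _ {X : Set} (_≟X_ : (x y : X) → Dec (x ≡ y)) where
  without-length : ∀ {x xs} → x ∈ xs → length (without _≟X_ x xs) < length xs
  without-length {x} {xs} x∈xs = ListP.filter-notAll (λ y → ¬? (y ≟X x)) xs (lose x∈xs (λ ne → ne ≡.refl))

  without⁺ : ∀ {x y xs} → y ∈ xs → y ≢ x → y ∈ without _≟X_ x xs
  without⁺ {x} = ∈-filter⁺ (λ y → ¬? (y ≟X x))

  without⁻ : ∀ {x y xs} → y ∈ without _≟X_ x xs → y ∈ xs × y ≢ x
  without⁻ {x} {xs = xs} = ∈-filter⁻ (λ y → ¬? (y ≟X x)) {xs = xs}

data View {n} (P Q : Fin n → Set) : Set where
  none : (∀ i → Q i) → View P Q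
  exactlyOne  : ∀ i → P i → (∀ j → j ≢ i → Q j) → View P Q
  exactlyTwo  : ∀ i j → i ≢ j → P i → P j → (∀ k → k ≢ i → k ≢ j → Q k) → View P Q
  many : (f : Fin 3 → Fin n) → Injective _≡_ _≡_ f → (∀ k → P (f k)) → View P Q

view : ∀ n {P Q : Fin n → Set} → (∀ i → P i ⊎ Q i) → View P Q
view zero    h = none λ ()
view (suc n) {P} {Q} h with h zero | view n (h ∘ suc)
... | _ | many f inj p = many (suc ∘ f) (inj ∘ FinP.suc-injective) p
... | inj₂ q | none qs = none λ { zero → q ; (suc i) → qs i }
... | inj₁ p | none qs = exactlyOne zero p λ { zero ne → contradiction ≡.refl ne ; (suc i) _ → qs i }
... | inj₂ q | exactlyOne i p qs = exactlyOne (suc i) p λ { zero _ → q ; (suc j) ne → qs j (ne ∘ ≡.cong suc) }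
... | inj₁ p | exactlyOne i p′ qs = exactlyTwo zero (suc i) (λ ()) p p′ λ
  { zero ne _ → contradiction ≡.refl ne ; (suc j) _ ne → qs j (ne ∘ ≡.cong suc) }
... | inj₂ q | exactlyTwo i j i≢j p p′ qs = exactlyTwo (suc i) (suc j) (i≢j ∘ FinP.suc-injective) p p′ λ
  { zero _ _ → q ; (suc k) ne ne′ → qs k (ne ∘ ≡.cong suc) (ne′ ∘ ≡.cong suc) }
... | inj₁ p | exactlyTwo i j i≢j p′ p″ qs = many f inj pf
  where
  f : Fin 3 → Fin (suc n)
  f zero             = zero
  f (suc zero)       = suc i
  f (suc (suc zero)) = suc j
  inj : Injective _≡_ _≡_ f
  inj {zero}           {zero}           _ = ≡.refl
  inj {zero}           {suc zero}       ()
  inj {zero}           {suc (suc zero)} ()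
  inj {suc zero}       {zero}           ()
  inj {suc (suc zero)} {zero}           ()
  inj {suc zero}       {suc zero}       _ = ≡.refl
  inj {suc (suc zero)} {suc (suc zero)} _ = ≡.refl
  inj {suc zero}       {suc (suc zero)} e = contradiction (FinP.suc-injective e) i≢j
  inj {suc (suc zero)} {suc zero}       e = contradiction (≡.sym (FinP.suc-injective e)) i≢j
  pf : ∀ k → P (f k)
  pf zero             = p
  pf (suc zero)       = p′
  pf (suc (suc zero)) = p″

module Graph {r m : ℕ} (N : Fin r → Fin m → Set) (N? : ∀ i j → Dec (N i j)) where

  V : Set
  V = Fin r ⊎ Fin m

  _≟V_ : (a b : V) → Dec (a ≡ b)
  _≟V_ = SumP.≡-dec _≟_ _≟_

  open DecMembership _≟V_ using (_∈?_)

  Adj : V → V → Set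
  Adj (inj₁ i) (inj₂ j) = N i j
  Adj (inj₂ j) (inj₁ i) = N i j
  Adj (inj₁ _) (inj₁ _) = ⊥
  Adj (inj₂ _) (inj₂ _) = ⊥

  adj? : ∀ a b → Dec (Adj a b)
  adj? (inj₁ i) (inj₂ j) = N? i j
  adj? (inj₂ j) (inj₁ i) = N? i j
  adj? (inj₁ _) (inj₁ _) = no λ ()
  adj? (inj₂ _) (inj₂ _) = no λ ()

  adj-sym : ∀ a b → Adj a b → Adj b a
  adj-sym (inj₁ i) (inj₂ j) n = n
  adj-sym (inj₂ j) (inj₁ i) n = n

  adj-irrefl : ∀ a → ¬ Adj a a
  adj-irrefl (inj₁ _) ()
  adj-irrefl (inj₂ _) ()

  data Path (S : V → Set) : V → V → Set where
    here  : ∀ {a} → S a → Path S a a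
    there : ∀ {a b c} → S a → Adj a b → Path S b c → Path S a c

  module _ {S : V → Set} where
    _▹_ : ∀ {a b c} → Path S a b → Path S b c → Path S a c
    here _      ▹ q = q
    there s n p ▹ q = there s n (p ▹ q)

    source : ∀ {a b} → Path S a b → S a
    source (here s)      = s
    source (there s _ _) = s

    edge : ∀ {a b} → S a → S b → Adj a b → Path S a b
    edge s t n = there s n (here t)

    reverse : ∀ {a b} → Path S a b → Path S b a
    reverse (here s)                = here s
    reverse (there {a} {b} s n p) = reverse p ▹ edge (source p) s (adj-sym a b n)

  path-mono : ∀ {S T : V → Set} → (∀ {a} → S a → T a) → ∀ {a b} → Path S a b → Path T a b
  path-mono f (here s)      = here (f s)
  path-mono f (there s n p) = there (f s) n (path-mono f p)

  -- The vertices outside U form a connected core to which three vertices of U are attached.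
  record Spider (U : List V) : Set where
    field
      leaf      : Fin 3 → V
      injective : Injective _≡_ _≡_ leaf
      inside    : ∀ k → leaf k ∈ U
      core      : Fin 3 → V
      outside   : ∀ k → core k ∉ U
      attached  : ∀ k → Adj (leaf k) (core k)
      connected : ∀ a b → a ∉ U → b ∉ U → Path (_∉ U) a b

  open Spider

  Closed : ∀ {U} → Spider U → Set
  Closed {U} s = ∀ k w → Adj (leaf s k) w → w ∉ U ⊎ ∃ λ l → w ≡ leaf s l

  replace : ∀ {X : Set} → Fin 3 → X → (Fin 3 → X) → Fin 3 → X
  replace k a f l with l ≟ k
  ... | yes _ = a
  ... | no  _ = f l

  -- The leaf joins the core and its neighbour `w` becomes a leaf in its place. The set `U` loses a
  -- vertex, which bounds the number of repetitions in `close`.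
  grow : ∀ {U} (s : Spider U) k w → Adj (leaf s k) w → w ∈ U → (∀ l → w ≢ leaf s l) → Spider (without _≟V_ (leaf s k) U)
  grow {U} s k w n w∈U fresh = record
    { leaf = leaf′ ; injective = inj ; inside = ins ; core = replace k (leaf s k) (core s)
    ; outside = out ; attached = att ; connected = conn }
    where
    U′ = without _≟V_ (leaf s k) U
    leaf′ = replace k w (leaf s)
    inj : Injective _≡_ _≡_ leaf′
    inj {a} {b} e with a ≟ k | b ≟ k
    ... | yes p | yes q = ≡.trans p (≡.sym q)
    ... | yes _ | no  _ = contradiction e (fresh b)
    ... | no  _ | yes _ = contradiction (≡.sym e) (fresh a)
    ... | no  _ | no  _ = injective s e
    ins : ∀ l → leaf′ l ∈ U′
    ins l with l ≟ k
    ... | yes _  = without⁺ _≟V_ w∈U (fresh k)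
    ... | no l≢k = without⁺ _≟V_ (inside s l) (l≢k ∘ injective s)
    weaken : ∀ {a} → a ∉ U → a ∉ U′
    weaken a∉U a∈U′ = a∉U (proj₁ (without⁻ _≟V_ a∈U′))
    out : ∀ l → replace k (leaf s k) (core s) l ∉ U′
    out l with l ≟ k
    ... | yes _ = λ e → proj₂ (without⁻ _≟V_ {xs = U} e) ≡.refl
    ... | no  _ = weaken (outside s l)
    att : ∀ l → Adj (leaf′ l) (replace k (leaf s k) (core s) l)
    att l with l ≟ k
    ... | yes _ = adj-sym (leaf s k) w n
    ... | no  _ = attached s l
    leaf∉ : leaf s k ∉ U′
    leaf∉ e = proj₂ (without⁻ _≟V_ {xs = U} e) ≡.refl
    to-core : ∀ a → a ∉ U′ → Path (_∉ U′) a (core s k)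
    to-core a a∉ with a ≟V leaf s k
    ... | yes ≡.refl = edge leaf∉ (weaken (outside s k)) (attached s k)
    ... | no a≢leaf  = path-mono weaken (connected s a (core s k) (λ a∈U → a∉ (without⁺ _≟V_ a∈U a≢leaf)) (outside s k))
    conn : ∀ a b → a ∉ U′ → b ∉ U′ → Path (_∉ U′) a b
    conn a b a∉ b∉ = to-core a a∉ ▹ reverse (to-core b b∉)

  close : ∀ n {U} → length U ≤ n → Spider U → ∃ λ U′ → ∃ λ (s : Spider U′) → Closed s
  close zero {[]} _ s with inside s zero
  ... | ()
  close (suc n) {U} len s with search 3 {P = λ k → ∃ λ w → w ∈ U × Adj (leaf s k) w × (∀ l → w ≢ leaf s l)}
                                        {Q = λ k → ∀ w → Adj (leaf s k) w → w ∉ U ⊎ ∃ λ l → w ≡ leaf s l} next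
    where
    next : ∀ k → (∃ λ w → w ∈ U × Adj (leaf s k) w × (∀ l → w ≢ leaf s l)) ⊎ (∀ w → Adj (leaf s k) w → w ∉ U ⊎ ∃ λ l → w ≡ leaf s l)
    next k with any? (λ w → adj? (leaf s k) w ×-dec FinP.all? (λ l → ¬? (w ≟V leaf s l))) U
    ... | yes found = inj₁ (find found)
    ... | no  none′ = inj₂ λ w n → decide w n (w ∈? U) (FinP.any? (λ l → w ≟V leaf s l))
      where
      decide : ∀ w → Adj (leaf s k) w → Dec (w ∈ U) → Dec (∃ λ l → w ≡ leaf s l) → w ∉ U ⊎ ∃ λ l → w ≡ leaf s l
      decide w n (no w∉U)  _       = inj₁ w∉U
      decide w n (yes w∈U) (yes l) = inj₂ l
      decide w n (yes w∈U) (no ne) = contradiction (lose w∈U (n , λ l e → ne (l , e))) none′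
  ... | inj₂ closed = U , s , closed
  ... | inj₁ (k , w , w∈U , adj , fresh) =
    close n (ℕP.≤-pred (ℕP.≤-trans (without-length _≟V_ (inside s k)) len)) (grow s k w adj w∈U fresh)

  vertices : List V
  vertices = List.map inj₁ (List.allFin r) List.++ List.map inj₂ (List.allFin m)

  ∈-vertices : ∀ v → v ∈ vertices
  ∈-vertices (inj₁ i) = ∈-++⁺ˡ (∈-map⁺ inj₁ (∈-allFin i))
  ∈-vertices (inj₂ j) = ∈-++⁺ʳ (List.map inj₁ (List.allFin r)) (∈-map⁺ inj₂ (∈-allFin j))

  start : ∀ z (f : Fin 3 → V) → Injective _≡_ _≡_ f → (∀ k → Adj z (f k)) → Spider (without _≟V_ z vertices)
  start z f inj n = record
    { leaf = f ; injective = inj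
    ; inside = λ k → without⁺ _≟V_ (∈-vertices (f k)) (λ e → adj-irrefl z (≡.subst (Adj z) e (n k)))
    ; core = λ _ → z ; outside = λ _ → z∉ ; attached = λ k → adj-sym z (f k) (n k)
    ; connected = λ a b a∉ b∉ → ≡.subst₂ (Path _) (≡.sym (only a a∉)) (≡.sym (only b b∉)) (here z∉) }
    where
    z∉ : z ∉ without _≟V_ z vertices
    z∉ e = proj₂ (without⁻ _≟V_ {xs = vertices} e) ≡.refl
    only : ∀ a → a ∉ without _≟V_ z vertices → a ≡ z
    only a a∉ with a ≟V z
    ... | yes e = e
    ... | no ne = contradiction (without⁺ _≟V_ (∈-vertices a) ne) a∉

  Avoid : V → V → V → Set
  Avoid u v w = w ≢ u × w ≢ v

  module _ {U} (s : Spider U) (closed : Closed s) {k l} (k≢l : k ≢ l)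
    (apart : ¬ Adj (leaf s k) (leaf s l)) where
    private
      u = leaf s k
      v = leaf s l

      off : ∀ {a} → a ∉ U → Avoid u v a
      off a∉U = (λ { ≡.refl → a∉U (inside s k) }) , (λ { ≡.refl → a∉U (inside s l) })

      reach : ∀ {e} → Adj u e → ∃ λ c → c ∉ U × Path (Avoid u v) e c
      reach {e} n with closed k e n
      ... | inj₁ e∉U = e , e∉U , here (off e∉U)
      ... | inj₂ (i , ≡.refl) = core s i , outside s i , edge
        ((λ eq → adj-irrefl u (≡.subst (Adj u) eq n)) , (λ eq → apart (≡.subst (Adj u) eq n)))
        (off (outside s i)) (attached s i)

    -- Since `u` and `v` are not adjacent, each neighbour of `u` is in the core or is the third
    -- leaf, which is attached to the core. The core is connected and contains neither `u` nor `v`.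
    neighbours : ∀ {e f} → Adj u e → Adj u f → Path (Avoid u v) e f
    neighbours n n′ =
      let c , c∉U , p = reach n
          d , d∉U , q = reach n′
      in p ▹ (path-mono off (connected s c d c∉U d∉U) ▹ reverse q)

  to-chain : ∀ {u v e f} → Path (Avoid (inj₂ u) (inj₂ v)) (inj₁ e) (inj₁ f) → Chain N u v e f
  to-chain (here _) = []
  to-chain (there {b = inj₂ w} _ n (there {b = inj₁ g} (w≢u , w≢v) n′ p)) =
    link w (w≢u ∘ ≡.cong inj₂) (w≢v ∘ ≡.cong inj₂) n n′ (to-chain p)

  to-cochain : ∀ {u v e f} → Path (Avoid (inj₁ u) (inj₁ v)) (inj₂ e) (inj₂ f) → Chain (flip N) u v e f
  to-cochain (here _) = []
  to-cochain (there {b = inj₁ w} _ n (there {b = inj₂ g} (w≢u , w≢v) n′ p)) =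
    link w (w≢u ∘ ≡.cong inj₁) (w≢v ∘ ≡.cong inj₁) n n′ (to-cochain p)

  record ColumnPair : Set where
    field
      u v   : Fin m
      u≢v   : u ≢ v
      i i′  : Fin r
      N-u   : N i u
      N-v   : N i′ v
      chain : ∀ {e f} → N e u → N f u → Chain N u v e f

  record RowPair : Set where
    field
      u v   : Fin r
      u≢v   : u ≢ v
      j j′  : Fin m
      N-u   : N u j
      N-v   : N v j′
      chain : ∀ {e f} → N u e → N u f → Chain (flip N) u v e f

  neighbour₂ : ∀ {u} w → Adj (inj₂ u) w → ∃ λ i → N i u
  neighbour₂ (inj₁ i) n = i , n

  neighbour₁ : ∀ {u} w → Adj (inj₁ u) w → ∃ λ j → N u j
  neighbour₁ (inj₂ j) n = j , n

  leaf-pair : ∀ {U} (s : Spider U) → Closed s → ∀ {k l} → k ≢ l →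
    (∀ {a b} → leaf s k ≡ inj₁ a → leaf s l ≡ inj₂ b → ⊥) → (∀ {a b} → leaf s k ≡ inj₂ a → leaf s l ≡ inj₁ b → ⊥) →
    RowPair ⊎ ColumnPair
  leaf-pair s closed {k} {l} k≢l h h′ with leaf s k in eqk | leaf s l in eql
  ... | inj₁ _ | inj₂ _ = contradiction ≡.refl (λ e → h e ≡.refl)
  ... | inj₂ _ | inj₁ _ = contradiction ≡.refl (λ e → h′ e ≡.refl)
  ... | inj₁ u | inj₁ v = inj₁ record
    { u = u ; v = v ; u≢v = λ e → k≢l (injective s (≡.trans eqk (≡.trans (≡.cong inj₁ e) (≡.sym eql))))
    ; j = proj₁ nu ; j′ = proj₁ nv ; N-u = proj₂ nu ; N-v = proj₂ nv
    ; chain = λ {e} {f} n n′ → to-cochain (≡.subst₂ (λ a b → Path (Avoid a b) _ _) eqk eql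
        (neighbours s closed k≢l (λ n″ → ≡.subst₂ Adj eqk eql n″) {inj₂ e} {inj₂ f} (≡.subst (λ a → Adj a _) (≡.sym eqk) n) (≡.subst (λ a → Adj a _) (≡.sym eqk) n′))) }
    where
    nu = neighbour₁ (core s k) (≡.subst (λ a → Adj a (core s k)) eqk (attached s k))
    nv = neighbour₁ (core s l) (≡.subst (λ a → Adj a (core s l)) eql (attached s l))
  ... | inj₂ u | inj₂ v = inj₂ record
    { u = u ; v = v ; u≢v = λ e → k≢l (injective s (≡.trans eqk (≡.trans (≡.cong inj₂ e) (≡.sym eql))))
    ; i = proj₁ nu ; i′ = proj₁ nv ; N-u = proj₂ nu ; N-v = proj₂ nv
    ; chain = λ {e} {f} n n′ → to-chain (≡.subst₂ (λ a b → Path (Avoid a b) _ _) eqk eql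
        (neighbours s closed k≢l (λ n″ → ≡.subst₂ Adj eqk eql n″) {inj₁ e} {inj₁ f} (≡.subst (λ a → Adj a _) (≡.sym eqk) n) (≡.subst (λ a → Adj a _) (≡.sym eqk) n′))) }
    where
    nu = neighbour₂ (core s k) (≡.subst (λ a → Adj a (core s k)) eqk (attached s k))
    nv = neighbour₂ (core s l) (≡.subst (λ a → Adj a (core s l)) eql (attached s l))

  -- Two of three leaves lie on the same side of the bipartition.
  pair : ∀ z (f : Fin 3 → V) → Injective _≡_ _≡_ f → (∀ k → Adj z (f k)) → RowPair ⊎ ColumnPair
  pair z f inj n with close _ ℕP.≤-refl (start z f inj n)
  ... | U , s , closed with leaf s zero in e₀ | leaf s (suc zero) in e₁ | leaf s (suc (suc zero)) in e₂
  ... | inj₁ _ | inj₁ _ | _ = leaf-pair s closed {zero} {suc zero} (λ ()) (λ _ b → clash e₁ b) (λ a _ → clash e₀ a)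
    where
    clash : ∀ {v : V} {a b} → v ≡ inj₁ a → v ≡ inj₂ b → ⊥
    clash ≡.refl ()
  ... | inj₂ _ | inj₂ _ | _ = leaf-pair s closed {zero} {suc zero} (λ ()) (λ a _ → clash a e₀) (λ _ b → clash b e₁)
    where
    clash : ∀ {v : V} {a b} → v ≡ inj₁ a → v ≡ inj₂ b → ⊥
    clash ≡.refl ()
  ... | inj₁ _ | inj₂ _ | inj₁ _ = leaf-pair s closed {zero} {suc (suc zero)} (λ ()) (λ _ b → clash e₂ b) (λ a _ → clash e₀ a)
    where
    clash : ∀ {v : V} {a b} → v ≡ inj₁ a → v ≡ inj₂ b → ⊥
    clash ≡.refl ()
  ... | inj₁ _ | inj₂ _ | inj₂ _ = leaf-pair s closed {suc zero} {suc (suc zero)} (λ ()) (λ a _ → clash a e₁) (λ _ b → clash b e₂)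
    where
    clash : ∀ {v : V} {a b} → v ≡ inj₁ a → v ≡ inj₂ b → ⊥
    clash ≡.refl ()
  ... | inj₂ _ | inj₁ _ | inj₁ _ = leaf-pair s closed {suc zero} {suc (suc zero)} (λ ()) (λ _ b → clash e₂ b) (λ a _ → clash e₁ a)
    where
    clash : ∀ {v : V} {a b} → v ≡ inj₁ a → v ≡ inj₂ b → ⊥
    clash ≡.refl ()
  ... | inj₂ _ | inj₁ _ | inj₂ _ = leaf-pair s closed {zero} {suc (suc zero)} (λ ()) (λ a _ → clash a e₀) (λ _ b → clash b e₂)
    where
    clash : ∀ {v : V} {a b} → v ≡ inj₁ a → v ≡ inj₂ b → ⊥
    clash ≡.refl ()

-- The lift theorem, by induction on the support

module LiftTheorem {Ω R : CommutativeRing 0ℓ 0ℓ} {𝒢 : UnitGroup Ω} {ℋ : UnitGroup R} (lifting : Lifting Ω R 𝒢 ℋ) where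
  open Existence lifting
  open Cycles lifting

  Support : ∀ {r m} → R.Mat r m → Fin r → Fin m → Set
  Support M i j = R.G (M i j)

  data Shape {r m} (M : R.Mat r m) : Set where
    zero   : (∀ i j → M i j R.≈ R.0#) → Shape M
    row    : ∀ x y → R.G (M x y) → (∀ j → j ≢ y → M x j R.≈ R.0#) → Shape M
    column : ∀ x y → R.G (M x y) → (∀ i → i ≢ x → M i y R.≈ R.0#) → Shape M
    pairs  : (N? : ∀ i j → Dec (Support M i j)) → Graph.RowPair (Support M) N? ⊎ Graph.ColumnPair (Support M) N? → Shape M
    corner : Corner M → Shape M

  module _ {r m} {M : R.Mat r m} (pmM : R.PM Every Every M) where
    private
      RowView : Fin r → Set
      RowView i = View (λ j → R.G (M i j)) (λ j → M i j R.≈ R.0#)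

      ColumnView : Fin m → Set
      ColumnView j = View (λ i → R.G (M i j)) (λ i → M i j R.≈ R.0#)

      entry : ∀ i j → R.G (M i j) ⊎ (M i j R.≈ R.0#)
      entry i j = swap (R.PM-entry pmM tt tt)

      rowView : ∀ i → RowView i
      rowView i = view m (entry i)

      columnView : ∀ j → ColumnView j
      columnView j = view r (λ i → entry i j)

      support? : ∀ i j → Dec (Support M i j)
      support? i j with entry i j
      ... | inj₁ g = yes g
      ... | inj₂ z = no λ g → R.G-≉0 g z

      -- Degree 0 or exactly 2: the classification has already turned degree 1 into the shapes `row`
      -- and `column`, and larger degrees into `pairs`.
      Degree≤₂ : ∀ {n} (P Q : Fin n → Set) → Set
      Degree≤₂ P Q = (∀ i → Q i) ⊎ ∃ λ i → ∃ λ j → i ≢ j × P i × P j × (∀ k → k ≢ i → k ≢ j → Q k)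

      manyRow : ∀ i (f : Fin 3 → Fin m) → Injective _≡_ _≡_ f → (∀ k → R.G (M i (f k))) → Shape M
      manyRow i f inj g = pairs support? (Graph.pair (Support M) support? (inj₁ i) (inj₂ ∘ f) (inj ∘ SumP.inj₂-injective) g)

      manyColumn : ∀ j (f : Fin 3 → Fin r) → Injective _≡_ _≡_ f → (∀ k → R.G (M (f k) j)) → Shape M
      manyColumn j f inj g = pairs support? (Graph.pair (Support M) support? (inj₂ j) (inj₁ ∘ f) (inj ∘ SumP.inj₁-injective) g)

      classifyRow : ∀ i → RowView i → Shape M ⊎ Degree≤₂ (λ j → R.G (M i j)) (λ j → M i j R.≈ R.0#)
      classifyRow i (none z)          = inj₂ (inj₁ z)
      classifyRow i (exactlyOne j g z)       = inj₁ (row i j g z)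
      classifyRow i (exactlyTwo j k ne g h z) = inj₂ (inj₂ (j , k , ne , g , h , z))
      classifyRow i (many f inj g)    = inj₁ (manyRow i f inj g)

      classifyColumn : ∀ j → ColumnView j → Shape M ⊎ Degree≤₂ (λ i → R.G (M i j)) (λ i → M i j R.≈ R.0#)
      classifyColumn j (none z)          = inj₂ (inj₁ z)
      classifyColumn j (exactlyOne i g z)       = inj₁ (column i j g z)
      classifyColumn j (exactlyTwo i k ne g h z) = inj₂ (inj₂ (i , k , ne , g , h , z))
      classifyColumn j (many f inj g)    = inj₁ (manyColumn j f inj g)

      other : ∀ {x y} → R.G (M x y) → Degree≤₂ (λ i → R.G (M i y)) (λ i → M i y R.≈ R.0#) →
        ∃ λ x′ → x′ ≢ x × R.G (M x′ y) × (∀ i → i ≢ x → i ≢ x′ → M i y R.≈ R.0#)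
      other {x} g (inj₁ z) = contradiction (z x) (R.G-≉0 g)
      other {x} g (inj₂ (i , k , ne , gi , gk , z)) with x ≟ i | x ≟ k
      ... | yes ≡.refl | _          = k , ≡.≢-sym ne , gk , z
      ... | no _       | yes ≡.refl = i , ne , gi , λ l a b → z l b a
      ... | no x≢i     | no x≢k     = contradiction (z x x≢i x≢k) (R.G-≉0 g)

      findCorner : (∀ i → Degree≤₂ (λ j → R.G (M i j)) (λ j → M i j R.≈ R.0#)) →
        (∀ j → Degree≤₂ (λ i → R.G (M i j)) (λ i → M i j R.≈ R.0#)) → Shape M
      findCorner rows columns with search r swap-rows
        where
        swap-rows : ∀ i → (∃ λ j → ∃ λ k → j ≢ k × R.G (M i j) × R.G (M i k) × (∀ l → l ≢ j → l ≢ k → M i l R.≈ R.0#)) ⊎ (∀ j → M i j R.≈ R.0#)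
        swap-rows i = swap (rows i)
      ... | inj₂ z = zero z
      ... | inj₁ (x , y₁ , y₂ , ne , g , h , z) =
        let x₁ , x₁≢x , g₁ , z₁ = other g (columns y₁)
            x₂ , x₂≢x , g₂ , z₂ = other h (columns y₂)
        in corner record
          { x = x ; x₁ = x₁ ; x₂ = x₂ ; y₁ = y₁ ; y₂ = y₂ ; x₁≢x = x₁≢x ; x₂≢x = x₂≢x ; y₁≢y₂ = ne
          ; row-x = z ; col-y₁ = z₁ ; col-y₂ = z₂ ; G-a = g ; G-b = h ; G-c = g₁ }

    shape : Shape M
    shape with search r (λ i → classifyRow i (rowView i))
    ... | inj₁ (_ , s) = s
    ... | inj₂ rows with search m (λ j → classifyColumn j (columnView j))
    ...   | inj₁ (_ , s)  = s
    ...   | inj₂ columns = findCorner rows columns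

  -- The total length of the two lists is the induction measure: deleting a column of the support
  -- shortens `Js`, and condensing at row `x` shortens `Is`.
  Covers : ∀ {r m} → List (Fin r) → List (Fin m) → R.Mat r m → Set
  Covers Is Js M = ∀ {i j} → R.G (M i j) → i ∈ Is × j ∈ Js

  delete-support : ∀ {r m} (M : R.Mat r m) u {i j} → R.G (R.delete M u i j) → j ≢ u × R.G (M i j)
  delete-support M u {i} {j} g with j ≟ u
  ... | yes _  = contradiction R.refl (R.G-≉0 g)
  ... | no j≢u = j≢u , g

  Covers-delete : ∀ {r m} {Is : List (Fin r)} {Js : List (Fin m)} {M : R.Mat r m} u →
    Covers Is Js M → Covers Is (without _≟_ u Js) (R.delete M u)
  Covers-delete {M = M} u c g =
    let j≢u , h = delete-support M u g
        i∈Is , j∈Js = c h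
    in i∈Is , without⁺ _≟_ j∈Js j≢u

  -- An entry (i, j) is filled in only if (i, y) and (x, j) are nonzero, so condensation brings no
  -- new row or column into the support.
  condense-support : ∀ {r m} {M : R.Mat r m} → R.PM Every Every M → ∀ x y {i j} → R.G (R.condense M x y i j) →
    i ≢ x × (R.G (M i j) ⊎ R.G (M i y) × R.G (M x j))
  condense-support {M = M} pmM x y {i} {j} g = i≢x , alternatives (e i j) (e i y) (e x j)
    where
    e : ∀ i j → R.E (M i j)
    e i j = R.PM-entry pmM tt tt
    i≢x : i ≢ x
    i≢x ≡.refl = R.G-≉0 g (R.-‿inverseʳ _)
    alternatives : R.E (M i j) → R.E (M i y) → R.E (M x j) → R.G (M i j) ⊎ R.G (M i y) × R.G (M x j)
    alternatives (inj₂ h) _ _ = inj₁ h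
    alternatives (inj₁ _) (inj₂ h) (inj₂ k) = inj₂ (h , k)
    alternatives (inj₁ z) (inj₁ z′) _ = contradiction (R.trans (R.+-cong (R.trans (R.*-congˡ z) (R.zeroʳ _)) (R.trans (R.-‿cong (R.trans (R.*-congʳ z′) (R.zeroˡ _))) R.-0#≈0#)) (R.+-identityˡ _)) (R.G-≉0 g)
    alternatives (inj₁ z) (inj₂ _) (inj₁ z′) = contradiction (R.trans (R.+-cong (R.trans (R.*-congˡ z) (R.zeroʳ _)) (R.trans (R.-‿cong (R.trans (R.*-congˡ z′) (R.zeroʳ _))) R.-0#≈0#)) (R.+-identityˡ _)) (R.G-≉0 g)

  drop-left : ∀ {a b a′ n} → a′ < a → a ℕ.+ b ≤ suc n → a′ ℕ.+ b ≤ n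
  drop-left {b = b} lt le = ℕP.≤-pred (ℕP.≤-trans (ℕP.+-monoˡ-≤ b lt) le)

  drop-right : ∀ a {b b′ n} → b′ < b → a ℕ.+ b ≤ suc n → a ℕ.+ b′ ≤ n
  drop-right a {b} {b′} lt le = ℕP.≤-pred (ℕP.≤-trans (ℕP.≤-reflexive (≡.sym (ℕP.+-suc a b′))) (ℕP.≤-trans (ℕP.+-monoʳ-≤ a lt) le))

  sizes-swap : ∀ {X Y : Set} (Is : List X) (Js : List Y) {n} → length Is ℕ.+ length Js ≤ n → length Js ℕ.+ length Is ≤ n
  sizes-swap Is Js le = ℕP.≤-trans (ℕP.≤-reflexive (ℕP.+-comm (length Js) (length Is))) le

  lifts : ∀ n {r m} (Is : List (Fin r)) (Js : List (Fin m)) (M : R.Mat r m) → R.PM Every Every M → Covers Is Js M →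
    length Is ℕ.+ length Js ≤ n → Lifts M
  lifts-shape : ∀ n {r m} (Is : List (Fin r)) (Js : List (Fin m)) (M : R.Mat r m) → R.PM Every Every M → Covers Is Js M →
    length Is ℕ.+ length Js ≤ suc n → Shape M → Lifts M

  lifts zero [] Js M pmM c le = Lifts-zero λ i j → zeros (R.PM-entry pmM {i} {j} tt tt)
    where
    zeros : ∀ {i j} → R.E (M i j) → M i j R.≈ R.0#
    zeros (inj₁ z) = z
    zeros (inj₂ g) with proj₁ (c g)
    ... | ()
  lifts (suc n) Is Js M pmM c le = lifts-shape n Is Js M pmM c le (shape pmM)

  private
    delete-lifts : ∀ n {r m} (Is : List (Fin r)) (Js : List (Fin m)) (M : R.Mat r m) → R.PM Every Every M → Covers Is Js M →
      length Is ℕ.+ length Js ≤ suc n → ∀ {u} → u ∈ Js → Lifts (R.delete M u)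
    pair-lifts : ∀ n {r m} (Is : List (Fin r)) (Js : List (Fin m)) (M : R.Mat r m) → R.PM Every Every M → Covers Is Js M →
      length Is ℕ.+ length Js ≤ suc n → ∀ {u v} → u ≢ v → ∃ (λ i → R.G (M i u)) → ∃ (λ i → R.G (M i v)) →
      (∀ {e f} → R.G (M e u) → R.G (M f u) → Chain (Support M) u v e f) → Lifts M

  delete-lifts n Is Js M pmM c le {u} u∈Js = lifts n Is (without _≟_ u Js) (R.delete M u)
    (R.PM-delete u (R.PM-mono (λ p → p) proj₁ pmM)) (Covers-delete u c)
    (drop-right (length Is) (without-length _≟_ u∈Js) le)

  pair-lifts n Is Js M pmM c le {u} {v} u≢v (i , g) (i′ , g′) chain = Pair.Lifts-pair pmM u≢v chain
    (delete-lifts n Is Js M pmM c le u∈Js) (delete-lifts n Is Js M pmM c le v∈Js)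
    (lifts n Is (without _≟_ u Js) (R.delete (R.delete M u) v)
      (R.PM-delete v (R.PM-mono (λ p → p) proj₁ (R.PM-delete u (R.PM-mono (λ p → p) proj₁ pmM))))
      (λ {i} {j} h → Covers-delete u c {i} {j} (proj₂ (delete-support (R.delete M u) v {i} {j} h)))
      (drop-right (length Is) (without-length _≟_ u∈Js) le))
    where
    u∈Js = proj₂ (c g)
    v∈Js = proj₂ (c g′)

  lifts-shape n Is Js M pmM c le (zero z) = Lifts-zero z
  lifts-shape n Is Js M pmM c le (column x y g z) = SingleColumn.Lifts-singleColumn pmM x y z g
    (delete-lifts n Is Js M pmM c le (proj₂ (c g)))
  lifts-shape n Is Js M pmM c le (row x y g z) = Lifts-transpose
    (SingleColumn.Lifts-singleColumn (R.PM-transpose pmM) y x z g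
      (delete-lifts n Js Is (M R.ᵀ) (R.PM-transpose pmM) (λ h → proj₂ (c h) , proj₁ (c h)) (sizes-swap Is Js le) (proj₁ (c g))))
  lifts-shape n Is Js M pmM c le (pairs N? (inj₂ p)) =
    let open Graph.ColumnPair p in pair-lifts n Is Js M pmM c le u≢v (i , N-u) (i′ , N-v) chain
  lifts-shape n Is Js M pmM c le (pairs N? (inj₁ p)) =
    let open Graph.RowPair p in Lifts-transpose
      (pair-lifts n Js Is (M R.ᵀ) (R.PM-transpose pmM) (λ h → proj₂ (c h) , proj₁ (c h)) (sizes-swap Is Js le)
        u≢v (j , N-u) (j′ , N-v) chain)
  lifts-shape n Is Js M pmM c le (corner k) = Lifts-corner pmM k
    (lifts n (without _≟_ x Is) Js (R.condense M x y₁) (R.PM-condense tt tt G-a pmM) cover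
      (drop-left (without-length _≟_ (proj₁ (c G-a))) le))
    where
    open Corner k
    cover : Covers (without _≟_ x Is) Js (R.condense M x y₁)
    cover g with condense-support pmM x y₁ g
    ... | i≢x , inj₁ h        = without⁺ _≟_ (proj₁ (c h)) i≢x , proj₂ (c h)
    ... | i≢x , inj₂ (h , h′) = without⁺ _≟_ (proj₁ (c h)) i≢x , proj₂ (c h′)

  lift-theorem : ∀ {r m} (M : R.Mat r m) → R.PM Every Every M → Lifts M
  lift-theorem {r} {m} M pmM = lifts _ (List.allFin r) (List.allFin m) M pmM
    (λ {i} {j} _ → ∈-allFin i , ∈-allFin j) ℕP.≤-refl

-- Powers, generated groups of units and homomorphisms

module Powers (S : CommutativeRing 0ℓ 0ℓ) where
  open CommutativeRing S hiding (zero)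
  open IntegerSolver S
  open import Algebra.Properties.Ring ring using (-‿distribˡ-*; -‿involutive)
  open import Relation.Binary.Reasoning.Setoid setoid

  powN-cong : ∀ k {g h} → g ≈ h → powN rawRing g k ≈ powN rawRing h k
  powN-cong zero    e = refl
  powN-cong (suc k) e = *-cong e (powN-cong k e)

  powN-+ : ∀ g k l → powN rawRing g (k ℕ.+ l) ≈ powN rawRing g k * powN rawRing g l
  powN-+ g zero    l = sym (*-identityˡ _)
  powN-+ g (suc k) l = trans (*-congˡ (powN-+ g k l)) (sym (*-assoc _ _ _))

  powN-* : ∀ g h k → powN rawRing (g * h) k ≈ powN rawRing g k * powN rawRing h k
  powN-* g h zero    = sym (*-identityˡ _)
  powN-* g h (suc k) = trans (*-congˡ (powN-* g h k))
    (solve 4 (λ g h p q → (g :* h) :* (p :* q) := (g :* p) :* (h :* q)) refl _ _ _ _)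

  powN-1 : ∀ k → powN rawRing 1# k ≈ 1#
  powN-1 zero    = refl
  powN-1 (suc k) = trans (*-identityˡ _) (powN-1 k)

  neg-one-square : - 1# * - 1# ≈ 1#
  neg-one-square = trans (sym (-‿distribˡ-* 1# (- 1#))) (trans (-‿cong (*-identityˡ _)) (-‿involutive 1#))

  powN-neg-square : ∀ s → powN rawRing (- 1#) s * powN rawRing (- 1#) s ≈ 1#
  powN-neg-square s = trans (sym (powN-* _ _ s)) (trans (powN-cong s neg-one-square) (powN-1 s))

  powZ-⊖ : ∀ {g h} → g * h ≈ 1# → ∀ m n → powZ rawRing g h (m ℤ.⊖ n) ≈ powN rawRing g m * powN rawRing h n
  powZ-⊖ e zero    zero    = sym (*-identityˡ _)
  powZ-⊖ e (suc m) zero    = sym (*-identityʳ _)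
  powZ-⊖ e zero    (suc n) = sym (*-identityˡ _)
  powZ-⊖ {g} {h} e (suc m) (suc n) = begin
    powZ rawRing g h (suc m ℤ.⊖ suc n)  ≡⟨ ≡.cong (powZ rawRing g h) (ℤP.[1+m]⊖[1+n]≡m⊖n m n) ⟩
    powZ rawRing g h (m ℤ.⊖ n)          ≈⟨ powZ-⊖ e m n ⟩
    p * q                                ≈⟨ sym (trans (*-congʳ e) (*-identityˡ _)) ⟩
    (g * h) * (p * q)                    ≈⟨ solve 4 (λ g h p q → (g :* h) :* (p :* q) := (g :* p) :* (h :* q)) refl _ _ _ _ ⟩
    (g * p) * (h * q) ∎
    where
    p = powN rawRing g m
    q = powN rawRing h n

  powZ-+ : ∀ {g h} → g * h ≈ 1# → ∀ i j → powZ rawRing g h (i ℤ.+ j) ≈ powZ rawRing g h i * powZ rawRing g h j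
  powZ-+ {g} {h} e (+ m) (+ n)           = powN-+ g m n
  powZ-+ {g} {h} e (+ m) -[1+ n ]        = powZ-⊖ e m (suc n)
  powZ-+ {g} {h} e -[1+ m ] (+ n)        = trans (powZ-⊖ e n (suc m)) (*-comm _ _)
  powZ-+ {g} {h} e -[1+ m ] -[1+ n ]     = trans
    (*-congˡ (*-congˡ (powN-+ h m n)))
    (solve 3 (λ h p q → h :* (h :* (p :* q)) := (h :* p) :* (h :* q)) refl _ _ _)

  prodFin-cong : ∀ m {f g : Fin m → Carrier} → (∀ j → f j ≈ g j) → prodFin rawRing m f ≈ prodFin rawRing m g
  prodFin-cong zero    e = refl
  prodFin-cong (suc m) e = *-cong (e zero) (prodFin-cong m (e ∘ suc))

  prodFin-* : ∀ m (f g : Fin m → Carrier) → prodFin rawRing m (λ j → f j * g j) ≈ prodFin rawRing m f * prodFin rawRing m g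
  prodFin-* zero    f g = sym (*-identityˡ _)
  prodFin-* (suc m) f g = trans (*-congˡ (prodFin-* m _ _))
    (solve 4 (λ g h p q → (g :* h) :* (p :* q) := (g :* p) :* (h :* q)) refl _ _ _ _)

  prodFin-1 : ∀ m {f : Fin m → Carrier} → (∀ j → f j ≈ 1#) → prodFin rawRing m f ≈ 1#
  prodFin-1 zero    e = refl
  prodFin-1 (suc m) e = trans (*-cong (e zero) (prodFin-1 m (e ∘ suc))) (*-identityˡ _)

monomial : ∀ (S : RawRing 0ℓ 0ℓ) m (gen ginv : Fin m → RawRing.Carrier S) → ℕ → (Fin m → ℤ) → RawRing.Carrier S
monomial S m gen ginv s e = powN S (- 1#) s * prodFin S m (λ j → powZ S (gen j) (ginv j) (e j))
  where open RawRing S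

module Generated (S : CommutativeRing 0ℓ 0ℓ) (m : ℕ) (gen ginv : Fin m → CommutativeRing.Carrier S)
  (inverse : ∀ j → CommutativeRing._≈_ S (CommutativeRing._*_ S (gen j) (ginv j)) (CommutativeRing.1# S))
  (nontrivial : ¬ CommutativeRing._≈_ S (CommutativeRing.1# S) (CommutativeRing.0# S)) where
  open CommutativeRing S hiding (zero)
  open IntegerSolver S
  open Powers S
  open import Algebra.Properties.Ring ring using (-‿distribˡ-*)

  mono : ℕ → (Fin m → ℤ) → Carrier
  mono = monomial rawRing m gen ginv

  mono-* : ∀ s e t f → mono s e * mono t f ≈ mono (s ℕ.+ t) (λ j → e j ℤ.+ f j)
  mono-* s e t f = sym (trans
    (*-cong (powN-+ _ s t) (trans (prodFin-cong m (λ j → powZ-+ (inverse j) (e j) (f j))) (prodFin-* m _ _)))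
    (solve 4 (λ g h p q → (g :* h) :* (p :* q) := (g :* p) :* (h :* q)) refl _ _ _ _))

  mono-exponents : ∀ s {e f} → (∀ j → e j ≡ f j) → mono s e ≈ mono s f
  mono-exponents s e = *-congˡ (prodFin-cong m (λ j → reflexive (≡.cong (powZ rawRing (gen j) (ginv j)) (e j))))

  mono-1 : mono 0 (λ _ → + 0) ≈ 1#
  mono-1 = trans (*-identityˡ _) (prodFin-1 m (λ _ → refl))

  mono-sign² : ∀ s e → mono (s ℕ.+ s) e ≈ mono 0 e
  mono-sign² s e = *-congʳ (trans (powN-+ _ s s) (powN-neg-square s))

  mono-inverse : ∀ s e → mono s e * mono s (λ j → ℤ.- e j) ≈ 1#
  mono-inverse s e = trans (mono-* s e s (λ j → ℤ.- e j)) (trans (mono-sign² s (λ j → e j ℤ.+ (ℤ.- e j)))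
    (trans (mono-exponents 0 {λ j → e j ℤ.+ (ℤ.- e j)} {λ _ → + 0} (λ j → ℤP.+-inverseʳ (e j))) mono-1))

  group : UnitGroup S
  group = record
    { G      = InGenerated rawRing m gen ginv
    ; G-resp = λ { eq (s , e , p) → s , e , trans (sym eq) p }
    ; G-1    = 0 , (λ _ → + 0) , sym mono-1
    ; G-neg  = λ { (s , e , p) → suc s , e , trans (-‿cong p) (trans (-‿cong (sym (*-identityˡ _)))
                 (trans (-‿distribˡ-* 1# _) (sym (*-assoc _ _ _)))) }
    ; G-*    = λ { (s , e , p) (t , f , q) → s ℕ.+ t , (λ j → e j ℤ.+ f j) , trans (*-cong p q) (mono-* s e t f) }
    ; G-inv  = λ { (s , e , p) → mono s (λ j → ℤ.- e j) , (s , (λ j → ℤ.- e j) , refl) ,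
                 trans (*-congʳ p) (mono-inverse s e) }
    ; G-≉0   = λ { (s , e , p) z → nontrivial (trans (sym (trans (*-congʳ p) (mono-inverse s e)))
                 (trans (*-congʳ z) (zeroˡ _))) }
    }

-- Raw rings are necessary because fractions with denominator zero do not satisfy the laws of a
-- ring. The relation is later the graph of a homomorphism, the predicate `Integral`, or having a
-- given value at a point.
module DetRelation (S T : RawRing 0ℓ 0ℓ) (_~_ : RawRing.Carrier S → RawRing.Carrier T → Set)
  (~-+ : ∀ {x y x′ y′} → x ~ x′ → y ~ y′ → RawRing._+_ S x y ~ RawRing._+_ T x′ y′)
  (~-* : ∀ {x y x′ y′} → x ~ x′ → y ~ y′ → RawRing._*_ S x y ~ RawRing._*_ T x′ y′)
  (~-neg : ∀ {x x′} → x ~ x′ → RawRing.-_ S x ~ RawRing.-_ T x′)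
  (~-0 : RawRing.0# S ~ RawRing.0# T) (~-1 : RawRing.1# S ~ RawRing.1# T) where

  private
    module S = RawRing S
    module T = RawRing T

  sum~ : ∀ n {f : Fin n → S.Carrier} {g : Fin n → T.Carrier} → (∀ i → f i ~ g i) → Det.sumFin S n f ~ Det.sumFin T n g
  sum~ zero    e = ~-0
  sum~ (suc n) e = ~-+ (e zero) (sum~ n (e ∘ suc))

  signed~ : ∀ k {x y} → x ~ y → Det.signed S k x ~ Det.signed T k y
  signed~ zero    e = e
  signed~ (suc k) e = ~-neg (signed~ k e)

  det~ : ∀ n {A : Fin n → Fin n → S.Carrier} {B : Fin n → Fin n → T.Carrier} → (∀ i j → A i j ~ B i j) →
    Det.det S n A ~ Det.det T n B
  det~ zero    e = ~-1
  det~ (suc n) e = sum~ (suc n) λ j → signed~ (toℕ j) (~-* (e zero j) (det~ n (λ r c → e (suc r) (punchIn j c))))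

  powN~ : ∀ {g h} k → g ~ h → powN S g k ~ powN T h k
  powN~ zero    e = ~-1
  powN~ (suc k) e = ~-* e (powN~ k e)

  powZ~ : ∀ {g g′ h h′} i → g ~ h → g′ ~ h′ → powZ S g g′ i ~ powZ T h h′ i
  powZ~ (+ k)    e f = powN~ k e
  powZ~ -[1+ k ] e f = powN~ (suc k) f

  prodFin~ : ∀ m {f : Fin m → S.Carrier} {g : Fin m → T.Carrier} → (∀ j → f j ~ g j) → prodFin S m f ~ prodFin T m g
  prodFin~ zero    e = ~-1
  prodFin~ (suc m) e = ~-* (e zero) (prodFin~ m (e ∘ suc))

  monomial~ : ∀ m {gen ginv : Fin m → S.Carrier} {gen′ ginv′ : Fin m → T.Carrier} →
    (∀ j → gen j ~ gen′ j) → (∀ j → ginv j ~ ginv′ j) → ∀ s e → monomial S m gen ginv s e ~ monomial T m gen′ ginv′ s e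
  monomial~ m p q s e = ~-* (powN~ s (~-neg ~-1)) (prodFin~ m (λ j → powZ~ (e j) (p j) (q j)))

record Hom (S T : CommutativeRing 0ℓ 0ℓ) : Set where
  private
    module S = CommutativeRing S
    module T = CommutativeRing T
  field
    φ      : S.Carrier → T.Carrier
    φ-cong : ∀ {x y} → x S.≈ y → φ x T.≈ φ y
    φ-+    : ∀ x y → φ (x S.+ y) T.≈ φ x T.+ φ y
    φ-*    : ∀ x y → φ (x S.* y) T.≈ φ x T.* φ y
    φ-neg  : ∀ x → φ (S.- x) T.≈ T.- φ x
    φ-0    : φ S.0# T.≈ T.0#
    φ-1    : φ S.1# T.≈ T.1#

  open DetRelation S.rawRing T.rawRing (λ x y → φ x T.≈ y)
    (λ p q → T.trans (φ-+ _ _) (T.+-cong p q)) (λ p q → T.trans (φ-* _ _) (T.*-cong p q))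
    (λ p → T.trans (φ-neg _) (T.-‿cong p)) φ-0 φ-1 public
    using () renaming (det~ to φ-det; monomial~ to φ-monomial)

-- Integer polynomials and elements with polynomial numerators

IntPoly : Set
IntPoly = List ℤ

addℤ : IntPoly → IntPoly → IntPoly
addℤ []      q       = q
addℤ (a ∷ p) []      = a ∷ p
addℤ (a ∷ p) (b ∷ q) = a ℤ.+ b ∷ addℤ p q

scaleℤ : ℤ → IntPoly → IntPoly
scaleℤ c = List.map (c ℤ.*_)

mulℤ : IntPoly → IntPoly → IntPoly
mulℤ []      q = []
mulℤ (a ∷ p) q = addℤ (scaleℤ a q) (+ 0 ∷ mulℤ p q)

powℤ : IntPoly → ℕ → IntPoly
powℤ p zero    = + 1 ∷ []
powℤ p (suc k) = mulℤ p (powℤ p k)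

evalℤ : IntPoly → ℤ → ℤ
evalℤ []      n = + 0
evalℤ (a ∷ p) n = a ℤ.+ n ℤ.* evalℤ p n

small-multiple : ∀ (a : ℤ) n e → ℤ.∣ a ∣ ℕ.< n → a ℤ.+ + n ℤ.* e ≡ + 0 → a ≡ + 0
small-multiple a n e lt eq = helper ℤ.∣ e ∣ ≡.refl
  where
  size : ℤ.∣ a ∣ ≡ n ℕ.* ℤ.∣ e ∣
  size = ≡.trans (cong ℤ.∣_∣ (≡.trans (≡.trans (≡.sym (ℤP.+-identityʳ a)) (cong (λ t → a ℤ.+ t) (≡.sym (ℤP.+-inverseʳ (+ n ℤ.* e)))))
    (≡.trans (≡.sym (ℤP.+-assoc a (+ n ℤ.* e) (ℤ.- (+ n ℤ.* e)))) (≡.trans (cong (λ t → t ℤ.- (+ n ℤ.* e)) eq) (ℤP.+-identityˡ (ℤ.- (+ n ℤ.* e)))))))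
    (≡.trans (ℤP.∣-i∣≡∣i∣ (+ n ℤ.* e)) (ℤP.abs-* (+ n) e))
  helper : ∀ m → ℤ.∣ e ∣ ≡ m → a ≡ + 0
  helper zero    eqe = ℤP.∣i∣≡0⇒i≡0 (≡.trans size (≡.trans (cong (n ℕ.*_) eqe) (ℕP.*-zeroʳ n)))
  helper (suc k) eqe = contradiction lt (ℕP.≤⇒≯ (ℕP.≤-trans (ℕP.m≤m*n n (suc k))
    (ℕP.≤-reflexive (≡.sym (≡.trans size (cong (n ℕ.*_) eqe))))))

-- If the constant coefficient `a` is nonzero, a root n divides it, so n is at most the absolute
-- value of `a`. If it is zero, the variable can be split off.
eventuallyℤ : ∀ p → All (_≡ + 0) p ⊎ ∃ λ N → ∀ n → N ℕ.≤ n → evalℤ p (+ n) ≢ + 0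
eventuallyℤ []      = inj₁ []
eventuallyℤ (a ∷ p) with a ℤ.≟ + 0 | eventuallyℤ p
... | no a≢0    | _          = inj₂ (suc ℤ.∣ a ∣ , λ n le e → a≢0 (small-multiple a n (evalℤ p (+ n)) le e))
... | yes a≡0   | inj₁ z     = inj₁ (a≡0 ∷ z)
-- The bound `suc N` excludes the point 0, where the factor n cannot be cancelled.
... | yes ≡.refl | inj₂ (N , h) = inj₂ (suc N , λ { (suc n) (s≤s le) e → h (suc n) (ℕP.m≤n⇒m≤1+n le)
    (cancel n (evalℤ p (+ suc n)) (≡.trans (≡.sym (ℤP.+-identityˡ _)) e)) })
  where
  cancel : ∀ n e → + suc n ℤ.* e ≡ + 0 → e ≡ + 0
  cancel n e eq with ℤP.i*j≡0⇒i≡0∨j≡0 (+ suc n) eq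
  ... | inj₂ z = z

module Evaluation (S : CommutativeRing 0ℓ 0ℓ) (a : CommutativeRing.Carrier S) where
  open CommutativeRing S hiding (zero)
  open IntegerSolver S
  open import Relation.Binary.Reasoning.Setoid setoid

  eval : IntPoly → Carrier
  eval []      = 0#
  eval (c ∷ p) = ⟦ c ⟧ℤ + a * eval p

  eval-zero : ∀ {p} → All (_≡ + 0) p → eval p ≈ 0#
  eval-zero []           = refl
  eval-zero (≡.refl ∷ z) = trans (+-identityˡ _) (trans (*-congˡ (eval-zero z)) (zeroʳ a))

  eval-add : ∀ p q → eval (addℤ p q) ≈ eval p + eval q
  eval-add []      q       = sym (+-identityˡ _)
  eval-add (c ∷ p) []      = sym (+-identityʳ _)
  eval-add (c ∷ p) (d ∷ q) = trans (+-cong (+-homoℤ c d) (*-congˡ (eval-add p q)))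
    (solve 5 (λ c d a p q → (c :+ d) :+ a :* (p :+ q) := (c :+ a :* p) :+ (d :+ a :* q)) refl _ _ _ _ _)

  eval-scale : ∀ c p → eval (scaleℤ c p) ≈ ⟦ c ⟧ℤ * eval p
  eval-scale c []      = sym (zeroʳ _)
  eval-scale c (d ∷ p) = trans (+-cong (*-homoℤ c d) (*-congˡ (eval-scale c p)))
    (solve 4 (λ c d a p → c :* d :+ a :* (c :* p) := c :* (d :+ a :* p)) refl _ _ _ _)

  eval-mul : ∀ p q → eval (mulℤ p q) ≈ eval p * eval q
  eval-mul []      q = sym (zeroˡ _)
  eval-mul (c ∷ p) q = begin
    eval (addℤ (scaleℤ c q) (+ 0 ∷ mulℤ p q))  ≈⟨ eval-add (scaleℤ c q) (+ 0 ∷ mulℤ p q) ⟩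
    eval (scaleℤ c q) + (0# + a * eval (mulℤ p q))
      ≈⟨ +-cong (eval-scale c q) (trans (+-identityˡ _) (*-congˡ (eval-mul p q))) ⟩
    ⟦ c ⟧ℤ * eval q + a * (eval p * eval q)
      ≈⟨ solve 4 (λ c q a p → c :* q :+ a :* (p :* q) := (c :+ a :* p) :* q) refl _ _ _ _ ⟩
    (⟦ c ⟧ℤ + a * eval p) * eval q ∎

  eval-one : eval (+ 1 ∷ []) ≈ 1#
  eval-one = trans (+-congˡ (zeroʳ a)) (+-identityʳ 1#)

  eval-pow : ∀ p k → eval (powℤ p k) ≈ powN rawRing (eval p) k
  eval-pow p zero    = eval-one
  eval-pow p (suc k) = trans (eval-mul p (powℤ p k)) (*-congˡ (eval-pow p k))

-- Elements that become polynomials with integer coefficients after multiplication by a power of the product of the generators.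
module Integrality (S : CommutativeRing 0ℓ 0ℓ) (gen ginv : Fin 3 → CommutativeRing.Carrier S)
  (inverse : ∀ j → CommutativeRing._≈_ S (CommutativeRing._*_ S (gen j) (ginv j)) (CommutativeRing.1# S))
  (rel₁ : CommutativeRing._≈_ S (gen (suc zero)) (CommutativeRing._-_ S (gen zero) (CommutativeRing.1# S)))
  (rel₂ : CommutativeRing._≈_ S (gen (suc (suc zero))) (CommutativeRing._-_ S (CommutativeRing._*_ S (gen zero) (gen zero)) (CommutativeRing.1# S))) where
  open CommutativeRing S hiding (zero)
  open IntegerSolver S
  open Powers S
  open Evaluation S (gen zero)
  open import Relation.Binary.Reasoning.Setoid setoid

  a b c δ δ⁻¹ : Carrier
  a = gen zero
  b = gen (suc zero)
  c = gen (suc (suc zero))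
  δ = a * (b * c)
  δ⁻¹ = ginv zero * (ginv (suc zero) * ginv (suc (suc zero)))

  δ-inverse : δ * δ⁻¹ ≈ 1#
  δ-inverse = trans (solve 6 (λ a b c x y z → (a :* (b :* c)) :* (x :* (y :* z)) := (a :* x) :* ((b :* y) :* (c :* z))) refl _ _ _ _ _ _)
    (trans (*-cong (inverse zero) (trans (*-cong (inverse (suc zero)) (inverse (suc (suc zero)))) (*-identityˡ 1#))) (*-identityˡ 1#))

  A B C Δ : IntPoly
  A = + 0 ∷ + 1 ∷ []
  B = ℤ.- + 1 ∷ + 1 ∷ []
  C = ℤ.- + 1 ∷ + 0 ∷ + 1 ∷ []
  Δ = mulℤ A (mulℤ B C)

  eval-A : eval A ≈ a
  eval-A = solve 1 (λ a → con (+ 0) :+ a :* (con (+ 1) :+ a :* con (+ 0)) := a) refl a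

  eval-B : eval B ≈ b
  eval-B = trans (solve 1 (λ a → (:- con (+ 1)) :+ a :* (con (+ 1) :+ a :* con (+ 0)) := a :- con (+ 1)) refl a) (sym rel₁)

  eval-C : eval C ≈ c
  eval-C = trans (solve 1 (λ a → (:- con (+ 1)) :+ a :* (con (+ 0) :+ a :* (con (+ 1) :+ a :* con (+ 0))) := a :* a :- con (+ 1)) refl a) (sym rel₂)

  eval-Δ : eval Δ ≈ δ
  eval-Δ = trans (eval-mul A (mulℤ B C)) (*-cong eval-A (trans (eval-mul B C) (*-cong eval-B eval-C)))

  Δ^ : ℕ → IntPoly
  Δ^ = powℤ Δ

  δ^ : ℕ → Carrier
  δ^ = powN rawRing δ

  eval-Δ^ : ∀ k → eval (Δ^ k) ≈ δ^ k
  eval-Δ^ k = trans (eval-pow Δ k) (powN-cong k eval-Δ)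

  record Integral (x : Carrier) : Set where
    field
      order     : ℕ
      numerator : IntPoly
      value     : x * δ^ order ≈ eval numerator

  open Integral

  integral-resp : ∀ {x y} → x ≈ y → Integral x → Integral y
  integral-resp e i = record { order = order i ; numerator = numerator i ; value = trans (*-congʳ (sym e)) (value i) }

  polynomial : ∀ {x} p → eval p ≈ x → Integral x
  polynomial p e = record { order = 0 ; numerator = p ; value = trans (*-identityʳ _) (sym e) }

  integral-0 : Integral 0#
  integral-0 = polynomial [] refl

  integral-1 : Integral 1#
  integral-1 = polynomial (+ 1 ∷ []) eval-one

  integral-* : ∀ {x y} → Integral x → Integral y → Integral (x * y)
  integral-* {x} {y} i j = record { order = order i ℕ.+ order j ; numerator = mulℤ (numerator i) (numerator j) ; value = begin
    x * y * δ^ (order i ℕ.+ order j)        ≈⟨ *-congˡ (powN-+ δ (order i) (order j)) ⟩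
    x * y * (δ^ (order i) * δ^ (order j))   ≈⟨ solve 4 (λ x y d e → x :* y :* (d :* e) := (x :* d) :* (y :* e)) refl _ _ _ _ ⟩
    (x * δ^ (order i)) * (y * δ^ (order j)) ≈⟨ *-cong (value i) (value j) ⟩
    eval (numerator i) * eval (numerator j) ≈⟨ sym (eval-mul (numerator i) (numerator j)) ⟩
    eval (mulℤ (numerator i) (numerator j)) ∎ }

  integral-+ : ∀ {x y} → Integral x → Integral y → Integral (x + y)
  integral-+ {x} {y} i j = record
    { order = order i ℕ.+ order j
    ; numerator = addℤ (mulℤ (numerator i) (Δ^ (order j))) (mulℤ (numerator j) (Δ^ (order i)))
    ; value = begin
      (x + y) * δ^ (order i ℕ.+ order j)        ≈⟨ *-congˡ (powN-+ δ (order i) (order j)) ⟩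
      (x + y) * (δ^ (order i) * δ^ (order j))   ≈⟨ solve 4 (λ x y d e → (x :+ y) :* (d :* e) := (x :* d) :* e :+ (y :* e) :* d) refl _ _ _ _ ⟩
      (x * δ^ (order i)) * δ^ (order j) + (y * δ^ (order j)) * δ^ (order i)
        ≈⟨ +-cong (*-cong (value i) (sym (eval-Δ^ (order j)))) (*-cong (value j) (sym (eval-Δ^ (order i)))) ⟩
      eval (numerator i) * eval (Δ^ (order j)) + eval (numerator j) * eval (Δ^ (order i))
        ≈⟨ sym (+-cong (eval-mul (numerator i) (Δ^ (order j))) (eval-mul (numerator j) (Δ^ (order i)))) ⟩
      eval (mulℤ (numerator i) (Δ^ (order j))) + eval (mulℤ (numerator j) (Δ^ (order i)))
        ≈⟨ sym (eval-add (mulℤ (numerator i) (Δ^ (order j))) _) ⟩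
      eval (addℤ (mulℤ (numerator i) (Δ^ (order j))) (mulℤ (numerator j) (Δ^ (order i)))) ∎ }

  integral-neg : ∀ {x} → Integral x → Integral (- x)
  integral-neg {x} i = integral-resp (solve 1 (λ x → (:- con (+ 1)) :* x := :- x) refl x)
    (integral-* (polynomial (ℤ.- + 1 ∷ []) (solve 1 (λ a → (:- con (+ 1)) :+ a :* con (+ 0) := :- con (+ 1)) refl a)) i)

  integral-gen : ∀ j → Integral (gen j)
  integral-gen zero             = polynomial A eval-A
  integral-gen (suc zero)       = polynomial B eval-B
  integral-gen (suc (suc zero)) = polynomial C eval-C

  private
    denominator : ∀ {h} q {x} → x * h ≈ 1# → x * eval q ≈ δ → Integral h
    denominator {h} q {x} e f = record { order = 1 ; numerator = q ; value = begin
      h * (δ * 1#)      ≈⟨ *-congˡ (trans (*-identityʳ δ) (sym f)) ⟩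
      h * (x * eval q)  ≈⟨ solve 3 (λ h x q → h :* (x :* q) := (x :* h) :* q) refl _ _ _ ⟩
      (x * h) * eval q  ≈⟨ trans (*-congʳ e) (*-identityˡ _) ⟩
      eval q ∎ }

  integral-ginv : ∀ j → Integral (ginv j)
  integral-ginv zero             = denominator (mulℤ B C) (inverse zero) (*-congˡ (trans (eval-mul B C) (*-cong eval-B eval-C)))
  integral-ginv (suc zero)       = denominator (mulℤ A C) (inverse (suc zero))
    (trans (*-congˡ (trans (eval-mul A C) (*-cong eval-A eval-C))) (solve 3 (λ a b c → b :* (a :* c) := a :* (b :* c)) refl _ _ _))
  integral-ginv (suc (suc zero)) = denominator (mulℤ A B) (inverse (suc (suc zero)))
    (trans (*-congˡ (trans (eval-mul A B) (*-cong eval-A eval-B))) (solve 3 (λ a b c → c :* (a :* b) := a :* (b :* c)) refl _ _ _))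

  open DetRelation rawRing rawRing (λ x _ → Integral x) integral-+ integral-* integral-neg integral-0 integral-1 public
    using () renaming (det~ to integral-det; monomial~ to integral-monomial)

  -- The denominator is a power of the unit `δ`, so it can be removed after the numerator has been
  -- found to be zero.
  numerator-zero : ∀ {x} (i : Integral x) → All (_≡ + 0) (numerator i) → x ≈ 0#
  numerator-zero {x} i z = begin
    x                                        ≈⟨ sym (*-identityʳ x) ⟩
    x * 1#                                   ≈⟨ *-congˡ (sym (trans (sym (powN-* δ δ⁻¹ k)) (trans (powN-cong k δ-inverse) (powN-1 k)))) ⟩
    x * (δ^ k * powN rawRing δ⁻¹ k)          ≈⟨ sym (*-assoc _ _ _) ⟩
    (x * δ^ k) * powN rawRing δ⁻¹ k          ≈⟨ *-congʳ (trans (value i) (eval-zero z)) ⟩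
    0# * powN rawRing δ⁻¹ k                  ≈⟨ zeroˡ _ ⟩
    0# ∎
    where k = order i

-- The concrete rings, evaluation points and generators

module Rings where
  module _ (S : RawRing 0ℓ 0ℓ) where
    open RawRing S
    fromLaws :
      (∀ x y z → (x + y) + z ≡ x + (y + z)) → (∀ x y → x + y ≡ y + x) → (∀ x → 0# + x ≡ x) → (∀ x → - x + x ≡ 0#) →
      (∀ x y z → (x * y) * z ≡ x * (y * z)) → (∀ x y → x * y ≡ y * x) → (∀ x → 1# * x ≡ x) →
      (∀ x y z → x * (y + z) ≡ x * y + x * z) → CommutativeRing 0ℓ 0ℓ
    fromLaws +-assoc +-comm +-idˡ +-invˡ *-assoc *-comm *-idˡ distribˡ = record
      { Carrier = Carrier ; _≈_ = _≡_ ; _+_ = _+_ ; _*_ = _*_ ; -_ = -_ ; 0# = 0# ; 1# = 1#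
      ; isCommutativeRing = record
        { isRing = record
          { +-isAbelianGroup = record
            { isGroup = record
              { isMonoid = record
                { isSemigroup = record
                  { isMagma = record { isEquivalence = ≡.isEquivalence ; ∙-cong = cong₂ _+_ }
                  ; assoc = +-assoc }
                ; identity = +-idˡ , λ x → ≡.trans (+-comm x 0#) (+-idˡ x) }
              ; inverse = +-invˡ , λ x → ≡.trans (+-comm x (- x)) (+-invˡ x)
              ; ⁻¹-cong = cong -_ }
            ; comm = +-comm }
          ; *-cong = cong₂ _*_
          ; *-assoc = *-assoc
          ; *-identity = *-idˡ , λ x → ≡.trans (*-comm x 1#) (*-idˡ x)
          ; distrib = distribˡ , λ x y z → ≡.trans (*-comm (y + z) x) (≡.trans (distribˡ x y z) (cong₂ _+_ (*-comm x y) (*-comm x z))) }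
        ; *-comm = *-comm } }

  _≟₄_ : (x y : GF4) → Dec (x ≡ y)
  O  ≟₄ O  = yes ≡.refl
  O  ≟₄ I  = no λ ()
  O  ≟₄ W  = no λ ()
  O  ≟₄ W² = no λ ()
  I  ≟₄ O  = no λ ()
  I  ≟₄ I  = yes ≡.refl
  I  ≟₄ W  = no λ ()
  I  ≟₄ W² = no λ ()
  W  ≟₄ O  = no λ ()
  W  ≟₄ I  = no λ ()
  W  ≟₄ W  = yes ≡.refl
  W  ≟₄ W² = no λ ()
  W² ≟₄ O  = no λ ()
  W² ≟₄ I  = no λ ()
  W² ≟₄ W  = no λ ()
  W² ≟₄ W² = yes ≡.refl

  all₄? : {P : GF4 → Set} → (∀ x → Dec (P x)) → Dec (∀ x → P x)
  all₄? P? = map′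
    (λ { (a , b , c , d) → λ { O → a ; I → b ; W → c ; W² → d } })
    (λ h → h O , h I , h W , h W²)
    (P? O ×-dec P? I ×-dec P? W ×-dec P? W²)

  GF4R : CommutativeRing 0ℓ 0ℓ
  GF4R = fromLaws GF4-ring
    (toWitness {a? = all₄? λ x → all₄? λ y → all₄? λ z → gf4+ (gf4+ x y) z ≟₄ gf4+ x (gf4+ y z)} _)
    (toWitness {a? = all₄? λ x → all₄? λ y → gf4+ x y ≟₄ gf4+ y x} _)
    (λ _ → ≡.refl)
    (toWitness {a? = all₄? λ x → gf4+ x x ≟₄ O} _)
    (toWitness {a? = all₄? λ x → all₄? λ y → all₄? λ z → gf4* (gf4* x y) z ≟₄ gf4* x (gf4* y z)} _)
    (toWitness {a? = all₄? λ x → all₄? λ y → gf4* x y ≟₄ gf4* y x} _)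
    (toWitness {a? = all₄? λ x → gf4* I x ≟₄ x} _)
    (toWitness {a? = all₄? λ x → all₄? λ y → all₄? λ z → gf4* x (gf4+ y z) ≟₄ gf4+ (gf4* x y) (gf4* x z)} _)

  ℚR : CommutativeRing 0ℓ 0ℓ
  ℚR = ℚP.+-*-commutativeRing

  rawQ : RawRing 0ℓ 0ℓ
  rawQ = CommutativeRing.rawRing ℚR

  module _ where
    open IntegerSolver ℚR
    open RawRing ℚi-ring

    ℚiR : CommutativeRing 0ℓ 0ℓ
    ℚiR = fromLaws ℚi-ring
      (λ { (a , b) (c , d) (e , f) → cong₂ _,_ (ℚP.+-assoc a c e) (ℚP.+-assoc b d f) })
      (λ { (a , b) (c , d) → cong₂ _,_ (ℚP.+-comm a c) (ℚP.+-comm b d) })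
      (λ { (a , b) → cong₂ _,_ (ℚP.+-identityˡ a) (ℚP.+-identityˡ b) })
      (λ { (a , b) → cong₂ _,_ (ℚP.+-inverseˡ a) (ℚP.+-inverseˡ b) })
      (λ { (a , b) (c , d) (e , f) → cong₂ _,_
        (solve 6 (λ a b c d e f → (a :* c :- b :* d) :* e :- (a :* d :+ b :* c) :* f := a :* (c :* e :- d :* f) :- b :* (c :* f :+ d :* e)) ≡.refl a b c d e f)
        (solve 6 (λ a b c d e f → (a :* c :- b :* d) :* f :+ (a :* d :+ b :* c) :* e := a :* (c :* f :+ d :* e) :+ b :* (c :* e :- d :* f)) ≡.refl a b c d e f) })
      (λ { (a , b) (c , d) → cong₂ _,_
        (solve 4 (λ a b c d → a :* c :- b :* d := c :* a :- d :* b) ≡.refl a b c d)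
        (solve 4 (λ a b c d → a :* d :+ b :* c := c :* b :+ d :* a) ≡.refl a b c d) })
      (λ { (a , b) → cong₂ _,_
        (≡.trans (cong₂ (λ x y → x ℚ.+ ℚ.- y) (ℚP.*-identityˡ a) (ℚP.*-zeroˡ b)) (ℚP.+-identityʳ a))
        (≡.trans (cong₂ ℚ._+_ (ℚP.*-identityˡ b) (ℚP.*-zeroˡ a)) (ℚP.+-identityʳ b)) })
      (λ { (a , b) (c , d) (e , f) → cong₂ _,_
        (solve 6 (λ a b c d e f → a :* (c :+ e) :- b :* (d :+ f) := (a :* c :- b :* d) :+ (a :* e :- b :* f)) ≡.refl a b c d e f)
        (solve 6 (λ a b c d e f → a :* (d :+ f) :+ b :* (c :+ e) := (a :* d :+ b :* c) :+ (a :* f :+ b :* e)) ≡.refl a b c d e f) })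

  P₀ : PartialField
  P₀ = GF4-pf ⊗ H₂

  RR : CommutativeRing 0ℓ 0ℓ
  RR = DirectProduct.commutativeRing GF4R ℚiR

  ΩR : CommutativeRing 0ℓ 0ℓ
  ΩR = DirectProduct.commutativeRing (Pointwise.commutativeRing ℕ ℚR) RR

  ι : ℤ → ℚ
  ι z = ℚ.fromℚᵘ (mkℚᵘ z 0)

  ι-+ : ∀ a b → ι (a ℤ.+ b) ≡ ι a ℚ.+ ι b
  ι-+ a b = ℚP.toℚᵘ-injective (begin
    ℚ.toℚᵘ (ι (a ℤ.+ b))              ≈⟨ ℚP.toℚᵘ-fromℚᵘ _ ⟩
    mkℚᵘ (a ℤ.+ b) 0                  ≈⟨ *≡* (cong (ℤ._* + 1) (cong₂ ℤ._+_ (≡.sym (ℤP.*-identityʳ a)) (≡.sym (ℤP.*-identityʳ b)))) ⟩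
    mkℚᵘ a 0 ℚᵘ.+ mkℚᵘ b 0            ≈⟨ ℚᵘP.+-cong (ℚᵘP.≃-sym (ℚP.toℚᵘ-fromℚᵘ (mkℚᵘ a 0))) (ℚᵘP.≃-sym (ℚP.toℚᵘ-fromℚᵘ (mkℚᵘ b 0))) ⟩
    ℚ.toℚᵘ (ι a) ℚᵘ.+ ℚ.toℚᵘ (ι b)    ≈⟨ ℚᵘP.≃-sym (ℚP.toℚᵘ-homo-+ (ι a) (ι b)) ⟩
    ℚ.toℚᵘ (ι a ℚ.+ ι b) ∎)
    where open import Relation.Binary.Reasoning.Setoid ℚᵘP.≃-setoid

  ι-* : ∀ a b → ι (a ℤ.* b) ≡ ι a ℚ.* ι b
  ι-* a b = ℚP.toℚᵘ-injective (begin
    ℚ.toℚᵘ (ι (a ℤ.* b))              ≈⟨ ℚP.toℚᵘ-fromℚᵘ _ ⟩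
    mkℚᵘ a 0 ℚᵘ.* mkℚᵘ b 0            ≈⟨ ℚᵘP.*-cong (ℚᵘP.≃-sym (ℚP.toℚᵘ-fromℚᵘ (mkℚᵘ a 0))) (ℚᵘP.≃-sym (ℚP.toℚᵘ-fromℚᵘ (mkℚᵘ b 0))) ⟩
    ℚ.toℚᵘ (ι a) ℚᵘ.* ℚ.toℚᵘ (ι b)    ≈⟨ ℚᵘP.≃-sym (ℚP.toℚᵘ-homo-* (ι a) (ι b)) ⟩
    ℚ.toℚᵘ (ι a ℚ.* ι b) ∎)
    where open import Relation.Binary.Reasoning.Setoid ℚᵘP.≃-setoid

  ι-neg : ∀ a → ι (ℤ.- a) ≡ ℚ.- ι a
  ι-neg a = begin
    ι (ℤ.- a)                           ≡⟨ ≡.sym (ℚP.+-identityʳ (ι (ℤ.- a))) ⟩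
    ι (ℤ.- a) ℚ.+ 0ℚ                    ≡⟨ cong (ι (ℤ.- a) ℚ.+_) (≡.sym (ℚP.+-inverseʳ (ι a))) ⟩
    ι (ℤ.- a) ℚ.+ (ι a ℚ.+ ℚ.- ι a)     ≡⟨ ≡.sym (ℚP.+-assoc (ι (ℤ.- a)) (ι a) (ℚ.- ι a)) ⟩
    (ι (ℤ.- a) ℚ.+ ι a) ℚ.+ ℚ.- ι a     ≡⟨ cong (ℚ._+ ℚ.- ι a) (≡.trans (≡.sym (ι-+ (ℤ.- a) a)) (cong ι (ℤP.+-inverseˡ a))) ⟩
    0ℚ ℚ.+ ℚ.- ι a                      ≡⟨ ℚP.+-identityˡ (ℚ.- ι a) ⟩
    ℚ.- ι a ∎
    where open ≡.≡-Reasoning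

  ι-injective : ∀ {a b} → ι a ≡ ι b → a ≡ b
  ι-injective {a} {b} e with ℚᵘP.≃-trans (ℚᵘP.≃-sym (ℚP.toℚᵘ-fromℚᵘ (mkℚᵘ a 0))) (ℚᵘP.≃-trans (ℚᵘP.≃-reflexive (cong ℚ.toℚᵘ e)) (ℚP.toℚᵘ-fromℚᵘ (mkℚᵘ b 0)))
  ... | *≡* p = ≡.trans (≡.sym (ℤP.*-identityʳ a)) (≡.trans p (ℤP.*-identityʳ b))

  -- The value at 0 only makes the function total; by `gen₁≢0` the generators do not vanish at the
  -- evaluation points.
  recip : ℚ → ℚ
  recip q with q ℚ.≟ 0ℚ
  ... | yes _  = 0ℚ
  ... | no q≢0 = ℚ.1/_ q {{ℚ.≢-nonZero q≢0}}

  recip-inverse : ∀ {q} → q ≢ 0ℚ → q ℚ.* recip q ≡ 1ℚ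
  recip-inverse {q} q≢0 with q ℚ.≟ 0ℚ
  ... | yes q≡0 = contradiction q≡0 q≢0
  ... | no ne   = ℚP.*-inverseʳ q {{ℚ.≢-nonZero ne}}

  ℚ-domain : ∀ {p q} → p ≢ 0ℚ → q ≢ 0ℚ → p ℚ.* q ≢ 0ℚ
  ℚ-domain {p} {q} p≢0 q≢0 e = q≢0 (begin
    q                      ≡⟨ ≡.sym (ℚP.*-identityˡ q) ⟩
    1ℚ ℚ.* q               ≡⟨ cong (ℚ._* q) (≡.trans (≡.sym (recip-inverse p≢0)) (ℚP.*-comm p (recip p))) ⟩
    (recip p ℚ.* p) ℚ.* q  ≡⟨ ≡.trans (ℚP.*-assoc (recip p) p q) (cong (recip p ℚ.*_) e) ⟩
    recip p ℚ.* 0ℚ         ≡⟨ ℚP.*-zeroʳ (recip p) ⟩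
    0ℚ ∎)
    where open ≡.≡-Reasoning

  -- Evaluation points for the indeterminate: all integers n ≥ 2, which determine polynomials, and -2 and 1/2, which serve to read off exponents.
  point : ℕ → ℚ
  point zero          = ι (ℤ.- + 2)
  point (suc zero)    = ½
  point (suc (suc n)) = ι (+ suc (suc n))

  gen₁ : ℚ → Fin 3 → ℚ
  gen₁ a zero             = a
  gen₁ a (suc zero)       = a ℚ.- 1ℚ
  gen₁ a (suc (suc zero)) = a ℚ.* a ℚ.- 1ℚ

  point≢0 : ∀ n → point n ≢ 0ℚ
  point≢0 zero          ()
  point≢0 (suc zero)    ()
  point≢0 (suc (suc n)) e with ι-injective {+ suc (suc n)} {+ 0} e
  ... | ()

  point≢1 : ∀ n → point n ≢ 1ℚ
  point≢1 zero          ()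
  point≢1 (suc zero)    ()
  point≢1 (suc (suc n)) e with ι-injective {+ suc (suc n)} {+ 1} e
  ... | ()

  point≢-1 : ∀ n → point n ≢ ℚ.- 1ℚ
  point≢-1 zero          ()
  point≢-1 (suc zero)    ()
  point≢-1 (suc (suc n)) e with ι-injective {+ suc (suc n)} {ℤ.- + 1} e
  ... | ()

  difference≢0 : ∀ {p q} → p ≢ q → p ℚ.- q ≢ 0ℚ
  difference≢0 {p} {q} ne e = ne (≡.trans (≡.sym (ℚP.+-identityʳ p)) (≡.trans (cong (p ℚ.+_) (≡.sym (ℚP.+-inverseˡ q)))
    (≡.trans (≡.sym (ℚP.+-assoc p (ℚ.- q) q)) (≡.trans (cong (ℚ._+ q) e) (ℚP.+-identityˡ q)))))

  gen₁≢0 : ∀ n j → gen₁ (point n) j ≢ 0ℚ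
  gen₁≢0 n zero             = point≢0 n
  gen₁≢0 n (suc zero)       = difference≢0 (point≢1 n)
  gen₁≢0 n (suc (suc zero)) e = ℚ-domain (difference≢0 (point≢1 n)) (difference≢0 (point≢-1 n)) (≡.trans (square (point n)) e)
    where
    open IntegerSolver ℚR
    square : ∀ a → (a ℚ.- 1ℚ) ℚ.* (a ℚ.- ℚ.- 1ℚ) ≡ a ℚ.* a ℚ.- 1ℚ
    square = solve 1 (λ a → (a :- con (+ 1)) :* (a :- :- con (+ 1)) := a :* a :- con (+ 1)) ≡.refl

  -- The images of α, α - 1 and α² - 1 for α = (ω, i): in GF(4), ω - 1 = ω² and ω² - 1 = ω, and in
  -- ℚ(i), i² - 1 = -2.
  gen₂ gen₂⁻¹ : Fin 3 → GF4 × (ℚ × ℚ)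
  gen₂ zero             = W  , (0ℚ , 1ℚ)
  gen₂ (suc zero)       = W² , (ℚ.- 1ℚ , 1ℚ)
  gen₂ (suc (suc zero)) = W  , (ι (ℤ.- + 2) , 0ℚ)
  gen₂⁻¹ zero             = W² , (0ℚ , ℚ.- 1ℚ)
  gen₂⁻¹ (suc zero)       = W  , (ℚ.- ½ , ℚ.- ½)
  gen₂⁻¹ (suc (suc zero)) = W² , (ℚ.- ½ , 0ℚ)

  genΩ genΩ⁻¹ : Fin 3 → (ℕ → ℚ) × (GF4 × (ℚ × ℚ))
  genΩ j   = (λ n → gen₁ (point n) j) , gen₂ j
  genΩ⁻¹ j = (λ n → recip (gen₁ (point n) j)) , gen₂⁻¹ j

  gen₂-inverse : ∀ j → RawRing._*_ (CommutativeRing.rawRing RR) (gen₂ j) (gen₂⁻¹ j) ≡ RawRing.1# (CommutativeRing.rawRing RR)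
  gen₂-inverse zero             = ≡.refl
  gen₂-inverse (suc zero)       = ≡.refl
  gen₂-inverse (suc (suc zero)) = ≡.refl

  genΩ-inverse : ∀ j → CommutativeRing._≈_ ΩR (CommutativeRing._*_ ΩR (genΩ j) (genΩ⁻¹ j)) (CommutativeRing.1# ΩR)
  genΩ-inverse j = (λ n → recip-inverse (gen₁≢0 n j)) , CommutativeRing.reflexive RR (gen₂-inverse j)

  nontrivialΩ : ¬ CommutativeRing._≈_ ΩR (CommutativeRing.1# ΩR) (CommutativeRing.0# ΩR)
  nontrivialΩ (_ , () , _)

  module GΩ = Generated ΩR 3 genΩ genΩ⁻¹ genΩ-inverse nontrivialΩ

  H₂-inverse : ∀ j → RawRing._*_ ℚi-ring (H₂-gen j) (H₂-inv j) ≡ RawRing.1# ℚi-ring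
  H₂-inverse zero       = ≡.refl
  H₂-inverse (suc zero) = ≡.refl

  module GH = Generated ℚiR 2 H₂-gen H₂-inv H₂-inverse (λ ())

  nonzero₄ : UnitGroup GF4R
  nonzero₄ = record
    { G = _≢ O ; G-resp = λ { ≡.refl ne → ne } ; G-1 = λ () ; G-neg = λ ne → ne
    ; G-* = λ {x} {y} → product x y ; G-inv = λ {x} → inverse x ; G-≉0 = λ ne e → ne e }
    where
    product : ∀ x y → x ≢ O → y ≢ O → gf4* x y ≢ O
    product O  y  p q = contradiction ≡.refl p
    product I  O  p q = contradiction ≡.refl q
    product W  O  p q = contradiction ≡.refl q
    product W² O  p q = contradiction ≡.refl q
    product I  I  p q ()
    product I  W  p q ()
    product I  W² p q ()
    product W  I  p q ()
    product W  W  p q ()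
    product W  W² p q ()
    product W² I  p q ()
    product W² W  p q ()
    product W² W² p q ()
    inverse : ∀ x → x ≢ O → Σ GF4 λ y → (y ≢ O) × (gf4* x y ≡ I)
    inverse O  p = contradiction ≡.refl p
    inverse I  p = I  , (λ ()) , ≡.refl
    inverse W  p = W² , (λ ()) , ≡.refl
    inverse W² p = W  , (λ ()) , ≡.refl

  _×ᵤ_ : ∀ {S T} → UnitGroup S → UnitGroup T → UnitGroup (DirectProduct.commutativeRing S T)
  𝒢 ×ᵤ ℋ = record
    { G = λ { (x , y) → A.G x × B.G y }
    ; G-resp = λ { (p , q) (g , h) → A.G-resp p g , B.G-resp q h }
    ; G-1 = A.G-1 , B.G-1
    ; G-neg = λ { (g , h) → A.G-neg g , B.G-neg h }
    ; G-* = λ { (g , h) (g′ , h′) → A.G-* g g′ , B.G-* h h′ }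
    ; G-inv = λ { (g , h) → (proj₁ (A.G-inv g) , proj₁ (B.G-inv h)) ,
        (proj₁ (proj₂ (A.G-inv g)) , proj₁ (proj₂ (B.G-inv h))) , (proj₂ (proj₂ (A.G-inv g)) , proj₂ (proj₂ (B.G-inv h))) }
    ; G-≉0 = λ { (g , _) (p , _) → A.G-≉0 g p } }
    where
    module A = UnitGroup 𝒢
    module B = UnitGroup ℋ

  𝒢Ω : UnitGroup ΩR
  𝒢Ω = GΩ.group

  ℋR : UnitGroup RR
  ℋR = nonzero₄ ×ᵤ GH.group

open Rings

-- Valuations and sums equal to 1

module Gradings where
  -- The possible pairs of valuations of two elements with sum 1: the rays of a tropical line.
  data Tropical : ℤ → ℤ → Set where
    both   : ∀ k → Tropical (ℤ.- + k) (ℤ.- + k)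
    first  : ∀ k → Tropical (+ k) (+ 0)
    second : ∀ k → Tropical (+ 0) (+ k)

  module Valuation (S : CommutativeRing 0ℓ 0ℓ) where
    open CommutativeRing S hiding (zero)
    open Powers S
    open IntegerSolver S
    open import Relation.Binary.Reasoning.Setoid setoid

    module _ (Int : Carrier → Set) (Int-resp : ∀ {x y} → x ≈ y → Int x → Int y)
      (Int-1 : Int 1#) (Int-neg : ∀ {x} → Int x → Int (- x))
      (Int-+ : ∀ {x y} → Int x → Int y → Int (x + y)) (Int-* : ∀ {x y} → Int x → Int y → Int (x * y))
      (p q : Carrier) (pq : p * q ≈ 1#) (Int-p : Int p) (¬Int-q : ¬ Int q) where

      Unit : Carrier → Set
      Unit a = Int a × ∃ λ b → Int b × (a * b ≈ 1#)

      private
        P : ℤ → Carrier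
        P = powZ rawRing p q

        Int-P : ∀ k → Int (P (+ k))
        Int-P zero    = Int-1
        Int-P (suc k) = Int-* Int-p (Int-P k)

        ¬Int-qa : ∀ {a} → Unit a → ¬ Int (q * a)
        ¬Int-qa (_ , b , ib , ab) i = ¬Int-q (Int-resp (trans (*-assoc _ _ _) (trans (*-congˡ ab) (*-identityʳ q))) (Int-* i ib))

        -- The first summand alone has the lowest valuation, -(m + 1). Multiplying the equation by
        -- p^m makes all other terms integral, so that q a would be integral too, and hence `q`.
        lone : ∀ m x′ k {a a′} → x′ ℤ.+ + m ≡ + k → Unit a → Unit a′ → ¬ (P -[1+ m ] * a + P x′ * a′ ≈ 1#)
        lone m x′ k {a} {a′} e ua (ia′ , _) eq = ¬Int-qa ua (Int-resp value
          (Int-+ (Int-P m) (Int-neg (Int-* (Int-P k) ia′))))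
          where
          value : P (+ m) + - (P (+ k) * a′) ≈ q * a
          value = begin
            P (+ m) + - (P (+ k) * a′)
              ≈⟨ +-cong (sym (*-identityʳ _)) (-‿cong (*-congʳ (trans (reflexive (≡.cong P (≡.sym e))) (powZ-+ pq x′ (+ m))))) ⟩
            P (+ m) * 1# + - (P x′ * P (+ m) * a′)
              ≈⟨ +-congʳ (*-congˡ (sym eq)) ⟩
            P (+ m) * (P -[1+ m ] * a + P x′ * a′) + - (P x′ * P (+ m) * a′)
              ≈⟨ solve 5 (λ m n x a a′ → m :* (n :* a :+ x :* a′) :+ (:- (x :* m :* a′)) := (m :* n) :* a) refl (P (+ m)) (P -[1+ m ]) (P x′) a a′ ⟩
            (P (+ m) * P -[1+ m ]) * a
              ≈⟨ *-congʳ (trans (sym (powZ-+ pq (+ m) -[1+ m ])) (reflexive (≡.cong P (minus m)))) ⟩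
            P -[1+ 0 ] * a   ≈⟨ *-congʳ (*-identityʳ q) ⟩
            q * a ∎
            where
            minus : ∀ m → + m ℤ.+ -[1+ m ] ≡ -[1+ 0 ]
            minus zero    = ≡.refl
            minus (suc m) = ≡.trans (ℤP.[1+m]⊖[1+n]≡m⊖n m (suc m)) (minus m)

        positive : ∀ m n {a a′} → Unit a → Unit a′ → ¬ (P (+ suc m) * a + P (+ suc n) * a′ ≈ 1#)
        positive m n {a} {a′} (ia , _) (ia′ , _) eq = ¬Int-q (Int-resp value
          (Int-+ (Int-* (Int-P m) ia) (Int-* (Int-P n) ia′)))
          where
          value : P (+ m) * a + P (+ n) * a′ ≈ q
          value = begin
            P (+ m) * a + P (+ n) * a′  ≈⟨ sym (trans (*-congʳ pq) (*-identityˡ _)) ⟩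
            (p * q) * (P (+ m) * a + P (+ n) * a′)
              ≈⟨ solve 6 (λ p q x y a b → (p :* q) :* (x :* a :+ y :* b) := q :* ((p :* x) :* a :+ (p :* y) :* b)) refl p q _ _ a a′ ⟩
            q * (P (+ suc m) * a + P (+ suc n) * a′)  ≈⟨ trans (*-congˡ eq) (*-identityʳ q) ⟩
            q ∎

      -- A subring `Int` in which `p` lacks an inverse stands in for a discrete valuation: p^x a has
      -- valuation `x` if `a` is a unit of `Int`. Among the valuations `x`, `x′` and that of 1, the
      -- minimum must occur at least twice.
      tropical : ∀ x x′ {a a′} → Unit a → Unit a′ → P x * a + P x′ * a′ ≈ 1# → Tropical x x′
      tropical (+ zero)  (+ n)      u u′ e = second n
      tropical (+ suc m) (+ zero)   u u′ e = first (suc m)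
      tropical (+ suc m) (+ suc n)  u u′ e = contradiction e (positive m n u u′)
      tropical -[1+ m ]  (+ n)      u u′ e = contradiction e (lone m (+ n) (n ℕ.+ m) ≡.refl u u′)
      tropical (+ n)     -[1+ m ]   u u′ e = contradiction (trans (+-comm _ _) e) (lone m (+ n) (n ℕ.+ m) ≡.refl u′ u)
      tropical -[1+ m ]  -[1+ n ]   u u′ e with ℕ.compare m n
      ... | ℕ.equal _     = both (suc m)
      ... | ℕ.greater n k = contradiction e (lone (suc (n ℕ.+ k)) -[1+ n ] k (cancel n k) u u′)
        where
        cancel : ∀ n k → -[1+ n ] ℤ.+ + suc (n ℕ.+ k) ≡ + k
        cancel zero    k = ≡.refl
        cancel (suc n) k = ≡.trans (ℤP.[1+m]⊖[1+n]≡m⊖n (suc n ℕ.+ k) (suc n)) (cancel n k)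
      ... | ℕ.less m k    = contradiction (trans (+-comm _ _) e) (lone (suc (m ℕ.+ k)) -[1+ m ] k (cancel m k) u′ u)
        where
        cancel : ∀ n k → -[1+ n ] ℤ.+ + suc (n ℕ.+ k) ≡ + k
        cancel zero    k = ≡.refl
        cancel (suc n) k = ≡.trans (ℤP.[1+m]⊖[1+n]≡m⊖n (suc n ℕ.+ k) (suc n)) (cancel n k)

  module Localised (r : ℕ) where
    open IntegerSolver ℚR

    power : ℕ → ℤ
    power n = + (r ℕ.^ n)

    -- The ring ℤ[1/r]. The valuation at 2 is taken with r = 3 and the one at 3 with r = 2; this is
    -- enough since only numbers ± 2^x 3^y are measured.
    record Away (q : ℚ) : Set where
      constructor _,_
      field
        exponent : ℕ
        integral : ∃ λ z → ι (power exponent) ℚ.* q ≡ ι z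

    power-+ : ∀ m n → ι (power (m ℕ.+ n)) ≡ ι (power m) ℚ.* ι (power n)
    power-+ m n = ≡.trans (cong ι (≡.trans (cong +_ (ℕP.^-distribˡ-+-* r m n)) (ℤP.pos-* (r ℕ.^ m) (r ℕ.^ n)))) (ι-* (power m) (power n))
      where import Data.Nat.Properties as ℕP

    away-ι : ∀ z → Away (ι z)
    away-ι z = 0 , z , ℚP.*-identityˡ (ι z)

    away-neg : ∀ {x} → Away x → Away (ℚ.- x)
    away-neg {x} (n , z , e) = n , ℤ.- z , ≡.trans (≡.sym (ℚP.neg-distribʳ-* (ι (power n)) x)) (≡.trans (cong ℚ.-_ e) (≡.sym (ι-neg z)))

    away-+ : ∀ {x y} → Away x → Away y → Away (x ℚ.+ y)
    away-+ {x} {y} (n , z , e) (m , w , f) = n ℕ.+ m , power m ℤ.* z ℤ.+ power n ℤ.* w , (begin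
      ι (power (n ℕ.+ m)) ℚ.* (x ℚ.+ y)  ≡⟨ cong (ℚ._* (x ℚ.+ y)) (power-+ n m) ⟩
      (ι (power n) ℚ.* ι (power m)) ℚ.* (x ℚ.+ y)
        ≡⟨ solve 4 (λ n m x y → (n :* m) :* (x :+ y) := m :* (n :* x) :+ n :* (m :* y)) ≡.refl (ι (power n)) (ι (power m)) x y ⟩
      ι (power m) ℚ.* (ι (power n) ℚ.* x) ℚ.+ ι (power n) ℚ.* (ι (power m) ℚ.* y)
        ≡⟨ cong₂ ℚ._+_ (≡.trans (cong (ι (power m) ℚ.*_) e) (≡.sym (ι-* (power m) z))) (≡.trans (cong (ι (power n) ℚ.*_) f) (≡.sym (ι-* (power n) w))) ⟩
      ι (power m ℤ.* z) ℚ.+ ι (power n ℤ.* w)  ≡⟨ ≡.sym (ι-+ (power m ℤ.* z) (power n ℤ.* w)) ⟩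
      ι (power m ℤ.* z ℤ.+ power n ℤ.* w) ∎)
      where open ≡.≡-Reasoning

    away-* : ∀ {x y} → Away x → Away y → Away (x ℚ.* y)
    away-* {x} {y} (n , z , e) (m , w , f) = n ℕ.+ m , z ℤ.* w , (begin
      ι (power (n ℕ.+ m)) ℚ.* (x ℚ.* y)  ≡⟨ cong (ℚ._* (x ℚ.* y)) (power-+ n m) ⟩
      (ι (power n) ℚ.* ι (power m)) ℚ.* (x ℚ.* y)
        ≡⟨ solve 4 (λ n m x y → (n :* m) :* (x :* y) := (n :* x) :* (m :* y)) ≡.refl (ι (power n)) (ι (power m)) x y ⟩
      (ι (power n) ℚ.* x) ℚ.* (ι (power m) ℚ.* y)  ≡⟨ cong₂ ℚ._*_ e f ⟩
      ι z ℚ.* ι w  ≡⟨ ≡.sym (ι-* z w) ⟩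
      ι (z ℤ.* w) ∎)
      where open ≡.≡-Reasoning

    away-recip : ∀ {q} → ι (+ r) ℚ.* q ≡ 1ℚ → Away q
    away-recip {q} e = 1 , + 1 , ≡.trans (cong (λ k → ι (+ k) ℚ.* q) (ℕP.*-identityʳ r)) e
      where import Data.Nat.Properties as ℕP

  third : ℚ
  third = + 1 ℚ./ 3

  P2 P3 : ℤ → ℚ
  P2 = powZ (CommutativeRing.rawRing ℚR) (ι (+ 2)) ½
  P3 = powZ (CommutativeRing.rawRing ℚR) (ι (+ 3)) third

  sgn : ℕ → ℚ
  sgn = powN (CommutativeRing.rawRing ℚR) (ℚ.- 1ℚ)

  record Is (q : ℚ) (x y : ℤ) : Set where
    constructor _,_
    field
      sign  : ℕ
      value : q ≡ sgn sign ℚ.* (P2 x ℚ.* P3 y)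

  module _ where
    open IntegerSolver ℚR
    open Powers ℚR
    Is-1 : Is 1ℚ (+ 0) (+ 0)
    Is-1 = 0 , ≡.refl

    Is-* : ∀ {p q x y x′ y′} → Is p x y → Is q x′ y′ → Is (p ℚ.* q) (x ℤ.+ x′) (y ℤ.+ y′)
    Is-* {p} {q} {x} {y} {x′} {y′} (s , e) (t , f) = s ℕ.+ t , ≡.trans (cong₂ ℚ._*_ e f) (≡.trans
      (solve 6 (λ s a b t c d → (s :* (a :* b)) :* (t :* (c :* d)) := (s :* t) :* ((a :* c) :* (b :* d))) ≡.refl (sgn s) (P2 x) (P3 y) (sgn t) (P2 x′) (P3 y′))
      (≡.sym (cong₂ ℚ._*_ (powN-+ (ℚ.- 1ℚ) s t) (cong₂ ℚ._*_ (powZ-+ {ι (+ 2)} {½} ≡.refl x x′) (powZ-+ {ι (+ 3)} {third} ≡.refl y y′)))))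

    Is-powN : ∀ {g x y} → Is g x y → ∀ k → Is (powN rawQ g k) (+ k ℤ.* x) (+ k ℤ.* y)
    Is-powN {x = x} {y} i zero    = ≡.subst₂ (Is 1ℚ) (≡.sym (ℤP.*-zeroˡ x)) (≡.sym (ℤP.*-zeroˡ y)) Is-1
    Is-powN {g} {x} {y} i (suc k) = ≡.subst₂ (Is (g ℚ.* powN rawQ g k)) (≡.sym (step x)) (≡.sym (step y)) (Is-* i (Is-powN i k))
      where
      step : ∀ x → + suc k ℤ.* x ≡ x ℤ.+ + k ℤ.* x
      step x = ℤP.suc-* (+ k) x

    Is-powZ : ∀ {g h x y} → Is g x y → Is h (ℤ.- x) (ℤ.- y) → ∀ i → Is (powZ rawQ g h i) (i ℤ.* x) (i ℤ.* y)
    Is-powZ i j (+ k)    = Is-powN i k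
    Is-powZ {h = h} {x} {y} i j -[1+ k ] = ≡.subst₂ (Is (powN rawQ h (suc k))) (flip-sign x) (flip-sign y) (Is-powN j (suc k))
      where
      flip-sign : ∀ x → + suc k ℤ.* (ℤ.- x) ≡ -[1+ k ] ℤ.* x
      flip-sign x = ≡.trans (≡.sym (ℤP.neg-distribʳ-* (+ suc k) x)) (ℤP.neg-distribˡ-* (+ suc k) x)

    private
      module L2 = Localised 2
      module L3 = Localised 3

      odd : ∀ n z → ¬ (+ (3 ℕ.^ n) ≡ + 2 ℤ.* z)
      odd zero    (+ zero)        ()
      odd zero    (+ suc zero)    ()
      odd zero    (+ suc (suc _)) ()
      odd zero    -[1+ _ ]        ()
      -- With t = 3^n, the equation 3 t = 2 z gives t = 3 t - 2 t = 2 (z - t), a descent to the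
      -- smaller exponent.
      odd (suc n) z e = odd n (z ℤ.- + (3 ℕ.^ n)) (begin
        t                             ≡⟨ Z.solve 1 (λ t → t Z.:= Z.con (+ 3) Z.:* t Z.:- Z.con (+ 2) Z.:* t) ≡.refl t ⟩
        + 3 ℤ.* t ℤ.- + 2 ℤ.* t       ≡⟨ cong (ℤ._- + 2 ℤ.* t) (≡.trans (≡.sym (ℤP.pos-* 3 (3 ℕ.^ n))) e) ⟩
        + 2 ℤ.* z ℤ.- + 2 ℤ.* t       ≡⟨ Z.solve 2 (λ z t → Z.con (+ 2) Z.:* z Z.:- Z.con (+ 2) Z.:* t Z.:= Z.con (+ 2) Z.:* (z Z.:- t)) ≡.refl z t ⟩
        + 2 ℤ.* (z ℤ.- t) ∎)
        where
        open ≡.≡-Reasoning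
        module Z = IntegerSolver ℤP.+-*-commutativeRing
        t = + (3 ℕ.^ n)

      nonmultiple : ∀ n z → ¬ (+ (2 ℕ.^ n) ≡ + 3 ℤ.* z)
      nonmultiple zero    (+ zero)        ()
      nonmultiple zero    (+ suc zero)    ()
      nonmultiple zero    (+ suc (suc _)) ()
      nonmultiple zero    -[1+ _ ]        ()
      nonmultiple (suc n) z e = nonmultiple n (t ℤ.- z) (begin
        t                             ≡⟨ Z.solve 1 (λ t → t Z.:= Z.con (+ 3) Z.:* t Z.:- Z.con (+ 2) Z.:* t) ≡.refl t ⟩
        + 3 ℤ.* t ℤ.- + 2 ℤ.* t       ≡⟨ cong (λ u → + 3 ℤ.* t ℤ.- u) (≡.trans (≡.sym (ℤP.pos-* 2 (2 ℕ.^ n))) e) ⟩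
        + 3 ℤ.* t ℤ.- + 3 ℤ.* z       ≡⟨ Z.solve 2 (λ z t → Z.con (+ 3) Z.:* t Z.:- Z.con (+ 3) Z.:* z Z.:= Z.con (+ 3) Z.:* (t Z.:- z)) ≡.refl z t ⟩
        + 3 ℤ.* (t ℤ.- z) ∎)
        where
        open ≡.≡-Reasoning
        module Z = IntegerSolver ℤP.+-*-commutativeRing
        t = + (2 ℕ.^ n)

      ¬half : ¬ L3.Away ½
      ¬half a = odd n z (ι-injective (≡.trans
        (≡.trans (≡.sym (ℚP.*-identityˡ (ι t))) (≡.trans (cong (ℚ._* ι t) {1ℚ} {½ ℚ.* ι (+ 2)} ≡.refl)
          (solve 3 (λ h two t → (h :* two) :* t := two :* (t :* h)) ≡.refl ½ (ι (+ 2)) (ι t))))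
        (≡.trans (cong (ι (+ 2) ℚ.*_) e) (≡.sym (ι-* (+ 2) z)))))
        where
        n = L3.Away.exponent a
        z = proj₁ (L3.Away.integral a)
        e = proj₂ (L3.Away.integral a)
        t = + (3 ℕ.^ n)

      ¬third : ¬ L2.Away third
      ¬third a = nonmultiple n z (ι-injective (≡.trans
        (≡.trans (≡.sym (ℚP.*-identityˡ (ι t))) (≡.trans (cong (ℚ._* ι t) {1ℚ} {third ℚ.* ι (+ 3)} ≡.refl)
          (solve 3 (λ h three t → (h :* three) :* t := three :* (t :* h)) ≡.refl third (ι (+ 3)) (ι t))))
        (≡.trans (cong (ι (+ 3) ℚ.*_) e) (≡.sym (ι-* (+ 3) z)))))
        where
        n = L2.Away.exponent a
        z = proj₁ (L2.Away.integral a)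
        e = proj₂ (L2.Away.integral a)
        t = + (2 ℕ.^ n)

      module V2 = Valuation ℚR
      Unit3 : ℚ → Set
      Unit3 a = L3.Away a × ∃ λ b → L3.Away b × (a ℚ.* b ≡ 1ℚ)

      tropical₂ : ∀ x x′ {a a′} → Unit3 a → Unit3 a′ → P2 x ℚ.* a ℚ.+ P2 x′ ℚ.* a′ ≡ 1ℚ → Tropical x x′
      tropical₂ = V2.tropical L3.Away (λ { ≡.refl i → i }) (L3.away-ι (+ 1)) L3.away-neg L3.away-+ L3.away-* (ι (+ 2)) ½ ≡.refl (L3.away-ι (+ 2)) ¬half

      Unit2 : ℚ → Set
      Unit2 a = L2.Away a × ∃ λ b → L2.Away b × (a ℚ.* b ≡ 1ℚ)

      tropical₃ : ∀ x x′ {a a′} → Unit2 a → Unit2 a′ → P3 x ℚ.* a ℚ.+ P3 x′ ℚ.* a′ ≡ 1ℚ → Tropical x x′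
      tropical₃ = V2.tropical L2.Away (λ { ≡.refl i → i }) (L2.away-ι (+ 1)) L2.away-neg L2.away-+ L2.away-* (ι (+ 3)) third ≡.refl (L2.away-ι (+ 3)) ¬third

      away-power : ∀ {Q : ℚ → Set} → Q 1ℚ → (∀ {x y} → Q x → Q y → Q (x ℚ.* y)) → ∀ {g h} → Q g → Q h → ∀ i → Q (powZ rawQ g h i)
      away-power {Q} one mul {g} {h} a b = go
        where
        pow : ∀ {g} → Q g → ∀ k → Q (powN rawQ g k)
        pow a zero    = one
        pow a (suc k) = mul a (pow a k)
        go : ∀ i → Q (powZ rawQ g h i)
        go (+ k)    = pow a k
        go -[1+ k ] = pow b (suc k)

      sgn-power : ∀ {Q : ℚ → Set} → Q 1ℚ → (∀ {x} → Q x → Q (ℚ.- x)) → ∀ s → Q (sgn s)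
      sgn-power     one neg zero    = one
      sgn-power {Q} one neg (suc s) = subst Q (≡.trans (cong ℚ.-_ (≡.sym (ℚP.*-identityˡ (sgn s)))) (ℚP.neg-distribˡ-* 1ℚ (sgn s))) (neg (sgn-power {Q} one neg s))

      inverse-signed : ∀ {g h} → g ℚ.* h ≡ 1ℚ → ∀ s y → (sgn s ℚ.* powZ rawQ g h y) ℚ.* (sgn s ℚ.* powZ rawQ g h (ℤ.- y)) ≡ 1ℚ
      inverse-signed {g} {h} e s y = begin
        (sgn s ℚ.* powZ rawQ g h y) ℚ.* (sgn s ℚ.* powZ rawQ g h (ℤ.- y))
          ≡⟨ solve 3 (λ s a b → (s :* a) :* (s :* b) := (s :* s) :* (a :* b)) ≡.refl (sgn s) (powZ rawQ g h y) (powZ rawQ g h (ℤ.- y)) ⟩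
        (sgn s ℚ.* sgn s) ℚ.* (powZ rawQ g h y ℚ.* powZ rawQ g h (ℤ.- y))
          ≡⟨ cong₂ ℚ._*_ (powN-neg-square s) (≡.trans (≡.sym (powZ-+ e y (ℤ.- y))) (cong (powZ rawQ g h) (ℤP.+-inverseʳ y))) ⟩
        1ℚ ∎
        where open ≡.≡-Reasoning

      unit3 : ∀ s y → Unit3 (sgn s ℚ.* P3 y)
      unit3 s y = away y , sgn s ℚ.* P3 (ℤ.- y) , away (ℤ.- y) , inverse-signed ≡.refl s y
        where
        away : ∀ y → L3.Away (sgn s ℚ.* P3 y)
        away y = L3.away-* (sgn-power {L3.Away} (L3.away-ι (+ 1)) L3.away-neg s)
          (away-power {L3.Away} (L3.away-ι (+ 1)) L3.away-* (L3.away-ι (+ 3)) (L3.away-recip ≡.refl) y)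

      unit2 : ∀ s y → Unit2 (sgn s ℚ.* P2 y)
      unit2 s y = away y , sgn s ℚ.* P2 (ℤ.- y) , away (ℤ.- y) , inverse-signed ≡.refl s y
        where
        away : ∀ y → L2.Away (sgn s ℚ.* P2 y)
        away y = L2.away-* (sgn-power {L2.Away} (L2.away-ι (+ 1)) L2.away-neg s)
          (away-power {L2.Away} (L2.away-ι (+ 1)) L2.away-* (L2.away-ι (+ 2)) (L2.away-recip ≡.refl) y)

    Is-tropical : ∀ {p q x y x′ y′} → Is p x y → Is q x′ y′ → p ℚ.+ q ≡ 1ℚ → Tropical x x′ × Tropical y y′
    Is-tropical {x = x} {y} {x′} {y′} (s , e) (t , f) eq =
      tropical₂ x x′ (unit3 s y) (unit3 t y′) (≡.trans (cong₂ ℚ._+_ (re₂ s x y) (re₂ t x′ y′)) sum) ,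
      tropical₃ y y′ (unit2 s x) (unit2 t x′) (≡.trans (cong₂ ℚ._+_ (re₃ s x y) (re₃ t x′ y′)) sum)
      where
      sum = ≡.trans (≡.sym (cong₂ ℚ._+_ e f)) eq
      re₂ : ∀ s x y → P2 x ℚ.* (sgn s ℚ.* P3 y) ≡ sgn s ℚ.* (P2 x ℚ.* P3 y)
      re₂ s x y = solve 3 (λ a s b → a :* (s :* b) := s :* (a :* b)) ≡.refl (P2 x) (sgn s) (P3 y)
      re₃ : ∀ s x y → P3 y ℚ.* (sgn s ℚ.* P2 x) ≡ sgn s ℚ.* (P2 x ℚ.* P3 y)
      re₃ s x y = solve 3 (λ a s b → b :* (s :* a) := s :* (a :* b)) ≡.refl (P2 x) (sgn s) (P3 y)

    private
      -- Only the ray through (-1, -1) contains a point with second coordinate -1.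
      on-diagonal : ∀ {x x′} → Tropical x x′ → x′ ≡ -[1+ 0 ] → x ≡ -[1+ 0 ]
      on-diagonal (both k)   e = e
      on-diagonal (first k)  ()
      on-diagonal (second k) ()

    open import Algebra.Properties.Group (CommutativeRing.+-group ℤP.+-*-commutativeRing) using (∙-cancelʳ)

    -- 1/2 + 1/2 = 1, and a ratio of the two representations multiplies the first summand.
    Is-unique : ∀ {q x y x′ y′} → Is q x y → Is q x′ y′ → q ≢ 0ℚ → x ≡ x′
    Is-unique {q} {x} {y} {x′} {y′} i (s , f) q≢0 = ℤP.i-j≡0⇒i≡j x x′ (∙-cancelʳ -[1+ 0 ] (x ℤ.- x′) (+ 0)
      (on-diagonal (proj₁ (Is-tropical (Is-* (Is-* i j) half) half (≡.trans (cong (ℚ._+ ½) (cong (ℚ._* ½) q·recip)) ≡.refl))) ≡.refl))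
      where
      half : Is ½ -[1+ 0 ] (+ 0)
      half = 0 , ≡.refl
      r = sgn s ℚ.* (P2 (ℤ.- x′) ℚ.* P3 (ℤ.- y′))
      j : Is r (ℤ.- x′) (ℤ.- y′)
      j = s , ≡.refl
      q·recip : q ℚ.* r ≡ 1ℚ
      q·recip = begin
        q ℚ.* r ≡⟨ cong (ℚ._* r) f ⟩
        (sgn s ℚ.* (P2 x′ ℚ.* P3 y′)) ℚ.* (sgn s ℚ.* (P2 (ℤ.- x′) ℚ.* P3 (ℤ.- y′)))
          ≡⟨ solve 5 (λ s a b c d → (s :* (a :* b)) :* (s :* (c :* d)) := (s :* s) :* ((a :* c) :* (b :* d))) ≡.refl (sgn s) (P2 x′) (P3 y′) (P2 (ℤ.- x′)) (P3 (ℤ.- y′)) ⟩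
        (sgn s ℚ.* sgn s) ℚ.* ((P2 x′ ℚ.* P2 (ℤ.- x′)) ℚ.* (P3 y′ ℚ.* P3 (ℤ.- y′)))
          ≡⟨ cong₂ ℚ._*_ (powN-neg-square s) (cong₂ ℚ._*_ (≡.trans (≡.sym (powZ-+ {ι (+ 2)} {½} ≡.refl x′ (ℤ.- x′))) (cong P2 (ℤP.+-inverseʳ x′)))
               (≡.trans (≡.sym (powZ-+ {ι (+ 3)} {third} ≡.refl y′ (ℤ.- y′))) (cong P3 (ℤP.+-inverseʳ y′)))) ⟩
        1ℚ ∎
        where open ≡.≡-Reasoning

open Gradings

-- Cross ratios of H₂

module GaussianCrossRatios where
  _≟ᵢ_ : (x y : ℚ × ℚ) → Dec (x ≡ y)
  _≟ᵢ_ = ProductP.≡-dec ℚ._≟_ ℚ._≟_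

  module QI = CommutativeRing ℚiR

  units : Fin 4 → ℚ × ℚ
  units zero                   = 1ℚ , 0ℚ
  units (suc zero)             = 0ℚ , 1ℚ
  units (suc (suc zero))       = ℚ.- 1ℚ , 0ℚ
  units (suc (suc (suc zero))) = 0ℚ , ℚ.- 1ℚ

  IsUnit : ℚ × ℚ → Set
  IsUnit u = ∃ λ k → u ≡ units k

  abstract
    units-* : ∀ k l → ∃ λ n → units k QI.* units l ≡ units n
    units-* = toWitness {a? = FinP.all? λ k → FinP.all? λ l → FinP.any? λ n → (units k QI.* units l) ≟ᵢ units n} _

    units-inverse : ∀ k → ∃ λ l → units k QI.* units l ≡ QI.1#
    units-inverse = toWitness {a? = FinP.all? λ k → FinP.any? λ l → (units k QI.* units l) ≟ᵢ QI.1#} _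

  IsUnit-* : ∀ {u v} → IsUnit u → IsUnit v → IsUnit (u QI.* v)
  IsUnit-* (k , ≡.refl) (l , ≡.refl) = units-* k l

  IsUnit-powN : ∀ {u} → IsUnit u → ∀ k → IsUnit (powN ℚi-ring u k)
  IsUnit-powN iu zero    = zero , ≡.refl
  IsUnit-powN iu (suc k) = IsUnit-* iu (IsUnit-powN iu k)

  -- Gaussian integers; those of the form half v include all fundamental elements of H₂.
  half : ℤ × ℤ → ℚ × ℚ
  half (p , q) = ½ ℚ.* ι p , ½ ℚ.* ι q

  -- The doubles of -1, 2, 1/2, i, -i, 1 + i, 1 - i, (1 + i) / 2 and (1 - i) / 2.
  fundamental : Fin 9 → ℤ × ℤ
  fundamental zero                                                       = ℤ.- + 2 , + 0
  fundamental (suc zero)                                                 = + 4 , + 0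
  fundamental (suc (suc zero))                                           = + 1 , + 0
  fundamental (suc (suc (suc zero)))                                     = + 0 , + 2
  fundamental (suc (suc (suc (suc zero))))                               = + 0 , ℤ.- + 2
  fundamental (suc (suc (suc (suc (suc zero)))))                         = + 2 , + 2
  fundamental (suc (suc (suc (suc (suc (suc zero))))))                   = + 2 , ℤ.- + 2
  fundamental (suc (suc (suc (suc (suc (suc (suc zero)))))))             = + 1 , + 1
  fundamental (suc (suc (suc (suc (suc (suc (suc (suc zero))))))))       = + 1 , ℤ.- + 1

  module _ where
    open IntegerSolver ℚiR
    private
      Gaussian : ℚ × ℚ → Set
      Gaussian z = ∃ λ p → ∃ λ q → z ≡ (ι p , ι q)

      γ γ⁻¹ : ℚ × ℚ
      γ   = H₂-gen (suc zero)
      γ⁻¹ = H₂-inv (suc zero)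

      gaussian-neg : ∀ {x} → Gaussian x → Gaussian (QI.- x)
      gaussian-neg (p , q , ≡.refl) = ℤ.- p , ℤ.- q , cong₂ _,_ (≡.sym (ι-neg p)) (≡.sym (ι-neg q))

      gaussian-+ : ∀ {x y} → Gaussian x → Gaussian y → Gaussian (x QI.+ y)
      gaussian-+ (p , q , ≡.refl) (r , s , ≡.refl) = p ℤ.+ r , q ℤ.+ s , cong₂ _,_ (≡.sym (ι-+ p r)) (≡.sym (ι-+ q s))

      gaussian-* : ∀ {x y} → Gaussian x → Gaussian y → Gaussian (x QI.* y)
      gaussian-* (p , q , ≡.refl) (r , s , ≡.refl) = p ℤ.* r ℤ.- q ℤ.* s , p ℤ.* s ℤ.+ q ℤ.* r , cong₂ _,_
        (≡.sym (≡.trans (ι-+ (p ℤ.* r) (ℤ.- (q ℤ.* s))) (cong₂ ℚ._+_ (ι-* p r) (≡.trans (ι-neg (q ℤ.* s)) (cong ℚ.-_ (ι-* q s))))))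
        (≡.sym (≡.trans (ι-+ (p ℤ.* s) (q ℤ.* r)) (cong₂ ℚ._+_ (ι-* p s) (ι-* q r))))

      ½-integral : ∀ z → ½ ≢ ι z
      ½-integral z e with double z (ι-injective (≡.trans (cong (ι (+ 2) ℚ.*_) e) (≡.sym (ι-* (+ 2) z))))
        where
        double : ∀ z → + 1 ≢ + 2 ℤ.* z
        double (+ zero)        ()
        double (+ suc zero)    ()
        double (+ suc (suc _)) ()
        double -[1+ _ ]        ()
      ... | ()

      ¬gaussian : ¬ Gaussian γ⁻¹
      ¬gaussian (p , _ , e) = ½-integral p (cong proj₁ e)

      gaussian-units : ∀ k → Gaussian (units k)
      gaussian-units zero                   = + 1 , + 0 , ≡.refl
      gaussian-units (suc zero)             = + 0 , + 1 , ≡.refl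
      gaussian-units (suc (suc zero))       = ℤ.- + 1 , + 0 , ≡.refl
      gaussian-units (suc (suc (suc zero))) = + 0 , ℤ.- + 1 , ≡.refl

      gaussian-unit : ∀ {u} → IsUnit u → Gaussian u × ∃ λ v → Gaussian v × (u QI.* v ≡ QI.1#)
      gaussian-unit (k , ≡.refl) = gaussian-units k , units (proj₁ (units-inverse k)) , gaussian-units (proj₁ (units-inverse k)) , proj₂ (units-inverse k)

      Pγ : ℤ → ℚ × ℚ
      Pγ = powZ ℚi-ring γ γ⁻¹

      tropicalγ : ∀ x x′ {u u′} → IsUnit u → IsUnit u′ → Pγ x QI.* u QI.+ Pγ x′ QI.* u′ ≡ QI.1# → Tropical x x′
      tropicalγ x x′ iu iu′ = Valuation.tropical ℚiR Gaussian (λ { ≡.refl i → i }) (+ 1 , + 0 , ≡.refl)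
        gaussian-neg gaussian-+ gaussian-* γ γ⁻¹ ≡.refl (+ 1 , ℤ.- + 1 , ≡.refl) ¬gaussian x x′ (gaussian-unit iu) (gaussian-unit iu′)

      split : ∀ {y} → PartialField.InG H₂ y → ∃ λ x → ∃ λ u → IsUnit u × (y ≡ Pγ x QI.* u)
      split (s , e , ≡.refl) = e (suc zero) , σ QI.* υ , IsUnit-* (IsUnit-powN (suc (suc zero) , ≡.refl) s) (powZ-unit (e zero)) ,
        ≡.trans (cong (λ t → σ QI.* (υ QI.* t)) (QI.*-identityʳ (Pγ (e (suc zero)))))
          (solve 3 (λ a b c → a :* (b :* c) := c :* (a :* b)) ≡.refl σ υ (Pγ (e (suc zero))))
        where
        σ = powN ℚi-ring (QI.- QI.1#) s
        υ = powZ ℚi-ring (H₂-gen zero) (H₂-inv zero) (e zero)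
        powZ-unit : ∀ i → IsUnit (powZ ℚi-ring (H₂-gen zero) (H₂-inv zero) i)
        powZ-unit (+ k)    = IsUnit-powN (suc zero , ≡.refl) k
        powZ-unit -[1+ k ] = IsUnit-powN (suc (suc (suc zero)) , ≡.refl) (suc k)

      by-inverse : ∀ {y} c d → c QI.* d ≡ QI.1# → y QI.* c ≡ QI.1# → y ≡ d
      by-inverse {y} c d cd yc = ≡.trans (≡.sym (QI.*-identityʳ y)) (≡.trans (cong (y QI.*_) (≡.sym cd))
        (≡.trans (≡.sym (QI.*-assoc y c d)) (≡.trans (cong (QI._* d) yc) (QI.*-identityˡ d))))

      complement : ∀ {y w} → y QI.+ w ≡ QI.1# → y ≡ QI.1# QI.- w
      complement {y} {w} e = ≡.trans (solve 2 (λ y w → y := (y :+ w) :- w) ≡.refl y w) (cong (QI._- w) e)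

      nonzero : ∀ {y} → PartialField.InG H₂ y → y ≢ QI.0#
      nonzero = UnitGroup.G-≉0 GH.group

      unit-case : ∀ {y w} k → y ≡ units k → y QI.+ w ≡ QI.1# → PartialField.InG H₂ w → ∃ λ k → y ≡ half (fundamental k)
      unit-case {w = w} zero ≡.refl e gw = contradiction (complement {w} {QI.1#} (≡.trans (QI.+-comm w QI.1#) e)) (nonzero gw)
      unit-case (suc zero) ≡.refl e gw = suc (suc (suc zero)) , ≡.refl
      unit-case (suc (suc zero)) ≡.refl e gw = zero , ≡.refl
      unit-case (suc (suc (suc zero))) ≡.refl e gw = suc (suc (suc (suc zero))) , ≡.refl

      counit-case : ∀ {y w} k → w ≡ units k → y QI.+ w ≡ QI.1# → PartialField.InG H₂ y → ∃ λ k → y ≡ half (fundamental k)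
      counit-case zero ≡.refl e gy = contradiction (complement e) (nonzero gy)
      counit-case (suc zero) ≡.refl e gy = suc (suc (suc (suc (suc (suc zero))))) , complement e
      counit-case (suc (suc zero)) ≡.refl e gy = suc zero , complement e
      counit-case (suc (suc (suc zero))) ≡.refl e gy = suc (suc (suc (suc (suc zero)))) , complement e

      ratio-case : ∀ {y v} k → v ≡ units k → y QI.* (QI.1# QI.+ v) ≡ QI.1# → ∃ λ k → y ≡ half (fundamental k)
      ratio-case zero ≡.refl e = suc (suc zero) , by-inverse _ (half (+ 1 , + 0)) ≡.refl e
      ratio-case (suc zero) ≡.refl e = suc (suc (suc (suc (suc (suc (suc (suc zero))))))) , by-inverse _ (half (+ 1 , ℤ.- + 1)) ≡.refl e
      ratio-case {y} (suc (suc zero)) ≡.refl e = contradiction (≡.trans (≡.sym e) (QI.zeroʳ y)) (λ ())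
      ratio-case (suc (suc (suc zero))) ≡.refl e = suc (suc (suc (suc (suc (suc (suc zero)))))) , by-inverse _ (half (+ 1 , + 1)) ≡.refl e

    abstract
      -- Elements of H₂ are units of ℤ[i] times powers of γ = 1 - i. By the valuation at γ, either
      -- `y` is a unit, or `w` is one, or both have the same valuation and y = 1 / (1 + v) for the
      -- unit v = w / y. Each case offers four units, one of which is impossible because an element
      -- or a denominator would be zero.
      H₂-fundamental : ∀ {y w} → PartialField.InG H₂ y → PartialField.InG H₂ w → y QI.+ w ≡ QI.1# → ∃ λ k → y ≡ half (fundamental k)
      H₂-fundamental {y} {w} gy gw e with split gy | split gw
      ... | x , u , (k , uk) , ey | x′ , u′ , (k′ , uk′) , ew =
        rays x x′ (tropicalγ x x′ (k , uk) (k′ , uk′) (≡.trans (≡.sym (cong₂ QI._+_ ey ew)) e)) ey ew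
        where
        rays : ∀ x x′ → Tropical x x′ → y ≡ Pγ x QI.* u → w ≡ Pγ x′ QI.* u′ → ∃ λ k → y ≡ half (fundamental k)
        rays _ _ (second n) ey ew = unit-case k (≡.trans ey (≡.trans (QI.*-identityˡ u) uk)) e gw
        rays _ _ (first n)  ey ew = counit-case k′ (≡.trans ew (≡.trans (QI.*-identityˡ u′) uk′)) e gy
        rays _ _ (both n)   ey ew = let l , v = units-inverse k
                                        n′ , v′ = units-* k′ l
                                    in ratio-case {y} {u′ QI.* units l} n′ (≡.trans (cong (QI._* units l) uk′) v′) (begin
          y QI.* (QI.1# QI.+ u′ QI.* units l)
            ≡⟨ cong (QI._* (QI.1# QI.+ u′ QI.* units l)) ey ⟩
          (P QI.* u) QI.* (QI.1# QI.+ u′ QI.* units l)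
            ≡⟨ solve 5 (λ p u o u′ l → (p :* u) :* (o :+ u′ :* l) := (p :* u) :* o :+ (p :* u′) :* (u :* l)) ≡.refl P u QI.1# u′ (units l) ⟩
          (P QI.* u) QI.* QI.1# QI.+ (P QI.* u′) QI.* (u QI.* units l)
            ≡⟨ cong₂ QI._+_ (QI.*-identityʳ (P QI.* u)) (≡.trans (cong ((P QI.* u′) QI.*_) (≡.trans (cong (QI._* units l) uk) v)) (QI.*-identityʳ (P QI.* u′))) ⟩
          P QI.* u QI.+ P QI.* u′  ≡⟨ ≡.sym (cong₂ QI._+_ ey ew) ⟩
          y QI.+ w  ≡⟨ e ⟩
          QI.1# ∎)
          where
          open ≡.≡-Reasoning
          P : ℚ × ℚ
          P = Pγ (ℤ.- + n)

open GaussianCrossRatios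

-- The table of cross ratios, checked by computation

module CrossRatioTable where
  -- The monomial ± α^e₀ (α - 1)^e₁ (α² - 1)^e₂ as data with decidable equality; the sign is reduced
  -- to its parity.
  record Exponents : Set where
    constructor ⟪_,_,_,_⟫
    field
      negative : Bool
      e₀ e₁ e₂ : ℤ

  open Exponents

  toℕ₂ : Bool → ℕ
  toℕ₂ false = 0
  toℕ₂ true  = 1

  exponent : Exponents → Fin 3 → ℤ
  exponent x zero             = e₀ x
  exponent x (suc zero)       = e₁ x
  exponent x (suc (suc zero)) = e₂ x

  _≟ₑ_ : (x y : Exponents) → Dec (x ≡ y)
  ⟪ s , a , b , c ⟫ ≟ₑ ⟪ s′ , a′ , b′ , c′ ⟫ = map′ (λ { (≡.refl , ≡.refl , ≡.refl , ≡.refl) → ≡.refl })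
    (λ { ≡.refl → ≡.refl , ≡.refl , ≡.refl , ≡.refl }) ((s BoolP.≟ s′) ×-dec (a ℤ.≟ a′) ×-dec (b ℤ.≟ b′) ×-dec (c ℤ.≟ c′))

  mulₑ : Exponents → Exponents → Exponents
  mulₑ ⟪ s , a , b , c ⟫ ⟪ s′ , a′ , b′ , c′ ⟫ = ⟪ s xor s′ , a ℤ.+ a′ , b ℤ.+ b′ , c ℤ.+ c′ ⟫

  invₑ : Exponents → Exponents
  invₑ ⟪ s , a , b , c ⟫ = ⟪ s , ℤ.- a , ℤ.- b , ℤ.- c ⟫

  negₑ : Exponents → Exponents
  negₑ ⟪ s , a , b , c ⟫ = ⟪ not s , a , b , c ⟫

  oneₑ : Exponents
  oneₑ = ⟪ false , + 0 , + 0 , + 0 ⟫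

  -- A cross ratio with exponents x whose complement to 1 has exponents x′; g is its image in GF(4) and v is twice its image in ℚ(i).
  record Entry : Set where
    constructor entry
    field
      x x′ : Exponents
      g    : GF4
      v    : ℤ × ℤ

  open Entry

  -- The orbit under z ↦ 1 - z and z ↦ 1/z.
  orbit : Exponents → Exponents → (vs : Fin 6 → GF4 × (ℤ × ℤ)) → List Entry
  orbit x w vs =
    at zero x w ∷ at (suc zero) w x ∷
    at (suc (suc zero)) (invₑ x) (negₑ (mulₑ w (invₑ x))) ∷
    at (suc (suc (suc zero))) (negₑ (mulₑ w (invₑ x))) (invₑ x) ∷
    at (suc (suc (suc (suc zero)))) (invₑ w) (negₑ (mulₑ x (invₑ w))) ∷
    at (suc (suc (suc (suc (suc zero))))) (negₑ (mulₑ x (invₑ w))) (invₑ w) ∷ []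
    where
    at : Fin 6 → Exponents → Exponents → Entry
    at k x x′ = entry x x′ (proj₁ (vs k)) (proj₂ (vs k))

  vec₆ : ∀ {X : Set} → X → X → X → X → X → X → Fin 6 → X
  vec₆ a b c d e f zero                               = a
  vec₆ a b c d e f (suc zero)                         = b
  vec₆ a b c d e f (suc (suc zero))                   = c
  vec₆ a b c d e f (suc (suc (suc zero)))             = d
  vec₆ a b c d e f (suc (suc (suc (suc zero))))       = e
  vec₆ a b c d e f (suc (suc (suc (suc (suc zero))))) = f

  values₁ : Fin 6 → GF4 × (ℤ × ℤ)
  values₁ = vec₆ (W , + 0 , + 2) (W² , + 2 , ℤ.- + 2) (W² , + 0 , ℤ.- + 2) (W , + 2 , + 2) (W , + 1 , + 1) (W² , + 1 , ℤ.- + 1)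

  values₂ : Fin 6 → GF4 × (ℤ × ℤ)
  values₂ = vec₆ (W , + 0 , ℤ.- + 2) (W² , + 2 , + 2) (W² , + 0 , + 2) (W , + 2 , ℤ.- + 2) (W , + 1 , ℤ.- + 1) (W² , + 1 , + 1)

  values₃ : Fin 6 → GF4 × (ℤ × ℤ)
  values₃ = vec₆ (W² , ℤ.- + 2 , + 0) (W , + 4 , + 0) (W , ℤ.- + 2 , + 0) (W² , + 4 , + 0) (W² , + 1 , + 0) (W , + 1 , + 0)

  -- The three orbits start from α + (1 - α) = 1, -α + (α + 1) = 1 and α² + (1 - α²) = 1, where α +
  -- 1 = (α² - 1) / (α - 1). Their eighteen members match the eighteen pairs of ω or ω² with one of
  -- the nine Gaussian values.
  table : List Entry
  table =
    orbit ⟪ false , + 1 , + 0 , + 0 ⟫ ⟪ true , + 0 , + 1 , + 0 ⟫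
      values₁ ++
    orbit ⟪ true , + 1 , + 0 , + 0 ⟫ ⟪ false , + 0 , ℤ.- + 1 , + 1 ⟫
      values₂ ++
    orbit ⟪ false , + 2 , + 0 , + 0 ⟫ ⟪ true , + 0 , + 0 , + 1 ⟫
      values₃

  module Monomials₃ (S : CommutativeRing 0ℓ 0ℓ) (gen ginv : Fin 3 → CommutativeRing.Carrier S)
    (inverse : ∀ j → CommutativeRing._≈_ S (CommutativeRing._*_ S (gen j) (ginv j)) (CommutativeRing.1# S))
    (nontrivial : ¬ CommutativeRing._≈_ S (CommutativeRing.1# S) (CommutativeRing.0# S)) where
    open CommutativeRing S hiding (zero)
    open IntegerSolver S renaming (_:+_ to _⊕_; _:*_ to _⊛_; :-_ to ⊖_)
    private
      κ : ∀ {n} → Polynomial n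
      κ = con (+ 1)
    open Powers S
    private module Gen = Generated S 3 gen ginv inverse nontrivial
    open import Algebra.Properties.Ring ring using (-‿distribˡ-*)
    open import Relation.Binary.Reasoning.Setoid setoid

    mono₃ : Exponents → Carrier
    mono₃ x = monomial rawRing 3 gen ginv (toℕ₂ (negative x)) (exponent x)

    private
      sign-xor : ∀ s t → powN rawRing (- 1#) (toℕ₂ s ℕ.+ toℕ₂ t) ≈ powN rawRing (- 1#) (toℕ₂ (s xor t))
      sign-xor false t     = refl
      sign-xor true  false = refl
      sign-xor true  true  = trans (*-congˡ (*-identityʳ _)) neg-one-square

      combine : ∀ x y j → exponent x j ℤ.+ exponent y j ≡ exponent (mulₑ x y) j
      combine x y zero             = ≡.refl
      combine x y (suc zero)       = ≡.refl
      combine x y (suc (suc zero)) = ≡.refl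

      opposite : ∀ x j → ℤ.- exponent x j ≡ exponent (invₑ x) j
      opposite x zero             = ≡.refl
      opposite x (suc zero)       = ≡.refl
      opposite x (suc (suc zero)) = ≡.refl

    abstract
      mono₃-* : ∀ x y → mono₃ (mulₑ x y) ≈ mono₃ x * mono₃ y
      mono₃-* x y = sym (trans (Gen.mono-* (toℕ₂ (negative x)) (exponent x) (toℕ₂ (negative y)) (exponent y))
        (*-cong (sign-xor (negative x) (negative y)) (prodFin-cong 3 (λ j → reflexive (cong (powZ rawRing (gen j) (ginv j)) (combine x y j))))))

      mono₃-inv : ∀ x → mono₃ x * mono₃ (invₑ x) ≈ 1#
      mono₃-inv x = trans (*-congˡ (*-congˡ (prodFin-cong 3 (λ j → reflexive (cong (powZ rawRing (gen j) (ginv j)) (≡.sym (opposite x j)))))))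
        (Gen.mono-inverse (toℕ₂ (negative x)) (exponent x))

      mono₃-neg : ∀ x → mono₃ (negₑ x) ≈ - mono₃ x
      mono₃-neg ⟪ false , a , b , c ⟫ = trans (*-congʳ (*-identityʳ _)) (trans (sym (-‿distribˡ-* 1# _)) (-‿cong (*-congˡ (prodFin-cong 3 {λ j → powZ rawRing (gen j) (ginv j) (exponent ⟪ true , a , b , c ⟫ j)} {λ j → powZ rawRing (gen j) (ginv j) (exponent ⟪ false , a , b , c ⟫ j)} (λ { zero → refl ; (suc zero) → refl ; (suc (suc zero)) → refl })))))
      mono₃-neg ⟪ true , a , b , c ⟫ = trans (*-congʳ (sym neg-one-square)) (trans (*-assoc _ _ _) (trans (sym (-‿distribˡ-* 1# _))
        (-‿cong (trans (*-identityˡ _) (*-cong (sym (*-identityʳ _)) (prodFin-cong 3 {λ j → powZ rawRing (gen j) (ginv j) (exponent ⟪ false , a , b , c ⟫ j)} {λ j → powZ rawRing (gen j) (ginv j) (exponent ⟪ true , a , b , c ⟫ j)} (λ { zero → refl ; (suc zero) → refl ; (suc (suc zero)) → refl })))))))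

      mono₃-one : mono₃ oneₑ ≈ 1#
      mono₃-one = trans (*-congˡ (prodFin-cong 3 {λ j → powZ rawRing (gen j) (ginv j) (exponent oneₑ j)} {λ _ → 1#} (λ { zero → refl ; (suc zero) → refl ; (suc (suc zero)) → refl }))) (trans (*-identityˡ _) (prodFin-1 3 (λ _ → refl)))

      mono₃-normal : ∀ {z} → InGenerated rawRing 3 gen ginv z → ∃ λ x → z ≈ mono₃ x
      mono₃-normal (s , e , p) = ⟪ proj₁ (parity s) , e zero , e (suc zero) , e (suc (suc zero)) ⟫ ,
        trans p (*-cong (proj₂ (parity s)) (prodFin-cong 3 {λ j → powZ rawRing (gen j) (ginv j) (e j)} {λ j → powZ rawRing (gen j) (ginv j) (exponent ⟪ proj₁ (parity s) , e zero , e (suc zero) , e (suc (suc zero)) ⟫ j)} (λ { zero → refl ; (suc zero) → refl ; (suc (suc zero)) → refl })))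
        where
        parity : ∀ s → ∃ λ b → powN rawRing (- 1#) s ≈ powN rawRing (- 1#) (toℕ₂ b)
        parity zero    = false , refl
        parity (suc s) = let b , e = parity s in not b , trans (*-congˡ e) (sign-xor true b)

    SumOne : Entry → Set
    SumOne t = mono₃ (Entry.x t) + mono₃ (Entry.x′ t) ≈ 1#

    private
      -- Dividing x + w = 1 by x gives 1 / x + (- w / x) = 1; in this way three identities produce
      -- the whole table.
      quotient : ∀ x w → mono₃ x + mono₃ w ≈ 1# → mono₃ (invₑ x) + mono₃ (negₑ (mulₑ w (invₑ x))) ≈ 1#
      quotient x w e = begin
        h + mono₃ (negₑ (mulₑ w (invₑ x)))  ≈⟨ +-congˡ (trans (mono₃-neg (mulₑ w (invₑ x))) (-‿cong (mono₃-* w (invₑ x)))) ⟩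
        h + - (mono₃ w * h)                 ≈⟨ +-congʳ (sym (trans (*-congʳ e) (*-identityˡ h))) ⟩
        (mono₃ x + mono₃ w) * h + - (mono₃ w * h) ≈⟨ solve 3 (λ x w h → (x ⊕ w) ⊛ h ⊕ (⊖ (w ⊛ h)) := x ⊛ h) refl (mono₃ x) (mono₃ w) h ⟩
        mono₃ x * h                         ≈⟨ mono₃-inv x ⟩
        1# ∎
        where h = mono₃ (invₑ x)

      orbit-sum : ∀ x w vs → mono₃ x + mono₃ w ≈ 1# → All SumOne (orbit x w vs)
      orbit-sum x w vs e = e ∷ e′ ∷ quotient x w e ∷ trans (+-comm _ _) (quotient x w e) ∷
        quotient w x e′ ∷ trans (+-comm _ _) (quotient w x e′) ∷ []
        where e′ = trans (+-comm (mono₃ w) (mono₃ x)) e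

    abstract
      table-sums : gen (suc zero) ≈ gen zero - 1# → gen (suc (suc zero)) ≈ gen zero * gen zero - 1# → All SumOne table
      table-sums rel₁ rel₂ = AllP.++⁺ (orbit-sum _ _ values₁ base₁) (AllP.++⁺ (orbit-sum _ _ values₂ base₂) (orbit-sum _ _ values₃ base₃))
        where
        a h : Carrier
        a = gen zero
        h = ginv (suc zero)

        base₁ : mono₃ ⟪ false , + 1 , + 0 , + 0 ⟫ + mono₃ ⟪ true , + 0 , + 1 , + 0 ⟫ ≈ 1#
        base₁ = trans
          (solve 2 (λ a b → κ ⊛ ((a ⊛ κ) ⊛ (κ ⊛ (κ ⊛ κ))) ⊕ ((⊖ κ) ⊛ κ) ⊛ (κ ⊛ ((b ⊛ κ) ⊛ (κ ⊛ κ))) := a ⊕ (⊖ b)) refl a (gen (suc zero)))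
          (trans (+-congˡ (-‿cong rel₁)) (solve 1 (λ a → a ⊕ (⊖ (a ⊕ ⊖ κ)) := κ) refl a))

        base₂ : mono₃ ⟪ true , + 1 , + 0 , + 0 ⟫ + mono₃ ⟪ false , + 0 , ℤ.- + 1 , + 1 ⟫ ≈ 1#
        base₂ = trans
          (solve 3 (λ a h c → ((⊖ κ) ⊛ κ) ⊛ ((a ⊛ κ) ⊛ (κ ⊛ (κ ⊛ κ))) ⊕ κ ⊛ (κ ⊛ ((h ⊛ κ) ⊛ ((c ⊛ κ) ⊛ κ))) := (⊖ a) ⊕ h ⊛ c) refl a h (gen (suc (suc zero))))
          (trans (+-congˡ (trans (*-congˡ (trans rel₂ (solve 1 (λ a → a ⊛ a ⊕ ⊖ κ := (a ⊕ ⊖ κ) ⊛ (a ⊕ κ)) refl a)))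
              (trans (sym (*-assoc _ _ _)) (*-congʳ (trans (*-congˡ (sym rel₁)) (trans (*-comm _ _) (inverse (suc zero))))))))
            (solve 1 (λ a → (⊖ a) ⊕ κ ⊛ (a ⊕ κ) := κ) refl a))

        base₃ : mono₃ ⟪ false , + 2 , + 0 , + 0 ⟫ + mono₃ ⟪ true , + 0 , + 0 , + 1 ⟫ ≈ 1#
        base₃ = trans
          (solve 2 (λ a c → κ ⊛ ((a ⊛ (a ⊛ κ)) ⊛ (κ ⊛ (κ ⊛ κ))) ⊕ ((⊖ κ) ⊛ κ) ⊛ (κ ⊛ (κ ⊛ ((c ⊛ κ) ⊛ κ))) := a ⊛ a ⊕ (⊖ c)) refl a (gen (suc (suc zero))))
          (trans (+-congˡ (-‿cong rel₂)) (solve 1 (λ a → a ⊛ a ⊕ (⊖ (a ⊛ a ⊕ ⊖ κ)) := κ) refl a))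

  module ΩM = CommutativeRing ΩR
  module RM = CommutativeRing RR

  module MΩ = Monomials₃ ΩR genΩ genΩ⁻¹ genΩ-inverse nontrivialΩ
  open MΩ using () renaming (mono₃ to monoΩ)

  monoR : Exponents → RM.Carrier
  monoR x = monomial RM.rawRing 3 gen₂ gen₂⁻¹ (toℕ₂ (negative x)) (exponent x)

  eval : ℕ → Exponents → ℚ
  eval n x = monomial (CommutativeRing.rawRing ℚR) 3 (gen₁ (point n)) (recip ∘ gen₁ (point n)) (toℕ₂ (negative x)) (exponent x)

  projR : Hom ΩR RR
  projR = record { φ = proj₂ ; φ-cong = proj₂ ; φ-+ = λ _ _ → RM.refl ; φ-* = λ _ _ → RM.refl
    ; φ-neg = λ _ → RM.refl ; φ-0 = RM.refl ; φ-1 = RM.refl }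

  projℚ : ℕ → Hom ΩR ℚR
  projℚ n = record { φ = λ x → proj₁ x n ; φ-cong = λ e → proj₁ e n ; φ-+ = λ _ _ → ≡.refl ; φ-* = λ _ _ → ≡.refl
    ; φ-neg = λ _ → ≡.refl ; φ-0 = ≡.refl ; φ-1 = ≡.refl }

  monoΩ-R : ∀ x → proj₂ (monoΩ x) RM.≈ monoR x
  monoΩ-R x = Hom.φ-monomial projR 3 {genΩ} {genΩ⁻¹} {gen₂} {gen₂⁻¹} (λ _ → RM.refl) (λ _ → RM.refl) (toℕ₂ (negative x)) (exponent x)

  monoΩ-eval : ∀ n x → proj₁ (monoΩ x) n ≡ eval n x
  monoΩ-eval n x = Hom.φ-monomial (projℚ n) 3 {genΩ} {genΩ⁻¹} {gen₁ (point n)} {recip ∘ gen₁ (point n)} (λ _ → ≡.refl) (λ _ → ≡.refl) (toℕ₂ (negative x)) (exponent x)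

  monoΩ-G : ∀ x → UnitGroup.G 𝒢Ω (monoΩ x)
  monoΩ-G x = toℕ₂ (negative x) , exponent x , ΩM.refl

  RM-≡ : ∀ {x y} → x RM.≈ y → x ≡ y
  RM-≡ (p , q) = cong₂ _,_ p q

  abstract
    monoΩ-sums : All MΩ.SumOne table
    monoΩ-sums = MΩ.table-sums ΩM.refl ΩM.refl

  valueR : Entry → RM.Carrier
  valueR t = Entry.g t , half (Entry.v t)

  _≟R_ : (x y : RM.Carrier) → Dec (x ≡ y)
  _≟R_ = ProductP.≡-dec _≟₄_ _≟ᵢ_

  _≟ᵥ_ : (x y : ℤ × ℤ) → Dec (x ≡ y)
  _≟ᵥ_ = ProductP.≡-dec ℤ._≟_ ℤ._≟_

  _·_ : ℤ × ℤ → ℤ × ℤ → ℤ × ℤ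
  (p , q) · (r , s) = p ℤ.* r ℤ.- q ℤ.* s , p ℤ.* s ℤ.+ q ℤ.* r

  twice : ℤ × ℤ → ℤ × ℤ
  twice (p , q) = + 2 ℤ.* p , + 2 ℤ.* q

  negᵥ : ℤ × ℤ → ℤ × ℤ
  negᵥ (p , q) = ℤ.- p , ℤ.- q

  abstract
    table-values : All (λ t → monoR (x t) ≡ valueR t) table
    table-values = toWitness {a? = All.all? (λ t → monoR (x t) ≟R valueR t) table} _

    table-covers : ∀ k → All (λ w → Any (λ t → (g t ≡ w) × (v t ≡ fundamental k)) table) (W ∷ W² ∷ [])
    table-covers = toWitness {a? = FinP.all? λ k → All.all? (λ w → Any.any? (λ t → (g t ≟₄ w) ×-dec (v t ≟ᵥ fundamental k)) table) (W ∷ W² ∷ [])} _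

    table-≢I : All (λ t → g t ≢ I) table
    table-≢I = toWitness {a? = All.all? (λ t → ¬? (g t ≟₄ I)) table} _

    -- The Gaussian values are stored doubled, so the product of two stored values is twice the
    -- stored value of their product.
    table-products : All (λ t → All (λ u → All (λ w → (gf4* (g t) (g u) ≡ g w) × (v t · v u ≡ twice (v w)) → mulₑ (x t) (x u) ≡ x w) table) table) table
    table-products = toWitness {a? = All.all? (λ t → All.all? (λ u → All.all? (λ w →
      ((gf4* (g t) (g u) ≟₄ g w) ×-dec ((v t · v u) ≟ᵥ twice (v w))) →-dec (mulₑ (x t) (x u) ≟ₑ x w)) table) table) table} _

    table-inverses : All (λ t → All (λ u → (gf4* (g t) (g u) ≡ I) × (v t · v u ≡ twice (+ 2 , + 0)) → mulₑ (x t) (x u) ≡ oneₑ) table) table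
    table-inverses = toWitness {a? = All.all? (λ t → All.all? (λ u →
      ((gf4* (g t) (g u) ≟₄ I) ×-dec ((v t · v u) ≟ᵥ twice (+ 2 , + 0))) →-dec (mulₑ (x t) (x u) ≟ₑ oneₑ)) table) table} _

    table-negatives : All (λ t → All (λ u → (g t ≡ g u) × (negᵥ (v t) ≡ v u) → negₑ (x t) ≡ x u) table) table
    table-negatives = toWitness {a? = All.all? (λ t → All.all? (λ u →
      ((g t ≟₄ g u) ×-dec (negᵥ (v t) ≟ᵥ v u)) →-dec (negₑ (x t) ≟ₑ x u)) table) table} _

    table-injective : All (λ t → All (λ u → (g t ≡ g u) × (v t ≡ v u) → x t ≡ x u) table) table
    table-injective = toWitness {a? = All.all? (λ t → All.all? (λ u →
      ((g t ≟₄ g u) ×-dec (v t ≟ᵥ v u)) →-dec (x t ≟ₑ x u)) table) table} _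

  -- The points with parameter at most 2 on the three rays of `Tropical`.
  candidates : List (ℤ × ℤ)
  candidates = (+ 0 , + 0) ∷ (+ 1 , + 0) ∷ (+ 2 , + 0) ∷ (+ 0 , + 1) ∷ (+ 0 , + 2) ∷ (ℤ.- + 1 , ℤ.- + 1) ∷ (ℤ.- + 2 , ℤ.- + 2) ∷ []

  booleans : List Bool
  booleans = false ∷ true ∷ []

  abstract
    -- At α = 2 the factor α - 1 disappears, so that the exponents of α and α + 1 can be restricted first.
    exhaustive : All (λ a → All (λ c → All (λ s → All (λ s′ →
        eval 2 ⟪ s , proj₁ a , + 0 , proj₁ c ⟫ ℚ.+ eval 2 ⟪ s′ , proj₂ a , + 0 , proj₂ c ⟫ ≡ 1ℚ →
        All (λ b → eval 0 ⟪ s , proj₁ a , proj₁ b ℤ.- proj₁ c , proj₁ c ⟫ ℚ.+ eval 0 ⟪ s′ , proj₂ a , proj₂ b ℤ.- proj₂ c , proj₂ c ⟫ ≡ 1ℚ →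
          Any (λ t → ⟪ s , proj₁ a , proj₁ b ℤ.- proj₁ c , proj₁ c ⟫ ≡ x t) table) candidates)
      booleans) booleans) candidates) candidates
    exhaustive = toWitness {a? = All.all? (λ a → All.all? (λ c → All.all? (λ s → All.all? (λ s′ →
        (eval 2 ⟪ s , proj₁ a , + 0 , proj₁ c ⟫ ℚ.+ eval 2 ⟪ s′ , proj₂ a , + 0 , proj₂ c ⟫) ℚ.≟ 1ℚ →-dec
        All.all? (λ b → (eval 0 ⟪ s , proj₁ a , proj₁ b ℤ.- proj₁ c , proj₁ c ⟫ ℚ.+ eval 0 ⟪ s′ , proj₂ a , proj₂ b ℤ.- proj₂ c , proj₂ c ⟫) ℚ.≟ 1ℚ →-dec
          Any.any? (λ t → ⟪ s , proj₁ a , proj₁ b ℤ.- proj₁ c , proj₁ c ⟫ ≟ₑ x t) table) candidates)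
      booleans) booleans) candidates) candidates} _

open CrossRatioTable

-- Cross ratios of GF(4) ⊗ H₂ and bounds for exponents

module ImageCrossRatios where
  open Exponents
  open Entry

  module Complements (S : CommutativeRing 0ℓ 0ℓ) where
    open CommutativeRing S hiding (zero)
    open IntegerSolver S

    sum-complement : ∀ x → x + (1# - x) ≈ 1#
    sum-complement x = solve 2 (λ o x → x :+ (o :- x) := o) refl 1# x

    complement-unique : ∀ {x y} → x + y ≈ 1# → 1# - x ≈ y
    complement-unique {x} {y} e = trans (+-congʳ (sym e)) (solve 2 (λ x y → (x :+ y) :- x := y) refl x y)

    complement-zero : ∀ {x} → 1# - x ≈ 0# → x ≈ 1#
    complement-zero {x} e = trans (solve 2 (λ o x → x := o :- (o :- x)) refl 1# x)
      (trans (+-congˡ (trans (-‿cong e) -0#≈0#)) (+-identityʳ 1#))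
      where open import Algebra.Properties.Ring ring using (-0#≈0#)

    complement-one : ∀ {x} → x ≈ 1# → 1# - x ≈ 0#
    complement-one e = trans (+-congˡ (-‿cong e)) (-‿inverseʳ 1#)

  module _ where
    open IntegerSolver ℚR
    private
      two : ℚ
      two = ι (+ 2)

      double-half : ∀ q → two ℚ.* (½ ℚ.* q) ≡ q
      double-half q = ≡.trans (≡.sym (ℚP.*-assoc two ½ q)) (ℚP.*-identityˡ q)

    half-injective : ∀ {v w} → half v ≡ half w → v ≡ w
    half-injective {p , q} {r , s} e = cong₂ _,_ (component (cong proj₁ e)) (component (cong proj₂ e))
      where
      component : ∀ {p r} → ½ ℚ.* ι p ≡ ½ ℚ.* ι r → p ≡ r
      component {p} {r} e = ι-injective (≡.trans (≡.sym (double-half (ι p))) (≡.trans (cong (two ℚ.*_) e) (double-half (ι r))))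

    private
      cancel : ∀ x y z w u n → ι n ≡ x ℚ.* z ℚ.+ y ℚ.* w →
        (½ ℚ.* x) ℚ.* (½ ℚ.* z) ℚ.+ (½ ℚ.* y) ℚ.* (½ ℚ.* w) ≡ ½ ℚ.* ι u → n ≡ + 2 ℤ.* u
      cancel x y z w u n en e = ι-injective (begin
        ι n  ≡⟨ en ⟩
        x ℚ.* z ℚ.+ y ℚ.* w  ≡⟨ ≡.sym (≡.trans (cong (ℚ._* (x ℚ.* z ℚ.+ y ℚ.* w)) {(two ℚ.* ½) ℚ.* (two ℚ.* ½)} {1ℚ} ≡.refl) (ℚP.*-identityˡ _)) ⟩
        ((two ℚ.* ½) ℚ.* (two ℚ.* ½)) ℚ.* (x ℚ.* z ℚ.+ y ℚ.* w)
          ≡⟨ solve 6 (λ t h x y z w → ((t :* h) :* (t :* h)) :* (x :* z :+ y :* w) := t :* (t :* ((h :* x) :* (h :* z) :+ (h :* y) :* (h :* w)))) ≡.refl two ½ x y z w ⟩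
        two ℚ.* (two ℚ.* ((½ ℚ.* x) ℚ.* (½ ℚ.* z) ℚ.+ (½ ℚ.* y) ℚ.* (½ ℚ.* w)))
          ≡⟨ cong (two ℚ.*_) (≡.trans (cong (two ℚ.*_) e) (double-half (ι u))) ⟩
        two ℚ.* ι u  ≡⟨ ≡.sym (ι-* (+ 2) u) ⟩
        ι (+ 2 ℤ.* u) ∎)
        where open ≡.≡-Reasoning

    half-product : ∀ {v w u} → half v QI.* half w ≡ half u → v · w ≡ twice u
    half-product {p , q} {r , s} {a , b} e = cong₂ _,_
      (cancel (ι p) (ℚ.- ι q) (ι r) (ι s) a (p ℤ.* r ℤ.- q ℤ.* s)
        (≡.trans (ι-+ (p ℤ.* r) (ℤ.- (q ℤ.* s))) (cong₂ ℚ._+_ (ι-* p r) (≡.trans (ι-neg (q ℤ.* s)) (≡.trans (cong ℚ.-_ (ι-* q s)) (ℚP.neg-distribˡ-* (ι q) (ι s))))))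
        (≡.trans (solve 5 (λ h p q r s → (h :* p) :* (h :* r) :+ (h :* (:- q)) :* (h :* s) := (h :* p) :* (h :* r) :- (h :* q) :* (h :* s)) ≡.refl ½ (ι p) (ι q) (ι r) (ι s)) (cong proj₁ e)))
      (cancel (ι p) (ι q) (ι s) (ι r) b (p ℤ.* s ℤ.+ q ℤ.* r)
        (≡.trans (ι-+ (p ℤ.* s) (q ℤ.* r)) (cong₂ ℚ._+_ (ι-* p s) (ι-* q r)))
        (cong proj₂ e))

    half-neg : ∀ v → QI.- half v ≡ half (negᵥ v)
    half-neg (p , q) = cong₂ _,_ (component p) (component q)
      where
      component : ∀ p → ℚ.- (½ ℚ.* ι p) ≡ ½ ℚ.* ι (ℤ.- p)
      component p = ≡.trans (ℚP.neg-distribʳ-* ½ (ι p)) (cong (½ ℚ.*_) (≡.sym (ι-neg p)))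

  module PΩ = PMatrices 𝒢Ω
  module PR = PMatrices ℋR
  module CΩ = Complements ΩR
  module CR = Complements RR

  abstract
    -- Unless x is 1, its GF(4) component differs from 0 and 1 and is therefore ω or ω². The other
    -- component has nine possible values, and the table contains all combinations.
    fundamentalR : ∀ {x} → PR.G x → PR.E (RM.1# RM.- x) → (x ≡ RM.1#) ⊎ ∃ λ t → t ∈ table × (x ≡ valueR t)
    fundamentalR gx (inj₁ z) = inj₁ (RM-≡ (CR.complement-zero z))
    fundamentalR {w , y} (w≢O , gy) (inj₂ (w′≢O , gy′)) = inj₂ (locate w w≢O w′≢O (H₂-fundamental gy gy′ (Complements.sum-complement ℚiR y)))
      where
      locate : ∀ w → w ≢ O → gf4+ I w ≢ O → (∃ λ k → y ≡ half (fundamental k)) → ∃ λ t → t ∈ table × ((w , y) ≡ valueR t)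
      locate O  p q _ = contradiction ≡.refl p
      locate I  p q _ = contradiction ≡.refl q
      locate W  p q (k , e) = let t , t∈ , eg , ev = find (All.lookup (table-covers k) (here ≡.refl))
                              in t , t∈ , cong₂ _,_ (≡.sym eg) (≡.trans e (cong half (≡.sym ev)))
      locate W² p q (k , e) = let t , t∈ , eg , ev = find (All.lookup (table-covers k) (there (here ≡.refl)))
                              in t , t∈ , cong₂ _,_ (≡.sym eg) (≡.trans e (cong half (≡.sym ev)))

  -- The exponent of 2 in the norm of the image in ℚ(i).
  weight : Exponents → ℤ
  weight x = e₁ x ℤ.+ + 2 ℤ.* e₂ x

  module ZS = IntegerSolver ℤP.+-*-commutativeRing

  record Small (p q : ℤ) : Set where
    constructor small
    field
      bounds : p ℤ.≤ + 2 × q ℤ.≤ + 2 × ℤ.- p ℤ.≤ + 2 × ℤ.- q ℤ.≤ + 2 × p ℤ.- q ℤ.≤ + 2 × q ℤ.- p ℤ.≤ + 2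

  open ZS using () renaming (solve to solveℤ; _:+_ to _⊕_; _:*_ to _⊛_; :-_ to ⊖_; con to κ; _:=_ to _≗_)

  private
    bound : ∀ k l {u} → + k ℤ.+ + l ≡ u → u ℤ.≤ + 2 → k ℕ.≤ 2
    bound k l ≡.refl le = ℤP.drop‿+≤+ (ℤP.≤-trans (ℤP.i≤i+j (+ k) (+ l)) le)

    small-both : ∀ k → k ℕ.≤ 2 → (ℤ.- + k , ℤ.- + k) ∈ candidates
    small-both 0 _ = here ≡.refl
    small-both 1 _ = there (there (there (there (there (here ≡.refl)))))
    small-both 2 _ = there (there (there (there (there (there (here ≡.refl))))))
    small-both (suc (suc (suc _))) (s≤s (s≤s ()))

    small-first : ∀ k → k ℕ.≤ 2 → (+ k , + 0) ∈ candidates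
    small-first 0 _ = here ≡.refl
    small-first 1 _ = there (here ≡.refl)
    small-first 2 _ = there (there (here ≡.refl))
    small-first (suc (suc (suc _))) (s≤s (s≤s ()))

    small-second : ∀ k → k ℕ.≤ 2 → (+ 0 , + k) ∈ candidates
    small-second 0 _ = here ≡.refl
    small-second 1 _ = there (there (there (here ≡.refl)))
    small-second 2 _ = there (there (there (there (here ≡.refl))))
    small-second (suc (suc (suc _))) (s≤s (s≤s ()))

  -- The rays have the directions (-1, -1), (1, 0) and (0, 1). For each choice of two rays, one of
  -- p, q, p - q and their negatives equals the parameter of the first point or the sum of both
  -- parameters. So bounds on these six numbers confine the first point; the number 2 comes from the
  -- weights in the table.
  bounded : ∀ {x x′ y y′ p q} → Tropical x x′ → Tropical y y′ → x ℤ.+ y ≡ p → x′ ℤ.+ y′ ≡ q → Small p q → (x , x′) ∈ candidates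
  bounded (both k) (both l) e e′ (small (_ , _ , p- , _)) = small-both k (bound k l
    (≡.trans (solveℤ 2 (λ k l → k ⊕ l ≗ ⊖ ((⊖ k) ⊕ (⊖ l))) ≡.refl (+ k) (+ l)) (cong ℤ.-_ e)) p-)
  bounded (both k) (first l) e e′ (small (_ , _ , _ , q- , _)) = small-both k (bound k 0
    (≡.trans (solveℤ 1 (λ k → k ⊕ κ (+ 0) ≗ ⊖ ((⊖ k) ⊕ κ (+ 0))) ≡.refl (+ k)) (cong ℤ.-_ e′)) q-)
  bounded (both k) (second l) e e′ (small (_ , _ , p- , _)) = small-both k (bound k 0
    (≡.trans (solveℤ 1 (λ k → k ⊕ κ (+ 0) ≗ ⊖ ((⊖ k) ⊕ κ (+ 0))) ≡.refl (+ k)) (cong ℤ.-_ e)) p-)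
  bounded (first k) (both l) e e′ (small (_ , _ , _ , _ , p-q , _)) = small-first k (bound k 0
    (≡.trans (solveℤ 2 (λ k l → k ⊕ κ (+ 0) ≗ (k ⊕ (⊖ l)) ⊕ (⊖ (κ (+ 0) ⊕ (⊖ l)))) ≡.refl (+ k) (+ l)) (cong₂ ℤ._-_ e e′)) p-q)
  bounded (first k) (first l) e e′ (small (p+ , _)) = small-first k (bound k l e p+)
  bounded (first k) (second l) e e′ (small (p+ , _)) = small-first k (bound k 0 e p+)
  bounded (second k) (both l) e e′ (small (_ , _ , _ , _ , _ , q-p)) = small-second k (bound k 0
    (≡.trans (solveℤ 2 (λ k l → k ⊕ κ (+ 0) ≗ (k ⊕ (⊖ l)) ⊕ (⊖ (κ (+ 0) ⊕ (⊖ l)))) ≡.refl (+ k) (+ l)) (cong₂ ℤ._-_ e′ e)) q-p)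
  bounded (second k) (first l) e e′ (small (_ , q+ , _)) = small-second k (bound k 0 e′ q+)
  bounded (second k) (second l) e e′ (small (_ , q+ , _)) = small-second k (bound k l e′ q+)

  small? : ∀ p q → Dec (Small p q)
  small? p q = map′ small Small.bounds ((p ℤ.≤? + 2) ×-dec (q ℤ.≤? + 2) ×-dec (ℤ.- p ℤ.≤? + 2) ×-dec (ℤ.- q ℤ.≤? + 2) ×-dec (p ℤ.- q ℤ.≤? + 2) ×-dec (q ℤ.- p ℤ.≤? + 2))
    where open import Relation.Nullary.Decidable using (map′)

  abstract
    table-small : All (λ t → Small (weight (x t)) (weight (x′ t)) × Small (ℤ.- weight (x t)) (ℤ.- weight (x′ t))) table
    table-small = toWitness {a? = All.all? (λ t → small? (weight (x t)) (weight (x′ t)) ×-dec small? (ℤ.- weight (x t)) (ℤ.- weight (x′ t))) table} _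

  module _ (g h : Fin 3 → ℚ) (a b : Fin 3 → ℤ) (Is-g : ∀ j → Is (g j) (a j) (b j)) (Is-h : ∀ j → Is (h j) (ℤ.- a j) (ℤ.- b j)) where
    Is-monomial : ∀ s e → Is (monomial rawQ 3 g h s e)
      (+ s ℤ.* + 0 ℤ.+ (e zero ℤ.* a zero ℤ.+ (e (suc zero) ℤ.* a (suc zero) ℤ.+ (e (suc (suc zero)) ℤ.* a (suc (suc zero)) ℤ.+ + 0))))
      (+ s ℤ.* + 0 ℤ.+ (e zero ℤ.* b zero ℤ.+ (e (suc zero) ℤ.* b (suc zero) ℤ.+ (e (suc (suc zero)) ℤ.* b (suc (suc zero)) ℤ.+ + 0))))
    Is-monomial s e = Is-* (Is-powN {ℚ.- 1ℚ} {+ 0} {+ 0} (1 , ≡.refl) s)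
      (Is-* (power zero) (Is-* (power (suc zero)) (Is-* (power (suc (suc zero))) Is-1)))
      where
      power : ∀ j → Is (powZ rawQ (g j) (h j) (e j)) (e j ℤ.* a j) (e j ℤ.* b j)
      power j = Is-powZ (Is-g j) (Is-h j) (e j)

  vec₃ : ∀ {X : Set} → X → X → X → Fin 3 → X
  vec₃ a b c zero             = a
  vec₃ a b c (suc zero)       = b
  vec₃ a b c (suc (suc zero)) = c

  abstract
    -- At α = 2 the generators are 2, 1, 3; at α = -2 they are -2, -3, 3; at α = 1/2 they are 1/2,
    -- -1/2, -3/4. The valuations at 2 and 3 thus reveal e₀ and e₂, then e₁ + e₂, and finally the
    -- sum of e₀ and the weight.
    eval₂ : ∀ x → Is (eval 2 x) (e₀ x) (e₂ x)
    eval₂ x = subst₂ (Is (eval 2 x))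
      (solveℤ 4 (λ s a b c → s ⊛ κ (+ 0) ⊕ (a ⊛ κ (+ 1) ⊕ (b ⊛ κ (+ 0) ⊕ (c ⊛ κ (+ 0) ⊕ κ (+ 0)))) ≗ a) ≡.refl (+ toℕ₂ (negative x)) (e₀ x) (e₁ x) (e₂ x))
      (solveℤ 4 (λ s a b c → s ⊛ κ (+ 0) ⊕ (a ⊛ κ (+ 0) ⊕ (b ⊛ κ (+ 0) ⊕ (c ⊛ κ (+ 1) ⊕ κ (+ 0)))) ≗ c) ≡.refl (+ toℕ₂ (negative x)) (e₀ x) (e₁ x) (e₂ x))
      (Is-monomial (gen₁ (point 2)) (recip ∘ gen₁ (point 2)) (vec₃ (+ 1) (+ 0) (+ 0)) (vec₃ (+ 0) (+ 0) (+ 1))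
        (λ { zero → 0 , ≡.refl ; (suc zero) → 0 , ≡.refl ; (suc (suc zero)) → 0 , ≡.refl })
        (λ { zero → 0 , ≡.refl ; (suc zero) → 0 , ≡.refl ; (suc (suc zero)) → 0 , ≡.refl }) (toℕ₂ (negative x)) (exponent x))

    eval₀ : ∀ x → Is (eval 0 x) (e₀ x) (e₁ x ℤ.+ e₂ x)
    eval₀ x = subst₂ (Is (eval 0 x))
      (solveℤ 4 (λ s a b c → s ⊛ κ (+ 0) ⊕ (a ⊛ κ (+ 1) ⊕ (b ⊛ κ (+ 0) ⊕ (c ⊛ κ (+ 0) ⊕ κ (+ 0)))) ≗ a) ≡.refl (+ toℕ₂ (negative x)) (e₀ x) (e₁ x) (e₂ x))
      (solveℤ 4 (λ s a b c → s ⊛ κ (+ 0) ⊕ (a ⊛ κ (+ 0) ⊕ (b ⊛ κ (+ 1) ⊕ (c ⊛ κ (+ 1) ⊕ κ (+ 0)))) ≗ b ⊕ c) ≡.refl (+ toℕ₂ (negative x)) (e₀ x) (e₁ x) (e₂ x))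
      (Is-monomial (gen₁ (point 0)) (recip ∘ gen₁ (point 0)) (vec₃ (+ 1) (+ 0) (+ 0)) (vec₃ (+ 0) (+ 1) (+ 1))
        (λ { zero → 1 , ≡.refl ; (suc zero) → 1 , ≡.refl ; (suc (suc zero)) → 0 , ≡.refl })
        (λ { zero → 1 , ≡.refl ; (suc zero) → 1 , ≡.refl ; (suc (suc zero)) → 0 , ≡.refl }) (toℕ₂ (negative x)) (exponent x))

    eval₁ : ∀ x → Is (eval 1 x) (ℤ.- (e₀ x ℤ.+ weight x)) (e₂ x)
    eval₁ x = subst₂ (Is (eval 1 x))
      (solveℤ 4 (λ s a b c → s ⊛ κ (+ 0) ⊕ (a ⊛ κ (ℤ.- + 1) ⊕ (b ⊛ κ (ℤ.- + 1) ⊕ (c ⊛ κ (ℤ.- + 2) ⊕ κ (+ 0)))) ≗ ⊖ (a ⊕ (b ⊕ κ (+ 2) ⊛ c))) ≡.refl (+ toℕ₂ (negative x)) (e₀ x) (e₁ x) (e₂ x))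
      (solveℤ 4 (λ s a b c → s ⊛ κ (+ 0) ⊕ (a ⊛ κ (+ 0) ⊕ (b ⊛ κ (+ 0) ⊕ (c ⊛ κ (+ 1) ⊕ κ (+ 0)))) ≗ c) ≡.refl (+ toℕ₂ (negative x)) (e₀ x) (e₁ x) (e₂ x))
      (Is-monomial (gen₁ (point 1)) (recip ∘ gen₁ (point 1)) (vec₃ (ℤ.- + 1) (ℤ.- + 1) (ℤ.- + 2)) (vec₃ (+ 0) (+ 0) (+ 1))
        (λ { zero → 0 , ≡.refl ; (suc zero) → 1 , ≡.refl ; (suc (suc zero)) → 1 , ≡.refl })
        (λ { zero → 0 , ≡.refl ; (suc zero) → 1 , ≡.refl ; (suc (suc zero)) → 1 , ≡.refl }) (toℕ₂ (negative x)) (exponent x))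

  norm : ℚ × ℚ → ℚ
  norm (p , q) = p ℚ.* p ℚ.+ q ℚ.* q

  norm-* : ∀ x y → norm (x QI.* y) ≡ norm x ℚ.* norm y
  norm-* (a , b) (c , d) = solve 4 (λ a b c d → (a :* c :- b :* d) :* (a :* c :- b :* d) :+ (a :* d :+ b :* c) :* (a :* d :+ b :* c)
    := (a :* a :+ b :* b) :* (c :* c :+ d :* d)) ≡.refl a b c d
    where open IntegerSolver ℚR

  norm-powN : ∀ x k → norm (powN ℚi-ring x k) ≡ powN rawQ (norm x) k
  norm-powN x zero    = ≡.refl
  norm-powN x (suc k) = ≡.trans (norm-* x (powN ℚi-ring x k)) (cong (norm x ℚ.*_) (norm-powN x k))

  norm-powZ : ∀ x y i → norm (powZ ℚi-ring x y i) ≡ powZ rawQ (norm x) (norm y) i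
  norm-powZ x y (+ k)    = norm-powN x k
  norm-powZ x y -[1+ k ] = norm-powN y (suc k)

  projI : Hom RR ℚiR
  projI = record { φ = proj₂ ; φ-cong = proj₂ ; φ-+ = λ _ _ → ≡.refl ; φ-* = λ _ _ → ≡.refl
    ; φ-neg = λ _ → ≡.refl ; φ-0 = ≡.refl ; φ-1 = ≡.refl }

  abstract
    -- The images i, -1 + i and -2 of the generators have norms 1, 2 and 4.
    norm-monoR : ∀ x → Is (norm (proj₂ (monoR x))) (weight x) (+ 0)
    norm-monoR x = subst (λ q → Is q (weight x) (+ 0)) (≡.sym value) (subst₂ (Is (monomial rawQ 3 (norm ∘ proj₂ ∘ gen₂) (norm ∘ proj₂ ∘ gen₂⁻¹) 0 (exponent x)))
      (solveℤ 4 (λ s a b c → s ⊛ κ (+ 0) ⊕ (a ⊛ κ (+ 0) ⊕ (b ⊛ κ (+ 1) ⊕ (c ⊛ κ (+ 2) ⊕ κ (+ 0)))) ≗ b ⊕ κ (+ 2) ⊛ c) ≡.refl (+ 0) (e₀ x) (e₁ x) (e₂ x))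
      (solveℤ 4 (λ s a b c → s ⊛ κ (+ 0) ⊕ (a ⊛ κ (+ 0) ⊕ (b ⊛ κ (+ 0) ⊕ (c ⊛ κ (+ 0) ⊕ κ (+ 0)))) ≗ κ (+ 0)) ≡.refl (+ 0) (e₀ x) (e₁ x) (e₂ x))
      (Is-monomial (norm ∘ proj₂ ∘ gen₂) (norm ∘ proj₂ ∘ gen₂⁻¹) (vec₃ (+ 0) (+ 1) (+ 2)) (vec₃ (+ 0) (+ 0) (+ 0))
        (λ { zero → 0 , ≡.refl ; (suc zero) → 0 , ≡.refl ; (suc (suc zero)) → 0 , ≡.refl })
        (λ { zero → 0 , ≡.refl ; (suc zero) → 0 , ≡.refl ; (suc (suc zero)) → 0 , ≡.refl }) 0 (exponent x)))
      where
      σ : ℚ × ℚ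
      σ = powN ℚi-ring (QI.- QI.1#) (toℕ₂ (negative x))
      P : Fin 3 → ℚ × ℚ
      P j = powZ ℚi-ring (proj₂ (gen₂ j)) (proj₂ (gen₂⁻¹ j)) (exponent x j)
      norm-σ : ∀ b → norm (powN ℚi-ring (QI.- QI.1#) (toℕ₂ b)) ≡ 1ℚ
      norm-σ false = ≡.refl
      norm-σ true  = ≡.refl
      value : norm (proj₂ (monoR x)) ≡ monomial rawQ 3 (norm ∘ proj₂ ∘ gen₂) (norm ∘ proj₂ ∘ gen₂⁻¹) 0 (exponent x)
      value = ≡.trans (cong norm (Hom.φ-monomial projI 3 {gen₂} {gen₂⁻¹} {proj₂ ∘ gen₂} {proj₂ ∘ gen₂⁻¹} (λ _ → ≡.refl) (λ _ → ≡.refl) (toℕ₂ (negative x)) (exponent x)))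
        (≡.trans (norm-* σ (P zero QI.* (P (suc zero) QI.* (P (suc (suc zero)) QI.* QI.1#))))
          (cong₂ ℚ._*_ (norm-σ (negative x)) (≡.trans (norm-* (P zero) (P (suc zero) QI.* (P (suc (suc zero)) QI.* QI.1#)))
            (cong₂ ℚ._*_ (norm-powZ (proj₂ (gen₂ zero)) (proj₂ (gen₂⁻¹ zero)) (e₀ x)) (≡.trans (norm-* (P (suc zero)) (P (suc (suc zero)) QI.* QI.1#))
              (cong₂ ℚ._*_ (norm-powZ (proj₂ (gen₂ (suc zero))) (proj₂ (gen₂⁻¹ (suc zero))) (e₁ x)) (≡.trans (norm-* (P (suc (suc zero))) QI.1#)
                (cong₂ ℚ._*_ (norm-powZ (proj₂ (gen₂ (suc (suc zero)))) (proj₂ (gen₂⁻¹ (suc (suc zero)))) (e₂ x)) ≡.refl))))))))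

open ImageCrossRatios

-- Lifting cross ratios from GF(4) ⊗ H₂ to Ω

module CrossRatioLifting where
  open Exponents
  open Entry
  open MΩ using () renaming (mono₃ to monoΩ; mono₃-* to monoΩ-*; mono₃-neg to monoΩ-neg; mono₃-one to monoΩ-one; mono₃-normal to monoΩ-normal)

  open ZS using () renaming (solve to solveℤ; _:+_ to _⊕_; _:*_ to _⊛_; :-_ to ⊖_; con to κ; _:=_ to _≗_)

  module _ {S : CommutativeRing 0ℓ 0ℓ} (𝒢 : UnitGroup S) where
    open CommutativeRing S hiding (zero)
    open UnitGroup 𝒢

    G-powN : ∀ {g} k → G g → G (powN rawRing g k)
    G-powN zero    g = G-1
    G-powN (suc k) g = G-* g (G-powN k g)

    G-powZ : ∀ {g h} i → G g → G h → G (powZ rawRing g h i)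
    G-powZ (+ k)    g h = G-powN k g
    G-powZ -[1+ k ] g h = G-powN (suc k) h

    G-prodFin : ∀ m {f : Fin m → Carrier} → (∀ j → G (f j)) → G (prodFin rawRing m f)
    G-prodFin zero    g = G-1
    G-prodFin (suc m) g = G-* (g zero) (G-prodFin m (g ∘ suc))

    G-monomial : ∀ m {gen ginv} → (∀ j → G (gen j)) → (∀ j → G (ginv j)) → ∀ s e → G (monomial rawRing m gen ginv s e)
    G-monomial m g h s e = G-* (G-powN s (G-neg G-1)) (G-prodFin m (λ j → G-powZ (e j) (g j) (h j)))

  vec₂ : ∀ {X : Set} → X → X → Fin 2 → X
  vec₂ a b zero       = a
  vec₂ a b (suc zero) = b

  gen₂-G : ∀ j → PR.G (gen₂ j)
  gen₂-G zero             = (λ ()) , (0 , vec₂ (+ 1) (+ 0) , ≡.refl)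
  gen₂-G (suc zero)       = (λ ()) , (1 , vec₂ (+ 0) (+ 1) , ≡.refl)
  gen₂-G (suc (suc zero)) = (λ ()) , (0 , vec₂ (ℤ.- + 1) (+ 2) , ≡.refl)

  gen₂⁻¹-G : ∀ j → PR.G (gen₂⁻¹ j)
  gen₂⁻¹-G zero             = (λ ()) , (1 , vec₂ (+ 1) (+ 0) , ≡.refl)
  gen₂⁻¹-G (suc zero)       = (λ ()) , (1 , vec₂ (+ 0) (ℤ.- + 1) , ≡.refl)
  gen₂⁻¹-G (suc (suc zero)) = (λ ()) , (0 , vec₂ (+ 1) (ℤ.- + 2) , ≡.refl)

  abstract
    monoR-G : ∀ x → PR.G (monoR x)
    monoR-G x = G-monomial ℋR 3 {gen₂} {gen₂⁻¹} gen₂-G gen₂⁻¹-G (toℕ₂ (negative x)) (exponent x)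

    project-G : ∀ {z} → PΩ.G z → PR.G (proj₂ z)
    project-G gz = let x , e = monoΩ-normal gz in PR.G-resp (RM.sym (RM.trans (proj₂ e) (monoΩ-R x))) (monoR-G x)

  private
    drop-middle : ∀ s a b c → eval 2 ⟪ s , a , b , c ⟫ ≡ eval 2 ⟪ s , a , + 0 , c ⟫
    drop-middle s a b c = cong (λ t → powN rawQ (ℚ.- 1ℚ) (toℕ₂ s) ℚ.* (powZ rawQ (gen₁ (point 2) zero) (recip (gen₁ (point 2) zero)) a ℚ.*
      (t ℚ.* (powZ rawQ (gen₁ (point 2) (suc (suc zero))) (recip (gen₁ (point 2) (suc (suc zero)))) c ℚ.* 1ℚ)))) (ones b)
      where
      ones : ∀ i → powZ rawQ (gen₁ (point 2) (suc zero)) (recip (gen₁ (point 2) (suc zero))) i ≡ 1ℚ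
      ones (+ k)    = Powers.powN-1 ℚR k
      ones -[1+ k ] = Powers.powN-1 ℚR (suc k)

    norm≢0 : ∀ {y} → PartialField.InG H₂ y → norm y ≢ 0ℚ
    norm≢0 {y} gy z = contradiction
      (≡.trans (≡.sym (≡.trans (norm-* y w) (≡.trans (cong (ℚ._* norm w) z) (ℚP.*-zeroˡ (norm w))))) (cong norm (proj₂ (proj₂ inverse)))) (λ ())
      where
      inverse = UnitGroup.G-inv GH.group gy
      w = proj₁ inverse

    weight-unique : ∀ {y p q} → PartialField.InG H₂ y → Is (norm y) p (+ 0) → Is (norm y) q (+ 0) → p ≡ q
    weight-unique gy i j = Is-unique i j (norm≢0 gy)

    same-weight : ∀ x y → monoR x ≡ monoR y → weight x ≡ weight y
    same-weight x y e = weight-unique {proj₂ (monoR x)} {weight x} {weight y} (proj₂ (monoR-G x)) (norm-monoR x)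
      (subst (λ r → Is (norm (proj₂ r)) (weight y) (+ 0)) (≡.sym e) (norm-monoR y))

    -- The weight depends on the image only, so it is as small as in the table. It is the sum of e₁
    -- + e₂ and e₂, and its negative is the sum of e₀ and the exponent of 2 at α = 1/2. All of
    -- these, paired with their counterparts for `y`, lie on tropical lines, so `bounded` leaves
    -- finitely many exponents, and `exhaustive` has tested these at α = 2 and α = -2.
    determined : ∀ x y → monoΩ x ΩM.+ monoΩ y ΩM.≈ ΩM.1# → ∀ t → t ∈ table → monoR x ≡ valueR t → ∃ λ u → u ∈ table × (x ≡ Entry.x u)
    determined ex@(⟪ s , a , b , c ⟫) ey@(⟪ s′ , a′ , b′ , c′ ⟫) e t t∈ et =
      let u , u∈ , eu = find (All.lookup (All.lookup (All.lookup (All.lookup (All.lookup exhaustive inA) inC) (bool s)) (bool s′) at₂) inB at₀)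
      in u , u∈ , ≡.trans (≡.sym (middle s a b c)) eu
      where
      at : ∀ n → eval n ex ℚ.+ eval n ey ≡ 1ℚ
      at n = ≡.trans (≡.sym (cong₂ ℚ._+_ (monoΩ-eval n ex) (monoΩ-eval n ey))) (proj₁ e n)
      in-R : monoR ex RM.+ monoR ey ≡ RM.1#
      in-R = RM-≡ (RM.trans (RM.sym (RM.+-cong (monoΩ-R ex) (monoΩ-R ey))) (proj₂ e))
      sum-t : monoR (Entry.x t) RM.+ monoR (x′ t) ≡ RM.1#
      sum-t = RM-≡ (RM.trans (RM.sym (RM.+-cong (monoΩ-R (Entry.x t)) (monoΩ-R (x′ t)))) (proj₂ (All.lookup monoΩ-sums t∈)))
      x-t : monoR ex ≡ monoR (Entry.x t)
      x-t = ≡.trans et (≡.sym (All.lookup table-values t∈))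
      y-t : monoR ey ≡ monoR (x′ t)
      y-t = ≡.trans (≡.sym (RM-≡ (CR.complement-unique {monoR ex} {monoR ey} (RM.reflexive in-R)))) (≡.trans (cong (λ r → RM.1# RM.- r) x-t) (RM-≡ (CR.complement-unique {monoR (Entry.x t)} {monoR (x′ t)} (RM.reflexive sum-t))))
      wx : weight ex ≡ weight (Entry.x t)
      wx = same-weight ex (Entry.x t) x-t
      wy : weight ey ≡ weight (x′ t)
      wy = same-weight ey (x′ t) y-t
      smalls : Small (weight ex) (weight ey) × Small (ℤ.- weight ex) (ℤ.- weight ey)
      smalls = subst₂ (λ p q → Small p q × Small (ℤ.- p) (ℤ.- q)) (≡.sym wx) (≡.sym wy) (All.lookup table-small t∈)
      tropA : Tropical a a′
      tropA = proj₁ (Is-tropical (eval₂ ex) (eval₂ ey) (at 2))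
      tropC : Tropical c c′
      tropC = proj₂ (Is-tropical (eval₂ ex) (eval₂ ey) (at 2))
      tropB : Tropical (b ℤ.+ c) (b′ ℤ.+ c′)
      tropB = proj₂ (Is-tropical (eval₀ ex) (eval₀ ey) (at 0))
      tropD : Tropical (ℤ.- (a ℤ.+ weight ex)) (ℤ.- (a′ ℤ.+ weight ey))
      tropD = proj₁ (Is-tropical (eval₁ ex) (eval₁ ey) (at 1))
      split₁ : ∀ b c → (b ℤ.+ c) ℤ.+ c ≡ b ℤ.+ + 2 ℤ.* c
      split₁ b c = solveℤ 2 (λ b c → (b ⊕ c) ⊕ c ≗ b ⊕ κ (+ 2) ⊛ c) ≡.refl b c
      split₂ : ∀ a w → a ℤ.+ ℤ.- (a ℤ.+ w) ≡ ℤ.- w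
      split₂ a w = solveℤ 2 (λ a w → a ⊕ ⊖ (a ⊕ w) ≗ ⊖ w) ≡.refl a w
      inB : (b ℤ.+ c , b′ ℤ.+ c′) ∈ candidates
      inB = bounded tropB tropC (split₁ b c) (split₁ b′ c′) (proj₁ smalls)
      inC : (c , c′) ∈ candidates
      inC = bounded tropC tropB (≡.trans (ℤP.+-comm c (b ℤ.+ c)) (split₁ b c)) (≡.trans (ℤP.+-comm c′ (b′ ℤ.+ c′)) (split₁ b′ c′)) (proj₁ smalls)
      inA : (a , a′) ∈ candidates
      inA = bounded tropA tropD (split₂ a (weight ex)) (split₂ a′ (weight ey)) (proj₂ smalls)
      bool : ∀ s → s ∈ booleans
      bool false = here ≡.refl
      bool true  = there (here ≡.refl)
      middle : ∀ s a b c → ⟪ s , a , (b ℤ.+ c) ℤ.- c , c ⟫ ≡ ⟪ s , a , b , c ⟫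
      middle s a b c = cong (λ t → ⟪ s , a , t , c ⟫) (solveℤ 2 (λ b c → (b ⊕ c) ⊕ (⊖ c) ≗ b) ≡.refl b c)
      at₂ : eval 2 ⟪ s , a , + 0 , c ⟫ ℚ.+ eval 2 ⟪ s′ , a′ , + 0 , c′ ⟫ ≡ 1ℚ
      at₂ = ≡.trans (≡.sym (cong₂ ℚ._+_ (drop-middle s a b c) (drop-middle s′ a′ b′ c′))) (at 2)
      at₀ : eval 0 ⟪ s , a , (b ℤ.+ c) ℤ.- c , c ⟫ ℚ.+ eval 0 ⟪ s′ , a′ , (b′ ℤ.+ c′) ℤ.- c′ , c′ ⟫ ≡ 1ℚ
      at₀ = ≡.trans (cong₂ (λ x y → eval 0 x ℚ.+ eval 0 y) (middle s a b c) (middle s′ a′ b′ c′)) (at 0)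

  abstract
    fundamentalΩ : ∀ {z} → PΩ.G z → PΩ.E (ΩM.1# ΩM.- z) → (z ΩM.≈ ΩM.1#) ⊎ ∃ λ t → t ∈ table × (z ΩM.≈ monoΩ (Entry.x t))
    fundamentalΩ {z} gz (inj₁ e) = inj₁ (CΩ.complement-zero {z} e)
    fundamentalΩ {z} gz (inj₂ gw) = combine (monoΩ-normal gz) (monoΩ-normal gw)
        (fundamentalR {proj₂ z} (project-G {z} gz) (inj₂ (project-G {ΩM.1# ΩM.- z} gw)))
      where
      sum : ∀ ex ey → z ΩM.≈ monoΩ ex → (ΩM.1# ΩM.- z) ΩM.≈ monoΩ ey → monoΩ ex ΩM.+ monoΩ ey ΩM.≈ ΩM.1#
      sum ex ey px py = ΩM.trans {monoΩ ex ΩM.+ monoΩ ey} {z ΩM.+ (ΩM.1# ΩM.- z)} {ΩM.1#}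
        (ΩM.sym {z ΩM.+ (ΩM.1# ΩM.- z)} {monoΩ ex ΩM.+ monoΩ ey} (ΩM.+-cong {z} {monoΩ ex} {ΩM.1# ΩM.- z} {monoΩ ey} px py)) (CΩ.sum-complement z)
      value : ∀ ex t → z ΩM.≈ monoΩ ex → proj₂ z ≡ valueR t → monoR ex ≡ valueR t
      value ex t px et = ≡.trans (≡.sym (RM-≡ {proj₂ z} {monoR ex} (RM.trans {proj₂ z} {proj₂ (monoΩ ex)} {monoR ex} (proj₂ px) (monoΩ-R ex)))) et
      combine : (∃ λ x → z ΩM.≈ monoΩ x) → (∃ λ y → (ΩM.1# ΩM.- z) ΩM.≈ monoΩ y) →
        (proj₂ z ≡ RM.1#) ⊎ (∃ λ t → t ∈ table × (proj₂ z ≡ valueR t)) →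
        (z ΩM.≈ ΩM.1#) ⊎ ∃ λ t → t ∈ table × (z ΩM.≈ monoΩ (Entry.x t))
      combine _ _ (inj₁ one) = contradiction (CR.complement-one {proj₂ z} (RM.reflexive one)) (PR.G-≉0 {RM.1# RM.- proj₂ z} (project-G {ΩM.1# ΩM.- z} gw))
      combine (ex , px) (ey , py) (inj₂ (t , t∈ , et)) =
        let u , u∈ , eu = determined ex ey (sum ex ey px py) t t∈ (value ex t px et)
        in inj₂ (u , u∈ , ≡.subst (λ y → z ΩM.≈ monoΩ y) eu px)

    complement-E : ∀ {t} → t ∈ table → PΩ.E (ΩM.1# ΩM.- monoΩ (Entry.x t))
    complement-E {t} t∈ = inj₂ (PΩ.G-resp {monoΩ (x′ t)} {ΩM.1# ΩM.- monoΩ (Entry.x t)} (ΩM.sym {ΩM.1# ΩM.- monoΩ (Entry.x t)} {monoΩ (x′ t)} (CΩ.complement-unique {monoΩ (Entry.x t)} {monoΩ (x′ t)} (All.lookup monoΩ-sums t∈))) (monoΩ-G (x′ t)))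

    table-value : ∀ {t} → t ∈ table → proj₂ (monoΩ (Entry.x t)) ≡ valueR t
    table-value {t} t∈ = ≡.trans (RM-≡ {proj₂ (monoΩ (Entry.x t))} {monoR (Entry.x t)} (monoΩ-R (Entry.x t))) (All.lookup table-values t∈)

    private
      E-one : ∀ {z} → z ΩM.≈ ΩM.1# → PΩ.E (ΩM.1# ΩM.- z)
      E-one {z} e = inj₁ (CΩ.complement-one {z} e)

      E-complement : ∀ {z w} → z ΩM.≈ w → PΩ.E (ΩM.1# ΩM.- z) → PΩ.E (ΩM.1# ΩM.- w)
      E-complement {z} {w} e = PΩ.E-resp {ΩM.1# ΩM.- z} {ΩM.1# ΩM.- w} (ΩM.+-congˡ {ΩM.1#} {ΩM.- z} {ΩM.- w} (ΩM.-‿cong {z} {w} e))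

      E-entry : ∀ {z t} → t ∈ table → z ΩM.≈ monoΩ (Entry.x t) → PΩ.E (ΩM.1# ΩM.- z)
      E-entry {z} {t} t∈ e = E-complement {monoΩ (Entry.x t)} {z} (ΩM.sym {z} {monoΩ (Entry.x t)} e) (complement-E {t} t∈)

      value-of : ∀ {z t} → t ∈ table → z ΩM.≈ monoΩ (Entry.x t) → proj₂ z ≡ valueR t
      value-of {z} {t} t∈ e = ≡.trans (RM-≡ {proj₂ z} {proj₂ (monoΩ (Entry.x t))} (proj₂ e)) (table-value {t} t∈)

      value-one : ∀ {z} → z ΩM.≈ ΩM.1# → proj₂ z ≡ RM.1#
      value-one {z} e = RM-≡ {proj₂ z} {RM.1#} (proj₂ e)

    crossLift : ∀ {x} → PR.G x → PR.E (RM.1# RM.- x) → ∃ λ z → PΩ.G z × PΩ.E (ΩM.1# ΩM.- z) × (proj₂ z RM.≈ x)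
    crossLift {x} gx e = choose (fundamentalR {x} gx e)
      where
      choose : (x ≡ RM.1#) ⊎ (∃ λ t → t ∈ table × (x ≡ valueR t)) → ∃ λ z → PΩ.G z × PΩ.E (ΩM.1# ΩM.- z) × (proj₂ z RM.≈ x)
      choose (inj₁ one) = ΩM.1# , PΩ.G-1 , E-one {ΩM.1#} (ΩM.refl {ΩM.1#}) , RM.reflexive (≡.sym one)
      choose (inj₂ (t , t∈ , v)) = monoΩ (Entry.x t) , monoΩ-G (Entry.x t) , complement-E {t} t∈ , RM.reflexive (≡.trans (table-value {t} t∈) (≡.sym v))

    private
      Classified : ΩM.Carrier → Set
      Classified z = (z ΩM.≈ ΩM.1#) ⊎ ∃ λ t → t ∈ table × (z ΩM.≈ monoΩ (Entry.x t))

      ClassifiedR : RM.Carrier → Set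
      ClassifiedR x = (x ≡ RM.1#) ⊎ ∃ λ t → t ∈ table × (x ≡ valueR t)

      one≢entry : ∀ {t} → t ∈ table → valueR t ≢ RM.1#
      one≢entry t∈ e = All.lookup table-≢I t∈ (cong proj₁ e)

      values-injective : ∀ {t u} → t ∈ table → u ∈ table → valueR t ≡ valueR u → Entry.x t ≡ Entry.x u
      values-injective {t} {u} t∈ u∈ e = All.lookup (All.lookup table-injective t∈) u∈ (cong proj₁ e , half-injective {v t} {v u} (cong proj₂ e))

      values-inverse : ∀ {t u} → t ∈ table → u ∈ table → valueR t RM.* valueR u ≡ RM.1# → mulₑ (Entry.x t) (Entry.x u) ≡ oneₑ
      values-inverse {t} {u} t∈ u∈ e = All.lookup (All.lookup table-inverses t∈) u∈ (cong proj₁ e , half-product {v t} {v u} {+ 2 , + 0} (cong proj₂ e))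

      values-product : ∀ {t u r} → t ∈ table → u ∈ table → r ∈ table → valueR t RM.* valueR u ≡ valueR r → mulₑ (Entry.x t) (Entry.x u) ≡ Entry.x r
      values-product {t} {u} {r} t∈ u∈ r∈ e = All.lookup (All.lookup (All.lookup table-products t∈) u∈) r∈ (cong proj₁ e , half-product {v t} {v u} {v r} (cong proj₂ e))

      values-negative : ∀ {t u} → t ∈ table → u ∈ table → RM.- valueR t ≡ valueR u → negₑ (Entry.x t) ≡ Entry.x u
      values-negative {t} {u} t∈ u∈ e = All.lookup (All.lookup table-negatives t∈) u∈
        (cong proj₁ e , half-injective {negᵥ (v t)} {v u} (≡.trans (≡.sym (half-neg (v t))) (cong proj₂ e)))

    crossUnique : ∀ {z w} → PΩ.G z → PΩ.E (ΩM.1# ΩM.- z) → PΩ.G w → PΩ.E (ΩM.1# ΩM.- w) → proj₂ z RM.≈ proj₂ w → z ΩM.≈ w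
    crossUnique {z} {w} gz ez gw ew e = compare (fundamentalΩ {z} gz ez) (fundamentalΩ {w} gw ew)
      where
      eq : proj₂ z ≡ proj₂ w
      eq = RM-≡ {proj₂ z} {proj₂ w} e
      compare : Classified z → Classified w → z ΩM.≈ w
      compare (inj₁ a) (inj₁ b) = ΩM.trans {z} {ΩM.1#} {w} a (ΩM.sym {w} {ΩM.1#} b)
      compare (inj₁ a) (inj₂ (u , u∈ , b)) = contradiction (≡.trans (≡.sym (value-of {w} {u} u∈ b)) (≡.trans (≡.sym eq) (value-one {z} a))) (one≢entry {u} u∈)
      compare (inj₂ (t , t∈ , a)) (inj₁ b) = contradiction (≡.trans (≡.sym (value-of {z} {t} t∈ a)) (≡.trans eq (value-one {w} b))) (one≢entry {t} t∈)
      compare (inj₂ (t , t∈ , a)) (inj₂ (u , u∈ , b)) = ΩM.trans {z} {monoΩ (Entry.x u)} {w}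
        (≡.subst (λ y → z ΩM.≈ monoΩ y) (values-injective {t} {u} t∈ u∈ (≡.trans (≡.sym (value-of {z} {t} t∈ a)) (≡.trans eq (value-of {w} {u} u∈ b)))) a)
        (ΩM.sym {w} {monoΩ (Entry.x u)} b)

    private
      product-entry : ∀ {z w} x y u → z ΩM.≈ monoΩ x → w ΩM.≈ monoΩ y → mulₑ x y ≡ u → z ΩM.* w ΩM.≈ monoΩ u
      product-entry {z} {w} x y u a b ≡.refl = ΩM.trans {z ΩM.* w} {monoΩ x ΩM.* monoΩ y} {monoΩ (mulₑ x y)}
        (ΩM.*-cong {z} {monoΩ x} {w} {monoΩ y} a b) (ΩM.sym {monoΩ (mulₑ x y)} {monoΩ x ΩM.* monoΩ y} (monoΩ-* x y))

      negative-entry : ∀ {z} x u → z ΩM.≈ monoΩ x → negₑ x ≡ u → ΩM.- z ΩM.≈ monoΩ u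
      negative-entry {z} x u a ≡.refl = ΩM.trans {ΩM.- z} {ΩM.- monoΩ x} {monoΩ (negₑ x)} (ΩM.-‿cong {z} {monoΩ x} a)
        (ΩM.sym {monoΩ (negₑ x)} {ΩM.- monoΩ x} (monoΩ-neg x))

    cross-product : ∀ {z w} → PΩ.G z → PΩ.E (ΩM.1# ΩM.- z) → PΩ.G w → PΩ.E (ΩM.1# ΩM.- w) →
      PR.E (RM.1# RM.- proj₂ (z ΩM.* w)) → PΩ.E (ΩM.1# ΩM.- z ΩM.* w)
    cross-product {z} {w} gz ez gw ew e = multiply (fundamentalΩ {z} gz ez) (fundamentalΩ {w} gw ew)
      (fundamentalR {proj₂ z RM.* proj₂ w} (PR.G-* {proj₂ z} {proj₂ w} (project-G {z} gz) (project-G {w} gw)) e)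
      where
      multiply : Classified z → Classified w → ClassifiedR (proj₂ z RM.* proj₂ w) → PΩ.E (ΩM.1# ΩM.- z ΩM.* w)
      multiply (inj₁ a) _ _ = E-complement {w} {z ΩM.* w} (ΩM.sym {z ΩM.* w} {w} (ΩM.trans {z ΩM.* w} {ΩM.1# ΩM.* w} {w} (ΩM.*-congʳ {w} {z} {ΩM.1#} a) (ΩM.*-identityˡ w))) ew
      multiply (inj₂ _) (inj₁ b) _ = E-complement {z} {z ΩM.* w} (ΩM.sym {z ΩM.* w} {z} (ΩM.trans {z ΩM.* w} {z ΩM.* ΩM.1#} {z} (ΩM.*-congˡ {z} {w} {ΩM.1#} b) (ΩM.*-identityʳ z))) ez
      multiply (inj₂ (t , t∈ , a)) (inj₂ (u , u∈ , b)) classified = finish classified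
        where
        values : valueR t RM.* valueR u ≡ proj₂ z RM.* proj₂ w
        values = ≡.sym (cong₂ RM._*_ (value-of {z} {t} t∈ a) (value-of {w} {u} u∈ b))
        finish : ClassifiedR (proj₂ z RM.* proj₂ w) → PΩ.E (ΩM.1# ΩM.- z ΩM.* w)
        finish (inj₁ one) = E-one {z ΩM.* w} (ΩM.trans {z ΩM.* w} {monoΩ oneₑ} {ΩM.1#}
          (product-entry {z} {w} (Entry.x t) (Entry.x u) oneₑ a b (values-inverse {t} {u} t∈ u∈ (≡.trans values one))) monoΩ-one)
        finish (inj₂ (r , r∈ , ev)) = E-entry {z ΩM.* w} {r} r∈
          (product-entry {z} {w} (Entry.x t) (Entry.x u) (Entry.x r) a b (values-product {t} {u} {r} t∈ u∈ r∈ (≡.trans values ev)))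

    private
      minus-minus : ∀ (r : RM.Carrier) → RM.1# RM.+ r RM.≈ RM.1# RM.- (RM.- r)
      minus-minus r = RM.+-congˡ {RM.1#} {r} {RM.- (RM.- r)} (RM.sym {RM.- (RM.- r)} {r} (-‿involutive r))
        where open import Algebra.Properties.Ring RM.ring using (-‿involutive)

    cross-negation : ∀ {z} → PΩ.G z → PΩ.E (ΩM.1# ΩM.- z) → PR.E (RM.1# RM.+ proj₂ z) → PΩ.E (ΩM.1# ΩM.+ z)
    cross-negation {z} gz ez e = negate (fundamentalΩ {z} gz ez)
      (fundamentalR {RM.- proj₂ z} (PR.G-neg {proj₂ z} (project-G {z} gz)) (PR.E-resp {RM.1# RM.+ proj₂ z} {RM.1# RM.- (RM.- proj₂ z)} (minus-minus (proj₂ z)) e))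
      where
      open import Algebra.Properties.Ring ΩM.ring using (-‿involutive)
      -- 1 + 1 is (0, 2), which is zero in GF(4) but not in ℚ(i) and hence is no element of the
      -- product; this excludes z = 1.
      two : ¬ PR.E (RM.1# RM.+ RM.1#)
      two (inj₁ (_ , ()))
      two (inj₂ (ne , _)) = ne ≡.refl
      negate : Classified z → ClassifiedR (RM.- proj₂ z) → PΩ.E (ΩM.1# ΩM.+ z)
      negate (inj₁ a) _ = contradiction (PR.E-resp {RM.1# RM.+ proj₂ z} {RM.1# RM.+ RM.1#} (RM.+-congˡ {RM.1#} {proj₂ z} {RM.1#} (proj₂ a)) e) two
      negate (inj₂ (t , t∈ , a)) (inj₁ one) = contradiction (≡.trans (≡.sym (cong proj₁ (value-of {z} {t} t∈ a))) (cong proj₁ one)) (All.lookup table-≢I t∈)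
      negate (inj₂ (t , t∈ , a)) (inj₂ (u , u∈ , ev)) = PΩ.E-resp {ΩM.1# ΩM.- (ΩM.- z)} {ΩM.1# ΩM.+ z}
        (ΩM.+-congˡ {ΩM.1#} {ΩM.- (ΩM.- z)} {z} (-‿involutive z))
        (E-entry {ΩM.- z} {u} u∈ (negative-entry {z} (Entry.x t) (Entry.x u) a
          (values-negative {t} {u} t∈ u∈ (≡.trans (cong (λ r → RM.- r) (≡.sym (value-of {z} {t} t∈ a))) ev))))

  module _ where
    private
      Liftable : RM.Carrier → Set
      Liftable r = ∃ λ z → PΩ.G z × (proj₂ z ≡ r)

      liftable-* : ∀ {r s} → Liftable r → Liftable s → Liftable (r RM.* s)
      liftable-* (z , gz , ez) (w , gw , ew) = z ΩM.* w , PΩ.G-* gz gw , cong₂ RM._*_ ez ew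

      from : ∀ x {r} → monoR x ≡ r → Liftable r
      from x e = monoΩ x , monoΩ-G x , ≡.trans (RM-≡ (monoΩ-R x)) e

      pow : ∀ {y} k → Liftable (I , y) → Liftable (I , powN ℚi-ring y k)
      pow zero    l = ΩM.1# , PΩ.G-1 , ≡.refl
      pow (suc k) l = liftable-* l (pow k l)

      powI : ∀ {y y′} i → Liftable (I , y) → Liftable (I , y′) → Liftable (I , powZ ℚi-ring y y′ i)
      powI (+ k)    l l′ = pow k l
      powI -[1+ k ] l l′ = pow (suc k) l′

      scalar : ∀ w → w ≢ O → Liftable (w , QI.1#)
      scalar O  ne = contradiction ≡.refl ne
      scalar I  ne = ΩM.1# , PΩ.G-1 , ≡.refl
      -- The Gaussian component of α⁴ and of α⁸ is 1, while ω⁴ = ω and ω⁸ = ω².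
      scalar W  ne = from ⟪ false , + 4 , + 0 , + 0 ⟫ ≡.refl
      scalar W² ne = from ⟪ false , + 8 , + 0 , + 0 ⟫ ≡.refl

      gaussian : ∀ {y} → PartialField.InG H₂ y → Liftable (I , y)
      gaussian (s , e , ≡.refl) = liftable-* (pow s (from ⟪ true , + 0 , + 0 , + 0 ⟫ ≡.refl))
        -- The powers α⁻³ and α³ project to (1, i) and (1, -i), because ω³ = 1.
        (liftable-* (powI (e zero) (from ⟪ false , ℤ.- + 3 , + 0 , + 0 ⟫ ≡.refl) (from ⟪ false , + 3 , + 0 , + 0 ⟫ ≡.refl))
          -- - α⁴ (α - 1) projects to (1, 1 - i), because ω⁴ ω² = 1 and - (i - 1) = 1 - i.
          (liftable-* (powI (e (suc zero)) (from ⟪ true , + 4 , + 1 , + 0 ⟫ ≡.refl) (from ⟪ true , ℤ.- + 4 , ℤ.- + 1 , + 0 ⟫ ≡.refl))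
            (ΩM.1# , PΩ.G-1 , ≡.refl)))

    abstract
      lift-unit : ∀ {r} → PR.G r → ∃ λ z → PΩ.G z × (proj₂ z RM.≈ r)
      lift-unit {w , y} (ne , gy) = let z , gz , e = liftable-* (scalar w ne) (gaussian gy)
        in z , gz , RM.reflexive (≡.trans e (cong₂ _,_ (≡.trans (CommutativeRing.*-comm GF4R w I) (CommutativeRing.*-identityˡ GF4R w)) (QI.*-identityˡ y)))

  lifting : Lifting ΩR RR 𝒢Ω ℋR
  lifting = record
    { π = proj₂ ; π-cong = proj₂ ; π-+ = λ _ _ → RM.refl ; π-* = λ _ _ → RM.refl ; π-neg = λ _ → RM.refl
    ; π-0 = RM.refl ; π-1 = RM.refl ; π-G = project-G ; section = lift-unit
    ; cross-lift = crossLift ; cross-unique = crossUnique ; cross-* = cross-product ; cross-neg = cross-negation }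

open CrossRatioLifting

-- Polynomials over ℚ, fractions and their values

module RationalFunctions where
  evalℚ : Poly → ℚ → ℚ
  evalℚ []      a = 0ℚ
  evalℚ (c ∷ p) a = c ℚ.+ a ℚ.* evalℚ p a

  module _ where
    open IntegerSolver ℚR

    evalℚ-add : ∀ p q a → evalℚ (padd p q) a ≡ evalℚ p a ℚ.+ evalℚ q a
    evalℚ-add []      q       a = ≡.sym (ℚP.+-identityˡ (evalℚ q a))
    evalℚ-add (c ∷ p) []      a = ≡.sym (ℚP.+-identityʳ (c ℚ.+ a ℚ.* evalℚ p a))
    evalℚ-add (c ∷ p) (d ∷ q) a = ≡.trans (cong (λ t → (c ℚ.+ d) ℚ.+ a ℚ.* t) (evalℚ-add p q a))
      (solve 5 (λ c d a p q → (c :+ d) :+ a :* (p :+ q) := (c :+ a :* p) :+ (d :+ a :* q)) ≡.refl c d a (evalℚ p a) (evalℚ q a))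

    evalℚ-neg : ∀ p a → evalℚ (pneg p) a ≡ ℚ.- evalℚ p a
    evalℚ-neg []      a = ≡.refl
    evalℚ-neg (c ∷ p) a = ≡.trans (cong (λ t → (ℚ.- c) ℚ.+ a ℚ.* t) (evalℚ-neg p a))
      (solve 3 (λ c a p → (:- c) :+ a :* (:- p) := :- (c :+ a :* p)) ≡.refl c a (evalℚ p a))

    evalℚ-scale : ∀ c p a → evalℚ (List.map (c ℚ.*_) p) a ≡ c ℚ.* evalℚ p a
    evalℚ-scale c []      a = ≡.sym (ℚP.*-zeroʳ c)
    evalℚ-scale c (d ∷ p) a = ≡.trans (cong (λ t → c ℚ.* d ℚ.+ a ℚ.* t) (evalℚ-scale c p a))
      (solve 4 (λ c d a p → c :* d :+ a :* (c :* p) := c :* (d :+ a :* p)) ≡.refl c d a (evalℚ p a))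

    evalℚ-mul : ∀ p q a → evalℚ (pmul p q) a ≡ evalℚ p a ℚ.* evalℚ q a
    evalℚ-mul []      q a = ≡.sym (ℚP.*-zeroˡ (evalℚ q a))
    evalℚ-mul (c ∷ p) q a = ≡.trans (evalℚ-add (List.map (c ℚ.*_) q) (0ℚ ∷ pmul p q) a)
      (≡.trans (cong₂ (λ s t → s ℚ.+ (0ℚ ℚ.+ a ℚ.* t)) (evalℚ-scale c q a) (evalℚ-mul p q a))
        (solve 4 (λ c q a p → c :* q :+ (con (+ 0) :+ a :* (p :* q)) := (c :+ a :* p) :* q) ≡.refl c (evalℚ q a) a (evalℚ p a)))

    evalℚ-one : ∀ a → evalℚ (1ℚ ∷ []) a ≡ 1ℚ
    evalℚ-one a = solve 1 (λ a → con (+ 1) :+ a :* con (+ 0) := con (+ 1)) ≡.refl a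

    evalℚ-zero : ∀ {p} → All (_≡ 0ℚ) p → ∀ a → evalℚ p a ≡ 0ℚ
    evalℚ-zero []           a = ≡.refl
    evalℚ-zero (≡.refl ∷ z) a = ≡.trans (cong (λ t → 0ℚ ℚ.+ a ℚ.* t) (evalℚ-zero z a)) (solve 1 (λ a → con (+ 0) :+ a :* con (+ 0) := con (+ 0)) ≡.refl a)

    clear-denominator : ∀ c → ι (↧ c) ℚ.* c ≡ ι (↥ c)
    clear-denominator c = ℚP.toℚᵘ-injective (begin
      ℚ.toℚᵘ (ι (↧ c) ℚ.* c)               ≈⟨ ℚP.toℚᵘ-homo-* (ι (↧ c)) c ⟩
      ℚ.toℚᵘ (ι (↧ c)) ℚᵘ.* ℚ.toℚᵘ c       ≈⟨ ℚᵘP.*-cong {ℚ.toℚᵘ (ι (↧ c))} {mkℚᵘ (↧ c) 0} {ℚ.toℚᵘ c} {ℚ.toℚᵘ c} (ℚP.toℚᵘ-fromℚᵘ (mkℚᵘ (↧ c) 0)) ℚᵘP.≃-refl ⟩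
      mkℚᵘ (↧ c) 0 ℚᵘ.* ℚ.toℚᵘ c           ≈⟨ cross c ⟩
      mkℚᵘ (↥ c) 0                         ≈⟨ ℚᵘP.≃-sym (ℚP.toℚᵘ-fromℚᵘ (mkℚᵘ (↥ c) 0)) ⟩
      ℚ.toℚᵘ (ι (↥ c)) ∎)
      where
      open import Relation.Binary.Reasoning.Setoid ℚᵘP.≃-setoid
      cross : ∀ c → mkℚᵘ (↧ c) 0 ℚᵘ.* ℚ.toℚᵘ c ℚᵘ.≃ mkℚᵘ (↥ c) 0
      cross (ℚ.mkℚ n d _) = *≡* (≡.trans (ℤP.*-identityʳ _) (≡.trans (ℤP.*-comm (+ suc d) n) (cong (λ k → n ℤ.* + suc k) (≡.sym (ℕP.+-identityʳ d)))))

    -- The factor `d` is the product of all denominators of coefficients. Only what the root bound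
    -- needs is recorded about `P`: its values at integers, and that `p` vanishes with it.
    clear-denominators : ∀ p → ∃ λ d → ∃ λ P → (d ≢ + 0) × (∀ n → ι d ℚ.* evalℚ p (ι n) ≡ ι (evalℤ P n)) × (All (_≡ + 0) P → All (_≡ 0ℚ) p)
    clear-denominators [] = + 1 , [] , (λ ()) , (λ n → ≡.refl) , λ _ → []
    clear-denominators (c ∷ p) with clear-denominators p
    ... | d , P , d≢0 , e , z = ↧ c ℤ.* d , (↥ c ℤ.* d) ∷ scaleℤ (↧ c) P ,
      (λ eq → nonzero (ℤP.i*j≡0⇒i≡0∨j≡0 (↧ c) eq)) , value , zeros
      where
      nonzero : ↧ c ≡ + 0 ⊎ d ≡ + 0 → _
      nonzero (inj₁ ())
      nonzero (inj₂ e) = d≢0 e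
      scaled : ∀ k P n → evalℤ (scaleℤ k P) n ≡ k ℤ.* evalℤ P n
      scaled k []      n = ≡.sym (ℤP.*-zeroʳ k)
      scaled k (x ∷ P) n = ≡.trans (cong (λ t → k ℤ.* x ℤ.+ n ℤ.* t) (scaled k P n))
        (Z.solve 4 (λ k x n e → k Z.:* x Z.:+ n Z.:* (k Z.:* e) Z.:= k Z.:* (x Z.:+ n Z.:* e)) ≡.refl k x n (evalℤ P n))
        where module Z = IntegerSolver ℤP.+-*-commutativeRing
      value : ∀ n → ι (↧ c ℤ.* d) ℚ.* (c ℚ.+ ι n ℚ.* evalℚ p (ι n)) ≡ ι (↥ c ℤ.* d ℤ.+ n ℤ.* evalℤ (scaleℤ (↧ c) P) n)
      value n = begin
        ι (↧ c ℤ.* d) ℚ.* (c ℚ.+ ι n ℚ.* x)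
          ≡⟨ cong (ℚ._* (c ℚ.+ ι n ℚ.* x)) (ι-* (↧ c) d) ⟩
        (ι (↧ c) ℚ.* ι d) ℚ.* (c ℚ.+ ι n ℚ.* x)
          ≡⟨ solve 5 (λ m d c n x → (m :* d) :* (c :+ n :* x) := (m :* c) :* d :+ n :* (m :* (d :* x))) ≡.refl (ι (↧ c)) (ι d) c (ι n) x ⟩
        (ι (↧ c) ℚ.* c) ℚ.* ι d ℚ.+ ι n ℚ.* (ι (↧ c) ℚ.* (ι d ℚ.* x))
          ≡⟨ cong₂ (λ s t → s ℚ.* ι d ℚ.+ ι n ℚ.* (ι (↧ c) ℚ.* t)) (clear-denominator c) (e n) ⟩
        ι (↥ c) ℚ.* ι d ℚ.+ ι n ℚ.* (ι (↧ c) ℚ.* ι (evalℤ P n))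
          ≡⟨ cong₂ ℚ._+_ (≡.sym (ι-* (↥ c) d)) (≡.trans (cong (ι n ℚ.*_) (≡.trans (≡.sym (ι-* (↧ c) (evalℤ P n))) (cong ι (≡.sym (scaled (↧ c) P n))))) (≡.sym (ι-* n _))) ⟩
        ι (↥ c ℤ.* d) ℚ.+ ι (n ℤ.* evalℤ (scaleℤ (↧ c) P) n)
          ≡⟨ ≡.sym (ι-+ (↥ c ℤ.* d) (n ℤ.* evalℤ (scaleℤ (↧ c) P) n)) ⟩
        ι (↥ c ℤ.* d ℤ.+ n ℤ.* evalℤ (scaleℤ (↧ c) P) n) ∎
        where
        open ≡.≡-Reasoning
        x = evalℚ p (ι n)
      unscale : ∀ P → All (_≡ + 0) (scaleℤ (↧ c) P) → All (_≡ + 0) P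
      unscale []      _       = []
      unscale (x ∷ P) (e ∷ z) with ℤP.i*j≡0⇒i≡0∨j≡0 (↧ c) e
      ... | inj₂ x≡0 = x≡0 ∷ unscale P z
      zeros : All (_≡ + 0) ((↥ c ℤ.* d) ∷ scaleℤ (↧ c) P) → All (_≡ 0ℚ) (c ∷ p)
      zeros (e ∷ zs) with ℤP.i*j≡0⇒i≡0∨j≡0 (↥ c) e
      ... | inj₁ c≡0 = ℚP.↥p≡0⇒p≡0 c c≡0 ∷ z (unscale P zs)
      ... | inj₂ d≡0 = contradiction d≡0 d≢0

  -- The integers from 2 on. The points -2 and 1/2 are left out, since vanishing of polynomials is
  -- tested at large integers.
  node : ℕ → ℚ
  node n = point (suc (suc n))

  abstract
    eventually : ∀ p → All (_≡ 0ℚ) p ⊎ ∃ λ N → ∀ n → N ℕ.≤ n → evalℚ p (node n) ≢ 0ℚ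
    eventually p with clear-denominators p
    ... | d , P , d≢0 , value , zeros with eventuallyℤ P
    ...   | inj₁ z       = inj₁ (zeros z)
    ...   | inj₂ (N , h) = inj₂ (N , λ n le e → h (suc (suc n)) (ℕP.m≤n⇒m≤1+n (ℕP.m≤n⇒m≤1+n le))
      (ι-injective (≡.trans (≡.sym (value (+ suc (suc n)))) (≡.trans (cong (ι d ℚ.*_) e) (ℚP.*-zeroʳ (ι d))))))

    vanishing : ∀ p N → (∀ n → N ℕ.≤ n → evalℚ p (node n) ≡ 0ℚ) → All (_≡ 0ℚ) p
    vanishing p N h with eventually p
    ... | inj₁ z        = z
    ... | inj₂ (N′ , h′) = contradiction (h (N ℕ.⊔ N′) (ℕP.m≤m⊔n N N′)) (h′ (N ℕ.⊔ N′) (ℕP.m≤n⊔m N N′))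

  module IΩ = Integrality ΩR genΩ genΩ⁻¹ genΩ-inverse (ΩM.refl {genΩ (suc zero)}) (ΩM.refl {genΩ (suc (suc zero))})

  module _ where
    private
      module Solver = IntegerSolver ΩR
      module EΩ = Evaluation ΩR (genΩ zero)
      open import Algebra.Properties.Semiring.Mult.TCOptimised ΩM.semiring using (1+×) renaming (_×_ to _⋆_)

      first-nat : ∀ k n → proj₁ (k ⋆ ΩM.1#) n ≡ ι (+ k)
      first-nat zero    n = ≡.refl
      first-nat (suc k) n = ≡.trans (proj₁ (1+× k ΩM.1#) n) (≡.trans (cong (1ℚ ℚ.+_) (first-nat k n)) (≡.sym (ι-+ (+ 1) (+ k))))

      first-int : ∀ c n → proj₁ Solver.⟦ c ⟧ℤ n ≡ ι c
      first-int (+ k)    n = first-nat k n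
      first-int -[1+ k ] n = ≡.trans (cong ℚ.-_ (first-nat (suc k) n)) (≡.sym (ι-neg (+ suc k)))

      first-eval : ∀ P n → proj₁ (EΩ.eval P) (suc (suc n)) ≡ ι (evalℤ P (+ suc (suc n)))
      first-eval []      n = ≡.refl
      first-eval (c ∷ P) n = ≡.trans (cong₂ (λ s t → s ℚ.+ node n ℚ.* t) (first-int c (suc (suc n))) (first-eval P n))
        (≡.trans (cong (ι c ℚ.+_) (≡.sym (ι-* (+ suc (suc n)) (evalℤ P (+ suc (suc n)))))) (≡.sym (ι-+ c (+ suc (suc n) ℤ.* evalℤ P (+ suc (suc n))))))

    abstract
      -- All components of x are given by the same integer polynomial, so that those over GF(4) and ℚ(i) vanish with the rational ones.
      integral-vanishing : ∀ {x} → IΩ.Integral x → ∀ N → (∀ n → N ℕ.≤ n → proj₁ x (suc (suc n)) ≡ 0ℚ) → x ΩM.≈ ΩM.0#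
      integral-vanishing {x} i N h = decide (eventuallyℤ P)
        where
        P : IntPoly
        P = IΩ.Integral.numerator i
        k : ℕ
        k = IΩ.Integral.order i
        root : ∀ n → N ℕ.≤ n → evalℤ P (+ suc (suc n)) ≡ + 0
        root n le = ι-injective (≡.trans (≡.sym (first-eval P n)) (≡.trans (≡.sym (proj₁ (IΩ.Integral.value i) (suc (suc n))))
          (≡.trans (cong (ℚ._* proj₁ (IΩ.δ^ k) (suc (suc n))) (h n le)) (ℚP.*-zeroˡ (proj₁ (IΩ.δ^ k) (suc (suc n)))))))
        decide : All (_≡ + 0) P ⊎ (∃ λ M → ∀ n → M ℕ.≤ n → evalℤ P (+ n) ≢ + 0) → x ΩM.≈ ΩM.0#
        decide (inj₁ z)        = IΩ.numerator-zero i z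
        decide (inj₂ (M , h′)) = contradiction (root (N ℕ.⊔ M) (ℕP.m≤m⊔n N M))
          (h′ (suc (suc (N ℕ.⊔ M))) (ℕP.m≤n⇒m≤1+n (ℕP.m≤n⇒m≤1+n (ℕP.m≤n⊔m N M))))

  module KP = PartialField K₂

  num den : ℚ → RatFun → ℚ
  num a r = evalℚ (proj₁ r) a
  den a r = evalℚ (proj₂ r) a

  -- The value of a fraction in a form without division; the nonzero denominator makes it unique.
  record Value (a : ℚ) (r : RatFun) (x : ℚ) : Set where
    constructor value
    field
      equation : num a r ≡ x ℚ.* den a r
      nonzero  : den a r ≢ 0ℚ

  module _ {a : ℚ} where
    open IntegerSolver ℚR
    private
      num-+ : ∀ r s → num a (r KP.+ s) ≡ num a r ℚ.* den a s ℚ.+ num a s ℚ.* den a r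
      num-+ (p , q) (p′ , q′) = ≡.trans (evalℚ-add (pmul p q′) (pmul p′ q) a) (cong₂ ℚ._+_ (evalℚ-mul p q′ a) (evalℚ-mul p′ q a))

      den-* : ∀ q q′ → evalℚ (pmul q q′) a ≡ evalℚ q a ℚ.* evalℚ q′ a
      den-* q q′ = evalℚ-mul q q′ a

    value-+ : ∀ {r s x y} → Value a r x → Value a s y → Value a (r KP.+ s) (x ℚ.+ y)
    value-+ {p , q} {p′ , q′} {x} {y} (value e nz) (value f nz′) = value
      (≡.trans (num-+ (p , q) (p′ , q′)) (≡.trans (cong₂ (λ s t → s ℚ.* evalℚ q′ a ℚ.+ t ℚ.* evalℚ q a) e f)
        (≡.trans (solve 4 (λ x y q r → (x :* q) :* r :+ (y :* r) :* q := (x :+ y) :* (q :* r)) ≡.refl x y (evalℚ q a) (evalℚ q′ a))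
          (cong ((x ℚ.+ y) ℚ.*_) (≡.sym (den-* q q′))))))
      (λ z → ℚ-domain nz nz′ (≡.trans (≡.sym (den-* q q′)) z))

    value-* : ∀ {r s x y} → Value a r x → Value a s y → Value a (r KP.* s) (x ℚ.* y)
    value-* {p , q} {p′ , q′} {x} {y} (value e nz) (value f nz′) = value
      (≡.trans (evalℚ-mul p p′ a) (≡.trans (cong₂ ℚ._*_ e f)
        (≡.trans (solve 4 (λ x y q r → (x :* q) :* (y :* r) := (x :* y) :* (q :* r)) ≡.refl x y (evalℚ q a) (evalℚ q′ a))
          (cong ((x ℚ.* y) ℚ.*_) (≡.sym (den-* q q′))))))
      (λ z → ℚ-domain nz nz′ (≡.trans (≡.sym (den-* q q′)) z))

    value-neg : ∀ {r x} → Value a r x → Value a (KP.- r) (ℚ.- x)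
    value-neg {p , q} {x} (value e nz) = value (≡.trans (evalℚ-neg p a) (≡.trans (cong ℚ.-_ e) (ℚP.neg-distribˡ-* x (evalℚ q a)))) nz

    private
      one≢0 : evalℚ (1ℚ ∷ []) a ≢ 0ℚ
      one≢0 e = contradiction (≡.trans (≡.sym (evalℚ-one a)) e) (λ ())

    value-0 : Value a KP.0# 0ℚ
    value-0 = value (≡.sym (ℚP.*-zeroˡ (evalℚ (1ℚ ∷ []) a))) one≢0

    value-1 : Value a KP.1# 1ℚ
    value-1 = value (≡.sym (ℚP.*-identityˡ (evalℚ (1ℚ ∷ []) a))) one≢0

    open DetRelation KP.ring rawQ (Value a) (λ {x} {y} {x′} {y′} → value-+ {x} {y} {x′} {y′}) (λ {x} {y} {x′} {y′} → value-* {x} {y} {x′} {y′}) (λ {x} {x′} → value-neg {x} {x′}) value-0 value-1 public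
      using () renaming (det~ to value-det; monomial~ to value-monomial)

open RationalFunctions

-- Fractions against elements of Ω, and representations carried to K₂

module Representations where
  module DΩ = Det ΩM.rawRing
  module DK = Det KP.ring
  module DP = Det (PartialField.ring P₀)
  module DTΩ = DetTheory ΩR
  module DTR = DetTheory RR

  module K-Polynomials (a : ℚ) where
    open IntegerSolver ℚR

    -- The numerator of the difference whose vanishing defines equality of fractions.
    difference : RatFun → RatFun → Poly
    difference (p , q) (p′ , q′) = padd (pmul p q′) (pneg (pmul p′ q))

    difference-eval : ∀ r s → evalℚ (difference r s) a ≡ num a r ℚ.* den a s ℚ.- num a s ℚ.* den a r
    difference-eval (p , q) (p′ , q′) = ≡.trans (evalℚ-add (pmul p q′) (pneg (pmul p′ q)) a)
      (cong₂ ℚ._+_ (evalℚ-mul p q′ a) (≡.trans (evalℚ-neg (pmul p′ q) a) (cong ℚ.-_ (evalℚ-mul p′ q a))))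

    minus-self : ∀ {x y} → x ≡ y → x ℚ.- y ≡ 0ℚ
    minus-self {x} ≡.refl = ℚP.+-inverseʳ x

    equal : ∀ {x y} → x ℚ.- y ≡ 0ℚ → x ≡ y
    equal {x} {y} e = ≡.trans (solve 2 (λ x y → x := (x :- y) :+ y) ≡.refl x y) (≡.trans (cong (ℚ._+ y) e) (ℚP.+-identityˡ y))

    same-value-difference : ∀ {r s x} → Value a r x → Value a s x → evalℚ (difference r s) a ≡ 0ℚ
    same-value-difference {r} {s} {x} (value e _) (value f _) = ≡.trans (difference-eval r s) (minus-self
      (≡.trans (cong (ℚ._* den a s) e) (≡.trans (solve 3 (λ x q r → (x :* q) :* r := (x :* r) :* q) ≡.refl x (den a r) (den a s)) (cong (ℚ._* den a r) (≡.sym f)))))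

    cross-multiplied : ∀ {r s} → r KP.≈ s → num a r ℚ.* den a s ≡ num a s ℚ.* den a r
    cross-multiplied {r} {s} e = equal (≡.trans (≡.sym (difference-eval r s)) (evalℚ-zero e a))

    cancel-right : ∀ {x y z} → z ≢ 0ℚ → x ℚ.* z ≡ y ℚ.* z → x ≡ y
    cancel-right {x} {y} {z} nz e = begin
      x                    ≡⟨ ≡.sym (ℚP.*-identityʳ x) ⟩
      x ℚ.* 1ℚ             ≡⟨ cong (x ℚ.*_) (≡.sym (recip-inverse nz)) ⟩
      x ℚ.* (z ℚ.* recip z) ≡⟨ ≡.sym (ℚP.*-assoc x z (recip z)) ⟩
      (x ℚ.* z) ℚ.* recip z ≡⟨ cong (ℚ._* recip z) e ⟩
      (y ℚ.* z) ℚ.* recip z ≡⟨ ℚP.*-assoc y z (recip z) ⟩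
      y ℚ.* (z ℚ.* recip z) ≡⟨ cong (y ℚ.*_) (recip-inverse nz) ⟩
      y ℚ.* 1ℚ             ≡⟨ ℚP.*-identityʳ y ⟩
      y ∎
      where open ≡.≡-Reasoning

    equal-values : ∀ {r s x y} → r KP.≈ s → Value a r x → Value a s y → x ≡ y
    equal-values {r} {s} {x} {y} e (value f nz) (value g nz′) = cancel-right (ℚ-domain nz nz′)
      (≡.trans (≡.sym (ℚP.*-assoc x (den a r) (den a s))) (≡.trans (cong (ℚ._* den a s) (≡.sym f))
        (≡.trans (cross-multiplied {r} {s} e) (≡.trans (cong (ℚ._* den a r) g)
          (solve 3 (λ y s r → (y :* s) :* r := y :* (r :* s)) ≡.refl y (den a s) (den a r))))))

    zero-numerator : ∀ {r} → r KP.≈ KP.0# → num a r ≡ 0ℚ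
    zero-numerator {r} e = cancel-right {z = den a KP.0#} (Value.nonzero (value-0 {a})) (≡.trans (cross-multiplied {r} {KP.0#} e)
      (≡.trans (ℚP.*-zeroˡ (den a r)) (≡.sym (ℚP.*-zeroˡ (den a KP.0#)))))

    numerator-of : ∀ {r s x} → r KP.≈ s → Value a s x → num a r ≡ x ℚ.* den a r
    numerator-of {r} {s} {x} e (value f nz) = cancel-right nz (≡.trans (cross-multiplied {r} {s} e)
      (≡.trans (cong (ℚ._* den a r) f) (solve 3 (λ x s r → (x :* s) :* r := (x :* r) :* s) ≡.refl x (den a s) (den a r))))

    zero-difference : ∀ {r} → num a r ≡ 0ℚ → evalℚ (difference r KP.0#) a ≡ 0ℚ
    zero-difference {r} e = ≡.trans (difference-eval r KP.0#) (minus-self (≡.trans (cong (ℚ._* den a KP.0#) e)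
      (≡.trans (ℚP.*-zeroˡ (den a KP.0#)) (≡.sym (ℚP.*-zeroˡ (den a r))))))

    -- `IsPMatrix` constrains an entry only through its 1×1 minor, a fraction with additional
    -- factors and a summand zero; these change neither numerator nor denominator at a point.
    num-scaled : ∀ r → num a (DK.det 1 (λ _ _ → r)) ≡ num a r
    num-scaled (p , q) = ≡.trans (evalℚ-add (pmul (pmul p o) o) [] a) (≡.trans (cong (ℚ._+ 0ℚ)
        (≡.trans (evalℚ-mul (pmul p o) o a) (cong₂ ℚ._*_ (≡.trans (evalℚ-mul p o a) (cong (evalℚ p a ℚ.*_) (evalℚ-one a))) (evalℚ-one a))))
      (solve 1 (λ x → (x :* con (+ 1)) :* con (+ 1) :+ con (+ 0) := x) ≡.refl (evalℚ p a)))
      where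
      o : Poly
      o = 1ℚ ∷ []

    den-scaled : ∀ r → den a (DK.det 1 (λ _ _ → r)) ≡ den a r
    den-scaled (p , q) = ≡.trans (evalℚ-mul (pmul q o) o a) (≡.trans (cong₂ ℚ._*_ (≡.trans (evalℚ-mul q o a) (cong (evalℚ q a ℚ.*_) (evalℚ-one a))) (evalℚ-one a))
      (solve 1 (λ x → (x :* con (+ 1)) :* con (+ 1) := x) ≡.refl (evalℚ q a)))
      where
      o : Poly
      o = 1ℚ ∷ []

    -- RatFun contains fractions with denominator zero, which make the denominator of every determinant in which they occur zero.
    Absorbed : RatFun → Set
    Absorbed r = den a r ≡ 0ℚ

    absorbed-*ˡ : ∀ r s → Absorbed r → den a (r KP.* s) ≡ 0ℚ
    absorbed-*ˡ (p , q) (p′ , q′) e = ≡.trans (evalℚ-mul q q′ a) (≡.trans (cong (ℚ._* evalℚ q′ a) e) (ℚP.*-zeroˡ (evalℚ q′ a)))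

    absorbed-*ʳ : ∀ r s → Absorbed s → den a (r KP.* s) ≡ 0ℚ
    absorbed-*ʳ (p , q) (p′ , q′) e = ≡.trans (evalℚ-mul q q′ a) (≡.trans (cong (evalℚ q a ℚ.*_) e) (ℚP.*-zeroʳ (evalℚ q a)))

    absorbed-signed : ∀ k r → Absorbed r → Absorbed (DK.signed k r)
    absorbed-signed zero    r e = e
    absorbed-signed (suc k) r e = absorbed-signed k r e

    absorbed-sum : ∀ m (f : Fin m → RatFun) j → Absorbed (f j) → Absorbed (DK.sumFin m f)
    absorbed-sum (suc m) f zero    e = absorbed-*ˡ (f zero) (DK.sumFin m (f ∘ suc)) e
    absorbed-sum (suc m) f (suc j) e = absorbed-*ʳ (f zero) (DK.sumFin m (f ∘ suc)) (absorbed-sum m (f ∘ suc) j e)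

    absorbed-det : ∀ k (M : Fin k → Fin k → RatFun) i c → Absorbed (M i c) → Absorbed (DK.det k M)
    absorbed-det (suc k) M zero c e = absorbed-sum (suc k) (λ j → DK.signed (toℕ j) (M zero j KP.* minor j)) c (absorbed-signed (toℕ c) (M zero c KP.* minor c) (absorbed-*ˡ (M zero c) (minor c) e))
      where
      minor : Fin (suc k) → RatFun
      minor j = DK.det k (λ r c → M (suc r) (punchIn j c))
    absorbed-det (suc (suc k)) M (suc i) c e = absorbed-sum (suc (suc k)) (λ j → DK.signed (toℕ j) (M zero j KP.* DK.det (suc k) (λ r c → M (suc r) (punchIn j c)))) j (absorbed-signed (toℕ j) (M zero j KP.* minor) (absorbed-*ʳ (M zero j) minor
      (absorbed-det (suc k) (λ r c → M (suc r) (punchIn j c)) i (punchOut j≢c) (≡.trans (cong (λ d → den a (M (suc i) d)) (FinP.punchIn-punchOut j≢c)) e))))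
      where
      -- Any column other than `c` serves: its term in the expansion along row 0 contains a minor
      -- through the bad entry, and one summand with denominator zero gives the whole sum
      -- denominator zero.
      j : Fin (suc (suc k))
      j = punchIn c zero
      j≢c : j ≢ c
      j≢c = FinP.punchInᵢ≢i c zero
      minor : RatFun
      minor = DK.det (suc k) (λ r c → M (suc r) (punchIn j c))

  module At (n : ℕ) = K-Polynomials (node n)

  open K-Polynomials 0ℚ using (difference)

  values-determine : ∀ {r s} (x : ℕ → ℚ) → (∀ n → Value (node n) r (x n)) → (∀ n → Value (node n) s (x n)) → r KP.≈ s
  values-determine {r} {s} x f g = vanishing (difference r s) 0 (λ n _ → At.same-value-difference n {r} {s} {x n} (f n) (g n))

  numerator-determines : ∀ {r} N → (∀ n → N ℕ.≤ n → num (node n) r ≡ 0ℚ) → r KP.≈ KP.0#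
  numerator-determines {r} N h = vanishing (difference r KP.0#) N (λ n le → At.zero-difference n {r} (h n le))

  module _ {a : ℚ} where
    open IntegerSolver ℚR

    K₂-gen-value : ∀ j → Value a (K₂-gen j) (gen₁ a j)
    K₂-gen-value j = value (equation j) (one≢0 j)
      where
      equation : ∀ j → num a (K₂-gen j) ≡ gen₁ a j ℚ.* den a (K₂-gen j)
      equation zero             = solve 1 (λ a → con (+ 0) :+ a :* (con (+ 1) :+ a :* con (+ 0)) := a :* (con (+ 1) :+ a :* con (+ 0))) ≡.refl a
      equation (suc zero)       = solve 1 (λ a → (:- con (+ 1)) :+ a :* (con (+ 1) :+ a :* con (+ 0)) := (a :- con (+ 1)) :* (con (+ 1) :+ a :* con (+ 0))) ≡.refl a
      equation (suc (suc zero)) = solve 1 (λ a → (:- con (+ 1)) :+ a :* (con (+ 0) :+ a :* (con (+ 1) :+ a :* con (+ 0))) := (a :* a :- con (+ 1)) :* (con (+ 1) :+ a :* con (+ 0))) ≡.refl a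
      one≢0 : ∀ j → den a (K₂-gen j) ≢ 0ℚ
      one≢0 zero             = Value.nonzero (value-0 {a})
      one≢0 (suc zero)       = Value.nonzero (value-0 {a})
      one≢0 (suc (suc zero)) = Value.nonzero (value-0 {a})

    private
      inverted : ∀ j → K₂-inv j ≡ (proj₂ (K₂-gen j) , proj₁ (K₂-gen j))
      inverted zero             = ≡.refl
      inverted (suc zero)       = ≡.refl
      inverted (suc (suc zero)) = ≡.refl

    K₂-inv-value : ∀ j → gen₁ a j ≢ 0ℚ → Value a (K₂-inv j) (recip (gen₁ a j))
    K₂-inv-value j nz = subst (λ r → Value a r (recip g)) (≡.sym (inverted j)) (value
      (≡.trans (≡.sym (ℚP.*-identityˡ d)) (≡.trans (cong (ℚ._* d) (≡.sym (≡.trans (ℚP.*-comm (recip g) g) (recip-inverse nz))))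
        (≡.trans (ℚP.*-assoc (recip g) g d) (cong (recip g ℚ.*_) (≡.sym (Value.equation (K₂-gen-value j)))))))
      (λ z → ℚ-domain nz (Value.nonzero (K₂-gen-value j)) (≡.trans (≡.sym (Value.equation (K₂-gen-value j))) z)))
      where
      g d : ℚ
      g = gen₁ a j
      d = den a (K₂-gen j)

  K₂-monomial : ℕ → (Fin 3 → ℤ) → RatFun
  K₂-monomial = monomial KP.ring 3 K₂-gen K₂-inv

  coordinate : ΩM.Carrier → ℕ → ℚ
  coordinate z n = proj₁ z (suc (suc n))

  abstract
    K₂-monomial-value : ∀ s e n → Value (node n) (K₂-monomial s e) (coordinate (GΩ.mono s e) n)
    K₂-monomial-value s e n = subst (Value (node n) (K₂-monomial s e))
      (≡.sym (Hom.φ-monomial (projℚ (suc (suc n))) 3 {genΩ} {genΩ⁻¹} {gen₁ (node n)} {recip ∘ gen₁ (node n)} (λ _ → ≡.refl) (λ _ → ≡.refl) s e))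
      (value-monomial 3 {K₂-gen} {K₂-inv} {gen₁ (node n)} {recip ∘ gen₁ (node n)} K₂-gen-value (λ j → K₂-inv-value j (gen₁≢0 (suc (suc n)) j)) s e)

    -- An element is zero or a monomial in the generators, and the same monomial formed in K₂ has
    -- the required values.
    rational : ∀ {z} → PΩ.E z → ∃ λ r → ∀ n → Value (node n) r (coordinate z n)
    rational (inj₁ z)           = KP.0# , λ n → subst (Value (node n) KP.0#) (≡.sym (proj₁ z (suc (suc n)))) value-0
    rational (inj₂ (s , e , p)) = K₂-monomial s e , λ n → subst (Value (node n) (K₂-monomial s e)) (≡.sym (proj₁ p (suc (suc n)))) (K₂-monomial-value s e n)

    rational-Elem : ∀ {r z} → PΩ.E z → (∀ n → Value (node n) r (coordinate z n)) → PartialField.Elem K₂ r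
    rational-Elem {r} {z} (inj₁ e) h = inj₁ (values-determine {r} {KP.0#} (coordinate z) h
      (λ n → subst (Value (node n) KP.0#) (≡.sym (proj₁ e (suc (suc n)))) value-0))
    rational-Elem {r} {z} (inj₂ (s , e , p)) h = inj₂ (s , e , values-determine {r} {K₂-monomial s e} (coordinate z) h
      (λ n → subst (Value (node n) (K₂-monomial s e)) (≡.sym (proj₁ p (suc (suc n)))) (K₂-monomial-value s e n)))

    first-unit : ∀ {z} → PΩ.G z → ∀ n → coordinate z n ≢ 0ℚ
    first-unit {z} gz n e = contradiction (≡.trans (≡.sym (≡.trans (cong (ℚ._* coordinate w n) e) (ℚP.*-zeroˡ (coordinate w n)))) (proj₁ (proj₂ (proj₂ inverse)) (suc (suc n)))) (λ ())
      where
      inverse : Σ ΩM.Carrier λ w → PΩ.G w × (z ΩM.* w ΩM.≈ ΩM.1#)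
      inverse = PΩ.G-inv gz
      w : ΩM.Carrier
      w = proj₁ inverse

    -- A unit is invertible at every point, so one evaluation decides whether an element of the
    -- partial field is zero.
    E-first-zero : ∀ {z} → PΩ.E z → ∀ n → coordinate z n ≡ 0ℚ → z ΩM.≈ ΩM.0#
    E-first-zero (inj₁ e) n _ = e
    E-first-zero {z} (inj₂ g) n e = contradiction e (first-unit {z} g n)

    det-first : ∀ k (M : Fin k → Fin k → ΩM.Carrier) n →
      coordinate (DΩ.det k M) n ≡ Det.det (CommutativeRing.rawRing ℚR) k (λ i j → coordinate (M i j) n)
    det-first k M n = Hom.φ-det (projℚ (suc (suc n))) k (λ _ _ → ≡.refl)

    det-value : ∀ k (A : Fin k → Fin k → RatFun) (M : Fin k → Fin k → ΩM.Carrier) n →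
      (∀ i j → Value (node n) (A i j) (coordinate (M i j) n)) → Value (node n) (DK.det k A) (coordinate (DΩ.det k M) n)
    det-value k A M n h = subst (Value (node n) (DK.det k A)) (≡.sym (det-first k M n)) (value-det k h)

    det-R : ∀ k (M : Fin k → Fin k → ΩM.Carrier) (A : Fin k → Fin k → RM.Carrier) → (∀ i j → proj₂ (M i j) RM.≈ A i j) →
      proj₂ (DΩ.det k M) RM.≈ DP.det k A
    det-R k M A h = Hom.φ-det projR k h

  module _ (P P′ : PartialField) {r n} (A : Matrix P r n) (B : Matrix P′ r n)
    (same : ∀ κ → Injective _≡_ _≡_ κ → NonsingularCols P A κ ⇔ NonsingularCols P′ B κ) where

    transfer-bases : ∀ S → IsBasisOf P A S ⇔ IsBasisOf P′ B S
    transfer-bases S = mk⇔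
      (λ { (κ , inj , range , ns) → κ , inj , range , Equivalence.to (same κ inj) ns })
      (λ { (κ , inj , range , ns) → κ , inj , range , Equivalence.from (same κ inj) ns })

    transfer-rank : FullRowRank P A → FullRowRank P′ B
    transfer-rank (κ , inj , ns) = κ , inj , Equivalence.to (same κ inj) ns

  transfer : ∀ (P P′ : PartialField) {n} (M : Matroid n) →
    (∀ r (A : Matrix P r n) → IsPMatrix P A → Σ (Matrix P′ r n) λ B → IsPMatrix P′ B ×
      (∀ κ → Injective _≡_ _≡_ κ → NonsingularCols P A κ ⇔ NonsingularCols P′ B κ)) →
    Representable P M → Representable P′ M
  transfer P P′ M convert (r , A , isP , rank , bases) with convert r A isP
  ... | B , isP′ , same = r , B , isP′ , transfer-rank P P′ A B same rank , λ S → mk⇔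
    (λ b → Equivalence.to (transfer-bases P P′ A B same S) (Equivalence.to (bases S) b))
    (λ b → Equivalence.from (bases S) (Equivalence.from (transfer-bases P P′ A B same S) b))

  ¬-cong : ∀ {X Y : Set} → (X → Y) → (Y → X) → (¬ X) ⇔ (¬ Y)
  ¬-cong f g = mk⇔ (λ nx y → nx (g y)) (λ ny x → ny (f x))

  module Forward {r m} (A : Matrix P₀ r m) (isP : IsPMatrix P₀ A) where
    module LT = Existence lifting

    abstract
      lifted : ∃ λ (Â : Fin r → Fin m → ΩM.Carrier) → PΩ.PM Every Every Â × (∀ i j → proj₂ (Â i j) RM.≈ A i j)
      lifted = let Â , l = LT.Lifts.exists (LiftTheorem.lift-theorem lifting A pmA) in Â , LT.IsLift.pm l , LT.IsLift.over l
        where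
        pmA : PR.PM Every Every A
        pmA = PR.PM-injective λ k ρ κ injρ injκ _ _ → PR.E-resp (RM.sym (DTR.D≈det k (λ i j → A (ρ i) (κ j)))) (isP k ρ κ injρ injκ)

    Â : Fin r → Fin m → ΩM.Carrier
    Â = proj₁ lifted

    E-det : ∀ k (ρ : Fin k → Fin r) (κ : Fin k → Fin m) → PΩ.E (DΩ.det k (λ i j → Â (ρ i) (κ j)))
    E-det k ρ κ = PΩ.E-resp (DTΩ.D≈det k (λ i j → Â (ρ i) (κ j))) (PΩ.minor (proj₁ (proj₂ lifted)) k ρ κ (λ _ → tt) (λ _ → tt))

    entries : ∀ i j → ∃ λ r → ∀ n → Value (node n) r (coordinate (Â i j) n)
    entries i j = rational {Â i j} (PΩ.PM-entry (proj₁ (proj₂ lifted)) {i} {j} tt tt)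

    B : Matrix K₂ r m
    B i j = proj₁ (entries i j)

    B-det : ∀ k (ρ : Fin k → Fin r) (κ : Fin k → Fin m) n →
      Value (node n) (DK.det k (λ i j → B (ρ i) (κ j))) (coordinate (DΩ.det k (λ i j → Â (ρ i) (κ j))) n)
    B-det k ρ κ n = det-value k (λ i j → B (ρ i) (κ j)) (λ i j → Â (ρ i) (κ j)) n (λ i j → proj₂ (entries (ρ i) (κ j)) n)

    isP-B : IsPMatrix K₂ B
    isP-B k ρ κ _ _ = rational-Elem (E-det k ρ κ) (B-det k ρ κ)

    same : ∀ κ → Injective _≡_ _≡_ κ → NonsingularCols P₀ A κ ⇔ NonsingularCols K₂ B κ
    same κ _ = ¬-cong down up
      where
      dΩ : ΩM.Carrier
      dΩ = DΩ.det r (λ i j → Â i (κ j))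
      over : proj₂ dΩ RM.≈ DP.det r (λ i j → A i (κ j))
      over = det-R r (λ i j → Â i (κ j)) (λ i j → A i (κ j)) (λ i j → proj₂ (proj₂ lifted) i (κ j))
      down : DP.det r (λ i j → A i (κ j)) RM.≈ RM.0# → DK.det r (λ i j → B i (κ j)) KP.≈ KP.0#
      down z = values-determine {DK.det r (λ i j → B i (κ j))} {KP.0#} (coordinate dΩ) (B-det r id κ)
        (λ n → subst (Value (node n) KP.0#) (≡.sym (proj₁ zeroΩ (suc (suc n)))) value-0)
        where
        zeroΩ : dΩ ΩM.≈ ΩM.0#
        zeroΩ = LT.E-kernel (E-det r id κ) (RM.trans over z)
      up : DK.det r (λ i j → B i (κ j)) KP.≈ KP.0# → DP.det r (λ i j → A i (κ j)) RM.≈ RM.0#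
      up z = RM.trans (RM.sym over) (proj₂ (E-first-zero {dΩ} (E-det r id κ) 0
        (At.equal-values 0 {DK.det r (λ i j → B i (κ j))} {KP.0#} z (B-det r id κ 0) value-0)))

open Representations

-- Representations over K₂ carried to GF(4) ⊗ H₂

module _ (S : CommutativeRing 0ℓ 0ℓ) where
  open CommutativeRing S hiding (zero)
  open DetTheory S
  open Det rawRing using (det)

  det-zeroColumn : ∀ k (M : Fin k → Fin k → Carrier) j → (∀ i → M i j ≈ 0#) → det k M ≈ 0#
  det-zeroColumn (suc k) M j e = trans (sym (D≈det (suc k) M)) (trans (sym (det-transpose (suc k) M)) (trans (det-front k (λ i l → M l i) j)
    (signed-zero (toℕ j) (det-zeroRow k _ e))))
    where
    signed-zero : ∀ n {x} → x ≈ 0# → Det.signed rawRing n x ≈ 0#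
    signed-zero zero    z = z
    signed-zero (suc n) z = trans (-‿cong (signed-zero n z)) -0#≈0#
      where open import Algebra.Properties.Ring ring using (-0#≈0#)

maximum : ∀ {k} (f : Fin k → ℕ) → ∃ λ N → ∀ i → f i ℕ.≤ N
maximum {zero}  f = 0 , λ ()
maximum {suc k} f = let N , h = maximum (f ∘ suc) in f zero ℕ.⊔ N , λ
  { zero → ℕP.m≤m⊔n (f zero) N ; (suc i) → ℕP.≤-trans (h i) (ℕP.m≤n⊔m (f zero) N) }

open import Algebra.Properties.Group ΩM.+-group using (x∙y⁻¹≈ε⇒x≈y)

abstract
  integral-mono : ∀ s e → IΩ.Integral (GΩ.mono s e)
  integral-mono s e = IΩ.integral-monomial 3 {genΩ} {genΩ⁻¹} {genΩ} {genΩ⁻¹} IΩ.integral-gen IΩ.integral-ginv s e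

  integral-E : ∀ {z} → PΩ.E z → IΩ.Integral z
  integral-E {z} (inj₁ e)           = IΩ.integral-resp (ΩM.sym {z} {ΩM.0#} e) IΩ.integral-0
  integral-E {z} (inj₂ (s , e , p)) = IΩ.integral-resp (ΩM.sym {z} {GΩ.mono s e} p) (integral-mono s e)

  integral-equal : ∀ {x y} → IΩ.Integral x → IΩ.Integral y → ∀ N → (∀ n → N ℕ.≤ n → coordinate x n ≡ coordinate y n) → x ΩM.≈ y
  integral-equal {x} {y} i j N h =
    x∙y⁻¹≈ε⇒x≈y x y (integral-vanishing {x ΩM.- y} (IΩ.integral-+ {x} {ΩM.- y} i (IΩ.integral-neg {y} j)) N
      (λ n le → ≡.trans (cong (ℚ._- coordinate y n) (h n le)) (ℚP.+-inverseʳ (coordinate y n))))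

  -- Equality of fractions controls the rational components at large points only. Integrality
  -- extends it to the remaining points and to the components over GF(4) and ℚ(i).
  rational-E : ∀ {r z} → IΩ.Integral z → PartialField.Elem K₂ r → ∀ N → (∀ n → N ℕ.≤ n → Value (node n) r (coordinate z n)) → PΩ.E z
  rational-E {r} {z} i (inj₁ e) N h = inj₁ (integral-vanishing {z} i N λ n le → At.equal-values n {r} {KP.0#} e (h n le) value-0)
  rational-E {r} {z} i (inj₂ (s , e , p)) N h = inj₂ (s , e , integral-equal {z} {GΩ.mono s e} i (integral-mono s e) N
    λ n le → At.equal-values n {r} {K₂-monomial s e} p (h n le) (K₂-monomial-value s e n))

  -- An element of K₂ equals 0 or a monomial, and the latter has nonzero denominators at all points.
  -- Cross multiplication with it makes the numerator vanish with the denominator, and 0 / 0 counts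
  -- as equal to 0.
  absorbed-zero : ∀ {r} → PartialField.Elem K₂ r → (∀ n → den (node n) r ≡ 0ℚ) → r KP.≈ KP.0#
  absorbed-zero (inj₁ e) _ = e
  absorbed-zero {r} (inj₂ (s , e , p)) h = numerator-determines {r} 0 λ n _ →
    ≡.trans (At.numerator-of n {r} {K₂-monomial s e} p (K₂-monomial-value s e n)) (≡.trans (cong (coordinate (GΩ.mono s e) n ℚ.*_) (h n)) (ℚP.*-zeroʳ (coordinate (GΩ.mono s e) n)))

  -- The relation between `r` and `z` is kept in multiplied form because the denominator of `r` may
  -- still be zero, in which case it says that the numerator is zero as well.
  lift-entry : ∀ r → PartialField.Elem K₂ (DK.det 1 (λ _ _ → r)) → ∃ λ z → PΩ.E z × (∀ n → num (node n) r ≡ coordinate z n ℚ.* den (node n) r)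
  lift-entry r (inj₁ e) = ΩM.0# , inj₁ (ΩM.refl {ΩM.0#}) , λ n → ≡.trans (≡.sym (At.num-scaled n r))
    (≡.trans (At.zero-numerator n {DK.det 1 (λ _ _ → r)} e) (≡.sym (ℚP.*-zeroˡ (den (node n) r))))
  lift-entry r (inj₂ (s , e , p)) = GΩ.mono s e , inj₂ (s , e , ΩM.refl {GΩ.mono s e}) , λ n → ≡.trans (≡.sym (At.num-scaled n r))
    (≡.trans (At.numerator-of n {DK.det 1 (λ _ _ → r)} {K₂-monomial s e} p (K₂-monomial-value s e n)) (cong (coordinate (GΩ.mono s e) n ℚ.*_) (At.den-scaled n r)))

module Backward {r m} (A : Matrix K₂ r m) (isP : IsPMatrix K₂ A) where
  module LT = Existence lifting

  Undefined Defined : Fin m → Set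
  Undefined j = ∃ λ i → ∀ n → den (node n) (A i j) ≡ 0ℚ
  Defined j = ∀ i → ∃ λ N → ∀ n → N ℕ.≤ n → den (node n) (A i j) ≢ 0ℚ

  abstract
    column : ∀ j → Undefined j ⊎ Defined j
    column j = search r (λ i → denominator (eventually (proj₂ (A i j))))
      where
      denominator : ∀ {q} → All (_≡ 0ℚ) q ⊎ (∃ λ N → ∀ n → N ℕ.≤ n → evalℚ q (node n) ≢ 0ℚ) →
        (∀ n → evalℚ q (node n) ≡ 0ℚ) ⊎ (∃ λ N → ∀ n → N ℕ.≤ n → evalℚ q (node n) ≢ 0ℚ)
      denominator (inj₁ z) = inj₁ (λ n → evalℚ-zero z (node n))
      denominator (inj₂ h) = inj₂ h

    entries : ∀ i j → ∃ λ z → PΩ.E z × (∀ n → num (node n) (A i j) ≡ coordinate z n ℚ.* den (node n) (A i j))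
    entries i j = lift-entry (A i j) (isP 1 (λ _ → i) (λ _ → j) single single)
      where
      single : ∀ {X : Set} {x : X} → Injective _≡_ _≡_ (λ (_ : Fin 1) → x)
      single {x = _} {zero} {zero} _ = ≡.refl

  entry-of : ∀ j → Undefined j ⊎ Defined j → Fin r → ΩM.Carrier
  entry-of j (inj₁ _) i = ΩM.0#
  entry-of j (inj₂ _) i = proj₁ (entries i j)

  -- A column with an undefined denominator occurs in no nonsingular matrix and is replaced by zero.
  Z : Fin r → Fin m → ΩM.Carrier
  Z i j = entry-of j (column j) i

  abstract
    undefined-zero : ∀ {j} → Undefined j → ∀ i → Z i j ΩM.≈ ΩM.0#
    undefined-zero {j} (i₀ , z) i = go (column j)
      where
      go : ∀ c → entry-of j c i ΩM.≈ ΩM.0#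
      go (inj₁ _) = ΩM.refl {ΩM.0#}
      go (inj₂ d) = let N , h = d i₀ in contradiction (z N) (h N ℕP.≤-refl)

    integral : ∀ i j → IΩ.Integral (Z i j)
    integral i j = go (column j)
      where
      go : ∀ c → IΩ.Integral (entry-of j c i)
      go (inj₁ _) = IΩ.integral-0
      go (inj₂ _) = integral-E {proj₁ (entries i j)} (proj₁ (proj₂ (entries i j)))

    values : ∀ {j} → Defined j → ∀ i → ∃ λ N → ∀ n → N ℕ.≤ n → Value (node n) (A i j) (coordinate (Z i j) n)
    values {j} d i = go (column j)
      where
      go : ∀ c → ∃ λ N → ∀ n → N ℕ.≤ n → Value (node n) (A i j) (coordinate (entry-of j c i) n)
      go (inj₁ (i₀ , z)) = let N , h = d i₀ in contradiction (z N) (h N ℕP.≤-refl)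
      go (inj₂ _)        = let N , h = d i in N , λ n le → value (proj₂ (proj₂ (entries i j)) n) (h n le)

  module Minor {k} (ρ : Fin k → Fin r) (κ : Fin k → Fin m) where
    dK : RatFun
    dK = DK.det k (λ i j → A (ρ i) (κ j))

    dΩ : ΩM.Carrier
    dΩ = DΩ.det k (λ i j → Z (ρ i) (κ j))

    abstract
      integral-dΩ : IΩ.Integral dΩ
      integral-dΩ = IΩ.integral-det k {λ i j → Z (ρ i) (κ j)} {λ i j → Z (ρ i) (κ j)} (λ i j → integral (ρ i) (κ j))

      undefined-dΩ : ∀ j → Undefined (κ j) → dΩ ΩM.≈ ΩM.0#
      undefined-dΩ j u = det-zeroColumn ΩR k (λ i j → Z (ρ i) (κ j)) j (λ i → undefined-zero u (ρ i))

      values-dΩ : (∀ j → Defined (κ j)) → ∃ λ N → ∀ n → N ℕ.≤ n → Value (node n) dK (coordinate dΩ n)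
      values-dΩ d = proj₁ outer , λ n le → det-value k (λ i j → A (ρ i) (κ j)) (λ i j → Z (ρ i) (κ j)) n
        (λ i j → proj₂ (values (d j) (ρ i)) n (ℕP.≤-trans (proj₂ (inner i) j) (ℕP.≤-trans (proj₂ outer i) le)))
        where
        inner : ∀ i → ∃ λ N → ∀ j → proj₁ (values (d j) (ρ i)) ℕ.≤ N
        inner i = maximum (λ j → proj₁ (values (d j) (ρ i)))
        outer : ∃ λ N → ∀ i → proj₁ (inner i) ℕ.≤ N
        outer = maximum (λ i → proj₁ (inner i))

      E-dΩ : PartialField.Elem K₂ dK → PΩ.E dΩ
      E-dΩ e = go (search k (λ j → column (κ j)))
        where
        go : (∃ λ j → Undefined (κ j)) ⊎ (∀ j → Defined (κ j)) → PΩ.E dΩ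
        go (inj₁ (j , u)) = inj₁ (undefined-dΩ j u)
        go (inj₂ d)       = let N , h = values-dΩ d in rational-E {dK} {dΩ} integral-dΩ e N h

  A′ : Matrix P₀ r m
  A′ i j = proj₂ (Z i j)

  over : ∀ k (ρ : Fin k → Fin r) (κ : Fin k → Fin m) → proj₂ (Minor.dΩ ρ κ) RM.≈ DP.det k (λ i j → A′ (ρ i) (κ j))
  over k ρ κ = det-R k (λ i j → Z (ρ i) (κ j)) (λ i j → A′ (ρ i) (κ j)) (λ i j → RM.refl)

  isP-A′ : IsPMatrix P₀ A′
  isP-A′ k ρ κ injρ injκ = PR.E-resp (over k ρ κ) (project (Minor.E-dΩ ρ κ (isP k ρ κ injρ injκ)))
    where
    project : ∀ {z} → PΩ.E z → PR.E (proj₂ z)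
    project     (inj₁ e) = inj₁ (proj₂ e)
    project {z} (inj₂ g) = inj₂ (project-G {z} g)

  same : ∀ κ → Injective _≡_ _≡_ κ → NonsingularCols K₂ A κ ⇔ NonsingularCols P₀ A′ κ
  same κ injκ = go (search r (λ j → column (κ j)))
    where
    open Minor id κ
    e : PartialField.Elem K₂ dK
    e = isP r id κ id injκ
    down : dΩ ΩM.≈ ΩM.0# → DP.det r (λ i j → A′ i (κ j)) RM.≈ RM.0#
    down z = RM.trans (RM.sym (over r id κ)) (proj₂ z)
    up : DP.det r (λ i j → A′ i (κ j)) RM.≈ RM.0# → dΩ ΩM.≈ ΩM.0#
    up z = LT.E-kernel (E-dΩ e) (RM.trans (over r id κ) z)
    go : (∃ λ j → Undefined (κ j)) ⊎ (∀ j → Defined (κ j)) → NonsingularCols K₂ A κ ⇔ NonsingularCols P₀ A′ κ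
    -- With an undefined column both determinants are zero: over Ω the column was replaced by zeros,
    -- and over K₂ the determinant has denominator zero and is equal to 0 by `absorbed-zero`.
    go (inj₁ (j , u)) = ¬-cong (λ _ → down (undefined-dΩ j u))
      (λ _ → absorbed-zero {dK} e (λ n → At.absorbed-det n r (λ i j → A i (κ j)) (proj₁ u) j (proj₂ u n)))
    go (inj₂ d) = ¬-cong
      (λ z → down (integral-vanishing {dΩ} integral-dΩ N (λ n le → At.equal-values n {dK} {KP.0#} z (h n le) value-0)))
      (λ z → numerator-determines {dK} N (λ n le → ≡.trans (Value.equation (h n le))
        (≡.trans (cong (ℚ._* den (node n) dK) (proj₁ (up z) (suc (suc n)))) (ℚP.*-zeroˡ (den (node n) dK)))))
      where
      N : ℕ
      N = proj₁ (values-dΩ d)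
      h : ∀ n → N ℕ.≤ n → Value (node n) dK (coordinate dΩ n)
      h = proj₂ (values-dΩ d)

theorem4p17 : ∀ n (M : Matroid n) →
    Representable (GF4-pf ⊗ H₂) M ⇔ Representable K₂ M
theorem4p17 n M = mk⇔
  (transfer P₀ K₂ M λ r A isP → Forward.B A isP , Forward.isP-B A isP , Forward.same A isP)
  (transfer K₂ P₀ M λ r A isP → Backward.A′ A isP , Backward.isP-A′ A isP , Backward.same A isP)
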